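{- Fix an integer $m\ge 2$. For $n\ge 1$ and a partition $\alpha\vdash n$, let $G_\alpha(m)$ be the number of $m$-tuples $(\pi_1,\dots,\pi_m)$ of permutations in $S_n$ such that $\pi_1\pi_2\cdots\pi_m=\pi$, where $\pi$ is a fixed permutation of cycle type $\alpha$, the group $\langle\pi_1,\dots,\pi_m\rangle$ acts transitively on $\{1,\dots,n\}$, and the total number of cycles of $\pi_1,\dots,\pi_m$ (counting fixed points as cycles) equals $(m-1)n-l(\alpha)+2$. Define the formal power series $$G=\sum_{n\ge1}\sum_{\alpha\vdash n}G_\alpha(m)\,\frac{z^n}{n!}\,|\mathcal{C}_\alpha|\,u^{l(\alpha)}\,p_\alpha\,x^{(m-1)n-l(\alpha)+2}.$$ Then $G$ satisfies the partial differential equation $$2m\,z\frac{\partial}{\partial z}\left(u\frac{\partial}{\partial u}-1\right)G=(m-1)\left(z\frac{\partial}{\partial z}\frac{\partial}{\partial x}G\right)^2.$$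
   Context: A partition $\alpha=(\alpha_1,\dots,\alpha_k)$ of $n$ (written $\alpha\vdash n$) has $l(\alpha)=k$ parts; $p_\alpha=p_{\alpha_1}\cdots p_{\alpha_k}$ where $p_1,p_2,\dots$ are indeterminates; $\mathcal{C}_\alpha\subseteq S_n$ is the conjugacy class of permutations of cycle type $\alpha$, so $|\mathcal{C}_\alpha|=n!/\prod_{i\ge1}i^{d_i}d_i!$ if $\alpha$ has $d_i$ parts equal to $i$. $z,u,x,p_1,p_2,\dots$ are independent indeterminates. It is known (Bousquet-Mélou and Schaeffer) that $G_\alpha(m)=m\frac{((m-1)n-1)!}{((m-1)n-l(\alpha)+2)!}\prod_{i\ge1}\left(i\binom{mi-1}{i}\right)^{d_i}$. -}

module Defs where

open import Function using (id; _∘_)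
open import Data.Nat using (ℕ; zero; suc; _+_; _*_; _∸_; _≤ᵇ_; _≡ᵇ_; _!)
open import Data.Nat.Properties using (_!≢0)
open import Data.Bool using (Bool; true; false; _∧_; _∨_; not; if_then_else_)
open import Data.List using (List; []; _∷_; [_]; _++_; map; concatMap; filterᵇ; length; upTo; allFin)
open import Data.Bool.ListAction using (all; any)
open import Data.Nat.ListAction using (sum)
open import Data.Vec using (Vec; lookup; tabulate)
import Data.Vec as Vec
open import Data.Fin using (Fin; toℕ)
open import Data.Integer using (ℤ; +_)
import Data.Integer as ℤ
open import Data.Rational using (ℚ; 0ℚ; _/_)
import Data.Rational as ℚ
open import Data.Product using (_×_; _,_; proj₁; proj₂)

-- Permutations of Fin n, represented by their table of values.
-- A vector σ represents the map i ↦ lookup σ i; it is a permutation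
-- iff this map is injective.

Perm : ℕ → Set
Perm n = Vec (Fin n) n

app : ∀ {n} → Perm n → Fin n → Fin n
app σ i = lookup σ i

finEqᵇ : ∀ {n} → Fin n → Fin n → Bool
finEqᵇ i j = toℕ i ≡ᵇ toℕ j

permEqᵇ : ∀ {n} → Perm n → Perm n → Bool
permEqᵇ {n} σ τ = all (λ i → finEqᵇ (app σ i) (app τ i)) (allFin n)

_∘ₚ_ : ∀ {n} → Perm n → Perm n → Perm n
σ ∘ₚ τ = tabulate (λ i → app σ (app τ i))

idₚ : ∀ {n} → Perm n
idₚ = tabulate id

vecs : ∀ {n} (k : ℕ) → List (Vec (Fin n) k)
vecs zero = [ Vec.[] ]
vecs {n} (suc k) = concatMap (λ i → map (i Vec.∷_) (vecs k)) (allFin n)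

isPermᵇ : ∀ {n} → Perm n → Bool
isPermᵇ {n} σ =
  all (λ i → all (λ j → not (finEqᵇ (app σ i) (app σ j)) ∨ finEqᵇ i j) (allFin n)) (allFin n)

perms : (n : ℕ) → List (Perm n)
perms n = filterᵇ isPermᵇ (vecs n)

iter : ∀ {A : Set} → ℕ → (A → A) → A → A
iter zero f a = a
iter (suc k) f a = f (iter k f a)

firstWith : (ℕ → Bool) → List ℕ → ℕ → ℕ
firstWith p [] d = d
firstWith p (k ∷ ks) d = if p k then k else firstWith p ks d

orbitLen : ∀ {n} → Perm n → Fin n → ℕ
orbitLen {n} σ i = firstWith (λ k → finEqᵇ (iter k (app σ) i) i) (map suc (upTo n)) n

isLeaderᵇ : ∀ {n} → Perm n → Fin n → Bool
isLeaderᵇ {n} σ i = all (λ k → toℕ i ≤ᵇ toℕ (iter k (app σ) i)) (upTo n)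

-- one representative per cycle (fixed points are cycles)
leaders : ∀ {n} → Perm n → List (Fin n)
leaders {n} σ = filterᵇ (isLeaderᵇ σ) (allFin n)

numCycles : ∀ {n} → Perm n → ℕ
numCycles σ = length (leaders σ)

insert : ℕ → List ℕ → List ℕ
insert x [] = [ x ]
insert x (y ∷ ys) = if x ≤ᵇ y then x ∷ y ∷ ys else y ∷ insert x ys

isort : List ℕ → List ℕ
isort [] = []
isort (x ∷ xs) = insert x (isort xs)

listEqᵇ : List ℕ → List ℕ → Bool
listEqᵇ [] [] = true
listEqᵇ (x ∷ xs) (y ∷ ys) = (x ≡ᵇ y) ∧ listEqᵇ xs ys
listEqᵇ _ _ = false

cycleType : ∀ {n} → Perm n → List ℕ
cycleType σ = isort (map (orbitLen σ) (leaders σ))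

-- Partitions of n: non-decreasing lists of positive integers summing to n
-- (a partition is a multiset of parts; we list parts in non-decreasing order)

partsFrom : ℕ → ℕ → ℕ → List (List ℕ)
partsFrom _ zero _ = [ [] ]
partsFrom zero (suc _) _ = []
partsFrom (suc f) (suc n) lo =
  concatMap (λ k → map (k ∷_) (partsFrom f (suc n ∸ k) k))
            (filterᵇ (λ k → lo ≤ᵇ k) (map suc (upTo (suc n))))

partitions : ℕ → List (List ℕ)
partitions n = partsFrom n n 1

memᵇ : List ℕ → List (List ℕ) → Bool
memᵇ x xs = any (listEqᵇ x) xs

-- Transitivity of ⟨π₁,…,π_m⟩ on {0,…,n-1}.
-- The orbit of i under the generated group is the closure of {i} under the
-- generators (inverses of permutations of a finite set are powers);
-- n rounds of closure suffice.

closure : ∀ {n} → ℕ → List (Perm n) → List (Fin n) → List (Fin n)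
closure zero gens S = S
closure (suc k) gens S = closure k gens (S ++ concatMap (λ g → map (app g) S) gens)

transitiveᵇ : ∀ {n} → List (Perm n) → Bool
transitiveᵇ {n} gens =
  all (λ i → all (λ j → any (finEqᵇ j) (closure n gens [ i ])) (allFin n)) (allFin n)

tuples : ∀ {A : Set} → ℕ → List A → List (List A)
tuples zero xs = [ [] ]
tuples (suc k) xs = concatMap (λ x → map (x ∷_) (tuples k xs)) xs

prodₚ : ∀ {n} → List (Perm n) → Perm n
prodₚ [] = idₚ
prodₚ (σ ∷ σs) = σ ∘ₚ prodₚ σs

xexp : ℕ → ℕ → ℕ → ℕ
xexp m n l = ((m ∸ 1) * n + 2) ∸ l

-- G_α(m), computed with respect to the given permutation π of type α
Gcount : (m n : ℕ) → Perm n → List ℕ → ℕ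
Gcount m n π α =
  length (filterᵇ (λ t → permEqᵇ (prodₚ t) π
                         ∧ transitiveᵇ t
                         ∧ (sum (map numCycles t) ≡ᵇ xexp m n (length α)))
                  (tuples m (perms n)))

classSize : (n : ℕ) → List ℕ → ℕ
classSize n α = length (filterᵇ (λ σ → listEqᵇ (cycleType σ) α) (perms n))

-- Formal power series in z, u, x, p₁, p₂, … with rational coefficients.
-- A monomial z^a u^b x^c p_λ is given by (a , b , c , λ), where the
-- monomial p_λ in the p_i is encoded by the partition λ (multiset of
-- indices).  A series is its coefficient function.

Series : Set
Series = ℕ → ℕ → ℕ → List ℕ → ℚ

ℕ→ℚ : ℕ → ℚ
ℕ→ℚ k = (+ k) / 1

scale : ℚ → Series → Series
scale q F a b c λ′ = q ℚ.* F a b c λ′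

zDz : Series → Series
zDz F a b c λ′ = ℕ→ℚ a ℚ.* F a b c λ′

uDuMinus1 : Series → Series
uDuMinus1 F a b c λ′ = (ℤ._-_ (+ b) (+ 1) / 1) ℚ.* F a b c λ′

Dx : Series → Series
Dx F a b c λ′ = ℕ→ℚ (suc c) ℚ.* F a b (suc c) λ′

sumℚ : List ℚ → ℚ
sumℚ [] = 0ℚ
sumℚ (q ∷ qs) = q ℚ.+ sumℚ qs

-- ordered pairs (β , γ) of p-monomials with p_β p_γ = p_λ
splits : List ℕ → List (List ℕ × List ℕ)
splits λ′ =
  filterᵇ (λ bg → listEqᵇ (isort (proj₁ bg ++ proj₂ bg)) λ′)
    (concatMap (λ j → concatMap (λ β → map (β ,_) (partitions (sum λ′ ∸ j)))
                                (partitions j))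
               (upTo (suc (sum λ′))))

_·_ : Series → Series → Series
(F · H) a b c λ′ =
  sumℚ (concatMap (λ a₁ → concatMap (λ b₁ → concatMap (λ c₁ →
    map (λ bg → F a₁ b₁ c₁ (proj₁ bg) ℚ.* H (a ∸ a₁) (b ∸ b₁) (c ∸ c₁) (proj₂ bg))
        (splits λ′))
    (upTo (suc c))) (upTo (suc b))) (upTo (suc a)))

-- The series G, given a choice rep n α of a permutation of cycle type α
-- for each partition α ⊢ n.
--   G = Σ_{n≥1} Σ_{α⊢n} G_α(m) z^n/n! |C_α| u^{l(α)} p_α x^{(m-1)n-l(α)+2}

Gseries : (m : ℕ) → ((n : ℕ) → List ℕ → Perm n) → Series
Gseries m rep a b c λ′ =
  if (1 ≤ᵇ a) ∧ memᵇ λ′ (partitions a) ∧ (b ≡ᵇ length λ′) ∧ (c ≡ᵇ xexp m a b)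
  then ((+ (Gcount m a (rep a λ′) λ′ * classSize a λ′)) / (a !)) {{a !≢0}}
  else 0ℚ

module Submission where

-- Fix a root r. If the first m - j factors of a planar tuple fix r, a transposition (i r) can be split off the next
-- factor. In the product it either merges the cycle of r with the cycle of i or cuts the cycle of r in two; in the
-- second case the tuple falls apart into two planar tuples. This is a recursion for the number F of planar tuples with
-- given cycle lengths. Read in the ring of functions on words (lists of cycle lengths) with the shuffle product, with
-- coefficients in the power series in one variable y for the length of the root cycle, it says u_{j+1} = [Y u_j]_{≥0}
-- for a Y whose part of positive degree in y is y u_m, so that it suffices to exhibit one Y with this property.
--
-- Such a Y is built from powers of the tree series A = 1 + y A^m and of R = 1 + Σ_c ψ_c q_c R^((m-1)c). A lemma of
-- Newton–Spitzer type expresses what leaves the exponents ≥ 0 through the residue [y⁻¹] Y^(m+1), and computing this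
-- residue gives e n G_α = m Q_α, where e = (m-1)n - l + 2 and (m-1) Q_α = ρ_1(α) - ρ_0(α), with ρ_t the coefficients
-- of R^t. Since R^t R^t′ = R^(t+t′), the right hand side of the equation is the second difference of t ↦ ρ_t, and
-- comparing it with the left hand side is an identity between falling factorials. The passage from words to partitions
-- divides by z_α, and |C_α| z_α = n!.

-- The obstacle is a circle: the recursion multiplies by a series whose positive part is the unknown
-- itself, so Y has to be guessed in closed form and the guess confirmed afterwards. With T = A(y
-- R^(m-1)), so that T - 1 = y R^(m-1) T^m, the guess is Y = R T + Σ_c c q_c y^(-c) z_c, where z_c
-- is T^(1-mc) times the binomial expansion of T^(mc-1) = (1 + (T - 1))^(mc-1) cut off below degree
-- c. Hence z_c = 1 + O(y^c), and the poles of Y are exactly the terms c q_c y^(-c) that the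
-- recursion demands. The confirmation is an induction on the number of points: if Y is right up to
-- N points, the residue gives the counts on N + 1 points, and these are again coefficients of Y.
-- The residue sees only the sum over all choices of the root cycle; that every choice gives the
-- same number comes from the combinatorial enumeration, so the analytic half takes it as a
-- hypothesis. Powers of Y become computable through the Euler operator in x, which turns Y into a
-- series of plain binomial coefficients.

-- Power series and shuffle products over a commutative semiring

module Semirings where
 open import Algebra.Bundles using (CommutativeSemiring)
 open import Algebra.Structures.Biased using (IsCommutativeSemiringˡ)
 import Algebra.Structures as AS
 open import Data.Maybe using (nothing)
 open import Tactic.RingSolver.Core.AlmostCommutativeRing using (fromCommutativeSemiring; AlmostCommutativeRing)
 open import Tactic.RingSolver using (solve-∀)
 open import Level using (0ℓ)
 open import Data.Nat using (ℕ; zero; suc)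
 open import Data.List using (List; []; _∷_)
 open import Data.Product using (_,_)
 open import Relation.Binary.Structures using (IsEquivalence)

 CSR : Set₁
 CSR = CommutativeSemiring 0ℓ 0ℓ

 toACR : CSR → AlmostCommutativeRing 0ℓ 0ℓ
 toACR A = fromCommutativeSemiring A (λ _ → nothing)

 module SemiringLaws (A : CSR) where
   acr : AlmostCommutativeRing 0ℓ 0ℓ
   acr = toACR A
   open AlmostCommutativeRing acr
   swap+ : ∀ a b c d → (a + b) + (c + d) ≈ (a + c) + (b + d)
   swap+ = solve-∀ acr
   rot+ : ∀ a b c → a + (b + c) ≈ c + (a + b)
   rot+ = solve-∀ acr

 module FunctionSemiring (A : CSR) (I : Set) where
   open CommutativeSemiring A
   Fn : Set
   Fn = I → Carrier
   infix 4 _≋_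
   _≋_ : Fn → Fn → Set
   f ≋ g = ∀ i → f i ≈ g i
   _⊕_ : Fn → Fn → Fn
   (f ⊕ g) i = f i + g i
   O : Fn
   O _ = 0#
   ≋-equiv : IsEquivalence _≋_
   ≋-equiv = record { refl = λ _ → refl ; sym = λ p i → sym (p i) ; trans = λ p q i → trans (p i) (q i) }
   ⊕-isCommutativeMonoid : AS.IsCommutativeMonoid _≋_ _⊕_ O
   ⊕-isCommutativeMonoid = record
     { isMonoid = record
       { isSemigroup = record
         { isMagma = record { isEquivalence = ≋-equiv ; ∙-cong = λ p q i → +-cong (p i) (q i) }
         ; assoc = λ f g h i → +-assoc (f i) (g i) (h i) }
       ; identity = (λ f i → +-identityˡ (f i)) , (λ f i → +-identityʳ (f i)) }
     ; comm = λ f g i → +-comm (f i) (g i) }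

 module PowerSeries (A : CSR) where
   open CommutativeSemiring A
   open SemiringLaws A
   open FunctionSemiring A ℕ public
   open import Relation.Binary.Reasoning.Setoid setoid

   infixl 7 _×ₛ_
   tail : Fn → Fn
   tail f i = f (suc i)

   _×ₛ_ : Fn → Fn → Fn
   (f ×ₛ g) zero = f 0 * g 0
   (f ×ₛ g) (suc k) = f 0 * g (suc k) + (tail f ×ₛ g) k

   ι : Fn
   ι zero = 1#
   ι (suc _) = 0#

   ×-cong : ∀ {f f' g g'} → f ≋ f' → g ≋ g' → f ×ₛ g ≋ f' ×ₛ g'
   ×-cong p q zero = *-cong (p 0) (q 0)
   ×-cong p q (suc k) = +-cong (*-cong (p 0) (q (suc k))) (×-cong (λ i → p (suc i)) q k)

   ×-distribʳ : ∀ h f g → (f ⊕ g) ×ₛ h ≋ (f ×ₛ h) ⊕ (g ×ₛ h)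
   ×-distribʳ h f g zero = distribʳ _ _ _
   ×-distribʳ h f g (suc k) = begin
     (f 0 + g 0) * h (suc k) + ((tail f ⊕ tail g) ×ₛ h) k ≈⟨ +-cong (distribʳ _ _ _) (×-distribʳ h (tail f) (tail g) k) ⟩
     (f 0 * h (suc k) + g 0 * h (suc k)) + ((tail f ×ₛ h) k + (tail g ×ₛ h) k) ≈⟨ swap+ _ _ _ _ ⟩
     _ ∎

   -- The defining recursion peels coefficients off the left factor. Peeling them off the right
   -- factor instead gives commutativity, and later isolates the constant coefficient of a right
   -- factor.
   ×-last : ∀ f g k → (f ×ₛ g) (suc k) ≈ f (suc k) * g 0 + (f ×ₛ tail g) k
   ×-last f g zero = +-comm _ _
   ×-last f g (suc k) = begin
     f 0 * g (suc (suc k)) + (tail f ×ₛ g) (suc k) ≈⟨ +-cong refl (×-last (tail f) g k) ⟩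
     f 0 * g (suc (suc k)) + (f (suc (suc k)) * g 0 + (tail f ×ₛ tail g) k) ≈⟨ trans (rot+ _ _ _) (trans (+-comm _ _) (trans (+-cong (+-comm _ _) refl) (+-assoc _ _ _))) ⟩
     f (suc (suc k)) * g 0 + (f 0 * g (suc (suc k)) + (tail f ×ₛ tail g) k) ∎

   ×-comm : ∀ f g → f ×ₛ g ≋ g ×ₛ f
   ×-comm f g zero = *-comm _ _
   ×-comm f g (suc k) = trans (+-cong (*-comm _ _) (×-comm (tail f) g k)) (sym (×-last g f k))

   _·ₛ_ : Carrier → Fn → Fn
   (c ·ₛ f) i = c * f i

   ×-scale : ∀ c f g → (c ·ₛ f) ×ₛ g ≋ c ·ₛ (f ×ₛ g)
   ×-scale c f g zero = *-assoc _ _ _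
   ×-scale c f g (suc k) = trans (+-cong (*-assoc _ _ _) (×-scale c (tail f) g k)) (sym (distribˡ _ _ _))

   ×-assoc : ∀ f g h → (f ×ₛ g) ×ₛ h ≋ f ×ₛ (g ×ₛ h)
   ×-assoc f g h zero = *-assoc _ _ _
   ×-assoc f g h (suc k) = begin
     f 0 * g 0 * h (suc k) + (((f 0 ·ₛ tail g) ⊕ (tail f ×ₛ g)) ×ₛ h) k
       ≈⟨ +-cong (*-assoc _ _ _) (trans (×-distribʳ h _ _ k) (+-cong (×-scale (f 0) (tail g) h k) (×-assoc (tail f) g h k))) ⟩
     f 0 * (g 0 * h (suc k)) + (f 0 * (tail g ×ₛ h) k + (tail f ×ₛ (g ×ₛ h)) k)
       ≈⟨ trans (sym (+-assoc _ _ _)) (+-cong (sym (distribˡ _ _ _)) refl) ⟩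
     f 0 * (g 0 * h (suc k) + (tail g ×ₛ h) k) + (tail f ×ₛ (g ×ₛ h)) k ∎

   ×-zeroˡ : ∀ f → O ×ₛ f ≋ O
   ×-zeroˡ f zero = zeroˡ _
   ×-zeroˡ f (suc k) = trans (+-cong (zeroˡ _) (×-zeroˡ f k)) (+-identityˡ _)

   ×-identityˡ : ∀ f → ι ×ₛ f ≋ f
   ×-identityˡ f zero = *-identityˡ _
   ×-identityˡ f (suc k) = trans (+-cong (*-identityˡ _) (×-zeroˡ f k)) (+-identityʳ _)

   pow-semiring : CSR
   pow-semiring = record { Carrier = Fn ; _≈_ = _≋_ ; _+_ = _⊕_ ; _*_ = _×ₛ_ ; 0# = O ; 1# = ι
     ; isCommutativeSemiring = IsCommutativeSemiringˡ.isCommutativeSemiring record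
       { +-isCommutativeMonoid = ⊕-isCommutativeMonoid
       ; *-isCommutativeMonoid = record
         { isMonoid = record
           { isSemigroup = record
             { isMagma = record { isEquivalence = ≋-equiv ; ∙-cong = ×-cong }
             ; assoc = ×-assoc }
           ; identity = ×-identityˡ , λ f i → trans (×-comm f ι i) (×-identityˡ f i) }
         ; comm = ×-comm }
       ; distribʳ = ×-distribʳ
       ; zeroˡ = ×-zeroˡ } }

 -- Functions on words with the shuffle product, given by the Leibniz rule for f ↦ f ∘ (c ∷_):
 -- (f ⋆ g) w sums f u * g v over the ways of splitting the positions of w into two subwords u, v.
 module Shuffle (A : CSR) (L : Set) where
   open CommutativeSemiring A
   open SemiringLaws A
   open FunctionSemiring A (List L) public
   open import Relation.Binary.Reasoning.Setoid setoid

   infixl 7 _⋆_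
   ∂ : L → Fn → Fn
   ∂ c f w = f (c ∷ w)

   _⋆_ : Fn → Fn → Fn
   (f ⋆ g) [] = f [] * g []
   (f ⋆ g) (c ∷ w) = (∂ c f ⋆ g) w + (f ⋆ ∂ c g) w

   ε : Fn
   ε [] = 1#
   ε (_ ∷ _) = 0#

   ⋆-cong : ∀ {f f' g g'} → f ≋ f' → g ≋ g' → f ⋆ g ≋ f' ⋆ g'
   ⋆-cong p q [] = *-cong (p []) (q [])
   ⋆-cong p q (c ∷ w) = +-cong (⋆-cong (λ v → p (c ∷ v)) q w) (⋆-cong p (λ v → q (c ∷ v)) w)

   ⋆-comm : ∀ f g → f ⋆ g ≋ g ⋆ f
   ⋆-comm f g [] = *-comm _ _
   ⋆-comm f g (c ∷ w) = trans (+-cong (⋆-comm (∂ c f) g w) (⋆-comm f (∂ c g) w)) (+-comm _ _)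

   ⋆-distribʳ : ∀ h f g → (f ⊕ g) ⋆ h ≋ (f ⋆ h) ⊕ (g ⋆ h)
   ⋆-distribʳ h f g [] = distribʳ _ _ _
   ⋆-distribʳ h f g (c ∷ w) =
     trans (+-cong (⋆-distribʳ h (∂ c f) (∂ c g) w) (⋆-distribʳ (∂ c h) f g w)) (swap+ _ _ _ _)

   ⋆-distribˡ : ∀ h f g → h ⋆ (f ⊕ g) ≋ (h ⋆ f) ⊕ (h ⋆ g)
   ⋆-distribˡ h f g w = trans (⋆-comm h _ w) (trans (⋆-distribʳ h f g w) (+-cong (⋆-comm f h w) (⋆-comm g h w)))

   ⋆-assoc : ∀ f g h → (f ⋆ g) ⋆ h ≋ f ⋆ (g ⋆ h)
   ⋆-assoc f g h [] = *-assoc _ _ _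
   ⋆-assoc f g h (c ∷ w) = begin
     (((∂ c f ⋆ g) ⊕ (f ⋆ ∂ c g)) ⋆ h) w + ((f ⋆ g) ⋆ ∂ c h) w
       ≈⟨ +-cong (trans (⋆-distribʳ h _ _ w) (+-cong (⋆-assoc (∂ c f) g h w) (⋆-assoc f (∂ c g) h w))) (⋆-assoc f g (∂ c h) w) ⟩
     ((∂ c f ⋆ (g ⋆ h)) w + (f ⋆ (∂ c g ⋆ h)) w) + (f ⋆ (g ⋆ ∂ c h)) w
       ≈⟨ trans (+-assoc _ _ _) (+-cong refl (sym (⋆-distribˡ f _ _ w))) ⟩
     (∂ c f ⋆ (g ⋆ h)) w + (f ⋆ ((∂ c g ⋆ h) ⊕ (g ⋆ ∂ c h))) w ∎

   ⋆-zeroˡ : ∀ f → O ⋆ f ≋ O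
   ⋆-zeroˡ f [] = zeroˡ _
   ⋆-zeroˡ f (c ∷ w) = trans (+-cong (⋆-zeroˡ f w) (⋆-zeroˡ (∂ c f) w)) (+-identityˡ _)

   ⋆-identityˡ : ∀ f → ε ⋆ f ≋ f
   ⋆-identityˡ f [] = *-identityˡ _
   ⋆-identityˡ f (c ∷ w) = trans (+-cong (⋆-zeroˡ f w) (⋆-identityˡ (∂ c f) w)) (+-identityˡ _)

   shuffle-semiring : CSR
   shuffle-semiring = record { Carrier = Fn ; _≈_ = _≋_ ; _+_ = _⊕_ ; _*_ = _⋆_ ; 0# = O ; 1# = ε
     ; isCommutativeSemiring = IsCommutativeSemiringˡ.isCommutativeSemiring record
       { +-isCommutativeMonoid = ⊕-isCommutativeMonoid
       ; *-isCommutativeMonoid = record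
         { isMonoid = record
           { isSemigroup = record
             { isMagma = record { isEquivalence = ≋-equiv ; ∙-cong = ⋆-cong }
             ; assoc = ⋆-assoc }
           ; identity = ⋆-identityˡ , λ f w → trans (⋆-comm f ε w) (⋆-identityˡ f w) }
         ; comm = ⋆-comm }
       ; distribʳ = ⋆-distribʳ
       ; zeroˡ = ⋆-zeroˡ } }

-- Binomial coefficients and falling factorials with integer upper argument

module Binomials where
 open import Data.Integer using (ℤ; +_; -[1+_]; _+_; _*_; -_; _-_; 0ℤ; 1ℤ)
 open import Data.Integer.Properties hiding (_≟_)
 open import Data.Integer.Tactic.RingSolver using (solve-∀)
 open import Data.Nat using (ℕ; zero; suc)
 import Data.Nat as ℕ
 import Data.Nat.Properties as ℕP
 open import Relation.Binary.PropositionalEquality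
 open ≡-Reasoning

 -- This takes the place of the polynomial argument: an identity in an integer parameter is proved
 -- by showing that the difference of its sides has period 1 and evaluating it at one convenient
 -- point.
 const-on-ℤ : (g : ℤ → ℤ) → (∀ x → g (x + 1ℤ) ≡ g x) → ∀ x → g x ≡ g 0ℤ
 const-on-ℤ g h (+ zero) = refl
 const-on-ℤ g h (+ suc n) = trans (cong g (trans (cong +_ (ℕP.+-comm 1 n)) (pos-+ n 1))) (trans (h (+ n)) (const-on-ℤ g h (+ n)))
 const-on-ℤ g h -[1+ zero ] = sym (h -[1+ 0 ])
 const-on-ℤ g h -[1+ suc n ] = trans (sym (h -[1+ suc n ])) (const-on-ℤ g h -[1+ n ])

 -- The generalised binomial coefficient, obtained by running Pascal's rule upwards from 0 and
 -- downwards below it, so that no division occurs. Negative upper arguments do arise, from negative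
 -- powers of the tree series.
 C : ℤ → ℕ → ℤ
 C x zero = 1ℤ
 C (+ zero) (suc k) = 0ℤ
 C (+ suc n) (suc k) = C (+ n) (suc k) + C (+ n) k
 C -[1+ zero ] (suc k) = - C -[1+ zero ] k
 C -[1+ suc n ] (suc k) = C -[1+ n ] (suc k) - C -[1+ suc n ] k

 +1≡suc : ∀ n → + n + 1ℤ ≡ + suc n
 +1≡suc n = trans (sym (pos-+ n 1)) (cong +_ (ℕP.+-comm n 1))

 pascal : ∀ x k → C (x + 1ℤ) (suc k) ≡ C x (suc k) + C x k
 pascal (+ n) k rewrite +1≡suc n = refl
 pascal -[1+ zero ] k = sym (+-inverseˡ (C -[1+ zero ] k))
 pascal -[1+ suc n ] k = lem (C -[1+ n ] (suc k)) (C -[1+ suc n ] k)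
   where lem : ∀ a b → a ≡ a - b + b
         lem = solve-∀

 absorb : ∀ x k → + suc k * C (x + 1ℤ) (suc k) ≡ (x + 1ℤ) * C x k
 absorb x zero = begin
   1ℤ * C (x + 1ℤ) 1 ≡⟨ *-identityˡ _ ⟩
   C (x + 1ℤ) 1 ≡⟨ lem (C (x + 1ℤ) 1) x ⟩
   (C (x + 1ℤ) 1 - x) + x ≡⟨ cong (_+ x) (const-on-ℤ (λ y → C (y + 1ℤ) 1 - y) step x) ⟩
   1ℤ + x ≡⟨ lem2 x ⟩
   (x + 1ℤ) * 1ℤ ∎
   where
   lem : ∀ a x → a ≡ (a - x) + x
   lem = solve-∀
   lem2 : ∀ x → 1ℤ + x ≡ (x + 1ℤ) * 1ℤ
   lem2 = solve-∀
   lem3 : ∀ a x → a + 1ℤ - (x + 1ℤ) ≡ a - x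
   lem3 = solve-∀
   step : ∀ y → C (y + 1ℤ + 1ℤ) 1 - (y + 1ℤ) ≡ C (y + 1ℤ) 1 - y
   step y = trans (cong (_- (y + 1ℤ)) (pascal (y + 1ℤ) 0)) (lem3 (C (y + 1ℤ) 1) y)
 -- The difference of the two sides has period 1 by the induction hypothesis, and it vanishes at -1,
 -- where `C 0 (suc (suc k))` and the factor x + 1 are both 0.
 absorb x (suc k) = i-j≡0⇒i≡j _ _ (trans (const-on-ℤ g step x) (trans (step -[1+ 0 ]) zr))
   where
   zr : + suc (suc k) * 0ℤ - 0ℤ ≡ 0ℤ
   zr = trans (+-identityʳ _) (*-zeroʳ (+ suc (suc k)))
   g : ℤ → ℤ
   g y = + suc (suc k) * C (y + 1ℤ) (suc (suc k)) - (y + 1ℤ) * C y (suc k)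
   lem : ∀ kk c1 d1 d2 y → (kk + 1ℤ) * (c1 + d1) - (y + 1ℤ + 1ℤ) * d1 + ((y + 1ℤ) * d2 - kk * d1) ≡ (kk + 1ℤ) * c1 - (y + 1ℤ) * (d1 - d2)
   lem = solve-∀
   step : ∀ y → g (y + 1ℤ) ≡ g y
   step y = begin
     + suc (suc k) * C (y + 1ℤ + 1ℤ) (suc (suc k)) - (y + 1ℤ + 1ℤ) * C (y + 1ℤ) (suc k)
       ≡⟨ cong₂ (λ u v → u * v - (y + 1ℤ + 1ℤ) * C (y + 1ℤ) (suc k)) (sym (+1≡suc (suc k))) (pascal (y + 1ℤ) (suc k)) ⟩
     (K + 1ℤ) * (c1 + d1) - (y + 1ℤ + 1ℤ) * d1
       ≡⟨ sym (trans (cong (_+_ ((K + 1ℤ) * (c1 + d1) - (y + 1ℤ + 1ℤ) * d1)) (i≡j⇒i-j≡0 (sym (absorb y k)))) (+-identityʳ _)) ⟩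
     (K + 1ℤ) * (c1 + d1) - (y + 1ℤ + 1ℤ) * d1 + ((y + 1ℤ) * d2 - K * d1)
       ≡⟨ lem K c1 d1 d2 y ⟩
     (K + 1ℤ) * c1 - (y + 1ℤ) * (d1 - d2)
       ≡⟨ cong₂ (λ u v → u * c1 - (y + 1ℤ) * v) (+1≡suc (suc k)) (trans (cong (_- d2) (pascal y k)) (lem4 (C y (suc k)) d2)) ⟩
     + suc (suc k) * c1 - (y + 1ℤ) * C y (suc k) ∎
     where
     K = + suc k
     c1 = C (y + 1ℤ) (suc (suc k))
     d1 = C (y + 1ℤ) (suc k)
     d2 = C y k
     lem4 : ∀ a b → a + b - b ≡ a
     lem4 = solve-∀

 absorb′ : ∀ x k → + suc k * C x (suc k) ≡ (x - + k) * C x k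
 absorb′ x k = begin
   + suc k * C x (suc k) ≡⟨ lem (+ suc k) (C x (suc k)) (C x k) ⟩
   + suc k * (C x (suc k) + C x k) - + suc k * C x k ≡⟨ cong₂ (λ u v → u - v * C x k) (trans (cong (+ suc k *_) (sym (pascal x k))) (absorb x k)) (sym (+1≡suc k)) ⟩
   (x + 1ℤ) * C x k - (+ k + 1ℤ) * C x k ≡⟨ lem2 x (+ k) (C x k) ⟩
   (x - + k) * C x k ∎
   where
   lem : ∀ s a b → s * a ≡ s * (a + b) - s * b
   lem = solve-∀
   lem2 : ∀ x k c → (x + 1ℤ) * c - (k + 1ℤ) * c ≡ (x - k) * c
   lem2 = solve-∀

 -- The falling factorial x (x - 1) ... (x - k + 1).
 ff : ℤ → ℕ → ℤ
 ff x zero = 1ℤ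
 ff x (suc k) = x * ff (x - 1ℤ) k

 ff-last : ∀ x k → ff x (suc k) ≡ ff x k * (x - + k)
 ff-last x zero = lem x
   where lem : ∀ x → x * 1ℤ ≡ 1ℤ * (x - 0ℤ)
         lem = solve-∀
 ff-last x (suc k) = begin
   x * ff (x - 1ℤ) (suc k) ≡⟨ cong (x *_) (ff-last (x - 1ℤ) k) ⟩
   x * (ff (x - 1ℤ) k * (x - 1ℤ - + k)) ≡⟨ lem x (ff (x - 1ℤ) k) (+ k) ⟩
   x * ff (x - 1ℤ) k * (x - (+ k + 1ℤ)) ≡⟨ cong (λ z → x * ff (x - 1ℤ) k * (x - z)) (+1≡suc k) ⟩
   x * ff (x - 1ℤ) k * (x - + suc k) ∎
   where lem : ∀ x f k → x * (f * (x - 1ℤ - k)) ≡ x * f * (x - (k + 1ℤ))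
         lem = solve-∀

-- The powers of R and of the tree series as elements of the shuffle algebra

module MultiplicativeFamilies where
 open Semirings
 open Binomials
 open import Data.Integer using (ℤ; +_; _+_; _*_; -_; _-_; 0ℤ; 1ℤ)
 open import Data.Integer.Properties hiding (_≟_)
 open import Data.Integer.Tactic.RingSolver using (solve-∀)
 open import Data.Nat using (ℕ; zero; suc; s≤s)
 import Data.Nat as ℕ
 import Data.Nat.Properties as ℕP
 open import Data.List using (List; []; _∷_; length)
 open import Data.Nat.ListAction using (sum)
 open import Relation.Binary.PropositionalEquality
 open ≡-Reasoning

 module PS = PowerSeries +-*-commutativeSemiring
 module Sh = Shuffle PS.pow-semiring ℕ
 open PS using (_×ₛ_)
 open Sh using (_⋆_; ε; ∂)

 Ser : Set
 Ser = ℕ → ℤ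

 -- A Laurent series in y over functions on words: `f α k` is the coefficient of y^(k - |α|) at the
 -- word α. Each letter c thus carries a factor y^(-c), so poles are bounded by |α| and the index k
 -- can stay a natural number.
 Elt : Set
 Elt = List ℕ → Ser

 data Pick {A : Set} : A → List A → List A → Set where
   here : ∀ {c α} → Pick c α (c ∷ α)
   there : ∀ {c d β α} → Pick d β α → Pick d (c ∷ β) (c ∷ α)

 sumPicks : (ℕ → List ℕ → ℤ) → List ℕ → ℤ
 sumPicks φ [] = 0ℤ
 sumPicks φ (c ∷ α) = φ c α + sumPicks (λ d β → φ d (c ∷ β)) α

 sumPicks-cong : ∀ {φ φ'} α → (∀ c β → Pick c β α → φ c β ≡ φ' c β) → sumPicks φ α ≡ sumPicks φ' α
 sumPicks-cong [] h = refl
 sumPicks-cong (c ∷ α) h = cong₂ _+_ (h c α here) (sumPicks-cong α λ d β p → h d (c ∷ β) (there p))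

 sumPicks-+ : ∀ φ φ' α → sumPicks (λ c β → φ c β + φ' c β) α ≡ sumPicks φ α + sumPicks φ' α
 sumPicks-+ φ φ' [] = refl
 sumPicks-+ φ φ' (c ∷ α) = trans (cong (_+_ (φ c α + φ' c α)) (sumPicks-+ (λ d β → φ d (c ∷ β)) (λ d β → φ' d (c ∷ β)) α))
   (lem (φ c α) (φ' c α) (sumPicks (λ d β → φ d (c ∷ β)) α) (sumPicks (λ d β → φ' d (c ∷ β)) α))
   where lem : ∀ a b c d → (a + b) + (c + d) ≡ (a + c) + (b + d)
         lem = solve-∀

 sumPicks-* : ∀ x φ α → sumPicks (λ c β → x * φ c β) α ≡ x * sumPicks φ α
 sumPicks-* x φ [] = sym (*-zeroʳ x)
 sumPicks-* x φ (c ∷ α) = trans (cong (_+_ (x * φ c α)) (sumPicks-* x (λ d β → φ d (c ∷ β)) α)) (sym (*-distribˡ-+ x _ _))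

 sumPicks-zero : ∀ α → sumPicks (λ _ _ → 0ℤ) α ≡ 0ℤ
 sumPicks-zero [] = refl
 sumPicks-zero (c ∷ α) = trans (+-identityˡ _) (sumPicks-zero α)

 sumPicks-linear : ∀ x y α → sumPicks (λ c _ → x + y * + c) α ≡ + length α * x + y * + sum α
 sumPicks-linear x y [] = lem x y
   where lem : ∀ x y → 0ℤ ≡ 0ℤ * x + y * 0ℤ
         lem = solve-∀
 sumPicks-linear x y (c ∷ α) = begin
   x + y * + c + sumPicks (λ c _ → x + y * + c) α ≡⟨ cong (_+_ (x + y * + c)) (sumPicks-linear x y α) ⟩
   x + y * + c + (+ length α * x + y * + sum α) ≡⟨ lem x y (+ c) (+ length α) (+ sum α) ⟩
   (+ length α + 1ℤ) * x + y * (+ c + + sum α) ≡⟨ cong₂ (λ u v → u * x + y * v) (+1≡suc (length α)) (sym (pos-+ c (sum α))) ⟩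
   + suc (length α) * x + y * + (c ℕ.+ sum α) ∎
   where lem : ∀ x y c l s → x + y * c + (l * x + y * s) ≡ (l + 1ℤ) * x + y * (c + s)
         lem = solve-∀

 pick-sum : ∀ {c β α} → Pick c β α → c ℕ.+ sum β ≡ sum α
 pick-sum here = refl
 pick-sum {c} (there {d} {_} {β} p) = trans (trans (sym (ℕP.+-assoc c d (sum β))) (trans (cong (ℕ._+ sum β) (ℕP.+-comm c d)) (ℕP.+-assoc d c (sum β)))) (cong (d ℕ.+_) (pick-sum p))

 pick-length : ∀ {A : Set} {c : A} {β α} → Pick c β α → suc (length β) ≡ length α
 pick-length here = refl
 pick-length (there p) = cong suc (pick-length p)

 cons0 : Ser → Ser
 cons0 f zero = 0ℤ
 cons0 f (suc k) = f k

 shift : ℕ → Ser → Ser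
 shift zero f = f
 shift (suc s) f = cons0 (shift s f)

 cons0-cong : ∀ {f g : Ser} → (∀ k → f k ≡ g k) → ∀ k → cons0 f k ≡ cons0 g k
 cons0-cong h zero = refl
 cons0-cong h (suc k) = h k

 shift-cong : ∀ s {f g : Ser} → (∀ k → f k ≡ g k) → ∀ k → shift s f k ≡ shift s g k
 shift-cong zero h = h
 shift-cong (suc s) h = cons0-cong (shift-cong s h)

 shift-+ : ∀ s (f g : Ser) k → shift s (λ i → f i + g i) k ≡ shift s f k + shift s g k
 shift-+ zero f g k = refl
 shift-+ (suc s) f g zero = refl
 shift-+ (suc s) f g (suc k) = shift-+ s f g k

 shift-* : ∀ s x (f : Ser) k → shift s (λ i → x * f i) k ≡ x * shift s f k
 shift-* zero x f k = refl
 shift-* (suc s) x f zero = sym (*-zeroʳ x)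
 shift-* (suc s) x f (suc k) = shift-* s x f k

 shift-shift : ∀ s s' (f : Ser) k → shift s (shift s' f) k ≡ shift (s ℕ.+ s') f k
 shift-shift zero s' f k = refl
 shift-shift (suc s) s' f zero = refl
 shift-shift (suc s) s' f (suc k) = shift-shift s s' f k

 shift-at : ∀ s (f : Ser) i → shift s f (s ℕ.+ i) ≡ f i
 shift-at zero f i = refl
 shift-at (suc s) f i = shift-at s f i

 shift-below : ∀ s (f : Ser) k → k ℕ.< s → shift s f k ≡ 0ℤ
 shift-below (suc s) f zero _ = refl
 shift-below (suc s) f (suc k) (s≤s p) = shift-below s f k p

 cons0-× : ∀ f g k → (cons0 f ×ₛ g) k ≡ cons0 (f ×ₛ g) k
 cons0-× f g zero = *-zeroˡ (g 0)
 cons0-× f g (suc k) = trans (cong (_+ (f ×ₛ g) k) (*-zeroˡ (g (suc k)))) (+-identityˡ _)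

 shift-× : ∀ s f g k → (shift s f ×ₛ g) k ≡ shift s (f ×ₛ g) k
 shift-× zero f g k = refl
 shift-× (suc s) f g k = trans (cons0-× (shift s f) g k) (cons0-cong (shift-× s f g) k)

 shift-×-shift : ∀ s s' f g k → (shift s f ×ₛ shift s' g) k ≡ shift (s ℕ.+ s') (f ×ₛ g) k
 shift-×-shift s s' f g k = trans (shift-× s f _ k) (trans (shift-cong s (λ i → trans (PS.×-comm f (shift s' g) i) (trans (shift-× s' g f i) (shift-cong s' (PS.×-comm g f) i))) k) (shift-shift s s' _ k))

 infixr 8 _▷_ _∙_
 -- Multiplication by y^c.
 _▷_ : ℕ → Elt → Elt
 (c ▷ f) α = shift c (f α)

 _∙_ : ℤ → Elt → Elt
 (x ∙ f) α k = x * f α k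

 ▷-⋆ : ∀ c f g α k → ((c ▷ f) ⋆ g) α k ≡ (c ▷ (f ⋆ g)) α k
 ▷-⋆ c f g [] k = shift-× c (f []) (g []) k
 ▷-⋆ c f g (d ∷ α) k = trans (cong₂ _+_ (▷-⋆ c (∂ d f) g α k) (▷-⋆ c f (∂ d g) α k)) (sym (shift-+ c _ _ k))

 ∙-⋆ : ∀ x f g α k → ((x ∙ f) ⋆ g) α k ≡ (x ∙ (f ⋆ g)) α k
 ∙-⋆ x f g [] k = PS.×-scale x (f []) (g []) k
 ∙-⋆ x f g (d ∷ α) k = trans (cong₂ _+_ (∙-⋆ x (∂ d f) g α k) (∙-⋆ x f (∂ d g) α k)) (sym (*-distribˡ-+ x _ _))

 -- The element Σ_c q_c y^(-c) z_c, with q_c the one-letter word: a letter is removed while k stays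
 -- fixed, which accounts for the factor y^(-c).
 Pk : (ℕ → Elt) → Elt
 Pk z α k = sumPicks (λ c β → z c β k) α

 Pk-⋆ : ∀ z g α k → (Pk z ⋆ g) α k ≡ Pk (λ c → z c ⋆ g) α k
 Pk-⋆ z g [] k = PS.×-zeroˡ (g []) k
 Pk-⋆ z g (d ∷ α) k = begin
   ((λ β k → z d β k + Pk (λ c → ∂ d (z c)) β k) ⋆ g) α k + (Pk z ⋆ ∂ d g) α k
     ≡⟨ cong₂ _+_ (trans (Sh.⋆-distribʳ g (z d) (Pk (λ c → ∂ d (z c))) α k) (cong (_+_ ((z d ⋆ g) α k)) (Pk-⋆ (λ c → ∂ d (z c)) g α k))) (Pk-⋆ z (∂ d g) α k) ⟩
   (z d ⋆ g) α k + Pk (λ c → ∂ d (z c) ⋆ g) α k + Pk (λ c → z c ⋆ ∂ d g) α k ≡⟨ +-assoc ((z d ⋆ g) α k) _ _ ⟩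
   (z d ⋆ g) α k + (Pk (λ c → ∂ d (z c) ⋆ g) α k + Pk (λ c → z c ⋆ ∂ d g) α k)
     ≡⟨ cong (_+_ ((z d ⋆ g) α k)) (sym (sumPicks-+ _ _ α)) ⟩
   Pk (λ c → z c ⋆ g) (d ∷ α) k ∎

 -- Throughout, D stands for m - 1.
 module Families (D : ℤ) where
   mm : ℤ
   mm = D + 1ℤ

   -- The factor that a part c contributes to the product formula for the counts.
   ψ : ℕ → ℤ
   ψ c = + c * C (mm * + c - 1ℤ) c

   Ψ : List ℕ → ℤ
   Ψ [] = 1ℤ
   Ψ (c ∷ α) = ψ c * Ψ α

   -- ρ t α is the coefficient of ∏ q_c (c ∈ α, labelled) in R^t, where R = 1 + Σ_c ψ c q_c R^(D c).
   ρ : ℤ → List ℕ → ℤ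
   ρ t [] = 1ℤ
   ρ t (c ∷ α) = Ψ (c ∷ α) * (t * ff (D * + sum (c ∷ α) + t - 1ℤ) (length α))

   pick-Ψ : ∀ {c β α} → Pick c β α → ψ c * Ψ β ≡ Ψ α
   pick-Ψ here = refl
   pick-Ψ {c} (there {d} {_} {β} p) = trans (lem (ψ c) (ψ d) (Ψ β)) (cong (ψ d *_) (pick-Ψ p))
     where lem : ∀ x y z → x * (y * z) ≡ y * (x * z)
           lem = solve-∀

   ρ-zero : ∀ c α → ρ 0ℤ (c ∷ α) ≡ 0ℤ
   ρ-zero c α = trans (cong (Ψ (c ∷ α) *_) (*-zeroˡ (ff (D * + sum (c ∷ α) + 0ℤ - 1ℤ) (length α)))) (*-zeroʳ (Ψ (c ∷ α)))

   ρ-pos : ∀ t α l → length α ≡ suc l → ρ t α ≡ Ψ α * (t * ff (D * + sum α + t - 1ℤ) l)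
   ρ-pos t (c ∷ α) .(length α) refl = refl

   -- R^(t+1) = R^t R, with the last R expanded by its equation. Once the falling factorial common
   -- to all terms is taken out, each pick contributes t + D c, and the picks sum to a linear
   -- expression in length and size of α.
   ρ-step : ∀ t α → ρ (t + 1ℤ) α ≡ ρ t α + sumPicks (λ c β → ψ c * ρ (t + D * + c) β) α
   ρ-step t [] = refl
   ρ-step t (c ∷ []) = lem (ψ c) t
     where lem : ∀ p t → p * 1ℤ * ((t + 1ℤ) * 1ℤ) ≡ p * 1ℤ * (t * 1ℤ) + (p * 1ℤ + 0ℤ)
           lem = solve-∀
   ρ-step t α@(c ∷ d ∷ α′) = begin
     Ψ α * ((t + 1ℤ) * ((N + (t + 1ℤ) - 1ℤ) * ff (N + (t + 1ℤ) - 1ℤ - 1ℤ) l))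
       ≡⟨ cong (λ z → Ψ α * ((t + 1ℤ) * ((N + (t + 1ℤ) - 1ℤ) * ff z l))) (lem0 N t) ⟩
     Ψ α * ((t + 1ℤ) * ((N + (t + 1ℤ) - 1ℤ) * F)) ≡⟨ lem1 (Ψ α) t N F (+ l) ⟩
     Ψ α * (t * (F * (N + t - 1ℤ - + l))) + Ψ α * F * (((+ l + 1ℤ) + 1ℤ) * t + N)
       ≡⟨ cong₂ _+_ (cong (λ z → Ψ α * (t * z)) (sym (ff-last (N + t - 1ℤ) l)))
                    (cong (λ z → Ψ α * F * (z * t + N)) (trans (cong (_+ 1ℤ) (+1≡suc l)) (+1≡suc (suc l)))) ⟩
     Ψ α * (t * ff (N + t - 1ℤ) (suc l)) + Ψ α * F * (+ length α * t + D * + sum α)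
       ≡⟨ cong (_+_ (ρ t α)) (sym (trans (sumPicks-cong α picks) (trans (sumPicks-* (Ψ α * F) (λ c _ → t + D * + c) α) (cong (Ψ α * F *_) (sumPicks-linear t D α))))) ⟩
     ρ t α + sumPicks (λ c β → ψ c * ρ (t + D * + c) β) α ∎
     where
     l = length α′
     N = D * + sum α
     F = ff (N + t - 1ℤ) l
     lem0 : ∀ N t → N + (t + 1ℤ) - 1ℤ - 1ℤ ≡ N + t - 1ℤ
     lem0 = solve-∀
     lem1 : ∀ P t N F l → P * ((t + 1ℤ) * ((N + (t + 1ℤ) - 1ℤ) * F)) ≡ P * (t * (F * (N + t - 1ℤ - l))) + P * F * (((l + 1ℤ) + 1ℤ) * t + N)
     lem1 = solve-∀
     lem2 : ∀ D s t c → D * s + (t + D * c) - 1ℤ ≡ D * (c + s) + t - 1ℤ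
     lem2 = solve-∀
     lem3 : ∀ p q t F → p * (q * (t * F)) ≡ p * q * F * t
     lem3 = solve-∀
     picks : ∀ c β → Pick c β α → ψ c * ρ (t + D * + c) β ≡ Ψ α * F * (t + D * + c)
     picks c β p = begin
       ψ c * ρ (t + D * + c) β ≡⟨ cong (ψ c *_) (ρ-pos _ β l (ℕP.suc-injective (pick-length p))) ⟩
       ψ c * (Ψ β * ((t + D * + c) * ff (D * + sum β + (t + D * + c) - 1ℤ) l)) ≡⟨ lem3 (ψ c) (Ψ β) _ _ ⟩
       ψ c * Ψ β * ff (D * + sum β + (t + D * + c) - 1ℤ) l * (t + D * + c)
         ≡⟨ cong₂ (λ u v → u * ff v l * (t + D * + c)) (pick-Ψ p) (trans (lem2 D (+ sum β) t (+ c)) (cong (λ z → D * z + t - 1ℤ) (trans (sym (pos-+ c (sum β))) (cong +_ (pick-sum p))))) ⟩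
       Ψ α * F * (t + D * + c) ∎

   -- `a p i` is p / (m i + p) times `b p i`, in a division-free form that also makes sense where m
   -- i + p = 0.
   a b : ℤ → ℕ → ℤ
   b p i = C (mm * + i + p) i
   a p zero = 1ℤ
   a p (suc i) = C (mm * + suc i + p) (suc i) - mm * C (mm * + suc i + p - 1ℤ) i

   -- The coefficient form of A^(p+1) = A^p + y A^(p+m). The product rule below rests on this
   -- recursion in p, so it covers the powers of A and their multiples by one fixed series alike.
   record Family (A : ℤ → ℕ → ℤ) : Set where
     field
       fam-zero : ∀ p → A (p + 1ℤ) 0 ≡ A p 0
       fam-suc : ∀ p i → A (p + 1ℤ) (suc i) ≡ A p (suc i) + A (p + mm) i

   private
     arg₁ : ∀ m i p → m * i + (p + 1ℤ) ≡ m * i + p + 1ℤ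
     arg₁ = solve-∀
     arg₂ : ∀ m i p → m * (i + 1ℤ) + p ≡ m * i + (p + m)
     arg₂ = solve-∀

   b-family : Family b
   b-family = record { fam-zero = λ _ → refl ; fam-suc = λ p i → begin
     C (mm * + suc i + (p + 1ℤ)) (suc i) ≡⟨ cong (λ z → C z (suc i)) (arg₁ mm (+ suc i) p) ⟩
     C (mm * + suc i + p + 1ℤ) (suc i) ≡⟨ pascal (mm * + suc i + p) i ⟩
     C (mm * + suc i + p) (suc i) + C (mm * + suc i + p) i
       ≡⟨ cong (λ z → C (mm * + suc i + p) (suc i) + C z i) (trans (cong (λ z → mm * z + p) (sym (+1≡suc i))) (arg₂ mm (+ i) p)) ⟩
     C (mm * + suc i + p) (suc i) + C (mm * + i + (p + mm)) i ∎ }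

   a-family : Family a
   a-family = record { fam-zero = λ _ → refl ; fam-suc = fs }
     where
     fs : ∀ p i → a (p + 1ℤ) (suc i) ≡ a p (suc i) + a (p + mm) i
     fs p zero = trans (cong (_- mm * 1ℤ) (Family.fam-suc b-family p 0)) (lem (b p 1) mm)
       where lem : ∀ x m → x + 1ℤ - m * 1ℤ ≡ x - m * 1ℤ + 1ℤ
             lem = solve-∀
     fs p (suc i) = begin
       b (p + 1ℤ) (suc (suc i)) - mm * C (mm * + suc (suc i) + (p + 1ℤ) - 1ℤ) (suc i)
         ≡⟨ cong₂ (λ u v → u - mm * v) (Family.fam-suc b-family p (suc i))
              (trans (cong (λ z → C z (suc i)) (lem1 mm (+ suc (suc i)) p)) (pascal (mm * + suc (suc i) + p - 1ℤ) i)) ⟩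
       b p (suc (suc i)) + b (p + mm) (suc i) - mm * (C (mm * + suc (suc i) + p - 1ℤ) (suc i) + C (mm * + suc (suc i) + p - 1ℤ) i)
         ≡⟨ cong (λ z → b p (suc (suc i)) + b (p + mm) (suc i) - mm * (C (mm * + suc (suc i) + p - 1ℤ) (suc i) + C z i))
              (trans (cong (λ z → mm * z + p - 1ℤ) (sym (+1≡suc (suc i)))) (cong (_- 1ℤ) (arg₂ mm (+ suc i) p))) ⟩
       b p (suc (suc i)) + b (p + mm) (suc i) - mm * (C (mm * + suc (suc i) + p - 1ℤ) (suc i) + C (mm * + suc i + (p + mm) - 1ℤ) i)
         ≡⟨ lem2 (b p (suc (suc i))) (b (p + mm) (suc i)) mm (C (mm * + suc (suc i) + p - 1ℤ) (suc i)) (C (mm * + suc i + (p + mm) - 1ℤ) i) ⟩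
       a p (suc (suc i)) + a (p + mm) (suc i) ∎
       where
       lem1 : ∀ m i p → m * i + (p + 1ℤ) - 1ℤ ≡ m * i + p - 1ℤ + 1ℤ
       lem1 = solve-∀
       lem2 : ∀ x y m u v → x + y - m * (u + v) ≡ x - m * u + (y - m * v)
       lem2 = solve-∀

   -- (m i + p) a p i = p b p i, so that a p lists the coefficients of A^p and b p those of A^p · (y d/dy A) / (A - 1),
   -- where A = 1 + y A^m.
   a-b : ∀ p i → (mm * + i + p) * a p i ≡ p * b p i
   a-b p zero = lem mm p
     where lem : ∀ m p → (m * 0ℤ + p) * 1ℤ ≡ p * 1ℤ
           lem = solve-∀
   a-b p (suc i) = begin
     x * (C x (suc i) - mm * C (x - 1ℤ) i) ≡⟨ lem x mm (C x (suc i)) (C (x - 1ℤ) i) ⟩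
     x * C x (suc i) - mm * ((x - 1ℤ + 1ℤ) * C (x - 1ℤ) i)
       ≡⟨ cong (λ z → x * C x (suc i) - mm * z) (sym (absorb (x - 1ℤ) i)) ⟩
     x * C x (suc i) - mm * (+ suc i * C (x - 1ℤ + 1ℤ) (suc i)) ≡⟨ cong (λ z → x * C x (suc i) - mm * (+ suc i * C z (suc i))) (lem2 x) ⟩
     x * C x (suc i) - mm * (+ suc i * C x (suc i)) ≡⟨ lem3 mm (+ suc i) p (C x (suc i)) ⟩
     p * C x (suc i) ∎
     where
     x = mm * + suc i + p
     lem : ∀ x m u v → x * (u - m * v) ≡ x * u - m * ((x - 1ℤ + 1ℤ) * v)
     lem = solve-∀
     lem2 : ∀ x → x - 1ℤ + 1ℤ ≡ x
     lem2 = solve-∀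
     lem3 : ∀ m i p c → (m * i + p) * c - m * (i * c) ≡ p * c
     lem3 = solve-∀

   a-0 : ∀ i → a 0ℤ (suc i) ≡ 0ℤ
   a-0 i = begin
     C x (suc i) - mm * C (x - 1ℤ) i ≡⟨ i-j≡0 ⟩
     0ℤ ∎
     where
     x = mm * + suc i + 0ℤ
     lem : ∀ m s u v → s * (u - m * v) ≡ s * u - m * s * v
     lem = solve-∀
     lem2 : ∀ m s → m * s + 0ℤ - 1ℤ + 1ℤ ≡ m * s + 0ℤ
     lem2 = solve-∀
     lem3 : ∀ m s v → (m * s + 0ℤ - 1ℤ + 1ℤ) * v - m * s * v ≡ 0ℤ
     lem3 = solve-∀
     s·≡0 : + suc i * (C x (suc i) - mm * C (x - 1ℤ) i) ≡ + suc i * 0ℤ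
     s·≡0 = begin
       + suc i * (C x (suc i) - mm * C (x - 1ℤ) i) ≡⟨ lem mm (+ suc i) (C x (suc i)) (C (x - 1ℤ) i) ⟩
       + suc i * C x (suc i) - mm * + suc i * C (x - 1ℤ) i
         ≡⟨ cong (_- mm * + suc i * C (x - 1ℤ) i) (trans (cong (λ z → + suc i * C z (suc i)) (sym (lem2 mm (+ suc i)))) (absorb (x - 1ℤ) i)) ⟩
       (x - 1ℤ + 1ℤ) * C (x - 1ℤ) i - mm * + suc i * C (x - 1ℤ) i ≡⟨ lem3 mm (+ suc i) (C (x - 1ℤ) i) ⟩
       0ℤ ≡⟨ sym (*-zeroʳ (+ suc i)) ⟩
       + suc i * 0ℤ ∎
     i-j≡0 : C x (suc i) - mm * C (x - 1ℤ) i ≡ 0ℤ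
     i-j≡0 = *-cancelˡ-≡ (+ suc i) _ _ s·≡0

   -- R^t times the series with coefficients `A p i` evaluated at y R^D: the i-th term acquires R^(D
   -- i). The shift by |α| places y^i at its index |α| + i.
   𝕏 : (ℤ → ℕ → ℤ) → ℤ → ℤ → Elt
   𝕏 A t p α = shift (sum α) (λ i → A p i * ρ (t + D * + i) α)

   module _ {A : ℤ → ℕ → ℤ} (fam : Family A) where
     open Family fam
     -- The recursion in p evaluated at y R^D: the new factor y appears as one shift, the new factor
     -- R^D in the exponent t + D.
     X-stepᵖ : ∀ t p α k → 𝕏 A t (p + 1ℤ) α k ≡ 𝕏 A t p α k + cons0 (𝕏 A (t + D) (p + mm) α) k
     X-stepᵖ t p α k = begin
       shift (sum α) (λ i → A (p + 1ℤ) i * ρ (t + D * + i) α) k ≡⟨ shift-cong (sum α) split k ⟩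
       shift (sum α) (λ i → A p i * ρ (t + D * + i) α + cons0 g i) k ≡⟨ shift-+ (sum α) _ _ k ⟩
       𝕏 A t p α k + shift (sum α) (shift 1 g) k
         ≡⟨ cong (_+_ (𝕏 A t p α k)) (trans (shift-shift (sum α) 1 g k) (trans (cong (λ s → shift s g k) (ℕP.+-comm (sum α) 1)) refl)) ⟩
       𝕏 A t p α k + cons0 (𝕏 A (t + D) (p + mm) α) k ∎
       where
       g : Ser
       g i = A (p + mm) i * ρ (t + D + D * + i) α
       lem : ∀ D t i → t + D * (i + 1ℤ) ≡ t + D + D * i
       lem = solve-∀
       split : ∀ i → A (p + 1ℤ) i * ρ (t + D * + i) α ≡ A p i * ρ (t + D * + i) α + cons0 g i
       split zero = trans (cong (_* ρ (t + D * 0ℤ) α) (fam-zero p)) (sym (+-identityʳ _))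
       split (suc i) = trans (cong (_* ρ (t + D * + suc i) α) (fam-suc p i)) (trans (*-distribʳ-+ (ρ (t + D * + suc i) α) (A p (suc i)) (A (p + mm) i))
         (cong (λ z → A p (suc i) * ρ (t + D * + suc i) α + A (p + mm) i * ρ z α) (trans (cong (λ z → t + D * z) (sym (+1≡suc i))) (lem D t (+ i)))))

     -- The equation of R applied to one factor R. In `Pk` the picked letter comes with y^(-c),
     -- which the shift by c compensates, so that no pole arises.
     X-stepᵗ : ∀ t p α k → 𝕏 A (t + 1ℤ) p α k ≡ 𝕏 A t p α k + Pk (λ c → ψ c ∙ (c ▷ 𝕏 A (t + D * + c) p)) α k
     X-stepᵗ t p α k = begin
       shift (sum α) (λ i → A p i * ρ (t + 1ℤ + D * + i) α) k ≡⟨ shift-cong (sum α) step k ⟩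
       shift (sum α) (λ i → A p i * ρ (t + D * + i) α + sumPicks (λ c β → ψ c * (A p i * ρ (t + D * + c + D * + i) β)) α) k
         ≡⟨ shift-+ (sum α) _ _ k ⟩
       𝕏 A t p α k + shift (sum α) (λ i → sumPicks (λ c β → ψ c * (A p i * ρ (t + D * + c + D * + i) β)) α) k
         ≡⟨ cong (_+_ (𝕏 A t p α k)) (trans (shift-sumPicks (sum α) (λ c β i → ψ c * (A p i * ρ (t + D * + c + D * + i) β)) α k) (sumPicks-cong α λ c β q →
              trans (shift-* (sum α) (ψ c) _ k) (cong (ψ c *_) (trans (cong (λ s → shift s _ k) (sym (pick-sum q))) (sym (shift-shift c (sum β) _ k)))))) ⟩
       𝕏 A t p α k + sumPicks (λ c β → ψ c * shift c (𝕏 A (t + D * + c) p β) k) α ∎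
       where
       shift-sumPicks : ∀ s (φ : ℕ → List ℕ → Ser) α k → shift s (λ i → sumPicks (λ c β → φ c β i) α) k ≡ sumPicks (λ c β → shift s (φ c β) k) α
       shift-sumPicks zero φ α k = refl
       shift-sumPicks (suc s) φ α zero = sym (sumPicks-zero α)
       shift-sumPicks (suc s) φ α (suc k) = shift-sumPicks s φ α k
       lem1 : ∀ t x → t + 1ℤ + x ≡ t + x + 1ℤ
       lem1 = solve-∀
       lem2 : ∀ A p r → A * (p * r) ≡ p * (A * r)
       lem2 = solve-∀
       lem3 : ∀ t x y → t + x + y ≡ t + y + x
       lem3 = solve-∀
       step : ∀ i → A p i * ρ (t + 1ℤ + D * + i) α ≡ A p i * ρ (t + D * + i) α + sumPicks (λ c β → ψ c * (A p i * ρ (t + D * + c + D * + i) β)) α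
       step i = begin
         A p i * ρ (t + 1ℤ + D * + i) α ≡⟨ cong (λ z → A p i * ρ z α) (lem1 t (D * + i)) ⟩
         A p i * ρ (t + D * + i + 1ℤ) α ≡⟨ cong (A p i *_) (ρ-step (t + D * + i) α) ⟩
         A p i * (ρ (t + D * + i) α + sumPicks (λ c β → ψ c * ρ (t + D * + i + D * + c) β) α) ≡⟨ *-distribˡ-+ (A p i) _ _ ⟩
         A p i * ρ (t + D * + i) α + A p i * sumPicks (λ c β → ψ c * ρ (t + D * + i + D * + c) β) α
           ≡⟨ cong (_+_ (A p i * ρ (t + D * + i) α)) (trans (sym (sumPicks-* (A p i) _ α)) (sumPicks-cong α λ c β _ →
                trans (lem2 (A p i) (ψ c) _) (cong (λ z → ψ c * (A p i * ρ z β)) (lem3 t (D * + i) (D * + c))))) ⟩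
         _ ∎

   M B : ℤ → ℤ → Elt
   M = 𝕏 a
   B = 𝕏 b

   M-00 : ∀ α k → M 0ℤ 0ℤ α k ≡ ε α k
   M-00 [] zero = refl
   M-00 [] (suc k) = trans (cong (_* 1ℤ) (a-0 k)) refl
   M-00 α@(c ∷ α′) k = trans (shift-cong (sum α) z k) (shift-O (sum α) k)
     where
     z : ∀ i → a 0ℤ i * ρ (0ℤ + D * + i) α ≡ 0ℤ
     z zero = trans (*-identityˡ _) (trans (cong (λ t → ρ t α) (trans (+-identityˡ (D * 0ℤ)) (*-zeroʳ D))) (ρ-zero c α′))
     z (suc i) = trans (cong (_* ρ (0ℤ + D * + suc i) α) (a-0 i)) (*-zeroˡ (ρ (0ℤ + D * + suc i) α))
     shift-O : ∀ s k → shift s (λ _ → 0ℤ) k ≡ 0ℤ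
     shift-O zero k = refl
     shift-O (suc s) zero = refl
     shift-O (suc s) (suc k) = shift-O s k

   module _ {A : ℤ → ℕ → ℤ} (fam : Family A) where
     private
       Goal : ℤ → ℤ → ℤ → ℤ → List ℕ → ℕ → Set
       Goal t p t' q α k = (M t p ⋆ 𝕏 A t' q) α k ≡ 𝕏 A (t + t') (p + q) α k

       arg₃ : ∀ t u d → t + d + u ≡ t + u + d
       arg₃ = solve-∀

       diff : ℤ → ℤ → ℤ → ℤ → List ℕ → ℕ → ℤ
       diff t p t' q α k = (M t p ⋆ 𝕏 A t' q) α k - 𝕏 A (t + t') (p + q) α k

       cancel : ∀ a b c → (a + c) - (b + c) ≡ a - b
       cancel = solve-∀

       -- Both sides of the product rule obey the same recursion in p, and the extra terms carry a
       -- factor y, so they agree by the hypothesis on smaller k.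
       stepᵖ : ∀ t t' q α k → (∀ k' → k' ℕ.< k → ∀ p → Goal (t + D) p t' q α k') →
               ∀ p → diff t (p + 1ℤ) t' q α k ≡ diff t p t' q α k
       stepᵖ t t' q α k ih p = begin
         (M t (p + 1ℤ) ⋆ 𝕏 A t' q) α k - 𝕏 A (t + t') (p + 1ℤ + q) α k
           ≡⟨ cong₂ _-_ (trans (Sh.⋆-cong {M t (p + 1ℤ)} {M t p Sh.⊕ (1 ▷ M (t + D) (p + mm))} {𝕏 A t' q} (λ β j → X-stepᵖ a-family t p β j) (λ _ _ → refl) α k)
                          (trans (Sh.⋆-distribʳ (𝕏 A t' q) (M t p) (1 ▷ M (t + D) (p + mm)) α k) (cong (_+_ ((M t p ⋆ 𝕏 A t' q) α k)) (trans (▷-⋆ 1 (M (t + D) (p + mm)) (𝕏 A t' q) α k) (tl k ih)))))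
                        (trans (cong (λ z → 𝕏 A (t + t') z α k) (arg₃ p q 1ℤ)) (trans (X-stepᵖ fam (t + t') (p + q) α k) (cong (_+_ (𝕏 A (t + t') (p + q) α k)) (cons0-cong (λ i → cong₂ (λ u v → 𝕏 A u v α i) (sym (arg₃ t t' D)) (sym (arg₃ p q mm))) k)))) ⟩
         ((M t p ⋆ 𝕏 A t' q) α k + rest) - (𝕏 A (t + t') (p + q) α k + rest) ≡⟨ cancel ((M t p ⋆ 𝕏 A t' q) α k) (𝕏 A (t + t') (p + q) α k) rest ⟩
         diff t p t' q α k ∎
         where
         rest = cons0 (𝕏 A (t + D + t') (p + mm + q) α) k
         tl : ∀ k → (∀ k' → k' ℕ.< k → ∀ p → Goal (t + D) p t' q α k') → cons0 ((M (t + D) (p + mm) ⋆ 𝕏 A t' q) α) k ≡ cons0 (𝕏 A (t + D + t') (p + mm + q) α) k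
         tl zero _ = refl
         tl (suc k) ih = ih k (ℕP.n<1+n k) (p + mm)

       -- The same argument in t: here the extra terms belong to words with one letter removed.
       stepᵗ : ∀ p t' q α k → (∀ c β → Pick c β α → ∀ t k → Goal t p t' q β k) →
               ∀ t → diff (t + 1ℤ) p t' q α k ≡ diff t p t' q α k
       stepᵗ p t' q α k ih t = begin
         (M (t + 1ℤ) p ⋆ 𝕏 A t' q) α k - 𝕏 A (t + 1ℤ + t') (p + q) α k
           ≡⟨ cong₂ _-_ (trans (Sh.⋆-cong {M (t + 1ℤ) p} {M t p Sh.⊕ Pk z} {𝕏 A t' q} (λ β j → X-stepᵗ a-family t p β j) (λ _ _ → refl) α k)
                          (trans (Sh.⋆-distribʳ (𝕏 A t' q) (M t p) (Pk z) α k) (cong (_+_ ((M t p ⋆ 𝕏 A t' q) α k)) (trans (Pk-⋆ z (𝕏 A t' q) α k) (sumPicks-cong α λ c β pk →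
                            trans (∙-⋆ (ψ c) (c ▷ M (t + D * + c) p) (𝕏 A t' q) β k) (cong (ψ c *_) (trans (▷-⋆ c (M (t + D * + c) p) (𝕏 A t' q) β k) (shift-cong c (ih c β pk (t + D * + c)) k))))))))
                        (trans (cong (λ z → 𝕏 A z (p + q) α k) (arg₃ t t' 1ℤ)) (trans (X-stepᵗ fam (t + t') (p + q) α k) (cong (_+_ (𝕏 A (t + t') (p + q) α k)) (sumPicks-cong α λ c β _ → cong (λ u → ψ c * shift c (𝕏 A u (p + q) β) k) (sym (arg₃ t t' (D * + c))))))) ⟩
         ((M t p ⋆ 𝕏 A t' q) α k + rest) - (𝕏 A (t + t') (p + q) α k + rest) ≡⟨ cancel ((M t p ⋆ 𝕏 A t' q) α k) (𝕏 A (t + t') (p + q) α k) rest ⟩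
         diff t p t' q α k ∎
         where
         z : ℕ → Elt
         z c = ψ c ∙ (c ▷ M (t + D * + c) p)
         rest = sumPicks (λ c β → ψ c * shift c (𝕏 A (t + D * + c + t') (p + q) β) k) α

       -- Periodicity carries first p and then t to 0, where the left factor is the unit. The step
       -- in t is used at p = 0 on shorter words but with the same k, so the bound on k starts
       -- afresh at each removal of a letter.
       main : ∀ n m α k → length α ℕ.≤ n → k ℕ.≤ m → ∀ t p t' q → Goal t p t' q α k
       main n m α k ln km t p t' q = i-j≡0⇒i≡j _ _ (begin
         diff t p t' q α k ≡⟨ const-on-ℤ (λ p → diff t p t' q α k) (stepᵖ t t' q α k (lower m km)) p ⟩
         diff t 0ℤ t' q α k ≡⟨ const-on-ℤ (λ t → diff t 0ℤ t' q α k) (stepᵗ 0ℤ t' q α k (shorter n ln)) t ⟩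
         diff 0ℤ 0ℤ t' q α k ≡⟨ i≡j⇒i-j≡0 (begin
           (M 0ℤ 0ℤ ⋆ 𝕏 A t' q) α k ≡⟨ Sh.⋆-cong {M 0ℤ 0ℤ} {ε} {𝕏 A t' q} M-00 (λ _ _ → refl) α k ⟩
           (ε ⋆ 𝕏 A t' q) α k ≡⟨ Sh.⋆-identityˡ (𝕏 A t' q) α k ⟩
           𝕏 A t' q α k ≡⟨ sym (cong₂ (λ u v → 𝕏 A u v α k) (+-identityˡ t') (+-identityˡ q)) ⟩
           𝕏 A (0ℤ + t') (0ℤ + q) α k ∎) ⟩
         0ℤ ∎)
         where
         lower : ∀ m → k ℕ.≤ m → ∀ k' → k' ℕ.< k → ∀ p → Goal (t + D) p t' q α k'
         lower zero k≤0 k' k'<k p with () ← ℕP.<-≤-trans k'<k k≤0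
         lower (suc m) k≤ k' k'<k p = main n m α k' ln (ℕP.≤-pred (ℕP.<-≤-trans k'<k k≤)) (t + D) p t' q
         shorter : ∀ n → length α ℕ.≤ n → ∀ c β → Pick c β α → ∀ t k → Goal t 0ℤ t' q β k
         shorter zero le c β pk t k with () ← subst (ℕ._≤ 0) (sym (pick-length pk)) le
         shorter (suc n) le c β pk t k = main n k β k (ℕP.≤-pred (subst (ℕ._≤ suc n) (sym (pick-length pk)) le)) ℕP.≤-refl t 0ℤ t' q

     -- Exponents add under multiplication: a convolution identity of Rothe-Hagen type, valid for
     -- all integer exponents.
     M-⋆ : ∀ t p t' q α k → (M t p ⋆ 𝕏 A t' q) α k ≡ 𝕏 A (t + t') (p + q) α k
     M-⋆ t p t' q α k = main (length α) k α k ℕP.≤-refl ℕP.≤-refl t p t' q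

-- The closed form of the step series Y

module StepSeries where
 open Binomials
 open MultiplicativeFamilies
 open import Data.Integer using (ℤ; +_; -[1+_]; _+_; _*_; -_; _-_; 0ℤ; 1ℤ; ≢-nonZero)
 open import Data.Integer.Properties hiding (_≟_)
 open import Data.Integer.Tactic.RingSolver using (solve-∀)
 open import Data.Nat using (ℕ; zero; suc)
 import Data.Nat as ℕ
 import Data.Nat.Properties as ℕP
 open import Data.List using ([]; _∷_)
 open import Data.List.Relation.Unary.All using (All; []; _∷_)
 open import Data.Nat.ListAction using (sum)
 open import Data.Product using (_,_; ∃)
 open import Data.Sum using (_⊎_; inj₁; inj₂)
 open import Relation.Binary.PropositionalEquality
 open import Relation.Nullary using (¬_; yes; no)
 open import Relation.Binary.Definitions using (tri<; tri≈; tri>)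
 open ≡-Reasoning
 open Sh using (_⋆_; _⊕_)

 sumTo : ℕ → (ℕ → ℤ) → ℤ
 sumTo zero f = 0ℤ
 sumTo (suc n) f = sumTo n f + f n

 sumTo-cong : ∀ n {f g} → (∀ j → j ℕ.< n → f j ≡ g j) → sumTo n f ≡ sumTo n g
 sumTo-cong zero h = refl
 sumTo-cong (suc n) h = cong₂ _+_ (sumTo-cong n λ j p → h j (ℕP.m<n⇒m<1+n p)) (h n (ℕP.n<1+n n))

 sumTo-zero : ∀ n {f} → (∀ j → j ℕ.< n → f j ≡ 0ℤ) → sumTo n f ≡ 0ℤ
 sumTo-zero zero h = refl
 sumTo-zero (suc n) h = cong₂ _+_ (sumTo-zero n λ j p → h j (ℕP.m<n⇒m<1+n p)) (h n (ℕP.n<1+n n))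

 Sum : ℕ → (ℕ → Elt) → Elt
 Sum n z α k = sumTo n (λ j → z j α k)

 Sum-⋆ : ∀ n z g α k → (Sum n z ⋆ g) α k ≡ Sum n (λ j → z j ⋆ g) α k
 Sum-⋆ zero z g α k = Sh.⋆-zeroˡ g α k
 Sum-⋆ (suc n) z g α k = trans (Sh.⋆-distribʳ g (Sum n z) (z n) α k) (cong (_+ (z n ⋆ g) α k) (Sum-⋆ n z g α k))

 -- The identities for Y hold on words with positive letters. Such words have only such subwords, so
 -- these identities may still be used inside products.
 ⋆-cong-on : ∀ {P : ℕ → Set} {f f' g g' : Elt} → (∀ α → All P α → ∀ k → f α k ≡ f' α k) → (∀ α → All P α → ∀ k → g α k ≡ g' α k) →
             ∀ α → All P α → ∀ k → (f ⋆ g) α k ≡ (f' ⋆ g') α k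
 ⋆-cong-on p q [] [] k = PS.×-cong (p [] []) (q [] []) k
 ⋆-cong-on p q (c ∷ α) (x ∷ xs) k =
   cong₂ _+_ (⋆-cong-on (λ β y → p (c ∷ β) (x ∷ y)) q α xs k) (⋆-cong-on p (λ β y → q (c ∷ β) (x ∷ y)) α xs k)

 Yp : Elt → ℕ → Elt → Elt
 Yp y zero g = g
 Yp y (suc j) g = y ⋆ Yp y j g

 below-or-shift : ∀ s k → (k ℕ.< s) ⊎ ∃ λ i → k ≡ s ℕ.+ i
 below-or-shift s k with k ℕ.<? s
 ... | yes p = inj₁ p
 ... | no ¬p = inj₂ (k ℕ.∸ s , sym (ℕP.m+[n∸m]≡n (ℕP.≮⇒≥ ¬p)))

 module Solution (d : ℕ) where
   D : ℤ
   D = + suc d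
   open Families D public

   xc : ℕ → ℤ
   xc c = mm * + c - 1ℤ

   pj : ℕ → ℕ → ℤ
   pj c j = 1ℤ - mm * (+ c - + j)

   -- The coefficient of (y R^D)^i in `zc c`.
   κ : ℕ → ℕ → ℤ
   κ c i = sumTo c (λ j → C (xc c) j * shift j (a (pj c j)) i)

   -- With T = A(y R^D) one has y R^D = (T - 1) T^(-m), so the j-th term is T^(1-mc) C(mc-1, j)
   -- (T-1)^j. The full sum over j would be T^(1-mc) T^(mc-1) = 1; cutting it at j < c leaves 1 +
   -- O(y^c).
   zc : ℕ → Elt
   zc c = Sum c (λ j → C (xc c) j ∙ (j ▷ M (D * + j) (pj c j)))

   -- `M 1 1` is R A(y R^D) and has no pole; all poles of Y come from Z. The two summands are named
   -- separately because powers of Y are expanded in powers of Z.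
   Z Y : Elt
   Z = Pk (λ c → (+ c) ∙ zc c)
   Y = M 1ℤ 1ℤ ⊕ Z

   zc-κ : ∀ c β k → zc c β k ≡ shift (sum β) (λ i → κ c i * ρ (D * + i) β) k
   zc-κ c β k = go c
     where
     term : ∀ j → _∙_ (C (xc c) j) (j ▷ M (D * + j) (pj c j)) β k ≡ shift (sum β) (λ i → C (xc c) j * shift j (a (pj c j)) i * ρ (D * + i) β) k
     term j = begin
       C (xc c) j * shift j (shift (sum β) (λ i → a (pj c j) i * ρ (D * + j + D * + i) β)) k
         ≡⟨ cong (C (xc c) j *_) (trans (shift-shift j (sum β) f k) (trans (cong (λ s → shift s f k) (ℕP.+-comm j (sum β))) (sym (shift-shift (sum β) j f k)))) ⟩
       C (xc c) j * shift (sum β) (shift j (λ i → a (pj c j) i * ρ (D * + j + D * + i) β)) k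
         ≡⟨ sym (shift-* (sum β) (C (xc c) j) _ k) ⟩
       shift (sum β) (λ i → C (xc c) j * shift j (λ i → a (pj c j) i * ρ (D * + j + D * + i) β) i) k
         ≡⟨ shift-cong (sum β) (λ i → trans (cong (C (xc c) j *_) (pull j i)) (sym (*-assoc (C (xc c) j) _ _))) k ⟩
       shift (sum β) (λ i → C (xc c) j * shift j (a (pj c j)) i * ρ (D * + i) β) k ∎
       where
       f : Ser
       f i = a (pj c j) i * ρ (D * + j + D * + i) β
       lem : ∀ D j i → D * j + D * i ≡ D * (j + i)
       lem = solve-∀
       pull : ∀ j i → shift j (λ i → a (pj c j) i * ρ (D * + j + D * + i) β) i ≡ shift j (a (pj c j)) i * ρ (D * + i) β
       pull j i with below-or-shift j i
       ... | inj₁ lt = trans (shift-below j _ i lt) (sym (trans (cong (_* ρ (D * + i) β) (shift-below j _ i lt)) (*-zeroˡ (ρ (D * + i) β))))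
       ... | inj₂ (i' , refl) = trans (shift-at j _ i') (cong₂ _*_ (sym (shift-at j _ i')) (cong (λ t → ρ t β) (trans (lem D (+ j) (+ i')) (cong (D *_) (sym (pos-+ j i'))))))
     go : ∀ n → sumTo n (λ j → _∙_ (C (xc c) j) (j ▷ M (D * + j) (pj c j)) β k) ≡ shift (sum β) (λ i → sumTo n (λ j → C (xc c) j * shift j (a (pj c j)) i) * ρ (D * + i) β) k
     go zero = sym (trans (shift-cong (sum β) (λ i → *-zeroˡ (ρ (D * + i) β)) k) (shift0 (sum β) k))
       where shift0 : ∀ s k → shift s (λ _ → 0ℤ) k ≡ 0ℤ
             shift0 s k = trans (trans (sym (*-identityˡ (shift s (λ _ → 0ℤ) k))) (trans (sym (shift-* s 1ℤ (λ _ → 0ℤ) k)) (shift-* s 0ℤ (λ _ → 0ℤ) k))) (*-zeroˡ (shift s (λ _ → 0ℤ) k))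
     go (suc n) = trans (cong₂ _+_ (go n) (term n)) (trans (sym (shift-+ (sum β) _ _ k)) (shift-cong (sum β) (λ i → sym (*-distribʳ-+ (ρ (D * + i) β) (sumTo n (λ j → C (xc c) j * shift j (a (pj c j)) i)) (C (xc c) n * shift n (a (pj c n)) i))) k))

   mm≡ : mm ≡ + suc (suc d)
   mm≡ = +1≡suc (suc d)

   -- D ≥ 1 makes m at least 2, so m z + 1 never vanishes on ℤ.
   mz+1≢0 : ∀ z → ¬ (mm * z + 1ℤ ≡ 0ℤ)
   mz+1≢0 z eq = helper z (subst (λ w → w * z + 1ℤ ≡ 0ℤ) mm≡ eq)
     where
     helper : ∀ z → ¬ (+ suc (suc d) * z + 1ℤ ≡ 0ℤ)
     helper (+ zero) e with () ← trans (sym (cong (_+ 1ℤ) (*-zeroʳ (+ suc (suc d))))) e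
     helper (+ suc n) e with () ← e
     helper -[1+ zero ] ()
     helper -[1+ suc n ] ()

   cancel : ∀ x {u v} → ¬ (x ≡ 0ℤ) → x * u ≡ x * v → u ≡ v
   cancel x nz = *-cancelˡ-≡ x _ _ {{≢-nonZero nz}}

   +suc≢0 : ∀ n → ¬ (+ suc n ≡ 0ℤ)
   +suc≢0 n ()

   -- The partial sums telescope: i times the sum over j < n is -n C(mc-1, n) C(m(i-c), i-n). The
   -- factor m(i-c) + 1 equals m(i-j) + `pj c j` for every j, so multiplying by it makes `a-b`
   -- applicable to all terms at once.
   κ-sum : ∀ c i n → (mm * (+ i - + c) + 1ℤ) * (+ i * sumTo n (λ j → C (xc c) j * shift j (a (pj c j)) i))
                     ≡ - ((mm * (+ i - + c) + 1ℤ) * (+ n * C (xc c) n * shift n (C (mm * (+ i - + c))) i))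
   κ-sum c i zero = lem (mm * (+ i - + c) + 1ℤ) (+ i) (C (mm * (+ i - + c)) i)
     where lem : ∀ X i s → X * (i * 0ℤ) ≡ - (X * (0ℤ * 1ℤ * s))
           lem = solve-∀
   κ-sum c i (suc n) = begin
     (X + 1ℤ) * (+ i * (S + Cn * sa)) ≡⟨ lem₁ (X + 1ℤ) (+ i) S Cn sa ⟩
     (X + 1ℤ) * (+ i * S) + Cn * ((X + 1ℤ) * (+ i * sa)) ≡⟨ cong (_+ Cn * ((X + 1ℤ) * (+ i * sa))) (κ-sum c i n) ⟩
     - ((X + 1ℤ) * (+ n * Cn * sn)) + Cn * ((X + 1ℤ) * (+ i * sa)) ≡⟨ lem₂ (X + 1ℤ) (+ n) Cn sn (+ i) sa ⟩
     Cn * ((X + 1ℤ) * (+ i * sa) - (X + 1ℤ) * (+ n * sn)) ≡⟨ cong (Cn *_) key ⟩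
     Cn * (- ((X + 1ℤ) * ((x - + n) * sn1))) ≡⟨ lem₃ Cn (X + 1ℤ) (x - + n) sn1 ⟩
     - ((X + 1ℤ) * ((x - + n) * Cn * sn1)) ≡⟨ cong (λ z → - ((X + 1ℤ) * (z * sn1))) (sym (absorb′ x n)) ⟩
     - ((X + 1ℤ) * (+ suc n * C x (suc n) * sn1)) ∎
     where
     X = mm * (+ i - + c)
     x = xc c
     p = pj c n
     S = sumTo n (λ j → C x j * shift j (a (pj c j)) i)
     Cn = C x n
     sa = shift n (a p) i
     sn = shift n (C X) i
     sn1 = shift (suc n) (C X) i
     lem₁ : ∀ X i S c s → X * (i * (S + c * s)) ≡ X * (i * S) + c * (X * (i * s))
     lem₁ = solve-∀
     lem₂ : ∀ X n c s i sa → - (X * (n * c * s)) + c * (X * (i * sa)) ≡ c * (X * (i * sa) - X * (n * s))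
     lem₂ = solve-∀
     lem₃ : ∀ c X y s → c * (- (X * (y * s))) ≡ - (X * (y * c * s))
     lem₃ = solve-∀
     key : (X + 1ℤ) * (+ i * sa) - (X + 1ℤ) * (+ n * sn) ≡ - ((X + 1ℤ) * ((x - + n) * sn1))
     key with ℕP.<-cmp i n
     ... | tri< i<n _ _ rewrite shift-below n (a p) i i<n | shift-below n (C X) i i<n | shift-below (suc n) (C X) i (ℕP.m<n⇒m<1+n i<n) = lem (X + 1ℤ) (+ i) (+ n) (x - + n)
       where lem : ∀ X i n y → X * (i * 0ℤ) - X * (n * 0ℤ) ≡ - (X * (y * 0ℤ))
             lem = solve-∀
     ... | tri≈ _ refl _ = begin
       (X + 1ℤ) * (+ i * sa) - (X + 1ℤ) * (+ i * sn) ≡⟨ cong₂ (λ u v → (X + 1ℤ) * (+ i * u) - (X + 1ℤ) * (+ i * v)) (at0 (a p)) (at0 (C X)) ⟩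
       (X + 1ℤ) * (+ i * 1ℤ) - (X + 1ℤ) * (+ i * 1ℤ) ≡⟨ lem (X + 1ℤ) (+ i) (x - + i) ⟩
       - ((X + 1ℤ) * ((x - + i) * 0ℤ)) ≡⟨ cong (λ z → - ((X + 1ℤ) * ((x - + i) * z))) (sym (shift-below (suc i) (C X) i (ℕP.n<1+n i))) ⟩
       - ((X + 1ℤ) * ((x - + i) * sn1)) ∎
       where
       lem : ∀ X i y → X * (i * 1ℤ) - X * (i * 1ℤ) ≡ - (X * (y * 0ℤ))
       lem = solve-∀
       at0 : ∀ f → shift i f i ≡ f 0
       at0 f = trans (cong (shift i f) (sym (ℕP.+-identityʳ i))) (shift-at i f 0)
     -- Only for i > n is the increment nontrivial. With i = n + 1 + e, multiplication by 1 + e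
     -- turns both binomial coefficients into multiples of `C X e`, and a polynomial identity
     -- remains.
     ... | tri> _ _ n<i with ℕP.m≤n⇒∃[o]m+o≡n n<i
     ... | e , refl = cancel (+ suc e) (+suc≢0 e) (begin
       E1 * ((X + 1ℤ) * (+ i * sa) - (X + 1ℤ) * (+ n * sn))
         ≡⟨ cong₂ (λ u v → E1 * ((X + 1ℤ) * (+ i * u) - (X + 1ℤ) * (+ n * v))) (at1 (a p)) (at1 (C X)) ⟩
       E1 * ((X + 1ℤ) * (+ i * a p (suc e)) - (X + 1ℤ) * (+ n * C X (suc e))) ≡⟨ lem₄ E1 (X + 1ℤ) (+ i) (a p (suc e)) (+ n) (C X (suc e)) ⟩
       + i * (E1 * ((X + 1ℤ) * a p (suc e))) - (X + 1ℤ) * (+ n * (E1 * C X (suc e)))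
         ≡⟨ cong₂ (λ u v → + i * (E1 * u) - (X + 1ℤ) * (+ n * v)) ab (absorb′ X e) ⟩
       + i * (E1 * (p * C (X + 1ℤ) (suc e))) - (X + 1ℤ) * (+ n * ((X - + e) * C X e))
         ≡⟨ cong (λ z → z - (X + 1ℤ) * (+ n * ((X - + e) * C X e))) (trans (lem₅ (+ i) E1 p (C (X + 1ℤ) (suc e))) (cong (λ z → + i * p * z) (absorb X e))) ⟩
       + i * p * ((X + 1ℤ) * C X e) - (X + 1ℤ) * (+ n * ((X - + e) * C X e)) ≡⟨ lem₆ mm (+ c) (+ n) (+ e) (+ i) E1 (C X e) i≡ (sym (+1≡suc e)) ⟩
       E1 * (- ((X + 1ℤ) * ((x - + n) * C X e))) ≡⟨ cong (λ z → E1 * (- ((X + 1ℤ) * ((x - + n) * z)))) (sym (shift-at (suc n) (C X) e)) ⟩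
       E1 * (- ((X + 1ℤ) * ((x - + n) * sn1))) ∎)
       where
       E1 = + suc e
       i≡ : + i ≡ + n + + e + 1ℤ
       i≡ = trans (sym (+1≡suc (n ℕ.+ e))) (cong (_+ 1ℤ) (pos-+ n e))
       at1 : ∀ f → shift n f i ≡ f (suc e)
       at1 f = trans (cong (shift n f) (sym (ℕP.+-suc n e))) (shift-at n f (suc e))
       lem₄ : ∀ E X i a n c → E * (X * (i * a) - X * (n * c)) ≡ i * (E * (X * a)) - X * (n * (E * c))
       lem₄ = solve-∀
       lem₅ : ∀ i E p c → i * (E * (p * c)) ≡ i * p * (E * c)
       lem₅ = solve-∀
       xe : mm * + suc e + p ≡ X + 1ℤ
       xe = trans (cong (λ z → mm * z + p) (sym (+1≡suc e))) (trans (lem mm (+ e) (+ c) (+ n)) (cong (λ z → mm * (z - + c) + 1ℤ) (sym i≡)))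
         where lem : ∀ m e c n → m * (e + 1ℤ) + (1ℤ - m * (c - n)) ≡ m * (n + e + 1ℤ - c) + 1ℤ
               lem = solve-∀
       ab : (X + 1ℤ) * a p (suc e) ≡ p * C (X + 1ℤ) (suc e)
       ab = trans (cong (_* a p (suc e)) (sym xe)) (trans (a-b p (suc e)) (cong (λ z → p * C z (suc e)) xe))
       lem₆ : ∀ m c n e i E f → i ≡ n + e + 1ℤ → E ≡ e + 1ℤ →
              i * (1ℤ - m * (c - n)) * ((m * (i - c) + 1ℤ) * f) - (m * (i - c) + 1ℤ) * (n * ((m * (i - c) - e) * f))
              ≡ E * (- ((m * (i - c) + 1ℤ) * ((m * c - 1ℤ - n) * f)))
       lem₆ m c n e _ _ f refl refl = lem m c n e f
         where lem : ∀ m c n e f → (n + e + 1ℤ) * (1ℤ - m * (c - n)) * ((m * (n + e + 1ℤ - c) + 1ℤ) * f) - (m * (n + e + 1ℤ - c) + 1ℤ) * (n * ((m * (n + e + 1ℤ - c) - e) * f))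
                     ≡ (e + 1ℤ) * (- ((m * (n + e + 1ℤ - c) + 1ℤ) * ((m * c - 1ℤ - n) * f)))
               lem = solve-∀

   -- This contains both the truncation effect (zero for 0 < i < c) and the tail from i = c on. At i
   -- = 0 it says nothing, so the constant term 1 is computed directly.
   κ-eq : ∀ c i → + i * κ c i ≡ - (ψ c * shift c (C (mm * (+ i - + c))) i)
   κ-eq c i = cancel _ (mz+1≢0 (+ i - + c)) (trans (κ-sum c i c) (neg-distribʳ-* (mm * (+ i - + c) + 1ℤ) _))

   κ-zero : ∀ c → κ (suc c) 0 ≡ 1ℤ
   κ-zero c = go c
     where go : ∀ n → sumTo (suc n) (λ j → C (xc (suc c)) j * shift j (a (pj (suc c) j)) 0) ≡ 1ℤ
           go zero = refl
           go (suc n) = trans (cong₂ _+_ (go n) (*-zeroʳ (C (xc (suc c)) (suc n)))) refl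

   κ-below : ∀ c i → suc i ℕ.< c → κ c (suc i) ≡ 0ℤ
   κ-below c i lt = cancel (+ suc i) (+suc≢0 i) (trans (κ-eq c (suc i)) (trans (cong -_ (trans (cong (ψ c *_) (shift-below c _ (suc i) lt)) (*-zeroʳ (ψ c)))) (sym (*-zeroʳ (+ suc i)))))

   κ-above : ∀ c i → + (c ℕ.+ i) * κ c (c ℕ.+ i) ≡ - (ψ c * b 0ℤ i)
   κ-above c i = trans (κ-eq c (c ℕ.+ i)) (cong (λ z → - (ψ c * z)) (trans (shift-at c _ i) (cong (λ z → C z i) (trans (cong (λ z → mm * (z - + c)) (pos-+ c i)) (lem mm (+ c) (+ i))))))
     where lem : ∀ m c i → m * (c + i - c) ≡ m * i + 0ℤ
           lem = solve-∀

-- The Euler operator turns Y into a binomial series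

module EulerOperator where
 open Binomials
 open MultiplicativeFamilies
 open StepSeries
 open import Data.Integer using (ℤ; +_; _+_; _*_; -_; _-_; 0ℤ; 1ℤ)
 open import Data.Integer.Properties hiding (_≟_)
 open import Data.Integer.Tactic.RingSolver using (solve-∀)
 open import Data.Nat using (ℕ; zero; suc)
 import Data.Nat as ℕ
 import Data.Nat.Properties as ℕP
 open import Data.List using (List; []; _∷_; length)
 open import Data.List.Relation.Unary.All using (All; []; _∷_)
 open import Data.Nat.ListAction using (sum)
 open import Data.Product using (_×_; _,_; proj₁; proj₂)
 open import Data.Sum using (inj₁; inj₂)
 open import Relation.Binary.PropositionalEquality
 open ≡-Reasoning

 Positive : List ℕ → Set
 Positive = All (1 ℕ.≤_)

 pick-All : ∀ {A : Set} {P : A → Set} {c β α} → Pick c β α → All P α → P c × All P β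
 pick-All here (p ∷ ps) = p , ps
 pick-All (there q) (p ∷ ps) = proj₁ (pick-All q ps) , p ∷ proj₂ (pick-All q ps)

 module Coefficients (d : ℕ) where
   open Solution d

   -- The exponent (m-1)n - l + 2 of x, for n = k points and l cycles, one more than the letters of
   -- α: the extra one is the root cycle.
   euler : List ℕ → ℕ → ℤ
   euler α k = D * + k - + length α + 1ℤ

   -- Two forms of the Fuss-Catalan number. Multiplied by m i + 1, which never vanishes, both become
   -- binomial coefficients related by `pascal` and `absorb`.
   a₁-b₀ : ∀ i → (D * + i + 1ℤ) * a 1ℤ i ≡ b 0ℤ i
   a₁-b₀ zero = cong (λ z → (z + 1ℤ) * 1ℤ) (*-zeroʳ D)
   a₁-b₀ (suc e) = cancel (x + 1ℤ) (mz+1≢0 (+ suc e)) (begin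
     (x + 1ℤ) * ((D * E + 1ℤ) * a 1ℤ (suc e)) ≡⟨ lem₁ (x + 1ℤ) (D * E + 1ℤ) (a 1ℤ (suc e)) ⟩
     (D * E + 1ℤ) * ((x + 1ℤ) * a 1ℤ (suc e)) ≡⟨ cong ((D * E + 1ℤ) *_) (a-b 1ℤ (suc e)) ⟩
     (D * E + 1ℤ) * (1ℤ * C (x + 1ℤ) (suc e)) ≡⟨ lem₂ D E (C (x + 1ℤ) (suc e)) ⟩
     (x + 1ℤ) * C (x + 1ℤ) (suc e) - E * C (x + 1ℤ) (suc e) ≡⟨ cong₂ (λ u v → (x + 1ℤ) * u - v) (pascal x e) (absorb x e) ⟩
     (x + 1ℤ) * (C x (suc e) + C x e) - (x + 1ℤ) * C x e ≡⟨ lem₃ (x + 1ℤ) (C x (suc e)) (C x e) ⟩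
     (x + 1ℤ) * C x (suc e) ≡⟨ cong (λ z → (x + 1ℤ) * C z (suc e)) (sym (+-identityʳ x)) ⟩
     (x + 1ℤ) * b 0ℤ (suc e) ∎)
     where
     E = + suc e
     x = mm * E
     lem₁ : ∀ x y z → x * (y * z) ≡ y * (x * z)
     lem₁ = solve-∀
     lem₂ : ∀ D E c → (D * E + 1ℤ) * (1ℤ * c) ≡ ((D + 1ℤ) * E + 1ℤ) * c - E * c
     lem₂ = solve-∀
     lem₃ : ∀ x u v → x * (u + v) - x * v ≡ x * u
     lem₃ = solve-∀

   Zt : ℕ → ℕ → List ℕ → ℤ
   Zt k c β = + c * shift (sum β) (λ i → κ c i * ρ (D * + i) β) k

   Z-picks : ∀ α k → Z α k ≡ sumPicks (Zt k) α
   Z-picks α k = sumPicks-cong α λ c β _ → cong (+ c *_) (zc-κ c β k)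

   M-at : ∀ t p α i → M t p α (sum α ℕ.+ i) ≡ a p i * ρ (t + D * + i) α
   M-at t p α i = shift-at (sum α) _ i

   B-at : ∀ t p α i → B t p α (sum α ℕ.+ i) ≡ b p i * ρ (t + D * + i) α
   B-at t p α i = shift-at (sum α) _ i

   -- The index leaves less than c for the exponent i in κ. For 0 < i < c the truncation gives κ =
   -- 0, and at i = 0 the factor R^0 = 1 has no coefficient on a nonempty word. So negative
   -- exponents of Y need words of a single letter.
   Zt-below : ∀ c e β k → k ℕ.< c ℕ.+ sum (e ∷ β) → Zt k c (e ∷ β) ≡ 0ℤ
   Zt-below c e β k lt with below-or-shift (sum (e ∷ β)) k
   ... | inj₁ lt′ = trans (cong (+ c *_) (shift-below (sum (e ∷ β)) _ k lt′)) (*-zeroʳ (+ c))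
   ... | inj₂ (zero , refl) = trans (cong (+ c *_) (trans (shift-at (sum (e ∷ β)) _ 0) (trans (cong (λ t → κ c 0 * ρ t (e ∷ β)) (*-zeroʳ D)) (trans (cong (κ c 0 *_) (ρ-zero e β)) (*-zeroʳ (κ c 0)))))) (*-zeroʳ (+ c))
   ... | inj₂ (suc q , refl) = trans (cong (+ c *_) (trans (shift-at (sum (e ∷ β)) _ (suc q)) (trans (cong (_* ρ (D * + suc q) (e ∷ β)) (κ-below c q q<c)) (*-zeroˡ (ρ (D * + suc q) (e ∷ β)))))) (*-zeroʳ (+ c))
     where q<c : suc q ℕ.< c
           q<c = ℕP.+-cancelˡ-< (sum (e ∷ β)) _ _ (subst (sum (e ∷ β) ℕ.+ suc q ℕ.<_) (ℕP.+-comm c (sum (e ∷ β))) lt)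

   Y-below : ∀ c e α k → k ℕ.< sum (c ∷ e ∷ α) → Y (c ∷ e ∷ α) k ≡ 0ℤ
   Y-below c e α k lt = cong₂ _+_ (shift-below (sum (c ∷ e ∷ α)) _ k lt) (trans (Z-picks (c ∷ e ∷ α) k) (trans (sumPicks-cong (c ∷ e ∷ α) z) (sumPicks-zero (c ∷ e ∷ α))))
     where
     z : ∀ c′ β → Pick c′ β (c ∷ e ∷ α) → Zt k c′ β ≡ 0ℤ
     z c′ [] p with () ← pick-length p
     z c′ (x ∷ β) p = Zt-below c′ x β k (subst (k ℕ.<_) (sym (pick-sum p)) lt)

   Z-single : ∀ c k → Z (c ∷ []) k ≡ + c * κ c k
   Z-single c k = trans (Z-picks (c ∷ []) k) (trans (+-identityʳ _) (cong (+ c *_) (*-identityʳ (κ c k))))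

   Y-single-0 : ∀ c → Y (suc c ∷ []) 0 ≡ + suc c
   Y-single-0 c = trans (+-identityˡ _) (trans (Z-single (suc c) 0) (trans (cong (+ suc c *_) (κ-zero c)) (*-identityʳ _)))

   Y-single-below : ∀ c k → suc k ℕ.< c → Y (c ∷ []) (suc k) ≡ 0ℤ
   Y-single-below c k lt = cong₂ _+_ (shift-below (c ℕ.+ 0) _ (suc k) (subst (suc k ℕ.<_) (sym (ℕP.+-identityʳ c)) lt))
     (trans (Z-single c (suc k)) (trans (cong (+ c *_) (κ-below c k lt)) (*-zeroʳ (+ c))))

   -- For at least two letters, the picks of Z are proportional to the picked part and sum to a
   -- multiple of |α| = k - i. Combined with the part from R A(y R^D), proportional to k, this
   -- leaves i, and the Euler factor becomes the last factor of the next falling factorial.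
   euler-above : ∀ α i → euler α (sum α ℕ.+ i) * Y α (sum α ℕ.+ i) ≡ b 0ℤ i * ρ (D * + i) α
   euler-above [] i = begin
     (D * + i - 0ℤ + 1ℤ) * (a 1ℤ i * 1ℤ + 0ℤ) ≡⟨ lem (D * + i) (a 1ℤ i) ⟩
     (D * + i + 1ℤ) * a 1ℤ i * 1ℤ ≡⟨ cong (_* 1ℤ) (a₁-b₀ i) ⟩
     b 0ℤ i * 1ℤ ∎
     where lem : ∀ x a → (x - 0ℤ + 1ℤ) * (a * 1ℤ + 0ℤ) ≡ (x + 1ℤ) * a * 1ℤ
           lem = solve-∀
   euler-above (c ∷ []) i = begin
     (D * + k - 1ℤ + 1ℤ) * (M 1ℤ 1ℤ (c ∷ []) k + Z (c ∷ []) k)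
       ≡⟨ cong₂ (λ u v → (D * + k - 1ℤ + 1ℤ) * (u + v)) (M-at 1ℤ 1ℤ (c ∷ []) i) (trans (Z-single c k) (cong (λ z → + c * κ c (z ℕ.+ i)) (ℕP.+-identityʳ c))) ⟩
     (D * + k - 1ℤ + 1ℤ) * (a 1ℤ i * (ψ c * 1ℤ * ((1ℤ + D * + i) * 1ℤ)) + + c * κ c (c ℕ.+ i))
       ≡⟨ lem₁ D (+ k) (a 1ℤ i) (ψ c) (+ i) (+ c) (κ c (c ℕ.+ i)) ⟩
     D * + k * (ψ c * ((D * + i + 1ℤ) * a 1ℤ i)) + D * + c * (+ k * κ c (c ℕ.+ i))
       ≡⟨ cong₂ (λ u v → D * + k * (ψ c * u) + D * + c * v) (a₁-b₀ i) (trans (cong (λ z → + (z ℕ.+ i) * κ c (c ℕ.+ i)) (ℕP.+-identityʳ c)) (κ-above c i)) ⟩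
     D * + k * (ψ c * b 0ℤ i) + D * + c * (- (ψ c * b 0ℤ i)) ≡⟨ cong (λ z → D * z * (ψ c * b 0ℤ i) + D * + c * (- (ψ c * b 0ℤ i))) (trans (cong (λ z → + (z ℕ.+ i)) (ℕP.+-identityʳ c)) (pos-+ c i)) ⟩
     D * (+ c + + i) * (ψ c * b 0ℤ i) + D * + c * (- (ψ c * b 0ℤ i)) ≡⟨ lem₂ D (+ c) (+ i) (ψ c) (b 0ℤ i) ⟩
     b 0ℤ i * (ψ c * 1ℤ * (D * + i * 1ℤ)) ∎
     where
     k = sum (c ∷ []) ℕ.+ i
     lem₁ : ∀ D k a p i c x → (D * k - 1ℤ + 1ℤ) * (a * (p * 1ℤ * ((1ℤ + D * i) * 1ℤ)) + c * x) ≡ D * k * (p * ((D * i + 1ℤ) * a)) + D * c * (k * x)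
     lem₁ = solve-∀
     lem₂ : ∀ D c i p b → D * (c + i) * (p * b) + D * c * (- (p * b)) ≡ b * (p * 1ℤ * (D * i * 1ℤ))
     lem₂ = solve-∀
   euler-above α@(c₁ ∷ c₂ ∷ α′) i = begin
     euler α k * (M 1ℤ 1ℤ α k + Z α k) ≡⟨ cong₂ (λ u v → euler α k * (u + v)) Mpart Zpart ⟩
     euler α k * (b 0ℤ i * Ψ α * (D * + k * F) + (- (D * Ψ α * b 0ℤ i * F)) * + s)
       ≡⟨ cong₂ (λ u v → (D * + k - u + 1ℤ) * (b 0ℤ i * Ψ α * (D * + k * F) + (- (D * Ψ α * b 0ℤ i * F)) * v)) l≡ s≡ ⟩
     (D * + k - (+ l + 1ℤ + 1ℤ) + 1ℤ) * (b 0ℤ i * Ψ α * (D * + k * F) + (- (D * Ψ α * b 0ℤ i * F)) * (+ k - + i))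
       ≡⟨ lem₁ D (+ k) (+ l) (b 0ℤ i) (Ψ α) F (+ i) ⟩
     b 0ℤ i * (Ψ α * (D * + i * (F * (D * + k - 1ℤ - + l)))) ≡⟨ cong (λ z → b 0ℤ i * (Ψ α * (D * + i * z))) (sym (ff-last (D * + k - 1ℤ) l)) ⟩
     b 0ℤ i * (Ψ α * (D * + i * ff (D * + k - 1ℤ) (suc l))) ≡⟨ cong (λ z → b 0ℤ i * (Ψ α * (D * + i * ff z (suc l)))) (sym (arg D (+ s) (+ i) (+ k) (pos-+ s i))) ⟩
     b 0ℤ i * ρ (D * + i) α ∎
     where
     s = sum α
     k = s ℕ.+ i
     l = length α′
     F = ff (D * + k - 1ℤ) l
     l≡ : + length α ≡ + l + 1ℤ + 1ℤ
     l≡ = sym (trans (cong (_+ 1ℤ) (+1≡suc l)) (+1≡suc (suc l)))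
     s≡ : + s ≡ + k - + i
     s≡ = trans (lem (+ s) (+ i)) (cong (_- + i) (sym (pos-+ s i)))
       where lem : ∀ s i → s ≡ s + i - i
             lem = solve-∀
     arg : ∀ D s i k → k ≡ s + i → D * s + D * i - 1ℤ ≡ D * k - 1ℤ
     arg D s i _ refl = lem D s i
       where lem : ∀ D s i → D * s + D * i - 1ℤ ≡ D * (s + i) - 1ℤ
             lem = solve-∀
     lem₁ : ∀ D k l b p F i → (D * k - (l + 1ℤ + 1ℤ) + 1ℤ) * (b * p * (D * k * F) + (- (D * p * b * F)) * (k - i)) ≡ b * (p * (D * i * (F * (D * k - 1ℤ - l))))
     lem₁ = solve-∀
     Mpart : M 1ℤ 1ℤ α k ≡ b 0ℤ i * Ψ α * (D * + k * F)
     Mpart = begin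
       M 1ℤ 1ℤ α k ≡⟨ M-at 1ℤ 1ℤ α i ⟩
       a 1ℤ i * (Ψ α * ((1ℤ + D * + i) * (W * ff (W - 1ℤ) l))) ≡⟨ lem (a 1ℤ i) (Ψ α) (D * + i) (W * ff (W - 1ℤ) l) ⟩
       (D * + i + 1ℤ) * a 1ℤ i * Ψ α * (W * ff (W - 1ℤ) l) ≡⟨ cong₂ (λ u v → u * Ψ α * (v * ff (v - 1ℤ) l)) (a₁-b₀ i) (trans (lem₀ D (+ s) (+ i)) (cong (D *_) (sym (pos-+ s i)))) ⟩
       b 0ℤ i * Ψ α * (D * + k * F) ∎
       where
       W = D * + s + (1ℤ + D * + i) - 1ℤ
       lem : ∀ a p x w → a * (p * ((1ℤ + x) * w)) ≡ (x + 1ℤ) * a * p * w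
       lem = solve-∀
       lem₀ : ∀ D s i → D * s + (1ℤ + D * i) - 1ℤ ≡ D * (s + i)
       lem₀ = solve-∀
     Zpart : Z α k ≡ (- (D * Ψ α * b 0ℤ i * F)) * + s
     Zpart = trans (Z-picks α k) (trans (sumPicks-cong α term) (trans (sumPicks-linear 0ℤ K α) (trans (cong (_+ K * + s) (*-zeroʳ (+ length α))) (+-identityˡ _))))
       where
       K = - (D * Ψ α * b 0ℤ i * F)
       term : ∀ c β → Pick c β α → Zt k c β ≡ 0ℤ + K * + c
       term c β p = begin
         + c * shift (sum β) (λ i → κ c i * ρ (D * + i) β) k
           ≡⟨ cong (λ z → + c * shift (sum β) (λ i → κ c i * ρ (D * + i) β) z) k≡ ⟩
         + c * shift (sum β) (λ i → κ c i * ρ (D * + i) β) (sum β ℕ.+ q) ≡⟨ cong (+ c *_) (shift-at (sum β) _ q) ⟩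
         + c * (κ c q * ρ (D * + q) β) ≡⟨ cong (λ z → + c * (κ c q * z)) (ρ-pos _ β l (ℕP.suc-injective (pick-length p))) ⟩
         + c * (κ c q * (Ψ β * (D * + q * ff (D * + sum β + D * + q - 1ℤ) l)))
           ≡⟨ cong (λ z → + c * (κ c q * (Ψ β * (D * + q * ff z l)))) (arg D (+ sum β) (+ q) (+ k) (trans (cong +_ k≡) (pos-+ (sum β) q))) ⟩
         + c * (κ c q * (Ψ β * (D * + q * F))) ≡⟨ lem₂ (+ c) (κ c q) (Ψ β) D (+ q) F ⟩
         + c * (Ψ β * D * F * (+ q * κ c q)) ≡⟨ cong (λ z → + c * (Ψ β * D * F * z)) (κ-above c i) ⟩
         + c * (Ψ β * D * F * (- (ψ c * b 0ℤ i))) ≡⟨ lem₃ (+ c) (Ψ β) D F (ψ c) (b 0ℤ i) ⟩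
         0ℤ + (- (D * (ψ c * Ψ β) * b 0ℤ i * F)) * + c ≡⟨ cong (λ z → 0ℤ + (- (D * z * b 0ℤ i * F)) * + c) (pick-Ψ p) ⟩
         0ℤ + K * + c ∎
         where
         q = c ℕ.+ i
         k≡ : k ≡ sum β ℕ.+ q
         k≡ = trans (cong (ℕ._+ i) (trans (sym (pick-sum p)) (ℕP.+-comm c (sum β)))) (ℕP.+-assoc (sum β) c i)
         lem₂ : ∀ c x p D q F → c * (x * (p * (D * q * F))) ≡ c * (p * D * F * (q * x))
         lem₂ = solve-∀
         lem₃ : ∀ c p D F s b → c * (p * D * F * (- (s * b))) ≡ 0ℤ + (- (D * (s * p) * b * F)) * c
         lem₃ = solve-∀

   -- Negative exponents occur only as the poles c q_c y^(-c). These sit at k = 0 on one-letter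
   -- words, where the Euler factor D 0 - 1 + 1 is zero.
   Y-euler : ∀ α → Positive α → ∀ k → euler α k * Y α k ≡ B 0ℤ 0ℤ α k
   Y-euler α pos k with below-or-shift (sum α) k
   ... | inj₂ (i , refl) = trans (euler-above α i) (sym (trans (B-at 0ℤ 0ℤ α i) (cong (λ t → b 0ℤ i * ρ t α) (+-identityˡ (D * + i)))))
   ... | inj₁ lt = trans (zero-below α k lt) (sym (shift-below (sum α) _ k lt))
     where
     zero-below : ∀ α k → k ℕ.< sum α → euler α k * Y α k ≡ 0ℤ
     zero-below (c ∷ []) zero lt = trans (cong (_* Y (c ∷ []) 0) (cong (λ z → z - 1ℤ + 1ℤ) (*-zeroʳ D))) (*-zeroˡ (Y (c ∷ []) 0))
     zero-below (c ∷ []) (suc k) lt = trans (cong (euler (c ∷ []) (suc k) *_) (Y-single-below c k (subst (suc k ℕ.<_) (ℕP.+-identityʳ c) lt))) (*-zeroʳ (euler (c ∷ []) (suc k)))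
     zero-below (c ∷ e ∷ α) k lt = trans (cong (euler (c ∷ e ∷ α) k *_) (Y-below c e α k lt)) (*-zeroʳ (euler (c ∷ e ∷ α) k))

-- The residue of Y^(m+1)

module Residues where
 open Binomials
 open MultiplicativeFamilies
 open StepSeries
 open EulerOperator
 open import Data.Integer using (ℤ; +_; _+_; _*_; -_; _-_; 0ℤ; 1ℤ)
 open import Data.Integer.Properties hiding (_≟_)
 open import Data.Integer.Tactic.RingSolver using (solve-∀)
 open import Data.Nat using (ℕ; zero; suc; s≤s)
 import Data.Nat as ℕ
 import Data.Nat.Properties as ℕP
 open import Data.List using (List; []; _∷_; length)
 open import Data.List.Relation.Unary.All using ([]; _∷_)
 open import Data.Nat.ListAction using (sum)
 open import Data.Product using (_,_)
 open import Data.Sum using (inj₁; inj₂)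
 open import Relation.Binary.PropositionalEquality
 open ≡-Reasoning
 open PS using (_×ₛ_)
 open Sh using (_⋆_; ε; ∂; _⊕_)

 ⋆-congˡ : ∀ {f f'} g → f Sh.≋ f' → f ⋆ g Sh.≋ f' ⋆ g
 ⋆-congˡ {f} {f'} g p = Sh.⋆-cong {f} {f'} {g} {g} p (λ _ _ → refl)

 ⋆-congʳ : ∀ f {g g'} → g Sh.≋ g' → f ⋆ g Sh.≋ f ⋆ g'
 ⋆-congʳ f {g} {g'} p = Sh.⋆-cong {f} {f} {g} {g'} (λ _ _ → refl) p

 ⋆-swap : ∀ f g h → f ⋆ (g ⋆ h) Sh.≋ g ⋆ (f ⋆ h)
 ⋆-swap f g h α k = trans (sym (Sh.⋆-assoc f g h α k)) (trans (⋆-congˡ h (Sh.⋆-comm f g) α k) (Sh.⋆-assoc g f h α k))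

 Yp-cong : ∀ y j {g g'} → g Sh.≋ g' → Yp y j g Sh.≋ Yp y j g'
 Yp-cong y zero p = p
 Yp-cong y (suc j) p = ⋆-congʳ y (Yp-cong y j p)

 Yp-⊕ : ∀ y j g h → Yp y j (g ⊕ h) Sh.≋ Yp y j g ⊕ Yp y j h
 Yp-⊕ y zero g h α k = refl
 Yp-⊕ y (suc j) g h α k = trans (⋆-congʳ y (Yp-⊕ y j g h) α k) (Sh.⋆-distribˡ y (Yp y j g) (Yp y j h) α k)

 Yp-⋆ : ∀ y j g → Yp y (suc j) g Sh.≋ Yp y j (y ⋆ g)
 Yp-⋆ y zero g α k = refl
 Yp-⋆ y (suc j) g α k = ⋆-congʳ y (Yp-⋆ y j g) α k

 module Residue (d : ℕ) where
   open Solution d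
   open Coefficients d

   ZB : ℕ → ℤ → ℤ → Elt
   ZB zero t p = B t p
   ZB (suc r) t p = Z ⋆ ZB r t p

   M-ZB : ∀ r t p t' p' → M t p ⋆ ZB r t' p' Sh.≋ ZB r (t + t') (p + p')
   M-ZB zero t p t' p' = M-⋆ b-family t p t' p'
   M-ZB (suc r) t p t' p' α k = trans (⋆-swap (M t p) Z (ZB r t' p') α k) (⋆-congʳ Z (M-ZB r t p t' p') α k)

   ZB-expand : ∀ r t p α k → ZB (suc r) t p α k ≡
     sumPicks (λ c β → + c * sumTo c (λ j → C (xc c) j * shift j (ZB r (D * + j + t) (pj c j + p) β) k)) α
   ZB-expand r t p α k = begin
     (Pk (λ c → (+ c) ∙ zc c) ⋆ ZB r t p) α k ≡⟨ Pk-⋆ (λ c → (+ c) ∙ zc c) (ZB r t p) α k ⟩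
     sumPicks (λ c β → (((+ c) ∙ zc c) ⋆ ZB r t p) β k) α ≡⟨ sumPicks-cong α (λ c β _ → trans (∙-⋆ (+ c) (zc c) (ZB r t p) β k) (cong (+ c *_)
        (trans (Sum-⋆ c (λ j → C (xc c) j ∙ (j ▷ M (D * + j) (pj c j))) (ZB r t p) β k) (sumTo-cong c λ j _ →
          trans (∙-⋆ (C (xc c) j) (j ▷ M (D * + j) (pj c j)) (ZB r t p) β k) (cong (C (xc c) j *_)
          (trans (▷-⋆ j (M (D * + j) (pj c j)) (ZB r t p) β k) (shift-cong j (M-ZB r (D * + j) (pj c j) t p β) k))))))) ⟩
     _ ∎

   -- Write e for the exponent k - |α|. A term of Z with parameters c and j changes e by c - j, p by
   -- 1 - m(c - j) and r by -1, so m e + p + r is preserved; and since c - j ≥ 1, so is the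
   -- inequality -e < r. At r = 0 this leaves C(m e + p, e) = C(0, e) with e > 0.
   ZB-vanish : ∀ r t p α k → mm * (+ k - + sum α) + p + + r ≡ 0ℤ → sum α ℕ.< k ℕ.+ r → ZB r t p α k ≡ 0ℤ
   ZB-vanish zero t p α k eq lt with ℕP.m≤n⇒∃[o]m+o≡n (subst (sum α ℕ.<_) (ℕP.+-identityʳ k) lt)
   ... | i , refl = begin
     B t p α (suc (sum α ℕ.+ i)) ≡⟨ cong (B t p α) (sym (ℕP.+-suc (sum α) i)) ⟩
     B t p α (sum α ℕ.+ suc i) ≡⟨ B-at t p α (suc i) ⟩
     C (mm * + suc i + p) (suc i) * ρ (t + D * + suc i) α ≡⟨ cong (λ z → C z (suc i) * ρ (t + D * + suc i) α) z≡0 ⟩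
     0ℤ * ρ (t + D * + suc i) α ≡⟨ *-zeroˡ (ρ (t + D * + suc i) α) ⟩
     0ℤ ∎
     where
     z≡0 : mm * + suc i + p ≡ 0ℤ
     z≡0 = trans (lem mm (+ suc i) p (+ sum α)) (trans (cong (λ z → mm * (z - + sum α) + p + 0ℤ) (trans (sym (pos-+ (sum α) (suc i))) (cong +_ (ℕP.+-suc (sum α) i)))) eq)
       where lem : ∀ m i p s → m * i + p ≡ m * (s + i - s) + p + 0ℤ
             lem = solve-∀
   ZB-vanish (suc r) t p α k eq lt = trans (ZB-expand r t p α k) (trans (sumPicks-cong α λ c β pk →
       trans (cong (+ c *_) (sumTo-zero c λ j j<c → trans (cong (C (xc c) j *_) (inner c β pk j j<c)) (*-zeroʳ (C (xc c) j)))) (*-zeroʳ (+ c))) (sumPicks-zero α))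
     where
     inner : ∀ c β → Pick c β α → ∀ j → j ℕ.< c → shift j (ZB r (D * + j + t) (pj c j + p) β) k ≡ 0ℤ
     inner c β pk j j<c with below-or-shift j k
     ... | inj₁ k<j = shift-below j _ k k<j
     ... | inj₂ (k₁ , refl) = trans (shift-at j _ k₁) (ZB-vanish r (D * + j + t) (pj c j + p) β k₁ eq′ lt′)
       where
       eq′ : mm * (+ k₁ - + sum β) + (pj c j + p) + + r ≡ 0ℤ
       eq′ = trans (lem mm (+ k₁) (+ sum β) (+ c) (+ j) p (+ r)) (trans (cong₂ (λ u v → mm * (u - v) + p + (+ r + 1ℤ)) (sym (pos-+ j k₁)) (trans (sym (pos-+ c (sum β))) (cong +_ (pick-sum pk))))
               (trans (cong (_+_ (mm * (+ (j ℕ.+ k₁) - + sum α) + p)) (+1≡suc r)) eq))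
         where lem : ∀ m k b c j p r → m * (k - b) + (1ℤ - m * (c - j) + p) + r ≡ m * (j + k - (c + b)) + p + (r + 1ℤ)
               lem = solve-∀
       lt′ : sum β ℕ.< k₁ ℕ.+ r
       lt′ = ℕP.+-cancelˡ-< (suc j) _ _ (ℕP.≤-<-trans (ℕP.+-monoˡ-≤ (sum β) j<c) (subst₂ ℕ._<_ (sym (pick-sum pk)) eq″ lt))
         where eq″ : j ℕ.+ k₁ ℕ.+ suc r ≡ suc j ℕ.+ (k₁ ℕ.+ r)
               eq″ = trans (ℕP.+-suc (j ℕ.+ k₁) r) (cong suc (ℕP.+-assoc j k₁ r))

   -- The series (R - 1) / (m - 1), with the division absorbed in C(mc-1, c-1) = C(mc-1, c) / (m-1).
   Q : List ℕ → ℤ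
   Q = sumPicks (λ c β → + c * C (xc c) (c ℕ.∸ 1) * ρ (D * + c) β)

   ψ-C : ∀ c → D * (+ c * C (xc c) (c ℕ.∸ 1)) ≡ ψ c
   ψ-C zero = *-zeroʳ D
   ψ-C (suc c) = sym (trans (absorb′ (xc (suc c)) c) (trans (cong (λ z → (z - + c) * C (xc (suc c)) c) (cong (λ z → mm * z - 1ℤ) (sym (+1≡suc c))))
       (trans (lem D (+ c) (C (xc (suc c)) c)) (cong (λ z → D * (z * C (xc (suc c)) c)) (+1≡suc c)))))
     where lem : ∀ D c x → ((D + 1ℤ) * (c + 1ℤ) - 1ℤ - c) * x ≡ D * ((c + 1ℤ) * x)
           lem = solve-∀

   D·Q : ∀ α → D * Q α ≡ ρ 1ℤ α - ρ 0ℤ α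
   D·Q α = trans (sym (sumPicks-* D _ α)) (trans (sumPicks-cong α λ c β _ → trans (sym (*-assoc D (+ c * C (xc c) (c ℕ.∸ 1)) (ρ (D * + c) β))) (cong₂ (λ u v → u * ρ v β) (ψ-C c) (sym (+-identityˡ (D * + c)))))
      (trans (lem (sumPicks (λ c β → ψ c * ρ (0ℤ + D * + c) β) α) (ρ 0ℤ α)) (cong (_- ρ 0ℤ α) (sym (ρ-step 0ℤ α)))))
     where lem : ∀ x y → x ≡ y + x - y
           lem = solve-∀

   -- For a part c only j = c - 1 contributes, where exponent 0 is left for the binomial series. For
   -- smaller j the remaining exponent is i = c - 1 - j > 0 and the parameter is p = -m i, so C(m i
   -- + p, i) = 0.
   ZB₁ : ∀ α k → suc k ≡ sum α → ZB 1 D D α k ≡ Q α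
   ZB₁ α k eq = trans (ZB-expand 0 D D α k) (sumPicks-cong α term)
     where
     term : ∀ c β → Pick c β α → + c * sumTo c (λ j → C (xc c) j * shift j (B (D * + j + D) (pj c j + D) β) k) ≡ + c * C (xc c) (c ℕ.∸ 1) * ρ (D * + c) β
     term zero β pk = trans (*-zeroˡ 0ℤ) (sym (*-zeroˡ (ρ (D * 0ℤ) β)))
     term (suc c) β pk = trans (cong (+ suc c *_) (trans (cong₂ _+_ (sumTo-zero c λ j lt → trans (cong (C (xc (suc c)) j *_) (low j lt)) (*-zeroʳ (C (xc (suc c)) j))) (cong (C (xc (suc c)) c *_) top)) (+-identityˡ _)))
         (sym (*-assoc (+ suc c) (C (xc (suc c)) c) (ρ (D * + suc c) β)))
       where
       k≡ : k ≡ c ℕ.+ sum β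
       k≡ = ℕP.suc-injective (trans eq (sym (pick-sum pk)))
       top : shift c (B (D * + c + D) (pj (suc c) c + D) β) k ≡ ρ (D * + suc c) β
       top = begin
         shift c (B (D * + c + D) (pj (suc c) c + D) β) k ≡⟨ cong (shift c (B (D * + c + D) (pj (suc c) c + D) β)) k≡ ⟩
         shift c (B (D * + c + D) (pj (suc c) c + D) β) (c ℕ.+ sum β) ≡⟨ shift-at c _ (sum β) ⟩
         B (D * + c + D) (pj (suc c) c + D) β (sum β) ≡⟨ cong (B (D * + c + D) (pj (suc c) c + D) β) (sym (ℕP.+-identityʳ (sum β))) ⟩
         B (D * + c + D) (pj (suc c) c + D) β (sum β ℕ.+ 0) ≡⟨ B-at (D * + c + D) (pj (suc c) c + D) β 0 ⟩
         1ℤ * ρ (D * + c + D + D * 0ℤ) β ≡⟨ trans (*-identityˡ _) (cong (λ z → ρ z β) (trans (lem D (+ c)) (cong (D *_) (+1≡suc c)))) ⟩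
         ρ (D * + suc c) β ∎
         where lem : ∀ D c → D * c + D + D * 0ℤ ≡ D * (c + 1ℤ)
               lem = solve-∀
       low : ∀ j → j ℕ.< c → shift j (B (D * + j + D) (pj (suc c) j + D) β) k ≡ 0ℤ
       low j lt with ℕP.m≤n⇒∃[o]m+o≡n lt
       ... | o , refl = begin
         shift j (B t p β) k ≡⟨ cong (shift j (B t p β)) (trans k≡ (trans (cong (ℕ._+ sum β) (sym (ℕP.+-suc j o))) (ℕP.+-assoc j (suc o) (sum β)))) ⟩
         shift j (B t p β) (j ℕ.+ (suc o ℕ.+ sum β)) ≡⟨ shift-at j _ _ ⟩
         B t p β (suc o ℕ.+ sum β) ≡⟨ ZB-vanish 0 t p β (suc o ℕ.+ sum β) vz (subst (sum β ℕ.<_) (sym (ℕP.+-identityʳ _)) (ℕP.m≤n+m (suc (sum β)) o ⟫ ℕP.≤-reflexive (ℕP.+-suc o (sum β)))) ⟩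
         0ℤ ∎
         where
         infixr 4 _⟫_
         _⟫_ : ∀ {a b c} → a ℕ.≤ b → b ℕ.≤ c → a ℕ.≤ c
         _⟫_ = ℕP.≤-trans
         t = D * + j + D
         p = pj (suc (suc j ℕ.+ o)) j + D
         vz : mm * (+ (suc o ℕ.+ sum β) - + sum β) + p + 0ℤ ≡ 0ℤ
         vz = trans (cong₂ (λ u v → mm * (u - + sum β) + (1ℤ - mm * (v - + j) + D) + 0ℤ)
                      (trans (pos-+ (suc o) (sum β)) (cong (_+ + sum β) (sym (+1≡suc o))))
                      (trans (sym (+1≡suc (suc j ℕ.+ o))) (cong (_+ 1ℤ) (trans (pos-+ (suc j) o) (cong (_+ + o) (sym (+1≡suc j)))))))
                (lem D (+ o) (+ sum β) (+ j))
           where lem : ∀ D o s j → (D + 1ℤ) * (o + 1ℤ + s - s) + (1ℤ - (D + 1ℤ) * (j + 1ℤ + o + 1ℤ - j) + D) + 0ℤ ≡ 0ℤ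
                 lem = solve-∀

   Y·ZB : ∀ r s → Y ⋆ ZB r (+ s) (+ s) Sh.≋ ZB r (+ suc s) (+ suc s) ⊕ ZB (suc r) (+ s) (+ s)
   Y·ZB r s α k = trans (Sh.⋆-distribʳ (ZB r (+ s) (+ s)) (M 1ℤ 1ℤ) Z α k) (cong (_+ ZB (suc r) (+ s) (+ s) α k)
     (M-ZB r 1ℤ 1ℤ (+ s) (+ s) α k))

   -- Expand Y^j = (R A(y R^D) + Z)^j, keeping r + s = m. Without Z there is no pole; each of the j
   -- terms with one Z gives Q; terms with two or more vanish by `ZB-vanish`.
   YpB : ∀ j s α k → j ℕ.+ s ≡ suc (suc d) → suc k ≡ sum α → Yp Y j (B (+ s) (+ s)) α k ≡ + j * Q α
   YpB j s α k eq keq = go₀ j s eq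
     where
     base : ∀ r s → r ℕ.+ s ≡ suc (suc d) → mm * (+ k - + sum α) + + s + + r ≡ 0ℤ
     base r s e = trans (cong₂ (λ u v → u * (+ k - v) + + s + + r) (trans mm≡ (trans (cong +_ (sym e)) (pos-+ r s))) (trans (cong +_ (sym keq)) (sym (+1≡suc k)))) (lem (+ r) (+ s) (+ k))
       where lem : ∀ r s k → (r + s) * (k - (k + 1ℤ)) + s + r ≡ 0ℤ
             lem = solve-∀
     step : ∀ j r s → Yp Y (suc j) (ZB r (+ s) (+ s)) α k ≡ Yp Y j (ZB r (+ suc s) (+ suc s)) α k + Yp Y j (ZB (suc r) (+ s) (+ s)) α k
     step j r s = trans (Yp-⋆ Y j (ZB r (+ s) (+ s)) α k) (trans (Yp-cong Y j (Y·ZB r s) α k) (Yp-⊕ Y j (ZB r (+ suc s) (+ suc s)) (ZB (suc r) (+ s) (+ s)) α k))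
     go₂ : ∀ j r s → j ℕ.+ (suc (suc r) ℕ.+ s) ≡ suc (suc d) → Yp Y j (ZB (suc (suc r)) (+ s) (+ s)) α k ≡ 0ℤ
     go₂ zero r s e = ZB-vanish (suc (suc r)) (+ s) (+ s) α k (base (suc (suc r)) s e) (subst (ℕ._< k ℕ.+ suc (suc r)) keq (subst (suc k ℕ.<_) (sym (trans (ℕP.+-suc k (suc r)) (cong suc (ℕP.+-suc k r)))) (s≤s (s≤s (ℕP.m≤m+n k r)))))
     go₂ (suc j) r s e = trans (step j (suc (suc r)) s) (cong₂ _+_
       (go₂ j r (suc s) (trans (cong (j ℕ.+_) (ℕP.+-suc (suc (suc r)) s)) (trans (ℕP.+-suc j _) e)))
       (go₂ j (suc r) s (trans (ℕP.+-suc j _) e)))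
     go₁ : ∀ j s → j ℕ.+ (1 ℕ.+ s) ≡ suc (suc d) → Yp Y j (ZB 1 (+ s) (+ s)) α k ≡ Q α
     go₁ zero s e with refl ← ℕP.suc-injective e = ZB₁ α k keq
     go₁ (suc j) s e = trans (step j 1 s) (trans (cong₂ _+_
       (go₁ j (suc s) (trans (ℕP.+-suc j (suc s)) e)) (go₂ j 0 s (trans (ℕP.+-suc j _) e))) (+-identityʳ _))
     go₀ : ∀ j s → j ℕ.+ s ≡ suc (suc d) → Yp Y j (B (+ s) (+ s)) α k ≡ + j * Q α
     go₀ zero s e = trans (shift-below (sum α) _ k (subst (k ℕ.<_) keq (ℕP.n<1+n k))) (sym (*-zeroˡ (Q α)))
     go₀ (suc j) s e = trans (step j 0 s) (trans (cong₂ _+_ (go₀ j (suc s) (trans (ℕP.+-suc j s) e)) (go₁ j s (trans (ℕP.+-suc j s) e)))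
       (trans (lem (+ j) (Q α)) (cong (_* Q α) (+1≡suc j))))
       where lem : ∀ j q → j * q + q ≡ (j + 1ℤ) * q
             lem = solve-∀

   -- The Euler operator on elements of degree x. Degrees add in products, and Y has degree 1.
   δ : ℤ → Elt → Elt
   δ x f α k = (D * + k - + length α + x) * f α k

   private
     δₛ : ℤ → Ser → Ser
     δₛ x f k = (D * + k + x) * f k

     δₛ-× : ∀ x y f g k → δₛ (x + y) (f ×ₛ g) k ≡ (δₛ x f ×ₛ g) k + (f ×ₛ δₛ y g) k
     δₛ-× x y f g zero = lem D x y (f 0) (g 0)
       where lem : ∀ D x y u v → (D * 0ℤ + (x + y)) * (u * v) ≡ (D * 0ℤ + x) * u * v + u * ((D * 0ℤ + y) * v)
             lem = solve-∀
     δₛ-× x y f g (suc k) = begin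
       (D * + suc k + (x + y)) * (f 0 * g (suc k) + T) ≡⟨ cong (λ z → (D * z + (x + y)) * (f 0 * g (suc k) + T)) (sym (+1≡suc k)) ⟩
       (D * (+ k + 1ℤ) + (x + y)) * (f 0 * g (suc k) + T) ≡⟨ lem₁ D (+ k) x y (f 0) (g (suc k)) T ⟩
       (D * 0ℤ + x) * f 0 * g (suc k) + f 0 * ((D * (+ k + 1ℤ) + y) * g (suc k)) + (D * + k + (D + x + y)) * T
         ≡⟨ cong₂ (λ u v → (D * 0ℤ + x) * f 0 * g (suc k) + f 0 * ((D * u + y) * g (suc k)) + v) (+1≡suc k) (δₛ-× (D + x) y (PS.tail f) g k) ⟩
       (D * 0ℤ + x) * f 0 * g (suc k) + f 0 * ((D * + suc k + y) * g (suc k)) + ((δₛ (D + x) (PS.tail f) ×ₛ g) k + (PS.tail f ×ₛ δₛ y g) k)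
         ≡⟨ cong (λ z → (D * 0ℤ + x) * f 0 * g (suc k) + f 0 * ((D * + suc k + y) * g (suc k)) + (z + (PS.tail f ×ₛ δₛ y g) k))
              (PS.×-cong {δₛ (D + x) (PS.tail f)} {PS.tail (δₛ x f)} {g} (λ i → cong (_* f (suc i)) (trans (lem₀ D (+ i) x) (cong (λ z → D * z + x) (+1≡suc i)))) (λ _ → refl) k) ⟩
       (D * 0ℤ + x) * f 0 * g (suc k) + f 0 * ((D * + suc k + y) * g (suc k)) + ((PS.tail (δₛ x f) ×ₛ g) k + (PS.tail f ×ₛ δₛ y g) k)
         ≡⟨ lem₂ ((D * 0ℤ + x) * f 0 * g (suc k)) _ _ _ ⟩
       (δₛ x f ×ₛ g) (suc k) + (f ×ₛ δₛ y g) (suc k) ∎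
       where
       T = (PS.tail f ×ₛ g) k
       lem₀ : ∀ D i x → D * i + (D + x) ≡ D * (i + 1ℤ) + x
       lem₀ = solve-∀
       lem₁ : ∀ D k x y f g T → (D * (k + 1ℤ) + (x + y)) * (f * g + T) ≡ (D * 0ℤ + x) * f * g + f * ((D * (k + 1ℤ) + y) * g) + (D * k + (D + x + y)) * T
       lem₁ = solve-∀
       lem₂ : ∀ a b c d → a + b + (c + d) ≡ (a + c) + (b + d)
       lem₂ = solve-∀

     δ-∂ : ∀ x c f α k → δ x f (c ∷ α) k ≡ δ (x - 1ℤ) (∂ c f) α k
     δ-∂ x c f α k = cong (_* f (c ∷ α) k) (trans (cong (λ z → D * + k - z + x) (sym (+1≡suc (length α)))) (lem D (+ k) (+ length α) x))
       where lem : ∀ D k l x → D * k - (l + 1ℤ) + x ≡ D * k - l + (x - 1ℤ)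
             lem = solve-∀

   -- Every product has z, u and x exponents equal to the sums of those of its factors, and x = 1 loses nothing.
   δ-⋆ : ∀ x y f g α k → δ (x + y) (f ⋆ g) α k ≡ (δ x f ⋆ g) α k + (f ⋆ δ y g) α k
   δ-⋆ x y f g [] k = begin
     (D * + k - 0ℤ + (x + y)) * (f [] ×ₛ g []) k ≡⟨ cong (_* (f [] ×ₛ g []) k) (lem D (+ k) (x + y)) ⟩
     (D * + k + (x + y)) * (f [] ×ₛ g []) k ≡⟨ δₛ-× x y (f []) (g []) k ⟩
     (δₛ x (f []) ×ₛ g []) k + (f [] ×ₛ δₛ y (g [])) k
       ≡⟨ cong₂ _+_ (PS.×-cong {δₛ x (f [])} {δ x f []} {g []} (λ i → cong (_* f [] i) (sym (lem D (+ i) x))) (λ _ → refl) k)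
                    (PS.×-cong {f []} {f []} {δₛ y (g [])} {δ y g []} (λ _ → refl) (λ i → cong (_* g [] i) (sym (lem D (+ i) y))) k) ⟩
     (δ x f [] ×ₛ g []) k + (f [] ×ₛ δ y g []) k ∎
     where lem : ∀ D k x → D * k - 0ℤ + x ≡ D * k + x
           lem = solve-∀
   δ-⋆ x y f g (c ∷ α) k = begin
     δ (x + y) (f ⋆ g) (c ∷ α) k ≡⟨ δ-∂ (x + y) c (f ⋆ g) α k ⟩
     (D * + k - + length α + (x + y - 1ℤ)) * ((∂ c f ⋆ g) α k + (f ⋆ ∂ c g) α k) ≡⟨ lem₁ (D * + k - + length α) x y _ _ ⟩
     δ (x - 1ℤ + y) (∂ c f ⋆ g) α k + δ (x + (y - 1ℤ)) (f ⋆ ∂ c g) α k ≡⟨ cong₂ _+_ (δ-⋆ (x - 1ℤ) y (∂ c f) g α k) (δ-⋆ x (y - 1ℤ) f (∂ c g) α k) ⟩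
     ((δ (x - 1ℤ) (∂ c f) ⋆ g) α k + (∂ c f ⋆ δ y g) α k) + ((δ x f ⋆ ∂ c g) α k + (f ⋆ δ (y - 1ℤ) (∂ c g)) α k)
       ≡⟨ cong₂ (λ u v → (u + (∂ c f ⋆ δ y g) α k) + ((δ x f ⋆ ∂ c g) α k + v))
            (⋆-congˡ g (λ β i → sym (δ-∂ x c f β i)) α k) (⋆-congʳ f (λ β i → sym (δ-∂ y c g β i)) α k) ⟩
     ((∂ c (δ x f) ⋆ g) α k + (∂ c f ⋆ δ y g) α k) + ((δ x f ⋆ ∂ c g) α k + (f ⋆ ∂ c (δ y g)) α k) ≡⟨ lem₂ ((∂ c (δ x f) ⋆ g) α k) ((∂ c f ⋆ δ y g) α k) ((δ x f ⋆ ∂ c g) α k) ((f ⋆ ∂ c (δ y g)) α k) ⟩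
     (δ x f ⋆ g) (c ∷ α) k + (f ⋆ δ y g) (c ∷ α) k ∎
     where
     lem₁ : ∀ z x y u v → (z + (x + y - 1ℤ)) * (u + v) ≡ (z + (x - 1ℤ + y)) * u + (z + (x + (y - 1ℤ))) * v
     lem₁ = solve-∀
     lem₂ : ∀ a b c d → (a + b) + (c + d) ≡ (a + c) + (b + d)
     lem₂ = solve-∀

   δ-power : ∀ j α k → δ (+ suc j) (Yp Y (suc j) ε) α k ≡ + suc j * Yp Y j (δ 1ℤ Y) α k
   δ-power j α k = begin
     δ (+ suc j) (Y ⋆ Yp Y j ε) α k ≡⟨ δ-⋆ 1ℤ (+ j) Y (Yp Y j ε) α k ⟩
     (δ 1ℤ Y ⋆ Yp Y j ε) α k + (Y ⋆ δ (+ j) (Yp Y j ε)) α k ≡⟨ cong₂ _+_ (slide j α k) (rest j) ⟩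
     Yp Y j (δ 1ℤ Y) α k + + j * Yp Y j (δ 1ℤ Y) α k ≡⟨ trans (lem (+ j) (Yp Y j (δ 1ℤ Y) α k)) (cong (_* Yp Y j (δ 1ℤ Y) α k) (+1≡suc j)) ⟩
     + suc j * Yp Y j (δ 1ℤ Y) α k ∎
     where
     lem : ∀ j y → y + j * y ≡ (j + 1ℤ) * y
     lem = solve-∀
     slide : ∀ j → δ 1ℤ Y ⋆ Yp Y j ε Sh.≋ Yp Y j (δ 1ℤ Y)
     slide zero α k = trans (Sh.⋆-comm (δ 1ℤ Y) ε α k) (Sh.⋆-identityˡ (δ 1ℤ Y) α k)
     slide (suc j) α k = trans (⋆-swap (δ 1ℤ Y) Y (Yp Y j ε) α k) (⋆-congʳ Y (slide j) α k)
     rest : ∀ j → (Y ⋆ δ (+ j) (Yp Y j ε)) α k ≡ + j * Yp Y j (δ 1ℤ Y) α k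
     rest zero = trans (⋆-congʳ Y {δ 0ℤ ε} {Sh.O} δε α k) (trans (trans (Sh.⋆-comm Y Sh.O α k) (Sh.⋆-zeroˡ Y α k)) (sym (*-zeroˡ (δ 1ℤ Y α k))))
       where δε : ∀ α k → δ 0ℤ ε α k ≡ 0ℤ
             δε [] zero = trans (*-identityʳ _) (cong (λ z → z - 0ℤ + 0ℤ) (*-zeroʳ D))
             δε [] (suc k) = *-zeroʳ (D * + suc k - 0ℤ + 0ℤ)
             δε (c ∷ α) k = *-zeroʳ (D * + k - + suc (length α) + 0ℤ)
     rest (suc j) = trans (⋆-congʳ Y {δ (+ suc j) (Yp Y (suc j) ε)} {(+ suc j) ∙ Yp Y j (δ 1ℤ Y)} (δ-power j) α k)
       (trans (Sh.⋆-comm Y ((+ suc j) ∙ Yp Y j (δ 1ℤ Y)) α k) (trans (∙-⋆ (+ suc j) (Yp Y j (δ 1ℤ Y)) Y α k) (cong (+ suc j *_) (Sh.⋆-comm (Yp Y j (δ 1ℤ Y)) Y α k))))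

   Yp-on : ∀ j {g g'} → (∀ α → Positive α → ∀ k → g α k ≡ g' α k) → ∀ α → Positive α → ∀ k → Yp Y j g α k ≡ Yp Y j g' α k
   Yp-on zero h = h
   Yp-on (suc j) {g} {g'} h = ⋆-cong-on {f = Y} {Y} {Yp Y j g} {Yp Y j g'} (λ _ _ _ → refl) (Yp-on j h)

   -- m Q is the x-derivative of [y⁻¹] Y^(m+1) / (m+1).
   residue : ∀ α → Positive α → ∀ k → suc k ≡ sum α →
             (D * + k - + length α + (mm + 1ℤ)) * Yp Y (suc (suc (suc d))) ε α k ≡ (mm + 1ℤ) * (mm * Q α)
   residue α pos k eq = begin
     (D * + k - + length α + (mm + 1ℤ)) * Yp Y (suc (suc (suc d))) ε α k ≡⟨ cong (λ z → (D * + k - + length α + z) * Yp Y (suc (suc (suc d))) ε α k) mm1 ⟩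
     δ (+ suc (suc (suc d))) (Yp Y (suc (suc (suc d))) ε) α k ≡⟨ δ-power (suc (suc d)) α k ⟩
     + suc (suc (suc d)) * Yp Y (suc (suc d)) (δ 1ℤ Y) α k
       ≡⟨ cong₂ _*_ (sym mm1) (Yp-on (suc (suc d)) {δ 1ℤ Y} {B 0ℤ 0ℤ} Y-euler α pos k) ⟩
     (mm + 1ℤ) * Yp Y (suc (suc d)) (B 0ℤ 0ℤ) α k ≡⟨ cong ((mm + 1ℤ) *_) (trans (YpB (suc (suc d)) 0 α k (ℕP.+-identityʳ _) eq) (cong (_* Q α) (sym mm≡))) ⟩
     (mm + 1ℤ) * (mm * Q α) ∎
     where
     mm1 : mm + 1ℤ ≡ + suc (suc (suc d))
     mm1 = trans (cong (_+ 1ℤ) mm≡) (+1≡suc (suc (suc d)))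

-- Walks that stay at nonnegative exponents, and the parts of Y by sign

module WalkLemma where
 open Semirings
 open Binomials
 open MultiplicativeFamilies
 open StepSeries
 open EulerOperator
 open Residues
 open import Data.Integer using (+_; -[1+_]; _+_; _*_; -_; _-_; 0ℤ; 1ℤ)
 open import Data.Integer.Properties hiding (_≟_; _<?_)
 open import Data.Integer.Tactic.RingSolver using (solve-∀)
 open import Data.Nat using (ℕ; zero; suc; z≤n; s≤s; _<?_)
 import Data.Nat as ℕ
 import Data.Nat.Properties as ℕP
 open import Data.Nat.Induction using (<-rec)
 open import Data.List using ([]; _∷_; length)
 open import Data.List.Relation.Unary.All using ([]; _∷_)
 open import Data.Nat.ListAction using (sum)
 open import Data.Product using (_,_; ∃)
 open import Relation.Binary.PropositionalEquality
 open import Relation.Nullary using (yes; no; contradiction)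
 open import Relation.Binary.Definitions using (tri<; tri≈; tri>)
 open ≡-Reasoning
 open PS using (_×ₛ_)
 open Sh using (_⋆_; ε; ∂; _⊕_; O)

 module TS = PowerSeries Sh.shuffle-semiring
 open TS using () renaming (_×ₛ_ to _×ₜ_)

 *-zero-l : ∀ {x} y → x ≡ 0ℤ → x * y ≡ 0ℤ
 *-zero-l y refl = *-zeroˡ y

 *-zero-r : ∀ x {y} → y ≡ 0ℤ → x * y ≡ 0ℤ
 *-zero-r x refl = *-zeroʳ x

 +-zero : ∀ {x y} → x ≡ 0ℤ → y ≡ 0ℤ → x + y ≡ 0ℤ
 +-zero refl refl = refl

 -- Degree at most s - d. The two numbers are kept apart because the difference may be negative.
 LowSer : ℕ → ℕ → Ser → Set
 LowSer s d f = ∀ k → s ℕ.< k ℕ.+ d → f k ≡ 0ℤ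

 LowSer-× : ∀ s d s' d' {f g} → LowSer s d f → LowSer s' d' g → LowSer (s ℕ.+ s') (d ℕ.+ d') (f ×ₛ g)
 LowSer-× s d s' d' {f} {g} p q zero lt with s <? d
 ... | yes s<d = *-zero-l (g 0) (p 0 s<d)
 ... | no s≮d = *-zero-r (f 0) (q 0 (ℕP.+-cancelˡ-< d _ _ (ℕP.≤-<-trans (ℕP.+-monoˡ-≤ s' (ℕP.≮⇒≥ s≮d)) lt)))
 LowSer-× s d s' d' {f} {g} p q (suc k) lt =
   +-zero first (LowSer-× s (suc d) s' d' {PS.tail f} {g} (λ i l → p (suc i) (subst (s ℕ.<_) (ℕP.+-suc i d) l)) q k (subst (s ℕ.+ s' ℕ.<_) (sym (ℕP.+-suc k (d ℕ.+ d'))) lt))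
   where
   first : f 0 * g (suc k) ≡ 0ℤ
   first with s <? d
   ... | yes s<d = *-zero-l (g (suc k)) (p 0 s<d)
   ... | no s≮d = *-zero-r (f 0) (q (suc k) (ℕP.+-cancelˡ-< d _ _ (ℕP.≤-<-trans (ℕP.+-monoˡ-≤ s' (ℕP.≮⇒≥ s≮d)) (subst (s ℕ.+ s' ℕ.<_) rearr lt))))
     where rearr : suc k ℕ.+ (d ℕ.+ d') ≡ d ℕ.+ (suc k ℕ.+ d')
           rearr = trans (sym (ℕP.+-assoc (suc k) d d')) (trans (cong (ℕ._+ d') (ℕP.+-comm (suc k) d)) (ℕP.+-assoc d (suc k) d'))

 HighSer-× : ∀ s s' {f g} → (∀ k → k ℕ.< s → f k ≡ 0ℤ) → (∀ k → k ℕ.< s' → g k ≡ 0ℤ) → ∀ k → k ℕ.< s ℕ.+ s' → (f ×ₛ g) k ≡ 0ℤ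
 HighSer-× zero s' {f} {g} p q zero lt = *-zero-r (f 0) (q 0 lt)
 HighSer-× (suc s) s' {f} {g} p q zero lt = *-zero-l (g 0) (p 0 (s≤s z≤n))
 HighSer-× zero s' {f} {g} p q (suc k) lt = +-zero (*-zero-r (f 0) (q (suc k) lt)) (HighSer-× zero s' {PS.tail f} {g} (λ _ ()) q k (ℕP.<-trans (ℕP.n<1+n k) lt))
 HighSer-× (suc s) s' {f} {g} p q (suc k) (s≤s lt) = +-zero (*-zero-l (g (suc k)) (p 0 (s≤s z≤n))) (HighSer-× s s' {PS.tail f} {g} (λ i l → p (suc i) (s≤s l)) q k lt)

 -- With exponent k - |α|: Low 0 d means exponents at most -d, High 0 means exponents at least 0.
 Low : ℕ → ℕ → Elt → Set
 Low s d f = ∀ α k → s ℕ.+ sum α ℕ.< k ℕ.+ d → f α k ≡ 0ℤ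

 High : ℕ → Elt → Set
 High s f = ∀ α k → k ℕ.< s ℕ.+ sum α → f α k ≡ 0ℤ

 private
   sum-shift : ∀ s c t → s ℕ.+ (c ℕ.+ t) ≡ s ℕ.+ c ℕ.+ t
   sum-shift s c t = sym (ℕP.+-assoc s c t)
   swapʳ : ∀ a b c → a ℕ.+ b ℕ.+ c ≡ a ℕ.+ c ℕ.+ b
   swapʳ a b c = trans (ℕP.+-assoc a b c) (trans (cong (a ℕ.+_) (ℕP.+-comm b c)) (sym (ℕP.+-assoc a c b)))

 Low-⋆ : ∀ s d s' d' {f g} → Low s d f → Low s' d' g → Low (s ℕ.+ s') (d ℕ.+ d') (f ⋆ g)
 Low-⋆ s d s' d' {f} {g} p q [] k lt = LowSer-× s d s' d' {f []} {g []}
   (λ i l → p [] i (subst (ℕ._< i ℕ.+ d) (sym (ℕP.+-identityʳ s)) l)) (λ i l → q [] i (subst (ℕ._< i ℕ.+ d') (sym (ℕP.+-identityʳ s')) l)) k (subst (ℕ._< k ℕ.+ (d ℕ.+ d')) (ℕP.+-identityʳ (s ℕ.+ s')) lt)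
 Low-⋆ s d s' d' {f} {g} p q (c ∷ α) k lt = +-zero
   (Low-⋆ (s ℕ.+ c) d s' d' {∂ c f} {g} (λ β i l → p (c ∷ β) i (subst (ℕ._< i ℕ.+ d) (sym (sum-shift s c (sum β))) l)) q α k
     (subst (ℕ._< k ℕ.+ (d ℕ.+ d')) (trans (sum-shift (s ℕ.+ s') c (sum α)) (cong (ℕ._+ sum α) (swapʳ s s' c))) lt))
   (Low-⋆ s d (s' ℕ.+ c) d' {f} {∂ c g} p (λ β i l → q (c ∷ β) i (subst (ℕ._< i ℕ.+ d') (sym (sum-shift s' c (sum β))) l)) α k
     (subst (ℕ._< k ℕ.+ (d ℕ.+ d')) (trans (sum-shift (s ℕ.+ s') c (sum α)) (cong (ℕ._+ sum α) (ℕP.+-assoc s s' c))) lt))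

 High-⋆ : ∀ s s' {f g} → High s f → High s' g → High (s ℕ.+ s') (f ⋆ g)
 High-⋆ s s' {f} {g} p q [] k lt = HighSer-× s s' {f []} {g []}
   (λ i l → p [] i (subst (i ℕ.<_) (sym (ℕP.+-identityʳ s)) l)) (λ i l → q [] i (subst (i ℕ.<_) (sym (ℕP.+-identityʳ s')) l)) k (subst (k ℕ.<_) (ℕP.+-identityʳ (s ℕ.+ s')) lt)
 High-⋆ s s' {f} {g} p q (c ∷ α) k lt = +-zero
   (High-⋆ (s ℕ.+ c) s' {∂ c f} {g} (λ β i l → p (c ∷ β) i (subst (i ℕ.<_) (sym (sum-shift s c (sum β))) l)) q α k
     (subst (k ℕ.<_) (trans (sum-shift (s ℕ.+ s') c (sum α)) (cong (ℕ._+ sum α) (swapʳ s s' c))) lt))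
   (High-⋆ s (s' ℕ.+ c) {f} {∂ c g} p (λ β i l → q (c ∷ β) i (subst (i ℕ.<_) (sym (sum-shift s' c (sum β))) l)) α k
     (subst (k ℕ.<_) (trans (sum-shift (s ℕ.+ s') c (sum α)) (cong (ℕ._+ sum α) (ℕP.+-assoc s s' c))) lt))

 Low-×ₜ : ∀ {f g} → (∀ i → Low 0 1 (f i)) → (∀ i → Low 0 1 (g i)) → ∀ j → Low 0 2 ((f ×ₜ g) j)
 Low-×ₜ {f} {g} p q zero = Low-⋆ 0 1 0 1 {f 0} {g 0} (p 0) (q 0)
 Low-×ₜ {f} {g} p q (suc j) α k lt = +-zero (Low-⋆ 0 1 0 1 {f 0} {g (suc j)} (p 0) (q (suc j)) α k lt) (Low-×ₜ (λ i → p (suc i)) q j α k lt)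

 High-×ₜ : ∀ {f g} → (∀ i → High 0 (f i)) → (∀ i → High 0 (g i)) → ∀ j → High 0 ((f ×ₜ g) j)
 High-×ₜ {f} {g} p q zero = High-⋆ 0 0 {f 0} {g 0} (p 0) (q 0)
 High-×ₜ {f} {g} p q (suc j) α k lt = +-zero (High-⋆ 0 0 {f 0} {g (suc j)} (p 0) (q (suc j)) α k lt) (High-×ₜ (λ i → p (suc i)) q j α k lt)

 nonneg neg : Elt → Elt
 nonneg f α k with k <? sum α
 ... | yes _ = 0ℤ
 ... | no _ = f α k
 neg f α k with k <? sum α
 ... | yes _ = f α k
 ... | no _ = 0ℤ

 split-sign : ∀ f → f Sh.≋ nonneg f ⊕ neg f
 split-sign f α k with k <? sum α
 ... | yes _ = sym (+-identityˡ _)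
 ... | no _ = sym (+-identityʳ _)

 nonneg-High : ∀ f → High 0 (nonneg f)
 nonneg-High f α k lt with k <? sum α
 ... | yes _ = refl
 ... | no ≮ = contradiction lt ≮

 nonneg-at : ∀ f α k → sum α ℕ.≤ k → nonneg f α k ≡ f α k
 nonneg-at f α k le with k <? sum α
 ... | yes lt = contradiction le (ℕP.<⇒≱ lt)
 ... | no _ = refl

 neg-at : ∀ f α k → k ℕ.< sum α → neg f α k ≡ f α k
 neg-at f α k lt with k <? sum α
 ... | yes _ = refl
 ... | no ≮ = contradiction lt ≮

 neg-Low : ∀ f → Low 0 1 (neg f)
 neg-Low f α k lt with k <? sum α
 ... | yes k< = contradiction k< (ℕP.≤⇒≯ (ℕP.≤-pred (subst (sum α ℕ.<_) (ℕP.+-comm k 1) lt)))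
 ... | no _ = refl

 -- For a walk whose steps are the terms of y, with u j collecting the j-step walks that never leave
 -- the exponents ≥ 0, the number of walks first leaving to -1 at step j + 1 is [y⁻¹] y^(j+1) / (j+1).
 -- In the power series ring over t, with u = c g and g = 1/(1 - t y), this follows by splitting
 -- t u' = t c' g + u (t y g) into parts with exponents ≥ 0 and < 0.
 module Walk (y : Elt) where
   u : ℕ → Elt
   u zero = ε
   u (suc j) = nonneg (y ⋆ u j)

   private
     -- Here c = 1 - t [y u]_{<0} records the steps that leave, and h = g - 1 = t y g is the
     -- logarithmic derivative t g′ / g.
     c g h h⁺ h⁻ : ℕ → Elt
     c zero = ε
     c (suc j) = (-[1+ 0 ]) ∙ neg (y ⋆ u j)
     g j = Yp y j ε
     h zero = O
     h (suc j) = y ⋆ g j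
     h⁺ j = nonneg (h j)
     h⁻ j = neg (h j)

     ϑ : (ℕ → Elt) → ℕ → Elt
     ϑ f j = (+ j) ∙ f j

     u-step : ∀ j → u (suc j) Sh.≋ (y ⋆ u j) ⊕ c (suc j)
     u-step j α k with k <? sum α
     ... | yes _ = lem ((y ⋆ u j) α k)
       where lem : ∀ x → 0ℤ ≡ x + -[1+ 0 ] * x
             lem = solve-∀
     ... | no _ = sym (+-identityʳ _)

     g-tail : ∀ f j → (f ×ₜ TS.tail g) j Sh.≋ y ⋆ (f ×ₜ g) j
     g-tail f zero = ⋆-swap (f 0) y ε
     g-tail f (suc j) α k = trans (cong₂ _+_ (⋆-swap (f 0) y (g (suc j)) α k) (g-tail (TS.tail f) j α k)) (sym (Sh.⋆-distribˡ y (f 0 ⋆ g (suc j)) ((TS.tail f ×ₜ g) j) α k))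

     ⋆-ε : ∀ f → f ⋆ ε Sh.≋ f
     ⋆-ε f α k = trans (Sh.⋆-comm f ε α k) (Sh.⋆-identityˡ f α k)

     g-rec : ∀ f j → (f ×ₜ g) (suc j) Sh.≋ (y ⋆ (f ×ₜ g) j) ⊕ f (suc j)
     g-rec f j α k = trans (TS.×-last f g j α k) (trans (cong₂ _+_ (⋆-ε (f (suc j)) α k) (g-tail f j α k)) (+-comm (f (suc j) α k) ((y ⋆ (f ×ₜ g) j) α k)))

     g-1+h : ∀ f j → (f ×ₜ g) j Sh.≋ f j ⊕ (f ×ₜ h) j
     g-1+h f zero α k = trans (⋆-ε (f 0) α k) (sym (trans (cong (_+_ (f 0 α k)) (trans (Sh.⋆-comm (f 0) O α k) (Sh.⋆-zeroˡ (f 0) α k))) (+-identityʳ _)))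
     g-1+h f (suc j) α k = trans (cong (_+_ ((f 0 ⋆ g (suc j)) α k)) (g-1+h (TS.tail f) j α k)) (lem ((f 0 ⋆ g (suc j)) α k) (f (suc j) α k) ((TS.tail f ×ₜ h) j α k))
       where lem : ∀ a b c → a + (b + c) ≡ b + (a + c)
             lem = solve-∀

     h-rec : ∀ f j → (f ×ₜ h) (suc j) Sh.≋ y ⋆ (f j ⊕ (f ×ₜ h) j)
     h-rec f j α k = trans (TS.×-last f h j α k) (trans (cong₂ _+_ (trans (Sh.⋆-comm (f (suc j)) O α k) (Sh.⋆-zeroˡ (f (suc j)) α k)) (g-tail f j α k)) (trans (+-identityˡ _) (⋆-congʳ y (g-1+h f j) α k)))

     u≡cg : ∀ j → u j Sh.≋ (c ×ₜ g) j
     u≡cg zero α k = sym (⋆-ε ε α k)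
     u≡cg (suc j) α k = trans (u-step j α k) (trans (cong (_+ c (suc j) α k) (⋆-congʳ y (u≡cg j) α k)) (sym (g-rec c j α k)))

     ϑu : ∀ j → ϑ u j Sh.≋ (ϑ c ×ₜ g) j ⊕ (u ×ₜ h) j
     ϑu zero α k = trans (*-zeroˡ (ε α k)) (sym (+-zero (trans (∙-⋆ 0ℤ ε ε α k) (*-zeroˡ ((ε ⋆ ε) α k))) (trans (Sh.⋆-comm ε O α k) (Sh.⋆-zeroˡ ε α k))))
     ϑu (suc j) α k = begin
       + suc j * u (suc j) α k ≡⟨ cong₂ _*_ (sym (+1≡suc j)) (u-step j α k) ⟩
       (+ j + 1ℤ) * ((y ⋆ u j) α k + c (suc j) α k) ≡⟨ lem₁ (+ j) ((y ⋆ u j) α k) (c (suc j) α k) ⟩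
       (+ j * (y ⋆ u j) α k + (y ⋆ u j) α k) + (+ j + 1ℤ) * c (suc j) α k
         ≡⟨ cong₂ _+_ (cong (_+ (y ⋆ u j) α k) (trans (trans (trans (cong (+ j *_) (Sh.⋆-comm y (u j) α k)) (sym (∙-⋆ (+ j) (u j) y α k))) (Sh.⋆-comm (ϑ u j) y α k)) (trans (⋆-congʳ y (ϑu j) α k) (Sh.⋆-distribˡ y ((ϑ c ×ₜ g) j) ((u ×ₜ h) j) α k)))) (cong (_* c (suc j) α k) (+1≡suc j)) ⟩
       ((y ⋆ (ϑ c ×ₜ g) j) α k + (y ⋆ (u ×ₜ h) j) α k + (y ⋆ u j) α k) + ϑ c (suc j) α k
         ≡⟨ lem₂ ((y ⋆ (ϑ c ×ₜ g) j) α k) ((y ⋆ (u ×ₜ h) j) α k) ((y ⋆ u j) α k) (ϑ c (suc j) α k) ⟩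
       ((y ⋆ (ϑ c ×ₜ g) j) α k + ϑ c (suc j) α k) + ((y ⋆ u j) α k + (y ⋆ (u ×ₜ h) j) α k)
         ≡⟨ cong₂ _+_ (sym (g-rec (ϑ c) j α k)) (sym (trans (h-rec u j α k) (Sh.⋆-distribˡ y (u j) ((u ×ₜ h) j) α k))) ⟩
       (ϑ c ×ₜ g) (suc j) α k + (u ×ₜ h) (suc j) α k ∎
       where
       lem₁ : ∀ j a b → (j + 1ℤ) * (a + b) ≡ (j * a + a) + (j + 1ℤ) * b
       lem₁ = solve-∀
       lem₂ : ∀ a b c d → (a + b + c) + d ≡ (a + d) + (c + b)
       lem₂ = solve-∀

     e : ℕ → Elt
     e = ϑ c TS.⊕ (c ×ₜ h⁻)

     -- e g = ϑ u - u h⁺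
     eg : ∀ j α k → (e ×ₜ g) j α k + (u ×ₜ h⁺) j α k ≡ ϑ u j α k
     eg j α k = begin
       (e ×ₜ g) j α k + (u ×ₜ h⁺) j α k ≡⟨ cong (_+ (u ×ₜ h⁺) j α k) (TS.×-distribʳ g (ϑ c) (c ×ₜ h⁻) j α k) ⟩
       (ϑ c ×ₜ g) j α k + ((c ×ₜ h⁻) ×ₜ g) j α k + (u ×ₜ h⁺) j α k
         ≡⟨ cong (λ z → (ϑ c ×ₜ g) j α k + z + (u ×ₜ h⁺) j α k) (trans (TS.×-assoc c h⁻ g j α k) (trans (TS.×-cong {c} {c} {h⁻ ×ₜ g} {g ×ₜ h⁻} (λ _ _ _ → refl) (TS.×-comm h⁻ g) j α k)
              (trans (sym (TS.×-assoc c g h⁻ j α k)) (TS.×-cong {c ×ₜ g} {u} {h⁻} (λ i α k → sym (u≡cg i α k)) (λ _ _ _ → refl) j α k)))) ⟩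
       (ϑ c ×ₜ g) j α k + (u ×ₜ h⁻) j α k + (u ×ₜ h⁺) j α k ≡⟨ trans (+-assoc ((ϑ c ×ₜ g) j α k) ((u ×ₜ h⁻) j α k) ((u ×ₜ h⁺) j α k)) (cong (_+_ ((ϑ c ×ₜ g) j α k)) (+-comm ((u ×ₜ h⁻) j α k) ((u ×ₜ h⁺) j α k))) ⟩
       (ϑ c ×ₜ g) j α k + ((u ×ₜ h⁺) j α k + (u ×ₜ h⁻) j α k)
         ≡⟨ cong (_+_ ((ϑ c ×ₜ g) j α k)) (sym (trans (TS.×-cong {u} {u} {h} {h⁺ TS.⊕ h⁻} (λ _ _ _ → refl) (λ i → split-sign (h i)) j α k) (distˡ j))) ⟩
       (ϑ c ×ₜ g) j α k + (u ×ₜ h) j α k ≡⟨ sym (ϑu j α k) ⟩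
       ϑ u j α k ∎
       where
       distˡ : ∀ j → (u ×ₜ (h⁺ TS.⊕ h⁻)) j α k ≡ (u ×ₜ h⁺) j α k + (u ×ₜ h⁻) j α k
       distˡ j = trans (TS.×-comm u (h⁺ TS.⊕ h⁻) j α k) (trans (TS.×-distribʳ u h⁺ h⁻ j α k) (cong₂ _+_ (TS.×-comm h⁺ u j α k) (TS.×-comm h⁻ u j α k)))

     u-High : ∀ j → High 0 (u j)
     u-High zero (c ∷ α) k lt = refl
     u-High (suc j) = nonneg-High (y ⋆ u j)

     eg-Low : ∀ j α k → k ℕ.< sum α → (e ×ₜ g) j α k ≡ 0ℤ
     eg-Low j α k lt = trans (sym (trans (cong (_+_ ((e ×ₜ g) j α k)) (High-×ₜ {u} {h⁺} u-High (λ i → nonneg-High (h i)) j α k lt)) (+-identityʳ _)))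
       (trans (eg j α k) (*-zero-r (+ j) (u-High j α k lt)))

     c-Low : ∀ j → Low 0 1 (c (suc j))
     c-Low j α k lt = *-zero-r -[1+ 0 ] (neg-Low (y ⋆ u j) α k lt)

     ch-Low : ∀ j → Low 0 1 ((c ×ₜ h⁻) j)
     ch-Low zero = λ α k lt → trans (Sh.⋆-identityˡ (h⁻ 0) α k) (neg-Low (h 0) α k lt)
     ch-Low (suc j) α k lt = +-zero (trans (Sh.⋆-identityˡ (h⁻ (suc j)) α k) (neg-Low (h (suc j)) α k lt))
       (Low-×ₜ {TS.tail c} {h⁻} c-Low (λ i → neg-Low (h i)) j α k (ℕP.<-trans lt (ℕP.+-monoʳ-< k (ℕP.n<1+n 1))))

     e-Low : ∀ j → Low 0 1 (e j)
     e-Low zero α k lt = +-zero (*-zeroˡ (ε α k)) (ch-Low zero α k lt)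
     e-Low (suc j) α k lt = +-zero (*-zero-r (+ suc j) (c-Low j α k lt)) (ch-Low (suc j) α k lt)

     leading : ∀ (f : ℕ → Elt) j → (∀ i → i ℕ.< j → f i Sh.≋ O) → (f ×ₜ g) j Sh.≋ f j
     leading f zero _ α k = ⋆-ε (f 0) α k
     leading f (suc j) z α k = trans (cong₂ _+_ (trans (⋆-congˡ (g (suc j)) (z 0 (s≤s z≤n)) α k) (Sh.⋆-zeroˡ (g (suc j)) α k)) (leading (TS.tail f) j (λ i lt → z (suc i) (s≤s lt)) α k)) (+-identityˡ _)

     -- A Wiener-Hopf argument. If all earlier coefficients vanish, the j-th coefficient of e g is
     -- that of e; the former has only exponents ≥ 0 and the latter only exponents < 0. The outcome
     -- is t c′ = -c h⁻.
     e≡0 : ∀ j → e j Sh.≋ O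
     e≡0 = <-rec (λ j → e j Sh.≋ O) λ j rec α k → go j (λ i lt → rec {i} lt) α k
       where
       go : ∀ j → (∀ i → i ℕ.< j → e i Sh.≋ O) → e j Sh.≋ O
       go j rec α k with k <? sum α
       ... | yes lt = trans (sym (leading e j rec α k)) (eg-Low j α k lt)
       ... | no ≮ = e-Low j α k (subst (sum α ℕ.<_) (ℕP.+-comm 1 k) (s≤s (ℕP.≮⇒≥ ≮)))

   -- Read t c′ = -c h⁻ at y^(-1). Beyond the leading coefficient 1, c has exponents at most -1, and
   -- so has h⁻; their products reach at most -2 and drop out.
   walk : ∀ j α k → suc k ≡ sum α → + suc j * (y ⋆ u j) α k ≡ Yp y (suc j) ε α k
   walk j α k eq = begin
     + suc j * (y ⋆ u j) α k ≡⟨ lem (+ suc j) ((y ⋆ u j) α k) ⟩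
     - (+ suc j * (-[1+ 0 ] * (y ⋆ u j) α k)) ≡⟨ cong (λ z → - (+ suc j * (-[1+ 0 ] * z))) (sym (neg-at (y ⋆ u j) α k k<)) ⟩
     - (ϑ c (suc j) α k) ≡⟨ lem₂ (ϑ c (suc j) α k) ((c ×ₜ h⁻) (suc j) α k) ⟩
     (c ×ₜ h⁻) (suc j) α k - e (suc j) α k ≡⟨ cong₂ _-_ (cong₂ _+_ (Sh.⋆-identityˡ (h⁻ (suc j)) α k) (Low-×ₜ {TS.tail c} {h⁻} c-Low (λ i → neg-Low (h i)) j α k (subst (ℕ._< k ℕ.+ 2) eq (subst (suc k ℕ.<_) (ℕP.+-comm 2 k) (ℕP.n<1+n (suc k)))))) (e≡0 (suc j) α k) ⟩
     h⁻ (suc j) α k + 0ℤ - 0ℤ ≡⟨ trans (+-identityʳ _) (+-identityʳ _) ⟩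
     h⁻ (suc j) α k ≡⟨ neg-at (h (suc j)) α k k< ⟩
     Yp y (suc j) ε α k ∎
     where
     k< : k ℕ.< sum α
     k< = subst (k ℕ.<_) eq (ℕP.n<1+n k)
     lem : ∀ s x → s * x ≡ - (s * (-[1+ 0 ] * x))
     lem = solve-∀
     lem₂ : ∀ a b → - a ≡ b - (a + b)
     lem₂ = solve-∀

   u-zero-below : ∀ j → High 0 (u j)
   u-zero-below = u-High

   u-at : ∀ j α k → sum α ℕ.≤ k → u (suc j) α k ≡ (y ⋆ u j) α k
   u-at j = nonneg-at (y ⋆ u j)

 module Decomposition (d : ℕ) where
   open Solution d
   open Coefficients d

   -- The parts of Y with negative and with positive exponents; `Y-split` shows that the unit is all
   -- that lies at exponent 0.
   V W : Elt
   V = Pk (λ c → (+ c) ∙ ε)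
   W α k with sum α <? k
   ... | yes _ = Y α k
   ... | no _ = 0ℤ

   W-above : ∀ α k → sum α ℕ.< k → W α k ≡ Y α k
   W-above α k lt with sum α <? k
   ... | yes _ = refl
   ... | no ≮ = contradiction lt ≮

   W-below : ∀ α k → k ℕ.≤ sum α → W α k ≡ 0ℤ
   W-below α k le with sum α <? k
   ... | yes lt = contradiction lt (ℕP.≤⇒≯ le)
   ... | no _ = refl

   V-long : ∀ c e α k → V (c ∷ e ∷ α) k ≡ 0ℤ
   V-long c e α k = trans (sumPicks-cong (c ∷ e ∷ α) z) (sumPicks-zero (c ∷ e ∷ α))
     where z : ∀ c′ β → Pick c′ β (c ∷ e ∷ α) → + c′ * ε β k ≡ 0ℤ
           z c′ [] p with () ← pick-length p
           z c′ (_ ∷ _) p = *-zeroʳ (+ c′)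

   V-suc : ∀ c k → V (c ∷ []) (suc k) ≡ 0ℤ
   V-suc c k = trans (+-identityʳ _) (*-zeroʳ (+ c))

   length≤sum : ∀ α → Positive α → length α ℕ.≤ sum α
   length≤sum [] [] = z≤n
   length≤sum (c ∷ α) (p ∷ ps) = ℕP.+-mono-≤ p (length≤sum α ps)

   -- From D ≥ 1 and k ≥ |α| ≥ length α the Euler factor is at least 1, so it may be cancelled.
   euler-pos : ∀ α k → Positive α → sum α ℕ.≤ k → ∃ λ e → euler α k ≡ + suc e
   euler-pos α k pos le with ℕP.m≤n⇒∃[o]m+o≡n (ℕP.≤-trans (length≤sum α pos) le)
   ... | o , refl = d ℕ.* (length α ℕ.+ o) ℕ.+ o , (begin
     + suc d * + (length α ℕ.+ o) - + length α + 1ℤ ≡⟨ cong₂ (λ u v → u * v - + length α + 1ℤ) (sym (+1≡suc d)) (pos-+ (length α) o) ⟩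
     (+ d + 1ℤ) * (+ length α + + o) - + length α + 1ℤ ≡⟨ lem (+ d) (+ length α) (+ o) ⟩
     + d * (+ length α + + o) + + o + 1ℤ ≡⟨ cong (λ z → + d * z + + o + 1ℤ) (sym (pos-+ (length α) o)) ⟩
     + d * + (length α ℕ.+ o) + + o + 1ℤ ≡⟨ cong (λ z → z + + o + 1ℤ) (sym (pos-* d (length α ℕ.+ o))) ⟩
     + (d ℕ.* (length α ℕ.+ o)) + + o + 1ℤ ≡⟨ cong (_+ 1ℤ) (sym (pos-+ (d ℕ.* (length α ℕ.+ o)) o)) ⟩
     + (d ℕ.* (length α ℕ.+ o) ℕ.+ o) + 1ℤ ≡⟨ +1≡suc _ ⟩
     + suc (d ℕ.* (length α ℕ.+ o) ℕ.+ o) ∎)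
     where lem : ∀ d l o → (d + 1ℤ) * (l + o) - l + 1ℤ ≡ d * (l + o) + o + 1ℤ
           lem = solve-∀

   -- The Euler equation at i = 0 leaves the coefficient of R^0, which is zero on nonempty words.
   Y-diagonal : ∀ c α → Positive (c ∷ α) → Y (c ∷ α) (sum (c ∷ α)) ≡ 0ℤ
   Y-diagonal c α pos with euler-pos (c ∷ α) (sum (c ∷ α)) pos ℕP.≤-refl
   ... | e , eq = cancel (+ suc e) (+suc≢0 e) (begin
     + suc e * Y (c ∷ α) s ≡⟨ cong (_* Y (c ∷ α) s) (sym eq) ⟩
     euler (c ∷ α) s * Y (c ∷ α) s ≡⟨ cong (λ k → euler (c ∷ α) k * Y (c ∷ α) k) (sym (ℕP.+-identityʳ s)) ⟩
     euler (c ∷ α) (s ℕ.+ 0) * Y (c ∷ α) (s ℕ.+ 0) ≡⟨ euler-above (c ∷ α) 0 ⟩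
     1ℤ * ρ (D * 0ℤ) (c ∷ α) ≡⟨ trans (*-identityˡ _) (cong (λ t → ρ t (c ∷ α)) (*-zeroʳ D)) ⟩
     ρ 0ℤ (c ∷ α) ≡⟨ ρ-zero c α ⟩
     0ℤ ≡⟨ sym (*-zeroʳ (+ suc e)) ⟩
     + suc e * 0ℤ ∎)
     where s = sum (c ∷ α)

   Y-split : ∀ α → Positive α → ∀ k → Y α k ≡ (ε α k + V α k) + W α k
   Y-split [] pos zero = refl
   Y-split [] pos (suc k) = sym (trans (+-identityˡ _) (W-above [] (suc k) (s≤s z≤n)))
   Y-split α@(c ∷ []) pos@(p ∷ _) k with ℕP.<-cmp k (sum α)
   ... | tri> _ _ gt = sym (trans (cong₂ _+_ (trans (+-identityˡ (V α k)) (V>0 k gt)) (W-above α k gt)) (+-identityˡ _))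
     where
           V>0 : ∀ k → sum α ℕ.< k → V α k ≡ 0ℤ
           V>0 (suc k) _ = V-suc c k
   ... | tri≈ _ refl _ = trans (Y-diagonal c [] pos) (sym (+-zero (trans (+-identityˡ _) (V0 c p)) (W-below α (sum α) ℕP.≤-refl)))
     where V0 : ∀ c → 1 ℕ.≤ c → V (c ∷ []) (sum (c ∷ [])) ≡ 0ℤ
           V0 (suc c) _ = V-suc (suc c) (c ℕ.+ 0)
   ... | tri< lt _ _ = sym (trans (cong (_+_ (0ℤ + V α k)) (W-below α k (ℕP.<⇒≤ lt))) (trans (+-identityʳ _) (trans (+-identityˡ _) (V≡ c k p lt))))
     where V≡ : ∀ c k → 1 ℕ.≤ c → k ℕ.< sum (c ∷ []) → V (c ∷ []) k ≡ Y (c ∷ []) k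
           V≡ (suc c) zero _ _ = trans (+-identityʳ _) (trans (*-identityʳ _) (sym (Y-single-0 c)))
           V≡ c (suc k) _ lt = trans (V-suc c k) (sym (Y-single-below c k (subst (suc k ℕ.<_) (ℕP.+-identityʳ c) lt)))
   Y-split α@(c ∷ e ∷ α′) pos k with ℕP.<-cmp k (sum α)
   ... | tri> _ _ gt = sym (trans (cong₂ _+_ (trans (+-identityˡ (V α k)) (V-long c e α′ k)) (W-above α k gt)) (+-identityˡ _))
   ... | tri≈ _ refl _ = trans (Y-diagonal c (e ∷ α′) pos) (sym (+-zero (trans (+-identityˡ _) (V-long c e α′ k)) (W-below α k ℕP.≤-refl)))
   ... | tri< lt _ _ = trans (Y-below c e α′ k lt) (sym (+-zero (trans (+-identityˡ _) (V-long c e α′ k)) (W-below α k (ℕP.<⇒≤ lt))))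

   -- One step of the recursion for the counts: the unit keeps the tuple, V joins a cycle of length
   -- c to the root cycle, W splits a piece off.
   Y-⋆ : ∀ f α → Positive α → ∀ k → (Y ⋆ f) α k ≡ f α k + sumPicks (λ c β → + c * f β k) α + (W ⋆ f) α k
   Y-⋆ f α pos k = begin
     (Y ⋆ f) α k ≡⟨ ⋆-cong-on {f = Y} {(ε ⊕ V) ⊕ W} {f} {f} Y-split (λ _ _ _ → refl) α pos k ⟩
     (((ε ⊕ V) ⊕ W) ⋆ f) α k ≡⟨ trans (Sh.⋆-distribʳ f (ε ⊕ V) W α k) (cong (_+ (W ⋆ f) α k) (Sh.⋆-distribʳ f ε V α k)) ⟩
     (ε ⋆ f) α k + (V ⋆ f) α k + (W ⋆ f) α k
       ≡⟨ cong₂ (λ u v → u + v + (W ⋆ f) α k) (Sh.⋆-identityˡ f α k) (trans (Pk-⋆ (λ c → (+ c) ∙ ε) f α k) (sumPicks-cong α λ c β _ → trans (∙-⋆ (+ c) ε f β k) (cong (+ c *_) (Sh.⋆-identityˡ f β k)))) ⟩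
     f α k + sumPicks (λ c β → + c * f β k) α + (W ⋆ f) α k ∎

-- The recursion for planar tuples and its solution

module Recursion where
 open Binomials
 open MultiplicativeFamilies
 open StepSeries
 open EulerOperator
 open Residues
 open WalkLemma
 open import Data.Integer using (ℤ; +_; _+_; _*_; -_; _-_; 0ℤ; 1ℤ)
 open import Data.Integer.Properties hiding (_≟_; _<?_)
 open import Data.Integer.Tactic.RingSolver using (solve-∀)
 open import Data.Nat using (ℕ; zero; suc; z≤n; s≤s)
 import Data.Nat as ℕ
 import Data.Nat.Properties as ℕP
 open import Data.List using (List; []; _∷_; length; map; _++_)
 open import Data.List.Properties using (map-∘)
 open import Data.List.Relation.Unary.All using (All; []; _∷_)
 import Data.List.Relation.Unary.All as All
 import Data.List.Relation.Unary.All.Properties as AllP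
 open import Data.Nat.ListAction using (sum)
 open import Data.Product using (_×_; _,_; proj₁; proj₂)
 open import Relation.Binary.PropositionalEquality
 open import Relation.Nullary using (¬_)
 open ≡-Reasoning
 open PS using (_×ₛ_)
 open Sh using (_⋆_; ε; ∂)

 picks : ∀ {A : Set} → List A → List (A × List A)
 picks [] = []
 picks (c ∷ α) = (c , α) ∷ map (λ (e , β) → e , c ∷ β) (picks α)

 shuffles : ∀ {A : Set} → List A → List (List A × List A)
 shuffles [] = ([] , []) ∷ []
 shuffles (c ∷ α) = map (λ (β , γ) → c ∷ β , γ) (shuffles α) ++ map (λ (β , γ) → β , c ∷ γ) (shuffles α)

 -- The sum of φ b b′ over b + 1 + b′ = a, the 1 being the point at which the list is cut.
 cuts : ℕ → (ℕ → ℕ → ℕ) → ℕ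
 cuts zero φ = 0
 cuts (suc a) φ = φ 0 a ℕ.+ cuts a (λ b b′ → φ (suc b) b′)

 -- F N j a α counts the planar m-tuples whose product has a cycle of length a + 1 through the root and
 -- other cycles of lengths α, the first m - j factors fixing the root; N is fuel, at least the number of points.
 module Count (m : ℕ) where
   F : ℕ → ℕ → ℕ → List ℕ → ℕ
   F N zero zero [] = 1
   F N zero _ _ = 0
   F zero (suc j) a α = 0
   F (suc N) (suc j) a α = F (suc N) j a α
     ℕ.+ (sum (map (λ (c , β) → c ℕ.* F (suc N) j (a ℕ.+ c) β) (picks α))
     ℕ.+ cuts a (λ b b′ → sum (map (λ (β , γ) → F (suc N) j b β ℕ.* F N m b′ γ) (shuffles α))))

 sum-picks : ∀ (φ : ℕ → List ℕ → ℕ) α → + sum (map (λ (c , β) → φ c β) (picks α)) ≡ sumPicks (λ c β → + φ c β) α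
 sum-picks φ [] = refl
 sum-picks φ (c ∷ α) = trans (pos-+ (φ c α) _) (cong (_+_ (+ φ c α)) (trans (cong (λ l → + sum l) (sym (map-∘ (picks α)))) (sum-picks (λ e β → φ e (c ∷ β)) α)))

 sumList : ∀ {A : Set} → (A → ℤ) → List A → ℤ
 sumList φ [] = 0ℤ
 sumList φ (x ∷ xs) = φ x + sumList φ xs

 sumList-++ : ∀ {A : Set} (φ : A → ℤ) xs ys → sumList φ (xs ++ ys) ≡ sumList φ xs + sumList φ ys
 sumList-++ φ [] ys = sym (+-identityˡ _)
 sumList-++ φ (x ∷ xs) ys = trans (cong (_+_ (φ x)) (sumList-++ φ xs ys)) (sym (+-assoc (φ x) _ _))

 sumList-map : ∀ {A B : Set} (φ : B → ℤ) (f : A → B) xs → sumList φ (map f xs) ≡ sumList (λ x → φ (f x)) xs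
 sumList-map φ f [] = refl
 sumList-map φ f (x ∷ xs) = cong (_+_ (φ (f x))) (sumList-map φ f xs)

 sumList-cong : ∀ {A : Set} {φ φ′ : A → ℤ} {xs} → All (λ x → φ x ≡ φ′ x) xs → sumList φ xs ≡ sumList φ′ xs
 sumList-cong [] = refl
 sumList-cong (e ∷ es) = cong₂ _+_ e (sumList-cong es)

 sumList-sum : ∀ {A : Set} (φ : A → ℕ) xs → + sum (map φ xs) ≡ sumList (λ x → + φ x) xs
 sumList-sum φ [] = refl
 sumList-sum φ (x ∷ xs) = trans (pos-+ (φ x) _) (cong (_+_ (+ φ x)) (sumList-sum φ xs))

 ⋆-shuffles : ∀ f g α k → (f ⋆ g) α k ≡ sumList (λ (β , γ) → (f β ×ₛ g γ) k) (shuffles α)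
 ⋆-shuffles f g [] k = sym (+-identityʳ _)
 ⋆-shuffles f g (c ∷ α) k = trans (cong₂ _+_ (trans (⋆-shuffles (∂ c f) g α k) (sym (sumList-map φ (λ (β , γ) → c ∷ β , γ) (shuffles α))))
     (trans (⋆-shuffles f (∂ c g) α k) (sym (sumList-map φ (λ (β , γ) → β , c ∷ γ) (shuffles α)))))
   (sym (sumList-++ φ (map (λ (β , γ) → c ∷ β , γ) (shuffles α)) _))
   where φ : List ℕ × List ℕ → ℤ
         φ (β , γ) = (f β ×ₛ g γ) k

 IsShuffle : List ℕ → List ℕ × List ℕ → Set
 IsShuffle α (β , γ) = (Positive β × Positive γ) × (sum β ℕ.+ sum γ ≡ sum α)

 shuffles-All : ∀ α → Positive α → All (IsShuffle α) (shuffles α)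
 shuffles-All [] [] = (([] , []) , refl) ∷ []
 shuffles-All (c ∷ α) (p ∷ ps) = AllP.++⁺
   (AllP.map⁺ (All.map (λ { {β , γ} ((pb , pg) , e) → ((p ∷ pb) , pg) , trans (ℕP.+-assoc c (sum β) (sum γ)) (cong (c ℕ.+_) e) }) (shuffles-All α ps)))
   (AllP.map⁺ (All.map (λ { {β , γ} ((pb , pg) , e) → (pb , (p ∷ pg)) , trans (sym (ℕP.+-assoc (sum β) c (sum γ))) (trans (cong (ℕ._+ sum γ) (ℕP.+-comm (sum β) c)) (trans (ℕP.+-assoc c (sum β) (sum γ)) (cong (c ℕ.+_) e))) }) (shuffles-All α ps)))

 cuts-sum : ∀ {A : Set} a (φ : ℕ → ℕ → A → ℕ) L → cuts a (λ b b′ → sum (map (φ b b′) L)) ≡ sum (map (λ x → cuts a (λ b b′ → φ b b′ x)) L)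
 cuts-sum a φ [] = zeros a
   where zeros : ∀ a → cuts a (λ _ _ → 0) ≡ 0
         zeros zero = refl
         zeros (suc a) = zeros a
 cuts-sum a φ (x ∷ L) = trans (cuts-+ a (λ b b′ → φ b b′ x) (λ b b′ → sum (map (φ b b′) L))) (cong (cuts a (λ b b′ → φ b b′ x) ℕ.+_) (cuts-sum a φ L))
   where
   cuts-+ : ∀ a φ φ′ → cuts a (λ b b′ → φ b b′ ℕ.+ φ′ b b′) ≡ cuts a φ ℕ.+ cuts a φ′
   cuts-+ zero φ φ′ = refl
   cuts-+ (suc a) φ φ′ = trans (cong (φ 0 a ℕ.+ φ′ 0 a ℕ.+_) (cuts-+ a (λ b → φ (suc b)) (λ b → φ′ (suc b))))
     (trans (ℕP.+-assoc (φ 0 a) (φ′ 0 a) _) (trans (cong (φ 0 a ℕ.+_) (trans (sym (ℕP.+-assoc (φ′ 0 a) (cuts a (λ b → φ (suc b))) _)) (trans (cong (ℕ._+ cuts a (λ b → φ′ (suc b))) (ℕP.+-comm (φ′ 0 a) (cuts a (λ b → φ (suc b))))) (ℕP.+-assoc (cuts a (λ b → φ (suc b))) (φ′ 0 a) _)))) (sym (ℕP.+-assoc (φ 0 a) _ _))))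

 -- A product of series times y: the cut point supplies the factor y, hence `cons0`.
 cuts-× : ∀ a (φ : ℕ → ℕ → ℕ) (x y : Ser) → (∀ b b′ → suc (b ℕ.+ b′) ≡ a → + φ b b′ ≡ x b * y b′) → + cuts a φ ≡ cons0 (x ×ₛ y) a
 cuts-× zero φ x y h = refl
 cuts-× (suc zero) φ x y h = trans (cong +_ (ℕP.+-identityʳ (φ 0 0))) (h 0 0 refl)
 cuts-× (suc (suc a)) φ x y h = trans (pos-+ (φ 0 (suc a)) _) (cong₂ _+_ (h 0 (suc a) refl) (cuts-× (suc a) (λ b → φ (suc b)) (PS.tail x) y λ b b′ e → h (suc b) b′ (cong suc e)))

 shift-drop : ∀ s (f : Ser) → (∀ k → k ℕ.< s → f k ≡ 0ℤ) → ∀ k → f k ≡ shift s (λ i → f (s ℕ.+ i)) k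
 shift-drop zero f z k = refl
 shift-drop (suc s) f z zero = z 0 (s≤s z≤n)
 shift-drop (suc s) f z (suc k) = shift-drop s (PS.tail f) (λ i lt → z (suc i) (s≤s lt)) k

 module Link (d : ℕ) where
   open Solution d
   open Coefficients d
   open Residue d
   open Decomposition d
   open Walk Y
   m : ℕ
   m = suc (suc d)
   open Count m public

   -- The positive part of Y counts planar tuples on at most N points. This breaks the circle, since
   -- the recursion on N + 1 points calls level m only for pieces with at most N points.
   Solved : ℕ → Set
   Solved N = ∀ b γ → Positive γ → suc (sum γ ℕ.+ b) ℕ.≤ N → + F N m b γ ≡ Y γ (suc (sum γ) ℕ.+ b)

   W⋆u : ∀ N j a α → Positive α → suc (sum α ℕ.+ a) ℕ.≤ suc N → Solved N →
         (∀ b β → Positive β → suc (sum β ℕ.+ b) ℕ.≤ suc N → + F (suc N) j b β ≡ u j β (sum β ℕ.+ b)) →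
         + cuts a (λ b b′ → sum (map (λ (β , γ) → F (suc N) j b β ℕ.* F N m b′ γ) (shuffles α))) ≡ (W ⋆ u j) α (sum α ℕ.+ a)
   W⋆u N j a α pos le solved ih = begin
     + cuts a (λ b b′ → sum (map (λ (β , γ) → F (suc N) j b β ℕ.* F N m b′ γ) (shuffles α)))
       ≡⟨ cong +_ (cuts-sum a (λ b b′ (β , γ) → F (suc N) j b β ℕ.* F N m b′ γ) (shuffles α)) ⟩
     + sum (map (λ (β , γ) → cuts a (λ b b′ → F (suc N) j b β ℕ.* F N m b′ γ)) (shuffles α)) ≡⟨ sumList-sum _ (shuffles α) ⟩
     sumList (λ (β , γ) → + cuts a (λ b b′ → F (suc N) j b β ℕ.* F N m b′ γ)) (shuffles α) ≡⟨ sumList-cong (All.map (λ {p} → term {p}) (shuffles-All α pos)) ⟩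
     sumList (λ (β , γ) → (u j β ×ₛ W γ) (sum α ℕ.+ a)) (shuffles α) ≡⟨ sym (⋆-shuffles (u j) W α (sum α ℕ.+ a)) ⟩
     (u j ⋆ W) α (sum α ℕ.+ a) ≡⟨ Sh.⋆-comm (u j) W α _ ⟩
     (W ⋆ u j) α (sum α ℕ.+ a) ∎
     where
     term : ∀ {p} → IsShuffle α p → + cuts a (λ b b′ → F (suc N) j b (proj₁ p) ℕ.* F N m b′ (proj₂ p)) ≡ (u j (proj₁ p) ×ₛ W (proj₂ p)) (sum α ℕ.+ a)
     term {β , γ} ((pβ , pγ) , e) = begin
       + cuts a (λ b b′ → F (suc N) j b β ℕ.* F N m b′ γ)
         ≡⟨ cuts-× a _ û ŵ (λ b b′ eq → trans (pos-* (F (suc N) j b β) (F N m b′ γ)) (cong₂ _*_ (ih b β pβ (boundβ b b′ eq)) (trans (solved b′ γ pγ (boundγ b b′ eq)) (sym (W-above γ _ (s≤s (ℕP.m≤m+n (sum γ) b′))))))) ⟩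
       cons0 (û ×ₛ ŵ) a ≡⟨ sym (shift-at (sum α) (cons0 (û ×ₛ ŵ)) a) ⟩
       shift (sum α) (shift 1 (û ×ₛ ŵ)) (sum α ℕ.+ a) ≡⟨ shift-shift (sum α) 1 (û ×ₛ ŵ) (sum α ℕ.+ a) ⟩
       shift (sum α ℕ.+ 1) (û ×ₛ ŵ) (sum α ℕ.+ a)
         ≡⟨ cong (λ s → shift s (û ×ₛ ŵ) (sum α ℕ.+ a)) (trans (cong (ℕ._+ 1) (sym e)) (trans (ℕP.+-assoc (sum β) (sum γ) 1) (cong (sum β ℕ.+_) (ℕP.+-comm (sum γ) 1)))) ⟩
       shift (sum β ℕ.+ suc (sum γ)) (û ×ₛ ŵ) (sum α ℕ.+ a) ≡⟨ sym (shift-×-shift (sum β) (suc (sum γ)) û ŵ (sum α ℕ.+ a)) ⟩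
       (shift (sum β) û ×ₛ shift (suc (sum γ)) ŵ) (sum α ℕ.+ a)
         ≡⟨ sym (PS.×-cong (shift-drop (sum β) (u j β) (u-zero-below j β)) (shift-drop (suc (sum γ)) (W γ) (λ k lt → W-below γ k (ℕP.≤-pred lt))) (sum α ℕ.+ a)) ⟩
       (u j β ×ₛ W γ) (sum α ℕ.+ a) ∎
       where
       û ŵ : Ser
       û b = u j β (sum β ℕ.+ b)
       ŵ b′ = W γ (suc (sum γ) ℕ.+ b′)
       β≤ : sum β ℕ.≤ sum α
       β≤ = subst (sum β ℕ.≤_) e (ℕP.m≤m+n (sum β) (sum γ))
       γ≤ : sum γ ℕ.≤ sum α
       γ≤ = subst (sum γ ℕ.≤_) e (ℕP.m≤n+m (sum γ) (sum β))
       boundβ : ∀ b b′ → suc (b ℕ.+ b′) ≡ a → suc (sum β ℕ.+ b) ℕ.≤ suc N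
       boundβ b b′ refl = ℕP.≤-trans (s≤s (ℕP.+-mono-≤ β≤ (ℕP.≤-trans (ℕP.m≤m+n b b′) (ℕP.n≤1+n _)))) le
       -- The root remains in the other piece, so this piece has at most N points and `Solved N`
       -- covers it.
       boundγ : ∀ b b′ → suc (b ℕ.+ b′) ≡ a → suc (sum γ ℕ.+ b′) ℕ.≤ N
       boundγ b b′ refl = ℕP.≤-trans (subst (ℕ._≤ sum α ℕ.+ suc (b ℕ.+ b′)) (ℕP.+-suc (sum γ) b′) (ℕP.+-mono-≤ γ≤ (s≤s (ℕP.m≤n+m b′ b)))) (ℕP.≤-pred le)

   -- The recursion for F is `Y-⋆` read at exponents ≥ 0, where truncation changes nothing.
   F-u : ∀ N → Solved N → ∀ j a α → Positive α → suc (sum α ℕ.+ a) ℕ.≤ suc N → + F (suc N) j a α ≡ u j α (sum α ℕ.+ a)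
   F-u N solved zero zero [] _ _ = refl
   F-u N solved zero (suc a) [] _ _ = refl
   F-u N solved zero zero (c ∷ α) _ _ = refl
   F-u N solved zero (suc a) (c ∷ α) _ _ = refl
   F-u N solved (suc j) a α pos le = begin
     + (F (suc N) j a α ℕ.+ (P ℕ.+ K)) ≡⟨ trans (pos-+ (F (suc N) j a α) (P ℕ.+ K)) (cong (_+_ (+ F (suc N) j a α)) (pos-+ P K)) ⟩
     + F (suc N) j a α + (+ P + + K) ≡⟨ sym (+-assoc (+ F (suc N) j a α) (+ P) (+ K)) ⟩
     + F (suc N) j a α + + P + + K ≡⟨ cong₂ _+_ (cong₂ _+_ (F-u N solved j a α pos le) P≡) (W⋆u N j a α pos le solved (F-u N solved j)) ⟩
     u j α k + sumPicks (λ c β → + c * u j β k) α + (W ⋆ u j) α k ≡⟨ sym (Y-⋆ (u j) α pos k) ⟩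
     (Y ⋆ u j) α k ≡⟨ sym (u-at j α k (ℕP.m≤m+n (sum α) a)) ⟩
     u (suc j) α k ∎
     where
     k = sum α ℕ.+ a
     P = sum (map (λ (c , β) → c ℕ.* F (suc N) j (a ℕ.+ c) β) (picks α))
     K = cuts a (λ b b′ → sum (map (λ (β , γ) → F (suc N) j b β ℕ.* F N m b′ γ) (shuffles α)))
     P≡ : + P ≡ sumPicks (λ c β → + c * u j β k) α
     P≡ = trans (sum-picks (λ c β → c ℕ.* F (suc N) j (a ℕ.+ c) β) α) (sumPicks-cong α λ c β pk →
       trans (pos-* c _) (cong (+ c *_) (trans (F-u N solved j (a ℕ.+ c) β (proj₂ (pick-All pk pos)) (subst (λ s → suc s ℕ.≤ suc N) (sym (k≡ c β pk)) le)) (cong (u j β) (k≡ c β pk)))))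
       where k≡ : ∀ c β → Pick c β α → sum β ℕ.+ (a ℕ.+ c) ≡ k
             k≡ c β pk = trans (cong (sum β ℕ.+_) (ℕP.+-comm a c)) (trans (sym (ℕP.+-assoc (sum β) c a)) (cong (ℕ._+ a) (trans (ℕP.+-comm (sum β) c) (pick-sum pk))))

   -- The residue determines only the sum of the counts over all choices of the root cycle, weighted
   -- by lengths. To isolate one of them, all must be known to agree; this follows once F is shown
   -- to count tuples for a permutation without a root.
   RootIndependent : Set
   RootIndependent = ∀ N α → Positive α → sum α ℕ.≤ N → ∀ c β c′ β′ → Pick (suc c) β α → Pick (suc c′) β′ α → F N m c β ≡ F N m c′ β′

   -- The exponent of x attached to α, as an integer so that subtraction is not truncated.
   degree : List ℕ → ℤ
   degree α = D * + sum α - + length α + 1ℤ + 1ℤ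

   module _ (root-independent : RootIndependent) where

     private
       -- The walk lemma at j = m equates m + 1 times [y^(-1)] Y u_m with [y^(-1)] Y^(m+1), which
       -- `residue` evaluates. The Euler factor at k = |α| - 1 is exactly `degree`, because
       -- (m-1)(n-1) - l + m + 1 = (m-1)n - l + 2.
       formula : ∀ N → Solved N → ∀ c γ → Positive γ → sum (suc c ∷ γ) ℕ.≤ suc N →
                 degree (suc c ∷ γ) * (+ sum (suc c ∷ γ) * + F (suc N) m c γ) ≡ mm * Q (suc c ∷ γ)
       formula N solved c γ pγ le = cancel (mm + 1ℤ) mm1≢0 (begin
         (mm + 1ℤ) * (degree α * (+ sum α * + F (suc N) m c γ)) ≡⟨ lem₁ (mm + 1ℤ) (degree α) _ ⟩
         degree α * ((mm + 1ℤ) * (+ sum α * + F (suc N) m c γ)) ≡⟨ cong₂ (λ x z → x * (z * (+ sum α * + F (suc N) m c γ))) deg≡ mm1 ⟩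
         (D * + k - + length α + (mm + 1ℤ)) * (+ suc m * (+ sum α * + F (suc N) m c γ)) ≡⟨ cong (λ z → (D * + k - + length α + (mm + 1ℤ)) * (+ suc m * z)) (sym total) ⟩
         (D * + k - + length α + (mm + 1ℤ)) * (+ suc m * (Y ⋆ u m) α k) ≡⟨ cong ((D * + k - + length α + (mm + 1ℤ)) *_) (walk m α k refl) ⟩
         (D * + k - + length α + (mm + 1ℤ)) * Yp Y (suc m) ε α k ≡⟨ residue α pos k refl ⟩
         (mm + 1ℤ) * (mm * Q α) ∎)
         where
         α = suc c ∷ γ
         k = c ℕ.+ sum γ
         pos : Positive α
         pos = s≤s z≤n ∷ pγ
         mm1 : mm + 1ℤ ≡ + suc m
         mm1 = trans (cong (_+ 1ℤ) mm≡) (+1≡suc m)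
         mm1≢0 : ¬ (mm + 1ℤ ≡ 0ℤ)
         mm1≢0 e = +suc≢0 m (trans (sym mm1) e)
         lem₁ : ∀ x y z → x * (y * z) ≡ y * (x * z)
         lem₁ = solve-∀
         deg≡ : degree α ≡ D * + k - + length α + (mm + 1ℤ)
         deg≡ = trans (cong (λ z → D * z - + length α + 1ℤ + 1ℤ) (sym (+1≡suc k))) (lem D (+ k) (+ length α))
           where lem : ∀ D k l → D * (k + 1ℤ) - l + 1ℤ + 1ℤ ≡ D * k - l + (D + 1ℤ + 1ℤ)
                 lem = solve-∀
         each : ∀ c′ β → Pick c′ β α → + c′ * u m β k ≡ 0ℤ + + F (suc N) m c γ * + c′
         each zero β pk with () ← proj₁ (pick-All pk pos)
         each (suc c′) β pk = trans (cong (+ suc c′ *_) (trans (cong (u m β) k≡) (trans (sym (F-u N solved m c′ β (proj₂ (pick-All pk pos)) (subst (ℕ._≤ suc N) (cong suc k≡) le)))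
              (cong +_ (root-independent (suc N) α pos le c′ β c γ pk here))))) (lem (+ suc c′) (+ F (suc N) m c γ))
           where k≡ : k ≡ sum β ℕ.+ c′
                 k≡ = trans (ℕP.suc-injective (sym (pick-sum pk))) (ℕP.+-comm c′ (sum β))
                 lem : ∀ x y → x * y ≡ 0ℤ + y * x
                 lem = solve-∀
         -- At y^(-1) neither u_m nor W u_m has a term, as their exponents are ≥ 0. Only V
         -- contributes: c F for each possible root cycle of length c, hence |α| F altogether.
         total : (Y ⋆ u m) α k ≡ + sum α * + F (suc N) m c γ
         total = begin
           (Y ⋆ u m) α k ≡⟨ Y-⋆ (u m) α pos k ⟩
           u m α k + sumPicks (λ c β → + c * u m β k) α + (W ⋆ u m) α k
             ≡⟨ cong₂ (λ x z → x + sumPicks (λ c β → + c * u m β k) α + z) (u-zero-below m α k ℕP.≤-refl)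
                  (High-⋆ 1 0 {W} {u m} (λ β i lt → W-below β i (ℕP.≤-pred lt)) (u-zero-below m) α k (ℕP.<-trans (ℕP.n<1+n k) (ℕP.n<1+n (suc k)))) ⟩
           0ℤ + sumPicks (λ c β → + c * u m β k) α + 0ℤ ≡⟨ trans (+-identityʳ _) (+-identityˡ _) ⟩
           sumPicks (λ c β → + c * u m β k) α ≡⟨ sumPicks-cong α each ⟩
           sumPicks (λ c′ _ → 0ℤ + + F (suc N) m c γ * + c′) α ≡⟨ sumPicks-linear 0ℤ (+ F (suc N) m c γ) α ⟩
           + length α * 0ℤ + + F (suc N) m c γ * + sum α ≡⟨ lem (+ length α) (+ F (suc N) m c γ) (+ sum α) ⟩
           + sum α * + F (suc N) m c γ ∎
           where lem : ∀ l f s → l * 0ℤ + f * s ≡ s * f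
                 lem = solve-∀

     -- Puts m Q in the shape of the right side of `euler-above`, with one cycle singled out as
     -- root, so that the counts can be compared with coefficients of Y.
     Q-value : ∀ c γ → mm * Q (suc c ∷ γ) ≡ + sum (suc c ∷ γ) * (b 0ℤ (suc c) * ρ (D * + suc c) γ)
     Q-value c γ = cancel D (+suc≢0 d) (begin
       D * (mm * Q α) ≡⟨ lem₁ D mm (Q α) ⟩
       mm * (D * Q α) ≡⟨ cong (mm *_) (trans (D·Q α) (trans (cong (λ z → ρ 1ℤ α - z) (ρ-zero (suc c) γ)) (+-identityʳ _))) ⟩
       mm * (ψ (suc c) * Ψ γ * (1ℤ * ff (D * + sum α + 1ℤ - 1ℤ) (length γ))) ≡⟨ cong (λ z → mm * (ψ (suc c) * Ψ γ * (1ℤ * ff z (length γ)))) (lem₀ (D * + sum α)) ⟩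
       mm * (ψ (suc c) * Ψ γ * (1ℤ * ff (D * + sum α) (length γ))) ≡⟨ lem₂ mm (ψ (suc c)) (Ψ γ) (ff (D * + sum α) (length γ)) ⟩
       mm * ψ (suc c) * (Ψ γ * ff (D * + sum α) (length γ)) ≡⟨ cong (_* (Ψ γ * ff (D * + sum α) (length γ))) mmψ ⟩
       D * + suc c * b 0ℤ (suc c) * (Ψ γ * ff (D * + sum α) (length γ)) ≡⟨ tail γ ⟩
       D * (+ sum α * (b 0ℤ (suc c) * ρ (D * + suc c) γ)) ∎)
       where
       α = suc c ∷ γ
       lem₀ : ∀ x → x + 1ℤ - 1ℤ ≡ x
       lem₀ = solve-∀
       lem₁ : ∀ x y z → x * (y * z) ≡ y * (x * z)
       lem₁ = solve-∀
       lem₂ : ∀ m p q f → m * (p * q * (1ℤ * f)) ≡ m * p * (q * f)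
       lem₂ = solve-∀
       mmψ : mm * ψ (suc c) ≡ D * + suc c * b 0ℤ (suc c)
       mmψ = sym (begin
         D * E * C (mm * E + 0ℤ) (suc c) ≡⟨ cong (λ z → D * E * C z (suc c)) (lem mm E) ⟩
         D * E * C (x + 1ℤ) (suc c) ≡⟨ lem₃ D E (C (x + 1ℤ) (suc c)) ⟩
         (x + 1ℤ) * C (x + 1ℤ) (suc c) - E * C (x + 1ℤ) (suc c) ≡⟨ cong₂ (λ p q → (x + 1ℤ) * p - q) (pascal x c) (absorb x c) ⟩
         (x + 1ℤ) * (C x (suc c) + C x c) - (x + 1ℤ) * C x c ≡⟨ lem₄ mm E (C x (suc c)) (C x c) ⟩
         mm * (E * C x (suc c)) ∎)
         where
         E = + suc c
         x = mm * E - 1ℤ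
         lem : ∀ m e → m * e + 0ℤ ≡ m * e - 1ℤ + 1ℤ
         lem = solve-∀
         lem₃ : ∀ D e y → D * e * y ≡ ((D + 1ℤ) * e - 1ℤ + 1ℤ) * y - e * y
         lem₃ = solve-∀
         lem₄ : ∀ m e p q → (m * e - 1ℤ + 1ℤ) * (p + q) - (m * e - 1ℤ + 1ℤ) * q ≡ m * (e * p)
         lem₄ = solve-∀
       tail : ∀ γ → D * + suc c * b 0ℤ (suc c) * (Ψ γ * ff (D * + sum (suc c ∷ γ)) (length γ)) ≡ D * (+ sum (suc c ∷ γ) * (b 0ℤ (suc c) * ρ (D * + suc c) γ))
       tail [] = trans (cong (λ s → D * + s * b 0ℤ (suc c) * (1ℤ * 1ℤ)) (sym (ℕP.+-identityʳ (suc c)))) (lem D (+ (suc c ℕ.+ 0)) (b 0ℤ (suc c)))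
         where lem : ∀ D e b → D * e * b * (1ℤ * 1ℤ) ≡ D * (e * (b * 1ℤ))
               lem = solve-∀
       tail γ@(e ∷ γ′) = trans (lem D (+ suc c) (b 0ℤ (suc c)) (Ψ γ) (+ sum (suc c ∷ γ)) _)
         (cong (λ z → D * (+ sum (suc c ∷ γ) * (b 0ℤ (suc c) * (Ψ γ * (D * + suc c * ff z (length γ′))))))
           (trans (cong (λ z → D * z - 1ℤ) (pos-+ (suc c) (sum γ))) (lem₅ D (+ suc c) (+ sum γ))))
         where lem : ∀ D c b p s f → D * c * b * (p * (D * s * f)) ≡ D * (s * (b * (p * (D * c * f))))
               lem = solve-∀
               lem₅ : ∀ D c s → D * (c + s) - 1ℤ ≡ D * s + D * c - 1ℤ
               lem₅ = solve-∀

     -- The count and the coefficient of Y have the same product with |α| and `degree`, both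
     -- nonzero: the Euler factor of γ at exponent c + 1 is the degree of the word with the root
     -- cycle added.
     solved : ∀ N → Solved N
     solved (suc N) c γ pγ le = cancel (degree α) deg≢0 (cancel (+ sum α) (+suc≢0 _) (begin
       + sum α * (degree α * + F (suc N) m c γ) ≡⟨ lem₁ (+ sum α) (degree α) _ ⟩
       degree α * (+ sum α * + F (suc N) m c γ) ≡⟨ formula N (solved N) c γ pγ (subst (ℕ._≤ suc N) n≡ le) ⟩
       mm * Q α ≡⟨ Q-value c γ ⟩
       + sum α * (b 0ℤ (suc c) * ρ (D * + suc c) γ) ≡⟨ cong (+ sum α *_) (sym (euler-above γ (suc c))) ⟩
       + sum α * (euler γ (sum γ ℕ.+ suc c) * Y γ (sum γ ℕ.+ suc c)) ≡⟨ cong (λ s → + sum α * (euler γ s * Y γ s)) (ℕP.+-suc (sum γ) c) ⟩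
       + sum α * (euler γ (suc (sum γ ℕ.+ c)) * Y γ (suc (sum γ ℕ.+ c))) ≡⟨ cong (λ z → + sum α * (z * Y γ (suc (sum γ ℕ.+ c)))) deg≡ ⟩
       + sum α * (degree α * Y γ (suc (sum γ) ℕ.+ c)) ∎))
       where
       α = suc c ∷ γ
       lem₁ : ∀ x y z → x * (y * z) ≡ y * (x * z)
       lem₁ = solve-∀
       n≡ : suc (sum γ ℕ.+ c) ≡ suc c ℕ.+ sum γ
       n≡ = cong suc (ℕP.+-comm (sum γ) c)
       deg≡ : euler γ (suc (sum γ ℕ.+ c)) ≡ degree α
       deg≡ = trans (cong (λ s → D * + s - + length γ + 1ℤ) n≡) (trans (lem (D * + sum α) (+ length γ)) (cong (λ z → D * + sum α - z + 1ℤ + 1ℤ) (+1≡suc (length γ))))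
         where lem : ∀ x l → x - l + 1ℤ ≡ x - (l + 1ℤ) + 1ℤ + 1ℤ
               lem = solve-∀
       deg≢0 : ¬ (degree α ≡ 0ℤ)
       deg≢0 e with euler-pos γ (suc (sum γ ℕ.+ c)) pγ (ℕP.≤-trans (ℕP.m≤m+n (sum γ) c) (ℕP.n≤1+n _))
       ... | e′ , eq = +suc≢0 e′ (trans (sym eq) (trans deg≡ e))

     F-formula : ∀ N c γ → Positive γ → sum (suc c ∷ γ) ℕ.≤ N →
                 degree (suc c ∷ γ) * (+ sum (suc c ∷ γ) * + F N m c γ) ≡ mm * Q (suc c ∷ γ)
     F-formula (suc N) c γ pγ le = formula N (solved N) c γ pγ le

-- Cycle lists of a map and multiplication by a transposition

module CycleLists where
 open import Data.Nat using (ℕ; suc)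
 import Data.Nat.Properties as ℕP
 open import Data.List using (List; []; _∷_; [_]; length; map; _++_; concat; concatMap; allFin)
 open import Data.List.Properties using (++-assoc; ++-identityʳ; length-++; map-++; map-∘)
 open import Data.List.Relation.Unary.All using (All; []; _∷_)
 import Data.List.Relation.Unary.All as All
 import Data.List.Relation.Unary.All.Properties as AllP
 open import Data.List.Relation.Unary.Any using (here; there)
 open import Data.List.Relation.Unary.AllPairs using ([]; _∷_)
 open import Data.List.Relation.Unary.Unique.Propositional using (Unique)
 open import Data.List.Relation.Unary.Unique.Propositional.Properties using (Unique[x∷xs]⇒x∉xs; allFin⁺)
 open import Data.List.Membership.Propositional using (_∈_; _∉_; find; lose)
 open import Data.List.Membership.Propositional.Properties
 open import Data.List.Membership.Propositional.Properties.WithK using (unique∧set⇒bag)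
 open import Data.List.Relation.Binary.BagAndSetEquality using (∼bag⇒↭)
 open import Data.List.Relation.Binary.Permutation.Propositional using (_↭_; prep; swap; refl; trans; ↭-reflexive)
 open import Data.List.Relation.Binary.Permutation.Propositional.Properties using (All-resp-↭; ∈-resp-↭; ++⁺; ++⁺ˡ; ++⁺ʳ; ++-comm; shifts) renaming (map⁺ to map-↭)
 open import Data.Fin using (Fin; _≟_)
 open import Data.Product using (_×_; _,_; ∃; ∃₂; proj₁; proj₂)
 open import Data.Empty using (⊥)
 open import Function using (mk⇔)
 open import Relation.Binary.PropositionalEquality hiding ([_]) renaming (trans to _∙_)
 open import Relation.Nullary using (yes; no; contradiction)
 open Recursion using (picks)

 private variable
   A B K : Set

 Unique-↭ : {xs ys : List A} → xs ↭ ys → Unique xs → Unique ys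
 Unique-↭ refl u = u
 Unique-↭ (prep x p) (a ∷ u) = All-resp-↭ p a ∷ Unique-↭ p u
 Unique-↭ (swap x y p) ((a ∷ b) ∷ c ∷ u) = ((λ e → a (sym e)) ∷ All-resp-↭ p c) ∷ All-resp-↭ p b ∷ Unique-↭ p u
 Unique-↭ (trans p q) u = Unique-↭ q (Unique-↭ p u)

 concat-↭ : {xs ys : List (List A)} → xs ↭ ys → concat xs ↭ concat ys
 concat-↭ refl = refl
 concat-↭ (prep x p) = ++⁺ˡ x (concat-↭ p)
 concat-↭ (swap x y p) = trans (shifts x y) (++⁺ˡ y (++⁺ˡ x (concat-↭ p)))
 concat-↭ (trans p q) = trans (concat-↭ p) (concat-↭ q)

 unique-set-↭ : {xs ys : List A} → Unique xs → Unique ys → (∀ {x} → x ∈ xs → x ∈ ys) → (∀ {x} → x ∈ ys → x ∈ xs) → xs ↭ ys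
 unique-set-↭ u v f g = ∼bag⇒↭ (unique∧set⇒bag u v (mk⇔ f g))

 unique-++ˡ : (xs : List A) {ys : List A} → Unique (xs ++ ys) → Unique xs
 unique-++ˡ [] u = []
 unique-++ˡ (x ∷ xs) (a ∷ u) = AllP.++⁻ˡ xs a ∷ unique-++ˡ xs u

 unique-++ʳ : (xs : List A) {ys : List A} → Unique (xs ++ ys) → Unique ys
 unique-++ʳ [] u = u
 unique-++ʳ (x ∷ xs) (_ ∷ u) = unique-++ʳ xs u

 unique-disjoint : (xs : List A) {ys : List A} → Unique (xs ++ ys) → ∀ {x} → x ∈ xs → x ∈ ys → ⊥
 unique-disjoint (x ∷ xs) (a ∷ u) (here refl) q = All.lookup (AllP.++⁻ʳ xs a) q refl
 unique-disjoint (x ∷ xs) (a ∷ u) (there p) q = unique-disjoint xs u p q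

 unique-++ : {xs ys : List A} → Unique xs → Unique ys → (∀ {x} → x ∈ xs → x ∈ ys → ⊥) → Unique (xs ++ ys)
 unique-++ [] v d = v
 unique-++ {xs = x ∷ xs} (a ∷ u) v d = AllP.++⁺ a (All.tabulate λ q e → d (here refl) (subst (_∈ _) (sym e) q)) ∷ unique-++ u v (λ p → d (there p))

 unique-map : (f : A → B) {xs : List A} → (∀ {x y} → x ∈ xs → y ∈ xs → f x ≡ f y → x ≡ y) → Unique xs → Unique (map f xs)
 unique-map f inj [] = []
 unique-map f {x ∷ xs} inj (a ∷ u) = AllP.map⁺ (All.tabulate λ q e → All.lookup a q (inj (here refl) (there q) e)) ∷ unique-map f (λ p q → inj (there p) (there q)) u

 ∈-concatMap : (f : A → List B) {xs : List A} {x : A} {y : B} → x ∈ xs → y ∈ f x → y ∈ concatMap f xs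
 ∈-concatMap f p q = ∈-concatMap⁺ f (lose p q)

 ∈-concatMap-inv : (f : A → List B) {xs : List A} {y : B} → y ∈ concatMap f xs → ∃ λ x → x ∈ xs × y ∈ f x
 ∈-concatMap-inv f p = find (∈-concatMap⁻ f p)

 -- The key recovers from an element the block that produced it, so blocks with distinct labels are
 -- disjoint.
 unique-concatMap : (f : A → List B) (key : B → K) (label : A → K) {xs : List A} → Unique (map label xs) →
                    (∀ {x} → x ∈ xs → Unique (f x)) → (∀ {x y} → x ∈ xs → y ∈ f x → key y ≡ label x) → Unique (concatMap f xs)
 unique-concatMap f key label {[]} _ _ _ = []
 unique-concatMap f key label {x ∷ xs} (a ∷ u) uf k = unique-++ (uf (here refl))
   (unique-concatMap f key label u (λ p → uf (there p)) (λ p → k (there p)))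
   λ {y} p q → let z , z∈ , y∈ = ∈-concatMap-inv f q in All.lookup a (∈-map⁺ label z∈) (sym (k (here refl) p) ∙ k (there z∈) y∈)

 picks-↭ : ∀ (α : List A) {c β} → (c , β) ∈ picks α → α ↭ c ∷ β
 picks-↭ (c ∷ α) (here refl) = refl
 picks-↭ (c ∷ α) (there p) with ∈-map⁻ _ p
 ... | (d , β) , q , refl = trans (prep c (picks-↭ α q)) (swap c d refl)

 picks-∈ : ∀ {α : List A} {c} → c ∈ α → ∃ λ β → (c , β) ∈ picks α
 picks-∈ (here refl) = _ , here refl
 picks-∈ {α = d ∷ _} (there p) = let β , q = picks-∈ p in d ∷ β , there (∈-map⁺ _ q)

 map-picks : ∀ (α : List A) → map proj₁ (picks α) ≡ α
 map-picks [] = refl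
 map-picks (c ∷ α) = cong (c ∷_) (sym (map-∘ (picks α)) ∙ map-picks α)

 splitsOf : List A → List (List A × A × List A)
 splitsOf [] = []
 splitsOf (i ∷ zs) = ([] , i , zs) ∷ map (λ (ys , j , ws) → i ∷ ys , j , ws) (splitsOf zs)

 splitsOf-sound : ∀ (xs : List A) {ys i zs} → (ys , i , zs) ∈ splitsOf xs → xs ≡ ys ++ i ∷ zs
 splitsOf-sound (x ∷ xs) (here refl) = refl
 splitsOf-sound (x ∷ xs) (there p) with ∈-map⁻ _ p
 ... | _ , q , refl = cong (x ∷_) (splitsOf-sound xs q)

 splitsOf-complete : ∀ (ys : List A) {i zs} → (ys , i , zs) ∈ splitsOf (ys ++ i ∷ zs)
 splitsOf-complete [] = here refl
 splitsOf-complete (y ∷ ys) = there (∈-map⁺ _ (splitsOf-complete ys))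

 splitsOf-∈ : ∀ {xs : List A} {i} → i ∈ xs → ∃₂ λ ys zs → (ys , i , zs) ∈ splitsOf xs
 splitsOf-∈ p with ∈-∃++ p
 ... | ys , zs , refl = ys , zs , splitsOf-complete ys

 map-splitsOf : ∀ (xs : List A) → map (λ (_ , i , _) → i) (splitsOf xs) ≡ xs
 map-splitsOf [] = refl
 map-splitsOf (x ∷ xs) = cong (x ∷_) (sym (map-∘ (splitsOf xs)) ∙ map-splitsOf xs)

 -- The ways of choosing a cycle and a rotation i ∷ ws of it, with the cycles left over.
 rotations : List A → List (A × List A)
 rotations c = map (λ (ys , i , zs) → i , zs ++ ys) (splitsOf c)

 merges : List (List A) → List (A × List A × List (List A))
 merges cs = concatMap (λ (c , cs′) → map (λ (i , ws) → i , ws , cs′) (rotations c)) (picks cs)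

 merges-sound : ∀ (cs : List (List A)) {i ws cs′} → (i , ws , cs′) ∈ merges cs →
                ∃₂ λ ys zs → ws ≡ zs ++ ys × cs ↭ (ys ++ i ∷ zs) ∷ cs′
 merges-sound cs p with ∈-concatMap-inv _ {picks cs} p
 ... | (c , cs′) , q , r with ∈-map⁻ _ r
 ... | _ , r′ , refl with ∈-map⁻ _ r′
 ... | (ys , i , zs) , s , refl = ys , zs , refl , subst (λ c → cs ↭ c ∷ cs′) (splitsOf-sound c s) (picks-↭ cs q)

 merges-∈ : ∀ {cs : List (List A)} {i} → i ∈ concat cs → ∃₂ λ ws cs′ → (i , ws , cs′) ∈ merges cs
 merges-∈ {cs = cs} p =
   let c , i∈c , c∈cs = find-concat cs p
       cs′ , q = picks-∈ c∈cs
       ys , zs , s = splitsOf-∈ i∈c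
   in zs ++ ys , cs′ , ∈-concatMap (λ (c , cs′) → map (λ (i , ws) → i , ws , cs′) (rotations c)) q (∈-map⁺ _ (∈-map⁺ _ s))
   where
   find-concat : ∀ (cs : List (List _)) {i} → i ∈ concat cs → ∃ λ c → i ∈ c × c ∈ cs
   find-concat cs p = ∈-concat⁻′ cs p

 map-merges : ∀ (cs : List (List A)) → map proj₁ (merges cs) ≡ concat cs
 map-merges cs = go (picks cs) ∙ cong concat (map-picks cs)
   where
   go : ∀ ps → map proj₁ (concatMap (λ (c , cs′) → map (λ (i , ws) → i , ws , cs′) (rotations c)) ps) ≡ concat (map proj₁ ps)
   go [] = refl
   go ((c , cs′) ∷ ps) = map-++ proj₁ (map _ (rotations c)) _ ∙ cong₂ _++_ (sym (map-∘ (rotations c)) ∙ (sym (map-∘ (splitsOf c)) ∙ map-splitsOf c)) (go ps)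

 module _ {n : ℕ} where
   private F = Fin n → Fin n

   sw : Fin n → Fin n → F
   sw i r x with x ≟ i
   ... | yes _ = r
   ... | no _ with x ≟ r
   ... | yes _ = i
   ... | no _ = x

   sw-i : ∀ i r → sw i r i ≡ r
   sw-i i r with i ≟ i
   ... | yes _ = refl
   ... | no ne = contradiction refl ne

   sw-r : ∀ i r → sw i r r ≡ i
   sw-r i r with r ≟ i
   ... | yes e = e
   ... | no _ with r ≟ r
   ... | yes _ = refl
   ... | no ne = contradiction refl ne

   sw-≢ : ∀ i r x → x ≢ i → x ≢ r → sw i r x ≡ x
   sw-≢ i r x p q with x ≟ i
   ... | yes e = contradiction e p
   ... | no _ with x ≟ r
   ... | yes e = contradiction e q
   ... | no _ = refl

   sw-sw : ∀ i r x → sw i r (sw i r x) ≡ x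
   sw-sw i r x with x ≟ i
   ... | yes refl = sw-r i r
   ... | no p with x ≟ r
   ... | yes refl = sw-i i r
   ... | no q = sw-≢ i r x p q

   sw-inj : ∀ i r {x y} → sw i r x ≡ sw i r y → x ≡ y
   sw-inj i r {x} {y} e = sym (sw-sw i r x) ∙ (cong (sw i r) e ∙ sw-sw i r y)

   -- The end point z is a parameter of its own, so that the last arrow can be redirected; a cycle
   -- is a chain that ends where it starts.
   Chain : F → Fin n → List (Fin n) → Fin n → Set
   Chain f a [] z = f a ≡ z
   Chain f a (b ∷ bs) z = f a ≡ b × Chain f b bs z

   Cyc : F → List (Fin n) → Set
   Cyc f [] = ⊥
   Cyc f (x ∷ xs) = Chain f x xs x

   chain-++ : ∀ f a xs {i ws z} → Chain f a xs i → Chain f i ws z → Chain f a (xs ++ i ∷ ws) z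
   chain-++ f a [] p q = p , q
   chain-++ f a (x ∷ xs) (p , c) q = p , chain-++ f x xs c q

   chain-split : ∀ f a xs {i ws z} → Chain f a (xs ++ i ∷ ws) z → Chain f a xs i × Chain f i ws z
   chain-split f a [] (p , q) = p , q
   chain-split f a (x ∷ xs) (p , c) = let q , r = chain-split f x xs c in (p , q) , r

   -- Composition with a map that fixes all inner points redirects the last arrow only.
   chain-map : ∀ (f g h : F) a xs {z} → (∀ x → g x ≡ h (f x)) → (∀ {x} → x ∈ xs → h x ≡ x) → Chain f a xs z → Chain g a xs (h z)
   chain-map f g h a [] e s p = e a ∙ cong h p
   chain-map f g h a (x ∷ xs) e s (p , c) = (e a ∙ (cong h p ∙ s (here refl))) , chain-map f g h x xs e (λ q → s (there q)) c

   cyc-map : ∀ (f g h : F) c → (∀ x → g x ≡ h (f x)) → (∀ {x} → x ∈ c → h x ≡ x) → Cyc f c → Cyc g c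
   cyc-map f g h (x ∷ xs) e s p = subst (Chain g x xs) (s (here refl)) (chain-map f g h x xs e (λ q → s (there q)) p)

   rotate : ∀ f ys {i zs} → Cyc f (ys ++ i ∷ zs) → Cyc f (i ∷ zs ++ ys)
   rotate f [] {i} {zs} p = subst (λ l → Chain f i l i) (sym (++-identityʳ zs)) p
   rotate f (y ∷ ys) {i} {zs} p = let q , r = chain-split f y ys p in chain-++ f i zs r q

   cyc-closed : ∀ f c {x} → Cyc f c → x ∈ c → f x ∈ c
   cyc-closed f (a ∷ xs) p (here refl) = go a xs p
     where go : ∀ a xs {z} → Chain f a xs z → f a ∈ z ∷ xs
           go a [] e = here e
           go a (x ∷ xs) (e , _) = there (here e)
   cyc-closed f (a ∷ xs) p (there q) = go a xs p q
     where go : ∀ a xs {z x} → Chain f a xs z → x ∈ xs → f x ∈ z ∷ xs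
           go a (b ∷ []) (_ , e) (here refl) = here e
           go a (b ∷ c ∷ xs) (_ , e , _) (here refl) = there (there (here e))
           go a (b ∷ c ∷ xs) (_ , ch) (there q) with go b (c ∷ xs) ch q
           ... | here e = here e
           ... | there s = there (there s)

   -- cs lists disjoint cycles of f, and f fixes every point not listed; fixed points may be listed or not.
   record Cycles (f : F) (cs : List (List (Fin n))) : Set where
     constructor cycles
     field
       cyc : All (Cyc f) cs
       uniq : Unique (concat cs)
       fixes : ∀ {x} → x ∉ concat cs → f x ≡ x
   open Cycles public

   Total : List (List (Fin n)) → Set
   Total cs = ∀ x → x ∈ concat cs

   cycles-ext : ∀ {f g cs} → (∀ x → f x ≡ g x) → Cycles f cs → Cycles g cs
   cycles-ext {f} {g} e (cycles c u x) = cycles (All.map (λ {c} → cyc-map f g (λ x → x) c (λ x → sym (e x)) (λ _ → refl)) c) u (λ p → sym (e _) ∙ x p)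

   cycles-↭ : ∀ {f cs ds} → cs ↭ ds → Cycles f cs → Cycles f ds
   cycles-↭ p (cycles c u x) = cycles (All-resp-↭ p c) (Unique-↭ (concat-↭ p) u) (λ q → x (λ r → q (∈-resp-↭ (concat-↭ p) r)))

   rotate-↭ : ∀ (ys : List (Fin n)) i zs → ys ++ i ∷ zs ↭ i ∷ zs ++ ys
   rotate-↭ ys i zs = ++-comm ys (i ∷ zs)

   cycles-rotate : ∀ {f ys i zs cs} → Cycles f ((ys ++ i ∷ zs) ∷ cs) → Cycles f ((i ∷ zs ++ ys) ∷ cs)
   cycles-rotate {f} {ys} {i} {zs} {cs} (cycles (p ∷ c) u x) = cycles (rotate f ys p ∷ c) (Unique-↭ e u) (λ q → x (λ r → q (∈-resp-↭ e r)))
     where e = ++⁺ʳ (concat cs) (rotate-↭ ys i zs)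

   merges-↭ : ∀ (cs : List (List (Fin n))) {i ws cs′} → (i , ws , cs′) ∈ merges cs →
              (concat cs ↭ i ∷ ws ++ concat cs′) × (map length cs ↭ suc (length ws) ∷ map length cs′)
   merges-↭ cs {i} {ws} {cs′} p with merges-sound cs p
   ... | ys , zs , refl , q = trans (concat-↭ q) (++⁺ʳ (concat cs′) (rotate-↭ ys i zs)) ,
     trans (map-↭ length q) (↭-reflexive (cong (_∷ map length cs′) (length-++ ys ∙ (ℕP.+-suc (length ys) (length zs) ∙ cong suc (ℕP.+-comm (length ys) (length zs) ∙ sym (length-++ zs))))))

   cycles-merges : ∀ {f cs i ws cs′} → (i , ws , cs′) ∈ merges cs → Cycles f cs → Cycles f ((i ∷ ws) ∷ cs′)
   cycles-merges {cs = cs} p c with merges-sound cs p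
   ... | ys , zs , refl , q = cycles-rotate {ys = ys} (cycles-↭ q c)

   private
     avoid : ∀ {i r : Fin n} {xs} → i ∉ xs → r ∉ xs → ∀ {x} → x ∈ xs → sw i r x ≡ x
     avoid i∉ r∉ {x} p = sw-≢ _ _ x (λ { refl → i∉ p }) (λ { refl → r∉ p })

     others : ∀ {f g : F} {i r cs} → (∀ x → g x ≡ sw i r (f x)) → i ∉ concat cs → r ∉ concat cs → All (Cyc f) cs → All (Cyc g) cs
     others e i∉ r∉ [] = []
     others {f} {g} {i} {r} {c ∷ cs} e i∉ r∉ (p ∷ ps) =
       cyc-map f g (sw i r) c e (avoid (λ q → i∉ (∈-++⁺ˡ q)) (λ q → r∉ (∈-++⁺ˡ q))) p ∷ others e (λ q → i∉ (∈-++⁺ʳ c q)) (λ q → r∉ (∈-++⁺ʳ c q)) ps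

   -- The transposition exchanges the end points of the chains from r and from i: each now leads to
   -- the start of the other, so two cycles close up to one.
   cycles-merge : ∀ {f g : F} {r xs i ws cs} → (∀ x → g x ≡ sw i r (f x)) →
                  Cycles f ((r ∷ xs) ∷ (i ∷ ws) ∷ cs) → Cycles g ((r ∷ xs ++ i ∷ ws) ∷ cs)
   cycles-merge {f} {g} {r} {xs} {i} {ws} {cs} e (cycles (p ∷ q ∷ c) u x) =
     cycles (chain-++ g r xs (subst (Chain g r xs) (sw-r i r) (chain-map f g (sw i r) r xs e (avoid i∉xs r∉xs) p))
                             (subst (Chain g i ws) (sw-i i r) (chain-map f g (sw i r) i ws e (avoid i∉ws r∉ws) q))
             ∷ others e i∉cs r∉cs c)
            (subst Unique (sym assoc) u)
            λ {y} y∉ → e y ∙ (cong (sw i r) (x (λ z → y∉ (subst (y ∈_) (sym assoc) z)))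
               ∙ sw-≢ i r y (λ { refl → y∉ (there (∈-++⁺ˡ (∈-++⁺ʳ xs (here refl)))) }) (λ { refl → y∉ (here refl) }))
     where
     assoc : concat ((r ∷ xs ++ i ∷ ws) ∷ cs) ≡ concat ((r ∷ xs) ∷ (i ∷ ws) ∷ cs)
     assoc = cong (r ∷_) (++-assoc xs (i ∷ ws) (concat cs))
     r∉ : r ∉ xs ++ (i ∷ ws) ++ concat cs
     r∉ = Unique[x∷xs]⇒x∉xs u
     u₁ = unique-++ʳ (r ∷ xs) u
     i∉ : i ∉ ws ++ concat cs
     i∉ = Unique[x∷xs]⇒x∉xs u₁
     i∉xs : i ∉ xs
     i∉xs z = unique-disjoint (r ∷ xs) u (there z) (here refl)
     r∉xs : r ∉ xs
     r∉xs z = r∉ (∈-++⁺ˡ z)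
     i∉ws : i ∉ ws
     i∉ws z = i∉ (∈-++⁺ˡ z)
     r∉ws : r ∉ ws
     r∉ws z = r∉ (∈-++⁺ʳ xs (there (∈-++⁺ˡ z)))
     i∉cs : i ∉ concat cs
     i∉cs z = i∉ (∈-++⁺ʳ ws z)
     r∉cs : r ∉ concat cs
     r∉cs z = r∉ (∈-++⁺ʳ xs (there (∈-++⁺ʳ ws z)))

   -- The same exchange on one cycle cut at i: each of its two halves now returns to its own start.
   cycles-split : ∀ {f g : F} {r ys i zs cs} → (∀ x → g x ≡ sw i r (f x)) →
                  Cycles f ((r ∷ ys ++ i ∷ zs) ∷ cs) → Cycles g ((r ∷ ys) ∷ (i ∷ zs) ∷ cs)
   cycles-split {f} {g} {r} {ys} {i} {zs} {cs} e (cycles (p ∷ c) u x) =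
     cycles (subst (Chain g r ys) (sw-i i r) (chain-map f g (sw i r) r ys e (avoid i∉ys r∉ys) p₁)
             ∷ subst (Chain g i zs) (sw-r i r) (chain-map f g (sw i r) i zs e (avoid i∉zs r∉zs) p₂)
             ∷ others e i∉cs r∉cs c)
            u′
            λ {y} y∉ → e y ∙ (cong (sw i r) (x (λ z → y∉ (subst (y ∈_) assoc z)))
               ∙ sw-≢ i r y (λ { refl → y∉ (∈-++⁺ʳ (r ∷ ys) (here refl)) }) (λ { refl → y∉ (here refl) }))
     where
     assoc : concat ((r ∷ ys ++ i ∷ zs) ∷ cs) ≡ concat ((r ∷ ys) ∷ (i ∷ zs) ∷ cs)
     assoc = cong (r ∷_) (++-assoc ys (i ∷ zs) (concat cs))
     u′ = subst Unique assoc u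
     p₁ = proj₁ (chain-split f r ys p)
     p₂ = proj₂ (chain-split f r ys p)
     r∉ : r ∉ ys ++ (i ∷ zs) ++ concat cs
     r∉ = Unique[x∷xs]⇒x∉xs u′
     i∉ : i ∉ zs ++ concat cs
     i∉ = Unique[x∷xs]⇒x∉xs (unique-++ʳ (r ∷ ys) u′)
     i∉ys : i ∉ ys
     i∉ys z = unique-disjoint (r ∷ ys) u′ (there z) (here refl)
     r∉ys : r ∉ ys
     r∉ys z = r∉ (∈-++⁺ˡ z)
     i∉zs : i ∉ zs
     i∉zs z = i∉ (∈-++⁺ˡ z)
     r∉zs : r ∉ zs
     r∉zs z = r∉ (∈-++⁺ʳ ys (there (∈-++⁺ˡ z)))
     i∉cs : i ∉ concat cs
     i∉cs z = i∉ (∈-++⁺ʳ zs z)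
     r∉cs : r ∉ concat cs
     r∉cs z = r∉ (∈-++⁺ʳ ys (there (∈-++⁺ʳ zs z)))

   singletons : List (Fin n) → List (List (Fin n))
   singletons = map [_]

   concat-singletons : ∀ xs → concat (singletons xs) ≡ xs
   concat-singletons [] = refl
   concat-singletons (x ∷ xs) = cong (x ∷_) (concat-singletons xs)

   Injective : F → Set
   Injective f = ∀ {x y} → f x ≡ f y → x ≡ y

   -- Induction on the points that f may move: if f r = i ≠ r then (i r) f fixes r.
   decompose : ∀ L f → Injective f → (∀ {x} → x ∉ L → f x ≡ x) → ∃ λ cs → Cycles f cs × Total cs
   decompose [] f inj s = singletons (allFin n) ,
     cycles (AllP.map⁺ (All.tabulate λ {x} _ → s (λ ()))) (subst Unique (sym (concat-singletons (allFin n))) (allFin⁺ n)) (λ _ → s (λ ())) ,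
     λ x → subst (x ∈_) (sym (concat-singletons (allFin n))) (∈-allFin x)
   decompose (r ∷ L) f inj s with f r ≟ r
   ... | yes fr = decompose L f inj s′
     where s′ : ∀ {x} → x ∉ L → f x ≡ x
           s′ {x} x∉ with x ≟ r
           ... | yes refl = fr
           ... | no x≢r = s (λ { (here e) → x≢r e ; (there p) → x∉ p })
   ... | no fr = finish (decompose L g g-inj g-s)
     where
     i = f r
     g : F
     g x = sw i r (f x)
     gr : g r ≡ r
     gr = sw-i i r
     g-inj : Injective g
     g-inj e = inj (sw-inj i r e)
     g-s : ∀ {x} → x ∉ L → g x ≡ x
     g-s {x} x∉ with x ≟ r
     ... | yes refl = gr
     ... | no x≢r = cong (sw i r) fx ∙ sw-≢ i r x (λ e → x≢r (inj (fx ∙ e))) x≢r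
       where fx : f x ≡ x
             fx = s (λ { (here e) → x≢r e ; (there p) → x∉ p })
     finish : (∃ λ cs → Cycles g cs × Total cs) → ∃ λ cs → Cycles f cs × Total cs
     finish (cs , c , t) with merges-∈ {cs = cs} (t r)
     -- Since g fixes r, the cycle through r cannot have a second point.
     ... | b ∷ ws , cs′ , p = contradiction (sym gr ∙ proj₁ (All.head (cyc (cycles-merges p c)))) (λ { refl → Unique[x∷xs]⇒x∉xs (uniq (cycles-merges p c)) (here refl) })
     ... | [] , cs′ , p with merges-↭ cs p
     ... | cs↭ , _ with ∈-resp-↭ cs↭ (t i)
     ... | here e = contradiction e fr
     ... | there i∈ with merges-∈ {cs = cs′} i∈
     ... | ws , ds , q = (r ∷ i ∷ ws) ∷ ds ,
       cycles-merge {xs = []} (λ x → sym (sw-sw i r (f x))) (cycles-↭-tail q (cycles-merges p c)) ,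
       λ x → shuffle-in x (∈-resp-↭ cs↭ (t x))
       where
       cycles-↭-tail : ∀ {a i ws cs ds} → (i , ws , ds) ∈ merges cs → Cycles g (a ∷ cs) → Cycles g (a ∷ (i ∷ ws) ∷ ds)
       cycles-↭-tail {a} {i} {ws} {cs} {ds} q (cycles (pa ∷ ps) u x) with merges-sound cs q
       ... | ys , zs , refl , r = cycles (pa ∷ cyc′) (Unique-↭ e u) (λ z → x (λ y → z (∈-resp-↭ e y)))
         where
         e : a ++ concat cs ↭ a ++ (i ∷ zs ++ ys) ++ concat ds
         e = ++⁺ˡ a (proj₁ (merges-↭ cs q))
         cyc′ : All (Cyc g) ((i ∷ zs ++ ys) ∷ ds)
         cyc′ with p ∷ ps′ ← All-resp-↭ r ps = rotate g ys p ∷ ps′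
       shuffle-in : ∀ x → x ∈ r ∷ concat cs′ → x ∈ concat ((r ∷ i ∷ ws) ∷ ds)
       shuffle-in x (here e) = here e
       shuffle-in x (there z) = there (∈-resp-↭ (proj₁ (merges-↭ cs′ q)) z)

   cyclesOf : ∀ f → Injective f → ∃ λ cs → Cycles f cs × Total cs
   cyclesOf f inj = decompose (allFin n) f inj (λ {x} x∉ → contradiction (∈-allFin x) x∉)

-- Cycle counts, cycle types and deficiencies of permutation tables

module CycleTypes where
 open import Defs
 open CycleLists
 open import Data.Nat using (ℕ; zero; suc; z≤n; s≤s; _+_; _∸_; _≤_; _<_; _≤ᵇ_; _≡ᵇ_)
 import Data.Nat.Properties as ℕP
 open import Data.Bool using (Bool; true; false; not; _∧_; _∨_; T; if_then_else_)
 open import Data.Bool.Properties using (T?)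
 open import Data.Bool.ListAction using (all; any)
 open import Data.List using (List; []; _∷_; [_]; length; map; _++_; concat; allFin; filter; filterᵇ; upTo; applyUpTo)
 open import Data.List.Properties using (length-++; map-++; filter-++; filter-accept; filter-none; concat-++; length-tabulate; length-map)
 open import Data.Nat.ListAction using (sum)
 open import Data.Nat.ListAction.Properties using (sum-++)
 open import Data.List.Relation.Unary.All using (All; []; _∷_)
 import Data.List.Relation.Unary.All as All
 import Data.List.Relation.Unary.All.Properties as AllP
 open import Data.List.Relation.Unary.Any using (here; there)
 open import Data.List.Relation.Unary.AllPairs using ([]; _∷_)
 open import Data.List.Relation.Unary.Unique.Propositional using (Unique)
 open import Data.List.Relation.Unary.Unique.Propositional.Properties using (Unique[x∷xs]⇒x∉xs; allFin⁺; filter⁺)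
 open import Data.List.Membership.Propositional using (_∈_; _∉_)
 open import Data.List.Membership.Propositional.Properties
 open import Data.List.Relation.Binary.Permutation.Propositional using (_↭_; refl; trans; ↭-reflexive)
 open import Data.List.Relation.Binary.Permutation.Propositional.Properties using (∈-resp-↭; ++⁺; filter-↭; ↭-length) renaming (map⁺ to map-↭)
 open import Data.Fin using (Fin; toℕ; _≟_)
 open import Data.Fin.Properties using (toℕ-injective)
 import Data.List.Membership.DecPropositional as DecMem
 open import Data.Vec using (tabulate)
 open import Data.Vec.Properties using (lookup∘tabulate; tabulate∘lookup; tabulate-cong)
 open import Data.Product using (_×_; _,_; ∃; proj₁; proj₂)
 open import Data.Sum using (inj₁; inj₂)
 open import Data.Empty using (⊥; ⊥-elim)
 open import Function using (_∘_)
 open import Relation.Binary.PropositionalEquality hiding ([_]) renaming (trans to _∙_)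
 open import Relation.Nullary using (¬_; yes; no; contradiction; ¬?)

 to-T : ∀ {b} → b ≡ true → T b
 to-T refl = _

 from-T : ∀ {b} → T b → b ≡ true
 from-T {true} _ = refl

 ∧-true : ∀ {a b} → a ∧ b ≡ true → a ≡ true × b ≡ true
 ∧-true {true} e = refl , e

 true≢false : ∀ {b} → b ≡ true → b ≡ false → ⊥
 true≢false refl ()

 ≢true : ∀ {b} → ¬ (b ≡ true) → b ≡ false
 ≢true {true} h = contradiction refl h
 ≢true {false} h = refl

 module _ {A : Set} (p : A → Bool) where
   all-true : ∀ xs → (∀ {x} → x ∈ xs → p x ≡ true) → all p xs ≡ true
   all-true [] h = refl
   all-true (x ∷ xs) h rewrite h (here refl) = all-true xs (λ q → h (there q))

   all-true⁻ : ∀ xs → all p xs ≡ true → ∀ {x} → x ∈ xs → p x ≡ true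
   all-true⁻ (x ∷ xs) e (here refl) = proj₁ (∧-true e)
   all-true⁻ (x ∷ xs) e (there q) = all-true⁻ xs (proj₂ (∧-true {p x} e)) q

   any-true : ∀ xs {x} → x ∈ xs → p x ≡ true → any p xs ≡ true
   any-true (x ∷ xs) (here refl) e rewrite e = refl
   any-true (x ∷ xs) (there q) e with p x
   ... | true = refl
   ... | false = any-true xs q e

   any-true⁻ : ∀ xs → any p xs ≡ true → ∃ λ x → x ∈ xs × p x ≡ true
   any-true⁻ (x ∷ xs) e with p x in eq
   ... | true = x , here refl , eq
   ... | false = let y , q , f = any-true⁻ xs e in y , there q , f

   filterᵇ-∈ : ∀ {xs x} → x ∈ xs → p x ≡ true → x ∈ filterᵇ p xs
   filterᵇ-∈ q e = ∈-filter⁺ (T? ∘ p) q (to-T e)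

   filterᵇ-∈⁻ : ∀ {xs x} → x ∈ filterᵇ p xs → x ∈ xs × p x ≡ true
   filterᵇ-∈⁻ {xs} q = let r , t = ∈-filter⁻ (T? ∘ p) {xs = xs} q in r , from-T t

 ≡ᵇ-true : ∀ {m n} → m ≡ n → (m ≡ᵇ n) ≡ true
 ≡ᵇ-true {m} {n} e = from-T (ℕP.≡⇒≡ᵇ m n e)

 ≡ᵇ-true⁻ : ∀ m n → (m ≡ᵇ n) ≡ true → m ≡ n
 ≡ᵇ-true⁻ m n e = ℕP.≡ᵇ⇒≡ m n (to-T e)

 ≤ᵇ-true : ∀ {m n} → m ≤ n → (m ≤ᵇ n) ≡ true
 ≤ᵇ-true p = from-T (ℕP.≤⇒≤ᵇ p)

 ≤ᵇ-true⁻ : ∀ m n → (m ≤ᵇ n) ≡ true → m ≤ n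
 ≤ᵇ-true⁻ m n e = ℕP.≤ᵇ⇒≤ m n (to-T e)

 firstWith-applyUpTo : ∀ p (f : ℕ → ℕ) n d i → i < n → p (f i) ≡ true → (∀ j → j < i → p (f j) ≡ false) → firstWith p (applyUpTo f n) d ≡ f i
 firstWith-applyUpTo p f (suc n) d zero _ e _ rewrite e = refl
 firstWith-applyUpTo p f (suc n) d (suc i) (s≤s lt) e h rewrite h 0 (s≤s z≤n) = firstWith-applyUpTo p (f ∘ suc) n d i lt e (λ j l → h (suc j) (s≤s l))

 map-applyUpTo′ : ∀ (g f : ℕ → ℕ) n → map g (applyUpTo f n) ≡ applyUpTo (g ∘ f) n
 map-applyUpTo′ g f zero = refl
 map-applyUpTo′ g f (suc n) = cong (g (f 0) ∷_) (map-applyUpTo′ g (f ∘ suc) n)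

 iter-suc : ∀ {A : Set} k (f : A → A) a → iter (suc k) f a ≡ iter k f (f a)
 iter-suc zero f a = refl
 iter-suc (suc k) f a = cong f (iter-suc k f a)

 finEq-true : ∀ {n} {i j : Fin n} → i ≡ j → finEqᵇ i j ≡ true
 finEq-true {i = i} refl = ≡ᵇ-true {toℕ i} refl

 finEq-true⁻ : ∀ {n} {i j : Fin n} → finEqᵇ i j ≡ true → i ≡ j
 finEq-true⁻ {i = i} {j} e = toℕ-injective (≡ᵇ-true⁻ (toℕ i) (toℕ j) e)

 app-∘ : ∀ {n} (σ τ : Perm n) x → app (σ ∘ₚ τ) x ≡ app σ (app τ x)
 app-∘ σ τ x = lookup∘tabulate _ x

 perm-ext : ∀ {n} {σ τ : Perm n} → (∀ x → app σ x ≡ app τ x) → σ ≡ τ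
 perm-ext {σ = σ} {τ} h = sym (tabulate∘lookup σ) ∙ (tabulate-cong h ∙ tabulate∘lookup τ)

 record Inj {n} (σ : Perm n) : Set where
   constructor mkInj
   field injective : Injective (app σ)
 open Inj public

 isPerm-true : ∀ {n} {σ : Perm n} → Inj σ → isPermᵇ σ ≡ true
 isPerm-true {n} {σ} inj = all-true _ (allFin n) λ {i} _ → all-true _ (allFin n) λ {j} _ → go i j
   where go : ∀ i j → not (finEqᵇ (app σ i) (app σ j)) ∨ finEqᵇ i j ≡ true
         go i j with finEqᵇ (app σ i) (app σ j) in e
         ... | true = finEq-true (injective inj (finEq-true⁻ e))
         ... | false = refl

 isPerm-true⁻ : ∀ {n} {σ : Perm n} → isPermᵇ σ ≡ true → Inj σ
 isPerm-true⁻ {n} {σ} e = mkInj λ {i} {j} eq → finEq-true⁻ (go i j eq (all-true⁻ _ (allFin n) (all-true⁻ _ (allFin n) e (∈-allFin i)) (∈-allFin j)))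
   where go : ∀ i j → app σ i ≡ app σ j → not (finEqᵇ (app σ i) (app σ j)) ∨ finEqᵇ i j ≡ true → finEqᵇ i j ≡ true
         go i j eq h rewrite finEq-true eq = h

 module _ {n : ℕ} where
   open DecMem (_≟_ {n}) using (_∈?_) public

   chain-iter : ∀ f a xs {z} → Chain {n} f a xs z → iter (suc (length xs)) f a ≡ z
   chain-iter f a [] e = e
   chain-iter f a (x ∷ xs) (e , c) = iter-suc (suc (length xs)) f a ∙ (cong (iter (suc (length xs)) f) e ∙ chain-iter f x xs c)

   chain-before : ∀ f a xs {z} → Chain {n} f a xs z → ∀ k → k < length xs → iter (suc k) f a ∈ xs
   chain-before f a (x ∷ xs) (e , c) zero _ = here e
   chain-before f a (x ∷ xs) (e , c) (suc k) (s≤s l) = there (subst (_∈ xs) (sym (iter-suc (suc k) f a ∙ cong (iter (suc k) f) e)) (chain-before f x xs c k l))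

   chain-reach : ∀ f a xs {z} → Chain {n} f a xs z → ∀ {y} → y ∈ xs → ∃ λ k → k < length xs × iter (suc k) f a ≡ y
   chain-reach f a (x ∷ xs) (e , c) (here refl) = 0 , s≤s z≤n , e
   chain-reach f a (x ∷ xs) (e , c) (there p) = let k , l , q = chain-reach f x xs c p in
     suc k , s≤s l , (iter-suc (suc k) f a ∙ (cong (iter (suc k) f) e ∙ q))

   chain-inv : ∀ {B : Set} (φ : Fin n → B) f a xs {z} → (∀ x → φ (f x) ≡ φ x) → Chain f a xs z → ∀ {y} → y ∈ xs → φ y ≡ φ a
   chain-inv φ f a (x ∷ xs) h (e , c) (here refl) = cong φ (sym e) ∙ h a
   chain-inv φ f a (x ∷ xs) h (e , c) (there p) = chain-inv φ f x xs h c p ∙ (cong φ (sym e) ∙ h a)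

   cyc-inv : ∀ {B : Set} (φ : Fin n → B) f c → (∀ x → φ (f x) ≡ φ x) → Cyc f c → ∀ {x y} → x ∈ c → y ∈ c → φ x ≡ φ y
   cyc-inv φ f (a ∷ xs) h p x∈ y∈ = to x∈ ∙ sym (to y∈)
     where to : ∀ {y} → y ∈ a ∷ xs → φ y ≡ φ a
           to (here refl) = refl
           to (there q) = chain-inv φ f a xs h p q

   complement : List (Fin n) → List (Fin n)
   complement xs = filter (λ x → ¬? (x ∈? xs)) (allFin n)

   complement-↭ : ∀ {xs} → Unique xs → allFin n ↭ xs ++ complement xs
   complement-↭ {xs} u = unique-set-↭ (allFin⁺ n)
     (unique-++ u (filter⁺ (λ x → ¬? (x ∈? xs)) (allFin⁺ n)) (λ p q → proj₂ (∈-filter⁻ (λ x → ¬? (x ∈? xs)) {xs = allFin n} q) p))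
     (λ {x} _ → cover x) (λ {x} _ → ∈-allFin x)
     where cover : ∀ x → x ∈ xs ++ complement xs
           cover x with x ∈? xs
           ... | yes p = ∈-++⁺ˡ p
           ... | no q = ∈-++⁺ʳ xs (∈-filter⁺ (λ x → ¬? (x ∈? xs)) (∈-allFin x) q)

   length-allFin : length (allFin n) ≡ n
   length-allFin = length-tabulate {n = n} (λ x → x)

   unique-length : ∀ {xs : List (Fin n)} → Unique xs → length xs ≤ n
   unique-length {xs} u = subst (length xs ≤_) (sym (length-++ xs) ∙ (sym (↭-length (complement-↭ u)) ∙ length-allFin)) (ℕP.m≤m+n (length xs) _)

   total-length : ∀ {xs : List (Fin n)} → Unique xs → (∀ x → x ∈ xs) → length xs ≡ n
   total-length u t = ↭-length (unique-set-↭ u (allFin⁺ n) (λ {x} _ → ∈-allFin x) (λ {x} _ → t x)) ∙ length-allFin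

   -- The earlier iterates run through `ws`, which avoids x, so the first return takes place after
   -- the full length; that length is at most n, hence within the search range.
   orbitLen-chain : ∀ (σ : Perm n) x ws → Unique (x ∷ ws) → Chain (app σ) x ws x → orbitLen σ x ≡ suc (length ws)
   orbitLen-chain σ x ws u c = cong (λ l → firstWith (λ k → finEqᵇ (iter k (app σ) x) x) l n) (map-applyUpTo′ suc (λ z → z) n) ∙
     firstWith-applyUpTo (λ k → finEqᵇ (iter k (app σ) x) x) suc n n (length ws) (unique-length u) (finEq-true (chain-iter (app σ) x ws c))
       (λ j l → ≢true (λ e → Unique[x∷xs]⇒x∉xs u (subst (_∈ ws) (finEq-true⁻ e) (chain-before (app σ) x ws c j l))))

   iter-closed : ∀ f c → Cyc {n} f c → ∀ k {x} → x ∈ c → iter k f x ∈ c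
   iter-closed f c p zero q = q
   iter-closed f c p (suc k) {x} q = cyc-closed f c {iter k f x} p (iter-closed f c p k q)

   record Rotated (f : Fin n → Fin n) (c : List (Fin n)) (x : Fin n) : Set where
     field
       rest : List (Fin n)
       perm : c ↭ x ∷ rest
       chain : Chain f x rest x

   rotated : ∀ f c {x} → Cyc f c → x ∈ c → Rotated f c x
   rotated f c p q with ∈-∃++ q
   ... | ys , zs , refl = record { rest = zs ++ ys ; perm = rotate-↭ ys _ zs ; chain = rotate f ys p }

   leader-true : ∀ (σ : Perm n) c {x} → Cyc (app σ) c → x ∈ c → (∀ {y} → y ∈ c → toℕ x ≤ toℕ y) → isLeaderᵇ σ x ≡ true
   leader-true σ c p q h = all-true _ (upTo n) λ {k} _ → ≤ᵇ-true (h (iter-closed (app σ) c p k q))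

   leader-true⁻ : ∀ (σ : Perm n) c {x} → Unique c → Cyc (app σ) c → x ∈ c → isLeaderᵇ σ x ≡ true → ∀ {y} → y ∈ c → toℕ x ≤ toℕ y
   leader-true⁻ σ c {x} u p q e {y} y∈ with rotated (app σ) c p q
   ... | record { rest = ws ; perm = c↭ ; chain = ch } with ∈-resp-↭ c↭ y∈
   ... | here refl = ℕP.≤-refl
   ... | there y∈ws = let k , l , eq = chain-reach (app σ) x ws ch y∈ws in
     subst (λ z → toℕ x ≤ toℕ z) eq (≤ᵇ-true⁻ _ _ (all-true⁻ _ (upTo n) e (∈-upTo⁺ (ℕP.≤-trans (s≤s l) (unique-length (Unique-↭ c↭ u))))))

   minimum : ∀ (c : List (Fin n)) {a} → a ∈ c → ∃ λ μ → μ ∈ c × (∀ {y} → y ∈ c → toℕ μ ≤ toℕ y)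
   minimum (x ∷ []) _ = x , here refl , λ { (here refl) → ℕP.≤-refl }
   minimum (x ∷ c@(_ ∷ _)) _ with minimum c (here refl)
   ... | μ , μ∈ , h with ℕP.≤-total (toℕ x) (toℕ μ)
   ... | inj₁ le = x , here refl , λ { (here refl) → ℕP.≤-refl ; (there q) → ℕP.≤-trans le (h q) }
   ... | inj₂ ge = μ , there μ∈ , λ { (here refl) → ge ; (there q) → h q }

   -- A leader is the minimum of its cycle.
   one-leader : ∀ (σ : Perm n) c → Unique c → Cyc (app σ) c → ∃ λ μ → μ ∈ c × filterᵇ (isLeaderᵇ σ) c ≡ [ μ ]
   one-leader σ c@(a ∷ _) u p with minimum c (here refl)
   ... | μ , μ∈ , h with ∈-∃++ μ∈
   ... | ys , zs , eq = μ , μ∈ , (cong (filterᵇ L) eq ∙ (filter-++ P? ys (μ ∷ zs) ∙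
           cong₂ _++_ (filter-none P? (All.tabulate none-ys)) (filter-accept P? {xs = zs} (to-T (leader-true σ c p μ∈ h)) ∙ cong (μ ∷_) (filter-none P? (All.tabulate none-zs)))))
     where
     L = isLeaderᵇ σ
     P? = T? ∘ L
     u′ : Unique (ys ++ μ ∷ zs)
     u′ = subst Unique eq u
     same : ∀ {x} → x ∈ c → T (L x) → x ≡ μ
     same x∈ t = toℕ-injective (ℕP.≤-antisym (leader-true⁻ σ c u p x∈ (from-T t) μ∈) (h x∈))
     none-ys : ∀ {x} → x ∈ ys → ¬ T (L x)
     none-ys q t with refl ← same (subst (_ ∈_) (sym eq) (∈-++⁺ˡ q)) t = unique-disjoint ys u′ q (here refl)
     none-zs : ∀ {x} → x ∈ zs → ¬ T (L x)
     none-zs q t with refl ← same (subst (_ ∈_) (sym eq) (∈-++⁺ʳ ys (there q))) t = Unique[x∷xs]⇒x∉xs (unique-++ʳ ys u′) q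

   leaders-lengths : ∀ (σ : Perm n) cs → All (Cyc (app σ)) cs → Unique (concat cs) → map (orbitLen σ) (filterᵇ (isLeaderᵇ σ) (concat cs)) ≡ map length cs
   leaders-lengths σ [] _ _ = refl
   leaders-lengths σ (c ∷ cs) (p ∷ ps) u with one-leader σ c (unique-++ˡ c u) p
   ... | μ , μ∈ , eq = cong (map (orbitLen σ)) (filter-++ (T? ∘ isLeaderᵇ σ) c (concat cs) ∙ cong (_++ filterᵇ (isLeaderᵇ σ) (concat cs)) eq)
       ∙ cong₂ _∷_ len (leaders-lengths σ cs ps (unique-++ʳ c u))
     where
     len : orbitLen σ μ ≡ length c
     len with rotated (app σ) c p μ∈
     ... | record { rest = ws ; perm = c↭ ; chain = ch } = orbitLen-chain σ μ ws (Unique-↭ c↭ (unique-++ˡ c u)) ch ∙ sym (↭-length c↭)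

   leaders-↭ : ∀ (σ : Perm n) {cs} → Cycles (app σ) cs → Total cs → map (orbitLen σ) (leaders σ) ↭ map length cs
   leaders-↭ σ {cs} c t = trans (map-↭ (orbitLen σ) (filter-↭ (T? ∘ isLeaderᵇ σ) (unique-set-↭ (allFin⁺ n) (uniq c) (λ {x} _ → t x) (λ {x} _ → ∈-allFin x))))
     (↭-reflexive (leaders-lengths σ cs (cyc c) (uniq c)))

   numCycles-cycles : ∀ (σ : Perm n) {cs} → Cycles (app σ) cs → Total cs → numCycles σ ≡ length cs
   numCycles-cycles σ {cs} c t = sym (length-map (orbitLen σ) (leaders σ)) ∙ (↭-length (leaders-↭ σ c t) ∙ length-map length cs)

   excess : List (List (Fin n)) → ℕ
   excess cs = sum (map (λ c → length c ∸ 1) cs)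

   excess-length : ∀ f cs → All (Cyc f) cs → excess cs + length cs ≡ length (concat cs)
   excess-length f [] [] = refl
   excess-length f ((x ∷ xs) ∷ cs) (_ ∷ ps) = ℕP.+-suc (length xs + excess cs) (length cs) ∙ cong suc (ℕP.+-assoc (length xs) (excess cs) (length cs) ∙ (cong (length xs +_) (excess-length f cs ps) ∙ sym (length-++ xs)))

   extend : ∀ {f cs} → Cycles f cs → Cycles f (cs ++ singletons (complement (concat cs))) × Total (cs ++ singletons (complement (concat cs)))
   extend {f} {cs} c =
     cycles (AllP.++⁺ (cyc c) (AllP.map⁺ (All.tabulate λ {x} q → fixes c (proj₂ (∈-filter⁻ (λ x → ¬? (x ∈? concat cs)) {xs = allFin n} q)))))
            (subst Unique (sym eq) (Unique-↭ p (allFin⁺ n))) (λ {x} x∉ → contradiction (t x) x∉) , t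
     where
     K = complement (concat cs)
     eq : concat (cs ++ singletons K) ≡ concat cs ++ K
     eq = sym (concat-++ cs (singletons K)) ∙ cong (concat cs ++_) (concat-singletons K)
     p = complement-↭ (uniq c)
     t : Total (cs ++ singletons K)
     t x = subst (x ∈_) (sym eq) (∈-resp-↭ p (∈-allFin x))

   -- The least number of transpositions whose product is σ.
   deficiency : Perm n → ℕ
   deficiency σ = n ∸ numCycles σ

   -- A fixed point adds 0 to the excess, so a list without the fixed points gives the right value.
   -- This makes deficiencies additive over pieces of a tuple.
   deficiency-cycles : ∀ (σ : Perm n) {cs} → Cycles (app σ) cs → deficiency σ ≡ excess cs
   deficiency-cycles σ {cs} c with extend c
   ... | c′ , t = cong (n ∸_) (numCycles-cycles σ c′ t) ∙ (cong (_∸ length ds) (sym (total-length (uniq c′) t) ∙ sym (excess-length (app σ) ds (cyc c′))) ∙ (ℕP.m+n∸n≡m (excess ds) (length ds) ∙ excess-ext))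
     where
     K = complement (concat cs)
     ds = cs ++ singletons K
     excess-sing : ∀ xs → excess (singletons xs) ≡ 0
     excess-sing [] = refl
     excess-sing (x ∷ xs) = excess-sing xs
     excess-ext : excess ds ≡ excess cs
     excess-ext = cong sum (map-++ _ cs (singletons K)) ∙ (sum-++ (map _ cs) _ ∙ (cong (excess cs +_) (excess-sing K) ∙ ℕP.+-identityʳ _))

   numCycles≤ : ∀ {σ : Perm n} → Inj σ → numCycles σ ≤ n
   numCycles≤ {σ} inj with cyclesOf (app σ) (injective inj)
   ... | cs , c , t = subst₂ _≤_ (sym (numCycles-cycles σ c t)) (excess-length (app σ) cs (cyc c) ∙ total-length (uniq c) t) (ℕP.m≤n+m (length cs) (excess cs))

   restrictF : (Fin n → Bool) → (Fin n → Fin n) → Fin n → Fin n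
   restrictF φ f x = if φ x then f x else x

   select : (Fin n → Bool) → List (List (Fin n)) → List (List (Fin n))
   select φ [] = []
   select φ ([] ∷ cs) = select φ cs
   select φ ((x ∷ xs) ∷ cs) = if φ x then (x ∷ xs) ∷ select φ cs else select φ cs

   select-∈ : ∀ φ cs {x} → x ∈ concat (select φ cs) → x ∈ concat cs
   select-∈ φ ([] ∷ cs) p = select-∈ φ cs p
   select-∈ φ ((y ∷ ys) ∷ cs) p with φ y
   ... | false = ∈-++⁺ʳ (y ∷ ys) (select-∈ φ cs p)
   ... | true with ∈-++⁻ (y ∷ ys) p
   ... | inj₁ q = ∈-++⁺ˡ q
   ... | inj₂ q = ∈-++⁺ʳ (y ∷ ys) (select-∈ φ cs q)

   module _ (φ : Fin n → Bool) (f : Fin n → Fin n) (h : ∀ x → φ (f x) ≡ φ x) where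
     private
       r-true : ∀ {x} → φ x ≡ true → restrictF φ f x ≡ f x
       r-true {x} e rewrite e = refl
       r-false : ∀ {x} → φ x ≡ false → restrictF φ f x ≡ x
       r-false {x} e rewrite e = refl

       chain-r : ∀ a xs {z} → φ a ≡ true → Chain f a xs z → Chain (restrictF φ f) a xs z
       chain-r a [] e p = r-true e ∙ p
       chain-r a (x ∷ xs) e (p , c) = (r-true e ∙ p) , chain-r x xs (cong φ (sym p) ∙ (h a ∙ e)) c

       select-cyc : ∀ cs → All (Cyc f) cs → All (Cyc (restrictF φ f)) (select φ cs)
       select-cyc [] [] = []
       select-cyc ((x ∷ xs) ∷ cs) (p ∷ ps) with φ x in e
       ... | true = chain-r x xs e p ∷ select-cyc cs ps
       ... | false = select-cyc cs ps

       select-uniq : ∀ cs → Unique (concat cs) → Unique (concat (select φ cs))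
       select-uniq [] u = []
       select-uniq ([] ∷ cs) u = select-uniq cs u
       select-uniq ((x ∷ xs) ∷ cs) u with φ x
       ... | false = select-uniq cs (unique-++ʳ (x ∷ xs) u)
       ... | true = unique-++ (unique-++ˡ (x ∷ xs) u) (select-uniq cs (unique-++ʳ (x ∷ xs) u)) (λ p q → unique-disjoint (x ∷ xs) u p (select-∈ φ cs q))

     select-∈⁺ : ∀ cs → All (Cyc f) cs → ∀ {x} → φ x ≡ true → x ∈ concat cs → x ∈ concat (select φ cs)
     select-∈⁺ ((y ∷ ys) ∷ cs) (p ∷ ps) e q with ∈-++⁻ (y ∷ ys) q
     ... | inj₁ q₁ with φ y in ey
     ... | true = ∈-++⁺ˡ q₁
     ... | false = ⊥-elim (true≢false e (cyc-inv φ f (y ∷ ys) h p q₁ (here refl) ∙ ey))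
     select-∈⁺ ((y ∷ ys) ∷ cs) (p ∷ ps) e q | inj₂ q₂ with φ y
     ... | true = ∈-++⁺ʳ (y ∷ ys) (select-∈⁺ cs ps e q₂)
     ... | false = select-∈⁺ cs ps e q₂

     select-φ : ∀ cs → All (Cyc f) cs → ∀ {x} → x ∈ concat (select φ cs) → φ x ≡ true
     select-φ ((y ∷ ys) ∷ cs) (p ∷ ps) q with φ y in ey
     ... | false = select-φ cs ps q
     ... | true with ∈-++⁻ (y ∷ ys) q
     ... | inj₁ q₁ = cyc-inv φ f (y ∷ ys) h p q₁ (here refl) ∙ ey
     ... | inj₂ q₂ = select-φ cs ps q₂

     cycles-restrict : ∀ {cs} → Cycles f cs → Cycles (restrictF φ f) (select φ cs)
     cycles-restrict {cs} (cycles c u x) = cycles (select-cyc cs c) (select-uniq cs u) fix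
       where fix : ∀ {y} → y ∉ concat (select φ cs) → restrictF φ f y ≡ y
             fix {y} y∉ with φ y in e
             ... | false = refl
             ... | true = x (λ q → y∉ (select-∈⁺ cs c e q))

   excess-select : ∀ f φ cs → All (Cyc f) cs → excess cs ≡ excess (select φ cs) + excess (select (not ∘ φ) cs)
   excess-select f φ [] [] = refl
   excess-select f φ ((x ∷ xs) ∷ cs) (_ ∷ ps) with φ x
   ... | true = cong (length xs +_) (excess-select f φ cs ps) ∙ sym (ℕP.+-assoc (length xs) _ _)
   ... | false = cong (length xs +_) (excess-select f φ cs ps) ∙ (sym (ℕP.+-assoc (length xs) _ _) ∙ (cong (_+ excess (select (not ∘ φ) cs)) (ℕP.+-comm (length xs) _) ∙ ℕP.+-assoc (excess (select φ cs)) (length xs) _))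

-- Orbits of tuples, splitting off transpositions, restriction and gluing

module Transitivity where
 open import Defs
 open CycleLists
 open CycleTypes
 open import Data.Nat using (ℕ; zero; suc; s≤s; _+_; _≤_; _<_)
 import Data.Nat.Properties as ℕP
 open import Data.Bool using (Bool; true; false; not; if_then_else_)
 open import Data.Bool.Properties using (not-injective)
 open import Data.Bool.ListAction using (any)
 open import Data.List using (List; []; _∷_; [_]; length; map; _++_; allFin; zipWith)
 open import Data.Nat.ListAction using (sum)
 open import Data.List.Relation.Unary.All using (All; []; _∷_)
 import Data.List.Relation.Unary.All as All
 open import Data.List.Relation.Unary.Any using (here; there)
 open import Data.List.Relation.Unary.AllPairs using ([]; _∷_)
 open import Data.List.Relation.Unary.Unique.Propositional using (Unique)
 open import Data.List.Relation.Unary.Unique.Propositional.Properties using (Unique[x∷xs]⇒x∉xs)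
 open import Data.List.Membership.Propositional using (_∈_; _∉_)
 open import Data.List.Membership.Propositional.Properties
 open import Data.List.Relation.Binary.Permutation.Propositional using (↭-refl; prep; swap)
 open import Data.List.Relation.Binary.Permutation.Propositional.Properties using (∈-resp-↭)
 open import Data.Fin using (Fin; _≟_)
 open import Data.Fin.Properties using (any?)
 open import Data.Vec using (lookup; tabulate)
 open import Data.Vec.Properties using (lookup∘tabulate)
 open import Data.Product using (_×_; _,_; ∃; proj₁)
 open import Data.Sum using (_⊎_; inj₁; inj₂)
 open import Data.Empty using (⊥-elim)
 open import Data.Unit using (⊤; tt)
 open import Function using (_∘_)
 open import Relation.Binary.PropositionalEquality hiding ([_]) renaming (trans to _∙_)
 open import Relation.Nullary using (yes; no; contradiction)

 bool-cases : ∀ (b : Bool) → b ≡ true ⊎ b ≡ false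
 bool-cases true = inj₁ refl
 bool-cases false = inj₂ refl

 bool-ext : ∀ {a b : Bool} → (a ≡ true → b ≡ true) → (b ≡ true → a ≡ true) → a ≡ b
 bool-ext {true} {b} f g = sym (f refl)
 bool-ext {false} {true} f g = g refl
 bool-ext {false} {false} f g = refl

 module _ {n : ℕ} where

   Tuple : Set
   Tuple = List (Perm n)

   InvariantUnder : (Fin n → Bool) → Perm n → Set
   InvariantUnder φ σ = ∀ x → φ (app σ x) ≡ φ x

   Invariant : (Fin n → Bool) → Tuple → Set
   Invariant φ = All (InvariantUnder φ)

   Walk : Tuple → Fin n → List (Fin n) → Fin n → Set
   Walk t x [] y = x ≡ y
   Walk t x (v ∷ vs) y = (∃ λ σ → σ ∈ t × app σ x ≡ v) × Walk t v vs y

   walk-++ : ∀ t x vs {y ws z} → Walk t x vs y → Walk t y ws z → Walk t x (vs ++ ws) z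
   walk-++ t x [] refl w = w
   walk-++ t x (v ∷ vs) (s , w) w′ = s , walk-++ t v vs w w′

   walk-invariant : ∀ φ t x vs {y} → Invariant φ t → Walk t x vs y → φ y ≡ φ x
   walk-invariant φ t x [] h refl = refl
   walk-invariant φ t x (v ∷ vs) h ((σ , σ∈ , refl) , w) = walk-invariant φ t v vs h w ∙ All.lookup h σ∈ x

   closure-⊇ : ∀ k (t : Tuple) S {x} → x ∈ S → x ∈ closure k t S
   closure-⊇ zero t S p = p
   closure-⊇ (suc k) t S p = closure-⊇ k t _ (∈-++⁺ˡ p)

   walk-closure : ∀ k (t : Tuple) S {x} vs {y} → x ∈ S → Walk t x vs y → length vs ≤ k → y ∈ closure k t S
   walk-closure k t S [] x∈ refl _ = closure-⊇ k t S x∈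
   walk-closure (suc k) t S {x} (v ∷ vs) x∈ ((σ , σ∈ , refl) , w) (s≤s l) =
     walk-closure k t _ vs (∈-++⁺ʳ S (∈-concatMap (λ g → map (app g) S) σ∈ (∈-map⁺ (app σ) x∈))) w l

   closure-walk : ∀ k (t : Tuple) S {y} → y ∈ closure k t S → ∃ λ x → x ∈ S × ∃ λ vs → Walk t x vs y
   closure-walk zero t S p = _ , p , [] , refl
   closure-walk (suc k) t S p with closure-walk k t _ p
   ... | x , x∈ , vs , w with ∈-++⁻ S x∈
   ... | inj₁ q = x , q , vs , w
   ... | inj₂ q with ∈-concatMap-inv (λ g → map (app g) S) {xs = t} q
   ... | σ , σ∈ , r with ∈-map⁻ (app σ) r
   ... | z , z∈ , refl = z , z∈ , _ ∷ vs , (σ , σ∈ , refl) , w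

   -- Loops can be cut out of a walk. A walk without repetition has fewer than n steps, which is why
   -- n rounds of `closure` reach the whole orbit.
   simple-walk : ∀ t x vs {y} → Walk t x vs y → ∃ λ ws → Walk t x ws y × Unique (x ∷ ws)
   simple-walk t x [] refl = [] , refl , [] ∷ []
   simple-walk t x (v ∷ vs) (s , w) with simple-walk t v vs w
   ... | ws , w′ , u with x ∈? (v ∷ ws)
   ... | no x∉ = v ∷ ws , (s , w′) , All.tabulate (λ q e → x∉ (subst (_∈ v ∷ ws) (sym e) q)) ∷ u
   ... | yes x∈ = from v ws w′ u x∈
     where
     from : ∀ v ws {y} → Walk t v ws y → Unique (v ∷ ws) → x ∈ v ∷ ws → ∃ λ ws → Walk t x ws y × Unique (x ∷ ws)
     from v ws w u (here refl) = ws , w , u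
     from v (v′ ∷ ws) (_ , w) (_ ∷ u) (there p) = from v′ ws w u p

   orb : Tuple → Fin n → Fin n → Bool
   orb t r y = any (finEqᵇ y) (closure n t [ r ])

   walk-orb : ∀ t r vs {y} → Walk t r vs y → orb t r y ≡ true
   walk-orb t r vs {y} w with simple-walk t r vs w
   ... | ws , w′ , u = any-true (finEqᵇ y) _ (walk-closure n t [ r ] ws (here refl) w′ (ℕP.≤-trans (ℕP.n≤1+n _) (unique-length u))) (finEq-true {i = y} refl)

   orb-walk : ∀ t r {y} → orb t r y ≡ true → ∃ λ vs → Walk t r vs y
   orb-walk t r {y} e with any-true⁻ (finEqᵇ y) (closure n t [ r ]) e
   ... | z , z∈ , eq with refl ← finEq-true⁻ {i = y} {z} eq with closure-walk n t [ r ] z∈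
   ... | _ , here refl , vs , w = vs , w

   orb-r : ∀ t r → orb t r r ≡ true
   orb-r t r = walk-orb t r [] refl

   orb-min : ∀ φ t r {y} → Invariant φ t → orb t r y ≡ true → φ y ≡ φ r
   orb-min φ t r h e = let vs , w = orb-walk t r e in walk-invariant φ t r vs h w

   -- Orbits are formed with the generators alone. A power of σ leads from σ x back to x, which
   -- makes these orbits closed in both directions.
   returns : ∀ {σ : Perm n} → Inj σ → ∀ x → ∃ λ k → iter k (app σ) (app σ x) ≡ x
   returns {σ} inj x with cyclesOf (app σ) (injective inj)
   ... | cs , c , t with merges-∈ {cs = cs} (t x)
   ... | ws , cs′ , p = length ws , sym (iter-suc (length ws) (app σ) x) ∙ chain-iter (app σ) x ws (All.head (cyc (cycles-merges p c)))

   walk-iter : ∀ t {σ} → σ ∈ t → ∀ k x → ∃ λ vs → Walk t x vs (iter k (app σ) x)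
   walk-iter t σ∈ zero x = [] , refl
   walk-iter t {σ} σ∈ (suc k) x = let vs , w = walk-iter t σ∈ k x in vs ++ [ _ ] , walk-++ t x vs w ((σ , σ∈ , refl) , refl)

   orb-invariant : ∀ t r → All Inj t → Invariant (orb t r) t
   orb-invariant t r inj = All.tabulate λ {σ} σ∈ x → bool-ext
     (λ e → let vs , w = orb-walk t r e
                k , eq = returns (All.lookup inj σ∈) x
                ws , w′ = walk-iter t σ∈ k (app σ x)
            in walk-orb t r (vs ++ ws) (walk-++ t r vs w (subst (Walk t (app σ x) ws) eq w′)))
     (λ e → let vs , w = orb-walk t r e in walk-orb t r (vs ++ [ _ ]) (walk-++ t r vs w ((σ , σ∈ , refl) , refl)))

   -- Transitivity is used in the form that every invariant two-valued function is constant; the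
   -- orbit of a point is the test function that shows this suffices.
   transitive-true : ∀ t → All Inj t → (∀ φ → Invariant φ t → ∀ x y → φ x ≡ φ y) → transitiveᵇ t ≡ true
   transitive-true t inj h = all-true _ (allFin n) λ {i} _ → all-true _ (allFin n) λ {j} _ →
     h (orb t i) (orb-invariant t i inj) j i ∙ orb-r t i

   transitive-true⁻ : ∀ t → transitiveᵇ t ≡ true → ∀ φ → Invariant φ t → ∀ x y → φ x ≡ φ y
   transitive-true⁻ t e φ h x y = sym (orb-min φ t x h (all-true⁻ _ (allFin n) (all-true⁻ _ (allFin n) e (∈-allFin x)) (∈-allFin y)))

   inv : Perm n → Fin n → Fin n
   inv σ y with any? (λ x → app σ x ≟ y)
   ... | yes (x , _) = x
   ... | no _ = y

   inv-right : ∀ {σ : Perm n} → Inj σ → ∀ y → app σ (inv σ y) ≡ y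
   inv-right {σ} inj y with any? (λ x → app σ x ≟ y)
   ... | yes (_ , e) = e
   ... | no ne = let k , e = returns inj y in contradiction (iter k (app σ) y , (sym (iter-suc′ k) ∙ e)) ne
     where iter-suc′ : ∀ k → iter k (app σ) (app σ y) ≡ app σ (iter k (app σ) y)
           iter-suc′ k = sym (iter-suc k (app σ) y)

   inv-left : ∀ {σ : Perm n} → Inj σ → ∀ x → inv σ (app σ x) ≡ x
   inv-left {σ} inj x = injective inj (inv-right inj (app σ x))

   swapₚ : Fin n → Fin n → Perm n
   swapₚ i r = tabulate (sw i r)

   app-swap : ∀ i r σ x → app (swapₚ i r ∘ₚ σ) x ≡ sw i r (app σ x)
   app-swap i r σ x = app-∘ (swapₚ i r) σ x ∙ lookup∘tabulate (sw i r) (app σ x)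

   -- ins k i r t multiplies the product of t on the left by the transposition (i r), by changing factor k only:
   -- moving (i r) past the first k factors, which fix r, conjugates it to (i′ r).
   ins : ℕ → Fin n → Fin n → Tuple → Tuple
   ins k i r [] = []
   ins zero i r (σ ∷ t) = (swapₚ i r ∘ₚ σ) ∷ t
   ins (suc k) i r (σ ∷ t) = σ ∷ ins k (inv σ i) r t

   -- The image of r under the product of the first k + 1 factors. When the first k fix r, this is
   -- the point i of the transposition (i r) to be split off.
   key : ℕ → Fin n → Tuple → Fin n
   key k r [] = r
   key zero r (σ ∷ t) = app σ r
   key (suc k) r (σ ∷ t) = app σ (key k r t)

   FixFirst : ℕ → Fin n → Tuple → Set
   FixFirst zero r t = ⊤
   FixFirst (suc k) r [] = ⊤
   FixFirst (suc k) r (σ ∷ t) = app σ r ≡ r × FixFirst k r t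

   SupportedOn : List (Fin n) → Tuple → Set
   SupportedOn S = All (λ σ → ∀ {x} → x ∉ S → app σ x ≡ x)

   deficiencies : Tuple → ℕ
   deficiencies t = sum (map deficiency t)

   length-ins : ∀ k i r t → length (ins k i r t) ≡ length t
   length-ins k i r [] = refl
   length-ins zero i r (σ ∷ t) = refl
   length-ins (suc k) i r (σ ∷ t) = cong suc (length-ins k (inv σ i) r t)

   ins-ins : ∀ k i r t → ins k i r (ins k i r t) ≡ t
   ins-ins k i r [] = refl
   ins-ins zero i r (σ ∷ t) = cong (_∷ t) (perm-ext λ x → app-swap i r (swapₚ i r ∘ₚ σ) x ∙ (cong (sw i r) (app-swap i r σ x) ∙ sw-sw i r (app σ x)))
   ins-ins (suc k) i r (σ ∷ t) = cong (σ ∷_) (ins-ins k (inv σ i) r t)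

   swap-inj : ∀ i r {σ} → Inj σ → Inj (swapₚ i r ∘ₚ σ)
   swap-inj i r {σ} inj = mkInj λ {x} {y} e → injective inj (sw-inj i r (sym (app-swap i r σ x) ∙ (e ∙ app-swap i r σ y)))

   ins-inj : ∀ k i r t → All Inj t → All Inj (ins k i r t)
   ins-inj k i r [] [] = []
   ins-inj zero i r (σ ∷ t) (p ∷ ps) = swap-inj i r p ∷ ps
   ins-inj (suc k) i r (σ ∷ t) (p ∷ ps) = p ∷ ins-inj k (inv σ i) r t ps

   sw-conj : ∀ {σ : Perm n} → Inj σ → ∀ i r → app σ r ≡ r → ∀ y → app σ (sw i r y) ≡ sw (app σ i) r (app σ y)
   sw-conj {σ} inj i r e y with y ≟ i
   ... | yes refl = e ∙ sym (sw-i (app σ i) r)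
   ... | no y≢i with y ≟ r
   ... | yes refl = sym (cong (sw (app σ i) r) e ∙ sw-r (app σ i) r)
   ... | no y≢r = sym (sw-≢ (app σ i) r (app σ y) (λ q → y≢i (injective inj q)) (λ q → y≢r (injective inj (q ∙ sym e))))

   prod-ins : ∀ k i r t → All Inj t → FixFirst k r t → k < length t → ∀ x → app (prodₚ (ins k i r t)) x ≡ sw i r (app (prodₚ t) x)
   prod-ins zero i r (σ ∷ t) _ _ _ x = app-∘ (swapₚ i r ∘ₚ σ) (prodₚ t) x ∙ (app-swap i r σ (app (prodₚ t) x) ∙ cong (sw i r) (sym (app-∘ σ (prodₚ t) x)))
   prod-ins (suc k) i r (σ ∷ t) (p ∷ ps) (e , f) (s≤s l) x = app-∘ σ (prodₚ (ins k (inv σ i) r t)) x ∙ (cong (app σ) (prod-ins k (inv σ i) r t ps f l x)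
     ∙ (sw-conj p (inv σ i) r e (app (prodₚ t) x) ∙ (cong (λ u → sw u r (app σ (app (prodₚ t) x))) (inv-right p i) ∙ cong (sw i r) (sym (app-∘ σ (prodₚ t) x)))))

   key-ins : ∀ k i r t → All Inj t → FixFirst (suc k) r t → k < length t → key k r (ins k i r t) ≡ i
   key-ins zero i r (σ ∷ t) _ (e , _) _ = app-swap i r σ r ∙ (cong (sw i r) e ∙ sw-r i r)
   key-ins (suc k) i r (σ ∷ t) (p ∷ ps) (_ , f) (s≤s l) = cong (app σ) (key-ins k (inv σ i) r t ps f l) ∙ inv-right p i

   key-fixed : ∀ k r t → FixFirst (suc k) r t → key k r t ≡ r
   key-fixed k r [] _ = refl
   key-fixed zero r (σ ∷ t) (e , _) = e
   key-fixed (suc k) r (σ ∷ t) (e , f) = cong (app σ) (key-fixed k r t f) ∙ e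

   key-fixed⁻ : ∀ k r t → All Inj t → FixFirst k r t → key k r t ≡ r → FixFirst (suc k) r t
   key-fixed⁻ k r [] _ _ _ = tt
   key-fixed⁻ zero r (σ ∷ t) _ _ e = e , tt
   key-fixed⁻ (suc k) r (σ ∷ t) (p ∷ ps) (f , fs) e = f , key-fixed⁻ k r t ps fs (injective p (e ∙ sym f))

   -- The transposition with the key undoes the displacement of r by factor k, so one more factor
   -- fixes r.
   fix-ins-key : ∀ k r t → All Inj t → FixFirst k r t → FixFirst (suc k) r (ins k (key k r t) r t)
   fix-ins-key k r [] _ _ = tt
   fix-ins-key zero r (σ ∷ t) _ _ = (app-swap (app σ r) r σ r ∙ sw-i (app σ r) r) , tt
   fix-ins-key (suc k) r (σ ∷ t) (p ∷ ps) (f , fs) = f , subst (λ i → FixFirst (suc k) r (ins k i r t)) (sym (inv-left p (key k r t))) (fix-ins-key k r t ps fs)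

   fix-ins : ∀ k i r t → FixFirst (suc k) r t → FixFirst k r (ins k i r t)
   fix-ins k i r [] _ = weaken k
     where weaken : ∀ k → FixFirst k r []
           weaken zero = tt
           weaken (suc k) = tt
   fix-ins zero i r (σ ∷ t) _ = tt
   fix-ins (suc k) i r (σ ∷ t) (f , fs) = f , fix-ins k (inv σ i) r t fs

   fix-weaken : ∀ k r t → FixFirst (suc k) r t → FixFirst k r t
   fix-weaken zero r t _ = tt
   fix-weaken (suc k) r [] _ = tt
   fix-weaken (suc k) r (σ ∷ t) (f , fs) = f , fix-weaken k r t fs

   -- The fixed point r is absorbed into the cycle of i, which lowers the number of cycles by one.
   deficiency-swap : ∀ {σ} i r → Inj σ → app σ r ≡ r → i ≢ r → deficiency (swapₚ i r ∘ₚ σ) ≡ suc (deficiency σ)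
   deficiency-swap {σ} i r inj e i≢r with cyclesOf (app σ) (injective inj)
   ... | cs , c , t with merges-∈ {cs = cs} (t r)
   ... | b ∷ ws , cs′ , p = contradiction (sym e ∙ proj₁ (All.head (cyc (cycles-merges p c)))) λ { refl → Unique[x∷xs]⇒x∉xs (uniq (cycles-merges p c)) (here refl) }
   ... | [] , cs′ , p with ∈-resp-↭ (proj₁ (merges-↭ cs p)) (t i)
   ... | here q = contradiction q i≢r
   ... | there i∈ with merges-∈ {cs = cs′} i∈
   ... | ws , ds , q = deficiency-cycles (swapₚ i r ∘ₚ σ) (cycles-merge {xs = []} (app-swap i r σ) c₂) ∙ cong suc (sym (deficiency-cycles σ c₂))
     where
     c₁ = cycles-merges p c
     c₂ : Cycles (app σ) ([ r ] ∷ (i ∷ ws) ∷ ds)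
     c₂ with merges-sound cs′ q
     ... | ys , zs , refl , s = cycles-swap (cycles-rotate {ys = ys} (cycles-swap (cycles-↭ (prep [ r ] s) c₁)))
       where cycles-swap : ∀ {a b ds} → Cycles (app σ) (a ∷ b ∷ ds) → Cycles (app σ) (b ∷ a ∷ ds)
             cycles-swap = cycles-↭ (swap _ _ ↭-refl)

   deficiencies-ins : ∀ k i r t → All Inj t → FixFirst (suc k) r t → k < length t → i ≢ r → deficiencies (ins k i r t) ≡ suc (deficiencies t)
   deficiencies-ins zero i r (σ ∷ t) (p ∷ _) (e , _) _ i≢r = cong (_+ deficiencies t) (deficiency-swap i r p e i≢r)
   deficiencies-ins (suc k) i r (σ ∷ t) (p ∷ ps) (e , f) (s≤s l) i≢r =
     cong (deficiency σ +_) (deficiencies-ins k (inv σ i) r t ps f l (λ q → i≢r (sym (inv-right p i) ∙ (cong (app σ) q ∙ e)))) ∙ ℕP.+-suc (deficiency σ) (deficiencies t)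

   sw-invariant : ∀ (φ : Fin n → Bool) i r → φ i ≡ φ r → ∀ y → φ (sw i r y) ≡ φ y
   sw-invariant φ i r e y with y ≟ i
   ... | yes refl = sym e
   ... | no _ with y ≟ r
   ... | yes refl = e
   ... | no _ = refl

   -- The altered factor maps r to a conjugate of i, and so forces equal values at i and r; given
   -- that, removing the transposition preserves invariance.
   ins-invariant⁻ : ∀ φ k i r t → All Inj t → FixFirst (suc k) r t → k < length t → Invariant φ (ins k i r t) → Invariant φ t × φ i ≡ φ r
   ins-invariant⁻ φ zero i r (σ ∷ t) _ (e , _) _ (h ∷ hs) = ((λ x → sym (sw-invariant φ i r ir (app σ x)) ∙ (cong φ (sym (app-swap i r σ x)) ∙ h x)) ∷ hs) , ir
     where ir : φ i ≡ φ r
           ir = cong φ (sym (app-swap i r σ r ∙ (cong (sw i r) e ∙ sw-r i r))) ∙ h r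
   ins-invariant⁻ φ (suc k) i r (σ ∷ t) (p ∷ ps) (e , f) (s≤s l) (h ∷ hs) with ins-invariant⁻ φ k (inv σ i) r t ps f l hs
   ... | hs′ , ir = (h ∷ hs′) , (cong φ (sym (inv-right p i)) ∙ (h (inv σ i) ∙ ir))

   ins-invariant : ∀ φ k i r t → All Inj t → FixFirst (suc k) r t → Invariant φ t → φ i ≡ φ r → Invariant φ (ins k i r t)
   ins-invariant φ k i r [] _ _ _ _ = []
   ins-invariant φ zero i r (σ ∷ t) _ _ (h ∷ hs) ir = (λ x → cong φ (app-swap i r σ x) ∙ (sw-invariant φ i r ir (app σ x) ∙ h x)) ∷ hs
   ins-invariant φ (suc k) i r (σ ∷ t) (p ∷ ps) (e , f) (h ∷ hs) ir = h ∷ ins-invariant φ k (inv σ i) r t ps f hs (sym (h (inv σ i)) ∙ (cong φ (inv-right p i) ∙ ir))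

   ins-supported : ∀ S k i r t → All Inj t → SupportedOn S t → r ∈ S → i ∈ S → SupportedOn S (ins k i r t)
   ins-supported S k i r [] _ _ _ _ = []
   ins-supported S zero i r (σ ∷ t) _ (s ∷ ss) r∈ i∈ = (λ {x} x∉ → app-swap i r σ x ∙ (cong (sw i r) (s x∉) ∙ sw-≢ i r x (λ { refl → x∉ i∈ }) (λ { refl → x∉ r∈ }))) ∷ ss
   ins-supported S (suc k) i r (σ ∷ t) (p ∷ ps) (s ∷ ss) r∈ i∈ = s ∷ ins-supported S k (inv σ i) r t ps ss r∈ inv∈
     where inv∈ : inv σ i ∈ S
           inv∈ with inv σ i ∈? S
           ... | yes q = q
           ... | no q = subst (_∈ S) (sym (inv-right p i) ∙ s q) i∈

   supported-∈ : ∀ S {σ : Perm n} → Inj σ → (∀ {x} → x ∉ S → app σ x ≡ x) → ∀ {x} → x ∈ S → app σ x ∈ S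
   supported-∈ S {σ} inj s {x} x∈ with app σ x ∈? S
   ... | yes q = q
   ... | no q = contradiction (subst (_∈ S) (sym (injective inj (s q))) x∈) q

   key-∈ : ∀ S k r t → All Inj t → SupportedOn S t → r ∈ S → key k r t ∈ S
   key-∈ S k r [] _ _ r∈ = r∈
   key-∈ S zero r (σ ∷ t) (p ∷ _) (s ∷ _) r∈ = supported-∈ S p s r∈
   key-∈ S (suc k) r (σ ∷ t) (p ∷ ps) (s ∷ ss) r∈ = supported-∈ S p s (key-∈ S k r t ps ss r∈)

   restrictₚ : (Fin n → Bool) → Perm n → Perm n
   restrictₚ φ σ = tabulate (restrictF φ (app σ))

   app-restrict : ∀ φ σ x → app (restrictₚ φ σ) x ≡ restrictF φ (app σ) x
   app-restrict φ σ x = lookup∘tabulate (restrictF φ (app σ)) x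

   restrict-in : ∀ φ σ {x} → φ x ≡ true → app (restrictₚ φ σ) x ≡ app σ x
   restrict-in φ σ {x} e = app-restrict φ σ x ∙ cong (λ b → if b then app σ x else x) e

   restrict-out : ∀ φ σ {x} → φ x ≡ false → app (restrictₚ φ σ) x ≡ x
   restrict-out φ σ {x} e = app-restrict φ σ x ∙ cong (λ b → if b then app σ x else x) e

   restrict : (Fin n → Bool) → Tuple → Tuple
   restrict φ = map (restrictₚ φ)

   prod-invariant : ∀ φ t → Invariant φ t → ∀ x → φ (app (prodₚ t) x) ≡ φ x
   prod-invariant φ [] [] x = cong φ (lookup∘tabulate (λ x → x) x)
   prod-invariant φ (σ ∷ t) (h ∷ hs) x = cong φ (app-∘ σ (prodₚ t) x) ∙ (h (app (prodₚ t) x) ∙ prod-invariant φ t hs x)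

   prod-restrict : ∀ φ t → Invariant φ t → ∀ x → app (prodₚ (restrict φ t)) x ≡ restrictF φ (app (prodₚ t)) x
   prod-restrict φ t h x with φ x in e
   ... | true = go t h
     where go : ∀ t → Invariant φ t → app (prodₚ (restrict φ t)) x ≡ app (prodₚ t) x
           go [] [] = refl
           go (σ ∷ t) (h ∷ hs) = app-∘ (restrictₚ φ σ) (prodₚ (restrict φ t)) x ∙ (cong (app (restrictₚ φ σ)) (go t hs) ∙ (restrict-in φ σ (prod-invariant φ t hs x ∙ e) ∙ sym (app-∘ σ (prodₚ t) x)))
   ... | false = go t
     where go : ∀ t → app (prodₚ (restrict φ t)) x ≡ x
           go [] = lookup∘tabulate (λ x → x) x
           go (σ ∷ t) = app-∘ (restrictₚ φ σ) (prodₚ (restrict φ t)) x ∙ (cong (app (restrictₚ φ σ)) (go t) ∙ restrict-out φ σ e)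

   restrict-inj : ∀ φ {σ : Perm n} → Inj σ → InvariantUnder φ σ → Inj (restrictₚ φ σ)
   restrict-inj φ {σ} inj h = mkInj λ {x} {y} → go x y
    where
    go : ∀ x y → app (restrictₚ φ σ) x ≡ app (restrictₚ φ σ) y → x ≡ y
    go x y e with bool-cases (φ x) | bool-cases (φ y)
    ... | inj₁ a | inj₁ b = injective inj (sym (restrict-in φ σ a) ∙ (e ∙ restrict-in φ σ b))
    ... | inj₂ a | inj₂ b = sym (restrict-out φ σ a) ∙ (e ∙ restrict-out φ σ b)
    ... | inj₁ a | inj₂ b = ⊥-elim (true≢false (sym (cong φ (sym (restrict-in φ σ a) ∙ (e ∙ restrict-out φ σ b))) ∙ (h x ∙ a)) b)
    ... | inj₂ a | inj₁ b = ⊥-elim (true≢false (cong φ (sym (restrict-out φ σ a) ∙ (e ∙ restrict-in φ σ b)) ∙ (h y ∙ b)) a)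

   restrict-All-inj : ∀ φ t → All Inj t → Invariant φ t → All Inj (restrict φ t)
   restrict-All-inj φ [] [] [] = []
   restrict-All-inj φ (σ ∷ t) (p ∷ ps) (h ∷ hs) = restrict-inj φ p h ∷ restrict-All-inj φ t ps hs

   not-invariant : ∀ φ t → Invariant φ t → Invariant (not ∘ φ) t
   not-invariant φ t = All.map (λ h x → cong not (h x))

   -- An invariant set is a union of cycles, and the excess is a sum over cycles.
   deficiency-restrict : ∀ φ {σ : Perm n} → Inj σ → InvariantUnder φ σ → deficiency σ ≡ deficiency (restrictₚ φ σ) + deficiency (restrictₚ (not ∘ φ) σ)
   deficiency-restrict φ {σ} inj h with cyclesOf (app σ) (injective inj)
   ... | cs , c , t = deficiency-cycles σ c ∙ (excess-select (app σ) φ cs (cyc c) ∙ sym (cong₂ _+_ (part φ h) (part (not ∘ φ) (λ x → cong not (h x)))))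
     where part : ∀ ψ → InvariantUnder ψ σ → deficiency (restrictₚ ψ σ) ≡ excess (select ψ cs)
           part ψ h = deficiency-cycles (restrictₚ ψ σ) (cycles-ext (λ x → sym (app-restrict ψ σ x)) (cycles-restrict ψ (app σ) h c))

   deficiencies-restrict : ∀ φ t → All Inj t → Invariant φ t → deficiencies t ≡ deficiencies (restrict φ t) + deficiencies (restrict (not ∘ φ) t)
   deficiencies-restrict φ [] [] [] = refl
   deficiencies-restrict φ (σ ∷ t) (p ∷ ps) (h ∷ hs) = cong₂ _+_ (deficiency-restrict φ p h) (deficiencies-restrict φ t ps hs) ∙
     inter (deficiency (restrictₚ φ σ)) (deficiency (restrictₚ (not ∘ φ) σ)) (deficiencies (restrict φ t)) _
     where inter : ∀ a b c d → (a + b) + (c + d) ≡ (a + c) + (b + d)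
           inter a b c d = ℕP.+-assoc a b (c + d) ∙ (cong (a +_) (sym (ℕP.+-assoc b c d) ∙ (cong (_+ d) (ℕP.+-comm b c) ∙ ℕP.+-assoc c b d)) ∙ sym (ℕP.+-assoc a c (b + d)))

   restrict-invariant : ∀ φ ψ t → Invariant ψ t → Invariant ψ (restrict φ t)
   restrict-invariant φ ψ [] [] = []
   restrict-invariant φ ψ (σ ∷ t) (h ∷ hs) = go ∷ restrict-invariant φ ψ t hs
     where go : InvariantUnder ψ (restrictₚ φ σ)
           go x with bool-cases (φ x)
           ... | inj₁ a = cong ψ (restrict-in φ σ a) ∙ h x
           ... | inj₂ a = cong ψ (restrict-out φ σ a)

   glue : Tuple → Tuple → Tuple
   glue = zipWith _∘ₚ_

   glue-restrict : ∀ φ t → Invariant φ t → glue (restrict φ t) (restrict (not ∘ φ) t) ≡ t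
   glue-restrict φ [] [] = refl
   glue-restrict φ (σ ∷ t) (h ∷ hs) = cong₂ _∷_ (perm-ext go) (glue-restrict φ t hs)
     where go : ∀ x → app (restrictₚ φ σ ∘ₚ restrictₚ (not ∘ φ) σ) x ≡ app σ x
           go x with bool-cases (φ x)
           ... | inj₁ a = app-∘ (restrictₚ φ σ) (restrictₚ (not ∘ φ) σ) x ∙ (cong (app (restrictₚ φ σ)) (restrict-out (not ∘ φ) σ (cong not a)) ∙ restrict-in φ σ a)
           ... | inj₂ a = app-∘ (restrictₚ φ σ) (restrictₚ (not ∘ φ) σ) x ∙ (cong (app (restrictₚ φ σ)) (restrict-in (not ∘ φ) σ (cong not a)) ∙ restrict-out φ σ (h x ∙ a))

   SupportedIn : (Fin n → Bool) → Tuple → Set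
   SupportedIn φ = All (λ σ → ∀ {x} → φ x ≡ false → app σ x ≡ x)

   -- A point of the set cannot be sent outside: its image would be fixed, and injectivity would
   -- make it equal to the point.
   supported-invariant : ∀ φ {σ : Perm n} → Inj σ → (∀ {x} → φ x ≡ false → app σ x ≡ x) → InvariantUnder φ σ
   supported-invariant φ {σ} inj s x with bool-cases (φ x) | bool-cases (φ (app σ x))
   ... | inj₂ a | _ = cong φ (s a)
   ... | inj₁ a | inj₁ b = b ∙ sym a
   ... | inj₁ a | inj₂ b = cong φ (injective inj (s b))

   module _ (φ : Fin n → Bool) where
     private
       not-supported : ∀ {σ : Perm n} → Inj σ → (∀ {x} → not (φ x) ≡ false → app σ x ≡ x) → InvariantUnder φ σ
       not-supported inj s x = not-injective (supported-invariant (not ∘ φ) inj s x)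

     glue-inj : ∀ tB tC → All Inj tB → All Inj tC → All Inj (glue tB tC)
     glue-inj [] _ _ _ = []
     glue-inj (σ ∷ tB) [] _ _ = []
     glue-inj (σ ∷ tB) (τ ∷ tC) (p ∷ ps) (q ∷ qs) = mkInj (λ {x} {y} e → injective q (injective p (sym (app-∘ σ τ x) ∙ (e ∙ app-∘ σ τ y)))) ∷ glue-inj tB tC ps qs

     glue-invariant : ∀ ψ tB tC → Invariant ψ tB → Invariant ψ tC → Invariant ψ (glue tB tC)
     glue-invariant ψ [] _ _ _ = []
     glue-invariant ψ (σ ∷ tB) [] _ _ = []
     glue-invariant ψ (σ ∷ tB) (τ ∷ tC) (h ∷ hs) (g ∷ gs) = (λ x → cong ψ (app-∘ σ τ x) ∙ (h (app τ x) ∙ g x)) ∷ glue-invariant ψ tB tC hs gs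

     invariant-B : ∀ tB → All Inj tB → SupportedIn φ tB → Invariant φ tB
     invariant-B [] [] [] = []
     invariant-B (σ ∷ tB) (p ∷ ps) (s ∷ ss) = supported-invariant φ p s ∷ invariant-B tB ps ss

     invariant-C : ∀ tC → All Inj tC → SupportedIn (not ∘ φ) tC → Invariant φ tC
     invariant-C [] [] [] = []
     invariant-C (σ ∷ tC) (p ∷ ps) (s ∷ ss) = not-supported {σ} p s ∷ invariant-C tC ps ss

     restrict-glue-B : ∀ tB tC → length tB ≡ length tC → All Inj tC → SupportedIn φ tB → SupportedIn (not ∘ φ) tC → restrict φ (glue tB tC) ≡ tB
     restrict-glue-B [] [] _ _ _ _ = refl
     restrict-glue-B (σ ∷ tB) (τ ∷ tC) l (q ∷ qs) (s ∷ ss) (r ∷ rs) = cong₂ _∷_ (perm-ext go) (restrict-glue-B tB tC (ℕP.suc-injective l) qs ss rs)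
       where go : ∀ x → app (restrictₚ φ (σ ∘ₚ τ)) x ≡ app σ x
             go x with bool-cases (φ x)
             ... | inj₁ a = restrict-in φ (σ ∘ₚ τ) a ∙ (app-∘ σ τ x ∙ cong (app σ) (r (cong not a)))
             ... | inj₂ a = restrict-out φ (σ ∘ₚ τ) a ∙ sym (s a)

     restrict-glue-C : ∀ tB tC → length tB ≡ length tC → All Inj tC → SupportedIn φ tB → SupportedIn (not ∘ φ) tC → restrict (not ∘ φ) (glue tB tC) ≡ tC
     restrict-glue-C [] [] _ _ _ _ = refl
     restrict-glue-C (σ ∷ tB) (τ ∷ tC) l (q ∷ qs) (s ∷ ss) (r ∷ rs) = cong₂ _∷_ (perm-ext go) (restrict-glue-C tB tC (ℕP.suc-injective l) qs ss rs)
       where go : ∀ x → app (restrictₚ (not ∘ φ) (σ ∘ₚ τ)) x ≡ app τ x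
             go x with bool-cases (φ x)
             ... | inj₁ a = restrict-out (not ∘ φ) (σ ∘ₚ τ) (cong not a) ∙ sym (r (cong not a))
             ... | inj₂ a = restrict-in (not ∘ φ) (σ ∘ₚ τ) (cong not a) ∙ (app-∘ σ τ x ∙ s (not-supported {τ} q r x ∙ a))

     glue-fix : ∀ k r tB tC → φ r ≡ true → SupportedIn (not ∘ φ) tC → FixFirst k r tB → FixFirst k r (glue tB tC)
     glue-fix zero r tB tC _ _ _ = tt
     glue-fix (suc k) r [] tC _ _ _ = tt
     glue-fix (suc k) r (σ ∷ tB) [] _ _ _ = tt
     glue-fix (suc k) r (σ ∷ tB) (τ ∷ tC) e (s ∷ ss) (f , fs) = (app-∘ σ τ r ∙ (cong (app σ) (s (cong not e)) ∙ f)) , glue-fix k r tB tC e ss fs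

     restrict-fix : ∀ k r t → φ r ≡ true → FixFirst k r t → FixFirst k r (restrict φ t)
     restrict-fix zero r t _ _ = tt
     restrict-fix (suc k) r [] _ _ = tt
     restrict-fix (suc k) r (σ ∷ t) e (f , fs) = (restrict-in φ σ e ∙ f) , restrict-fix k r t e fs

   length-glue : ∀ tB tC → length tB ≡ length tC → length (glue tB tC) ≡ length tB
   length-glue [] [] _ = refl
   length-glue (σ ∷ tB) (τ ∷ tC) e = cong suc (length-glue tB tC (ℕP.suc-injective e))

-- The enumeration of minimal tuples: soundness and absence of repetitions

module Tuples where
 open import Defs
 open Recursion using (shuffles; module Count)
 open CycleLists
 open CycleTypes
 open Transitivity
 open import Data.Nat using (ℕ; zero; suc; s≤s; _+_; _<_)
 import Data.Nat.Properties as ℕP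
 open import Data.Nat.Tactic.RingSolver using (solve-∀)
 open import Data.Bool using (Bool; true; false; not; if_then_else_)
 open import Data.List using (List; []; _∷_; [_]; length; map; _++_; concat; concatMap; replicate)
 open import Data.List.Properties using (length-map; length-++; length-replicate; map-id; ++-assoc; concatMap-map; ++-identityʳ)
 open import Data.List.Relation.Unary.All using (All; []; _∷_)
 import Data.List.Relation.Unary.All as All
 import Data.List.Relation.Unary.All.Properties as AllP
 open import Data.List.Relation.Unary.Any using (here; there)
 open import Data.List.Relation.Unary.AllPairs using ([]; _∷_)
 open import Data.List.Relation.Unary.Unique.Propositional using (Unique)
 open import Data.List.Relation.Unary.Unique.Propositional.Properties using (Unique[x∷xs]⇒x∉xs)
 open import Data.List.Membership.Propositional using (_∈_; _∉_)
 open import Data.List.Membership.Propositional.Properties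
 open import Data.List.Relation.Binary.Permutation.Propositional using (_↭_; ↭-refl; ↭-sym; ↭-trans; prep; ↭-reflexive)
 open import Data.List.Relation.Binary.Permutation.Propositional.Properties using (All-resp-↭; ∈-resp-↭; ++⁺ˡ; shifts; ↭-length)
 open import Data.Fin using (Fin)
 open import Data.Vec.Properties using (lookup∘tabulate)
 open import Data.Product using (_×_; _,_; ∃₂; proj₁; proj₂)
 open import Data.Sum using (_⊎_; inj₁; inj₂)
 open import Data.Empty using (⊥)
 open import Data.Unit using (tt)
 open import Function using (_∘_; case_of_)
 open import Relation.Binary.PropositionalEquality hiding ([_]) renaming (trans to _∙_)
 open import Relation.Nullary using (yes; does)
 open import Relation.Nullary.Decidable using (dec-true; dec-false)

 private variable
   A B : Set

 shuffles-↭ : ∀ (cs : List (List A)) {β γ} → (β , γ) ∈ shuffles cs → concat cs ↭ concat β ++ concat γ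
 shuffles-↭ [] (here refl) = ↭-refl
 shuffles-↭ (c ∷ cs) p with ∈-++⁻ (map _ (shuffles cs)) p
 ... | inj₁ q with ∈-map⁻ _ q
 ... | (β , γ) , r , refl = ↭-trans (++⁺ˡ c (shuffles-↭ cs r)) (↭-reflexive (sym (++-assoc c (concat β) (concat γ))))
 shuffles-↭ (c ∷ cs) p | inj₂ q with ∈-map⁻ _ q
 ... | (β , γ) , r , refl = ↭-trans (++⁺ˡ c (shuffles-↭ cs r)) (shifts c (concat β))

 shuffles-length : ∀ (cs : List A) {β γ} → (β , γ) ∈ shuffles cs → length β + length γ ≡ length cs
 shuffles-length [] (here refl) = refl
 shuffles-length (c ∷ cs) p with ∈-++⁻ (map _ (shuffles cs)) p
 ... | inj₁ q with ∈-map⁻ _ q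
 ... | _ , r , refl = cong suc (shuffles-length cs r)
 shuffles-length (c ∷ cs) p | inj₂ q with ∈-map⁻ _ q
 ... | (β , γ) , r , refl = ℕP.+-suc (length β) (length γ) ∙ cong suc (shuffles-length cs r)

 shuffles-All⁺ : ∀ {P : A → Set} (cs : List A) {β γ} → (β , γ) ∈ shuffles cs → All P β → All P γ → All P cs
 shuffles-All⁺ [] (here refl) _ _ = []
 shuffles-All⁺ (c ∷ cs) p a b with ∈-++⁻ (map _ (shuffles cs)) p
 ... | inj₁ q with ∈-map⁻ _ q
 shuffles-All⁺ (c ∷ cs) p (x ∷ a) b | inj₁ q | _ , r , refl = x ∷ shuffles-All⁺ cs r a b
 shuffles-All⁺ (c ∷ cs) p a b | inj₂ q with ∈-map⁻ _ q
 shuffles-All⁺ (c ∷ cs) p a (x ∷ b) | inj₂ q | _ , r , refl = x ∷ shuffles-All⁺ cs r a b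

 -- mark records on which side of the shuffle each item lies.
 unique-shuffles : ∀ (mark : B → A → Bool) (cs : List A) (f : List A × List A → List B) →
   (∀ {p} → p ∈ shuffles cs → Unique (f p)) →
   (∀ {β γ b} → (β , γ) ∈ shuffles cs → b ∈ f (β , γ) → All (λ c → mark b c ≡ true) β × All (λ c → mark b c ≡ false) γ) →
   Unique (concatMap f (shuffles cs))
 unique-shuffles mark [] f u _ = subst Unique (sym (++-identityʳ (f ([] , [])))) (u (here refl))
 unique-shuffles {B = B} {A = A} mark (c ∷ cs) f u h = subst Unique (sym eq) (unique-++
     (unique-shuffles mark cs (f ∘ left) (λ p → u (inl p)) (λ p q → let x , y = h (inl p) q in All.tail x , y))
     (unique-shuffles mark cs (f ∘ right) (λ p → u (inr p)) (λ p q → let x , y = h (inr p) q in x , All.tail y))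
     disjoint)
   where
   left right : List A × List A → List A × List A
   left (β , γ) = c ∷ β , γ
   right (β , γ) = β , c ∷ γ
   inl : ∀ {p} → p ∈ shuffles cs → left p ∈ shuffles (c ∷ cs)
   inl p = ∈-++⁺ˡ (∈-map⁺ left p)
   inr : ∀ {p} → p ∈ shuffles cs → right p ∈ shuffles (c ∷ cs)
   inr p = ∈-++⁺ʳ (map left (shuffles cs)) (∈-map⁺ right p)
   concatMap-++ : ∀ {X : Set} (f : X → List B) xs ys → concatMap f (xs ++ ys) ≡ concatMap f xs ++ concatMap f ys
   concatMap-++ f [] ys = refl
   concatMap-++ f (x ∷ xs) ys = cong (f x ++_) (concatMap-++ f xs ys) ∙ sym (++-assoc (f x) _ _)
   eq : concatMap f (shuffles (c ∷ cs)) ≡ concatMap (f ∘ left) (shuffles cs) ++ concatMap (f ∘ right) (shuffles cs)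
   eq = concatMap-++ f (map left (shuffles cs)) (map right (shuffles cs)) ∙ cong₂ _++_ (concatMap-map f left (shuffles cs)) (concatMap-map f right (shuffles cs))
   disjoint : ∀ {b} → b ∈ concatMap (f ∘ left) (shuffles cs) → b ∈ concatMap (f ∘ right) (shuffles cs) → ⊥
   disjoint p q with ∈-concatMap-inv (f ∘ left) p | ∈-concatMap-inv (f ∘ right) q
   ... | (β , γ) , p₁ , p₂ | (β′ , γ′) , q₁ , q₂ = true≢false (All.head (proj₁ (h (inl p₁) p₂))) (All.head (proj₂ (h (inr q₁) q₂)))

 module Enumeration {n : ℕ} (m : ℕ) where
   open Count m

   private
     Enumerator : Set
     Enumerator = List (Fin n) → List (List (Fin n)) → List (List (Perm n))

     mergeWith : ℕ → Fin n → List (Fin n) → Enumerator → Fin n × List (Fin n) × List (List (Fin n)) → List (List (Perm n))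
     mergeWith k r xs E (i , ws , cs′) = map (ins k i r) (E (xs ++ i ∷ ws) cs′)

     glueWith : Enumerator → Enumerator → List (Fin n) → List (Fin n) → List (List (Fin n)) × List (List (Fin n)) → List (List (Perm n))
     glueWith EB EC ys zs (β , γ) = concatMap (λ tB → map (glue tB) (EC zs γ)) (EB ys β)

     splitWith : ℕ → Fin n → List (List (Fin n)) → Enumerator → (Fin n → Enumerator) → List (Fin n) × Fin n × List (Fin n) → List (List (Perm n))
     splitWith k r cs EB EC (ys , i , zs) = map (ins k i r) (concatMap (glueWith EB (EC i) ys zs) (shuffles cs))

   -- The minimal transitive m-tuples with given product: the product has cycles (r ∷ xs) ∷ cs and fixes all other
   -- points, and the first k factors fix r. N is fuel, and k + j = m.
   en : ℕ → ℕ → ℕ → Fin n → List (Fin n) → List (List (Fin n)) → List (List (Perm n))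
   en N k zero r [] [] = [ replicate m idₚ ]
   en N k zero r _ _ = []
   en zero k (suc j) r xs cs = []
   en (suc N) k (suc j) r xs cs = en (suc N) (suc k) j r xs cs
     ++ (concatMap (mergeWith k r xs (en (suc N) (suc k) j r)) (merges cs)
     ++ concatMap (splitWith k r cs (en (suc N) (suc k) j r) (en N 0 m)) (splitsOf xs))

   mergeBlock : ℕ → ℕ → ℕ → Fin n → List (Fin n) → Fin n × List (Fin n) × List (List (Fin n)) → List (List (Perm n))
   mergeBlock N k j r xs = mergeWith k r xs (en (suc N) (suc k) j r)

   splitBlock : ℕ → ℕ → ℕ → Fin n → List (List (Fin n)) → List (Fin n) × Fin n × List (Fin n) → List (List (Perm n))
   splitBlock N k j r cs = splitWith k r cs (en (suc N) (suc k) j r) (en N 0 m)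

   glueBlock : ℕ → ℕ → ℕ → Fin n → List (Fin n) → Fin n → List (Fin n) → List (List (Fin n)) × List (List (Fin n)) → List (List (Perm n))
   glueBlock N k j r ys i zs = glueWith (en (suc N) (suc k) j r) (en N 0 m i) ys zs

   points : Fin n → List (Fin n) → List (List (Fin n)) → List (Fin n)
   points r xs cs = concat ((r ∷ xs) ∷ cs)

   -- Support and connectedness refer to the listed points instead of all of `Fin n`, so that the
   -- two pieces of a tuple that falls apart are again of this kind.
   record Factorisation (k : ℕ) (r : Fin n) (xs : List (Fin n)) (cs : List (List (Fin n))) (t : List (Perm n)) : Set where
     field
       len : length t ≡ m
       inj : All Inj t
       supp : SupportedOn (points r xs cs) t
       fix : FixFirst k r t
       prod : Cycles (app (prodₚ t)) ((r ∷ xs) ∷ cs)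
       conn : ∀ φ → Invariant φ t → ∀ {y} → y ∈ points r xs cs → φ y ≡ φ r

   -- The number of points plus the number of cycles of the product. Minimality, with deficiencies
   -- summing to n + l - 2, is the Riemann-Hurwitz formula in genus 0; the 2 is moved across to
   -- avoid subtraction.
   bound : Fin n → List (Fin n) → List (List (Fin n)) → ℕ
   bound r xs cs = length (points r xs cs) + suc (length cs)

   Minimal : ℕ → Fin n → List (Fin n) → List (List (Fin n)) → List (Perm n) → Set
   Minimal k r xs cs t = Factorisation k r xs cs t × deficiencies t + 2 ≡ bound r xs cs

   points-split : ∀ r ys i zs cs {β γ} → (β , γ) ∈ shuffles cs → points r (ys ++ i ∷ zs) cs ↭ points r ys β ++ points i zs γ
   points-split r ys i zs cs {β} {γ} p = prep r (↭-trans (↭-reflexive (++-assoc ys (i ∷ zs) (concat cs)))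
     (↭-trans (++⁺ˡ ys (↭-trans (++⁺ˡ (i ∷ zs) (shuffles-↭ cs p)) (shifts (i ∷ zs) (concat β)))) (↭-reflexive (sym (++-assoc ys (concat β) ((i ∷ zs) ++ concat γ))))))

   points-merge : ∀ r xs cs {i ws cs′} → (i , ws , cs′) ∈ merges cs → points r xs cs ↭ points r (xs ++ i ∷ ws) cs′
   points-merge r xs cs {i} {ws} {cs′} p = prep r (↭-trans (++⁺ˡ xs (proj₁ (merges-↭ cs p))) (↭-reflexive (sym (++-assoc xs (i ∷ ws) (concat cs′)))))

   merges-length : ∀ (cs : List (List (Fin n))) {i ws cs′} → (i , ws , cs′) ∈ merges cs → length cs ≡ suc (length cs′)
   merges-length cs {cs′ = cs′} p = sym (length-map length cs) ∙ (↭-length (proj₂ (merges-↭ cs p)) ∙ cong suc (length-map length cs′))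

   chain-agree : ∀ (f g : Fin n → Fin n) a xs {z} → (∀ {x} → x ∈ a ∷ xs → f x ≡ g x) → Chain f a xs z → Chain g a xs z
   chain-agree f g a [] e p = sym (e (here refl)) ∙ p
   chain-agree f g a (x ∷ xs) e (p , c) = (sym (e (here refl)) ∙ p) , chain-agree f g x xs (λ q → e (there q)) c

   cyc-agree : ∀ (f g : Fin n → Fin n) cs → (∀ {x} → x ∈ concat cs → f x ≡ g x) → All (Cyc f) cs → All (Cyc g) cs
   cyc-agree f g [] e [] = []
   cyc-agree f g ((x ∷ xs) ∷ cs) e (p ∷ ps) = chain-agree f g x xs (λ q → e (∈-++⁺ˡ q)) p ∷ cyc-agree f g cs (λ q → e (∈-++⁺ʳ (x ∷ xs) q)) ps

   cycles-unmerges : ∀ {f : Fin n → Fin n} {a cs i ws cs′} → (i , ws , cs′) ∈ merges cs → Cycles f (a ∷ (i ∷ ws) ∷ cs′) → Cycles f (a ∷ cs)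
   cycles-unmerges {f} {a} {cs} {i} p (cycles (pa ∷ pi ∷ ps) u x) with merges-sound cs p
   ... | ys , zs , refl , q = cycles (pa ∷ All-resp-↭ (↭-sym q) (back ys pi ∷ ps)) (Unique-↭ (↭-sym e) u) (λ z → x (λ y → z (∈-resp-↭ (↭-sym e) y)))
     where
     e = ++⁺ˡ a (proj₁ (merges-↭ cs p))
     back : ∀ ys → Cyc f (i ∷ zs ++ ys) → Cyc f (ys ++ i ∷ zs)
     back [] c = subst (λ l → Chain f i l i) (++-identityʳ zs) c
     back (y ∷ ys) c = rotate f (i ∷ zs) c

   cycles-domerges : ∀ {f : Fin n → Fin n} {a cs i ws cs′} → (i , ws , cs′) ∈ merges cs → Cycles f (a ∷ cs) → Cycles f (a ∷ (i ∷ ws) ∷ cs′)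
   cycles-domerges {f} {a} {cs} {i} p (cycles (pa ∷ ps) u x) with merges-sound cs p
   ... | ys , zs , refl , q = cycles (pa ∷ rot (All-resp-↭ q ps)) (Unique-↭ e u) (λ z → x (λ y → z (∈-resp-↭ e y)))
     where
     e = ++⁺ˡ a (proj₁ (merges-↭ cs p))
     rot : ∀ {cs′} → All (Cyc f) ((ys ++ i ∷ zs) ∷ cs′) → All (Cyc f) ((i ∷ zs ++ ys) ∷ cs′)
     rot (c ∷ cs) = rotate f ys c ∷ cs

   indicator : List (Fin n) → Fin n → Bool
   indicator S x = does (x ∈? S)

   indicator-true : ∀ {S x} → x ∈ S → indicator S x ≡ true
   indicator-true {S} {x} p = dec-true (x ∈? S) p

   indicator-true⁻ : ∀ {S x} → indicator S x ≡ true → x ∈ S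
   indicator-true⁻ {S} {x} e with x ∈? S
   ... | yes p = p

   indicator-false⁻ : ∀ {S x} → indicator S x ≡ false → x ∉ S
   indicator-false⁻ {S} {x} e p = true≢false (indicator-true p) e

   not-false⁻ : ∀ {b} → not b ≡ false → b ≡ true
   not-false⁻ {true} _ = refl

   deficiencies-replicate : ∀ k → deficiencies {n} (replicate k idₚ) ≡ 0
   deficiencies-replicate zero = refl
   deficiencies-replicate (suc k) = cong₂ _+_ (deficiency-cycles (idₚ {n}) {[]} (cycles [] [] (λ {x} _ → lookup∘tabulate (λ x → x) x))) (deficiencies-replicate k)

   private
     id-app : ∀ x → app (idₚ {n}) x ≡ x
     id-app x = lookup∘tabulate (λ x → x) x

     prod-id : ∀ k x → app (prodₚ {n} (replicate k idₚ)) x ≡ x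
     prod-id zero x = id-app x
     prod-id (suc k) x = app-∘ idₚ (prodₚ (replicate k idₚ)) x ∙ (id-app _ ∙ prod-id k x)

     fix-id : ∀ k l r → FixFirst {n} k r (replicate l idₚ)
     fix-id zero l r = tt
     fix-id (suc k) zero r = tt
     fix-id (suc k) (suc l) r = id-app r , fix-id k l r

   base-minimal : ∀ k r → Minimal k r [] [] (replicate m idₚ)
   base-minimal k r = record
     { len = length-replicate m
     ; inj = AllP.replicate⁺ m (mkInj λ {x} {y} e → sym (id-app x) ∙ (e ∙ id-app y))
     ; supp = AllP.replicate⁺ m (λ {x} _ → id-app x)
     ; fix = fix-id k m r
     ; prod = cycles (prod-id m r ∷ []) ([] ∷ []) (λ {x} _ → prod-id m x)
     ; conn = λ { φ _ (here refl) → refl } } , cong (_+ 2) (deficiencies-replicate m)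

   -- Two tuples on disjoint sets of points are multiplied factor by factor and then joined by (i
   -- r). The indicator of the first set is invariant, so restriction recovers both tuples, and
   -- before the insertion r and i lie in different orbits.
   module Glued {k r ys i zs cs β γ tB tC} (p : (β , γ) ∈ shuffles cs) (u : Unique (points r (ys ++ i ∷ zs) cs))
                (fB : Factorisation (suc k) r ys β tB) (fC : Factorisation 0 i zs γ tC) where
     private
       module FB = Factorisation fB
       module FC = Factorisation fC
       SB = points r ys β
       SC = points i zs γ
       S = points r (ys ++ i ∷ zs) cs
       S↭ : S ↭ SB ++ SC
       S↭ = points-split r ys i zs cs p
       uBC : Unique (SB ++ SC)
       uBC = Unique-↭ S↭ u
       φ = indicator SB
     t′ = glue tB tC

     lengths : length tB ≡ length tC
     lengths = FB.len ∙ sym FC.len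

     sB : SupportedIn φ tB
     sB = All.map (λ s {x} e → s (indicator-false⁻ e)) FB.supp

     sC : SupportedIn (not ∘ φ) tC
     sC = All.map (λ s {x} e → s (λ q → unique-disjoint SB uBC (indicator-true⁻ (not-false⁻ e)) q)) FC.supp

     t′-inj : All Inj t′
     t′-inj = glue-inj φ tB tC FB.inj FC.inj

     t′-φ : Invariant φ t′
     t′-φ = glue-invariant φ φ tB tC (invariant-B φ tB FB.inj sB) (invariant-C φ tC FC.inj sC)

     restrict-B : restrict φ t′ ≡ tB
     restrict-B = restrict-glue-B φ tB tC lengths FC.inj sB sC

     restrict-C : restrict (not ∘ φ) t′ ≡ tC
     restrict-C = restrict-glue-C φ tB tC lengths FC.inj sB sC

     t′-len : length t′ ≡ m
     t′-len = length-glue tB tC lengths ∙ FB.len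

     t′-fix : FixFirst (suc k) r t′
     t′-fix = glue-fix φ (suc k) r tB tC (indicator-true {SB} {r} (here refl)) sC FB.fix

     invariant-parts : ∀ ψ → Invariant ψ t′ → Invariant ψ tB × Invariant ψ tC
     invariant-parts ψ h = subst (Invariant ψ) restrict-B (restrict-invariant φ ψ t′ h) , subst (Invariant ψ) restrict-C (restrict-invariant (not ∘ φ) ψ t′ h)

     S-cases : ∀ {x} → x ∈ S → x ∈ SB ⊎ x ∈ SC
     S-cases q = ∈-++⁻ SB (∈-resp-↭ S↭ q)

     t′-supp : SupportedOn S t′
     t′-supp = go tB tC FB.supp FC.supp
       where go : ∀ tB tC → SupportedOn SB tB → SupportedOn SC tC → SupportedOn S (glue tB tC)
             go [] _ _ _ = []
             go (σ ∷ tB) [] _ _ = []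
             go (σ ∷ tB) (τ ∷ tC) (s ∷ ss) (s′ ∷ ss′) = (λ {x} x∉ → app-∘ σ τ x ∙ (cong (app σ) (s′ (λ q → x∉ (∈-resp-↭ (↭-sym S↭) (∈-++⁺ʳ SB q)))) ∙ s (λ q → x∉ (∈-resp-↭ (↭-sym S↭) (∈-++⁺ˡ q))))) ∷ go tB tC ss ss′

     t′-cycles : Cycles (app (prodₚ t′)) ((r ∷ ys) ∷ (i ∷ zs) ∷ cs)
     t′-cycles = cycles (headOf (cyc-agree _ _ ((r ∷ ys) ∷ β) onB (cyc FB.prod)) ∷ headOf (cyc-agree _ _ ((i ∷ zs) ∷ γ) onC (cyc FC.prod)) ∷
         shuffles-All⁺ cs p (tailOf (cyc-agree _ _ ((r ∷ ys) ∷ β) onB (cyc FB.prod))) (tailOf (cyc-agree _ _ ((i ∷ zs) ∷ γ) onC (cyc FC.prod))))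
       (subst Unique assoc u) outside
       where
       headOf : ∀ {P : List (Fin n) → Set} {x xs} → All P (x ∷ xs) → P x
       headOf = All.head
       tailOf : ∀ {P : List (Fin n) → Set} {x xs} → All P (x ∷ xs) → All P xs
       tailOf = All.tail
       assoc : S ≡ concat ((r ∷ ys) ∷ (i ∷ zs) ∷ cs)
       assoc = cong (r ∷_) (++-assoc ys (i ∷ zs) (concat cs))
       onB : ∀ {x} → x ∈ SB → app (prodₚ tB) x ≡ app (prodₚ t′) x
       onB {x} q = cong (λ t → app (prodₚ t) x) (sym restrict-B) ∙ (prod-restrict φ t′ t′-φ x ∙ cong (λ b → if b then app (prodₚ t′) x else x) (indicator-true q))
       offB : ∀ {x} → x ∉ SB → app (prodₚ tC) x ≡ app (prodₚ t′) x
       offB {x} q = cong (λ t → app (prodₚ t) x) (sym restrict-C) ∙ (prod-restrict (not ∘ φ) t′ (not-invariant φ t′ t′-φ) x ∙ cong (λ b → if not b then app (prodₚ t′) x else x) (dec-false (x ∈? SB) q))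
       onC : ∀ {x} → x ∈ SC → app (prodₚ tC) x ≡ app (prodₚ t′) x
       onC q = offB (λ q′ → unique-disjoint SB uBC q′ q)
       outside : ∀ {x} → x ∉ concat ((r ∷ ys) ∷ (i ∷ zs) ∷ cs) → app (prodₚ t′) x ≡ x
       outside {x} x∉ = sym (offB (λ q → x∉S (∈-resp-↭ (↭-sym S↭) (∈-++⁺ˡ q)))) ∙ fixes FC.prod (λ q → x∉S (∈-resp-↭ (↭-sym S↭) (∈-++⁺ʳ SB q)))
         where x∉S : x ∉ S
               x∉S q = x∉ (subst (x ∈_) assoc q)

     t′-deficiencies : deficiencies t′ ≡ deficiencies tB + deficiencies tC
     t′-deficiencies = deficiencies-restrict φ t′ t′-inj t′-φ ∙ cong₂ (λ a b → deficiencies a + deficiencies b) restrict-B restrict-C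

     orb-B : ∀ {x} → x ∈ SB → orb t′ r x ≡ true
     orb-B q = FB.conn (orb t′ r) (proj₁ (invariant-parts _ (orb-invariant t′ r t′-inj))) q ∙ orb-r t′ r

     orb-C : ∀ {x} → x ∈ SC → orb t′ r x ≡ false
     orb-C {x} q = ≢true λ e → unique-disjoint SB uBC (indicator-true⁻ (orb-min φ t′ r t′-φ e ∙ indicator-true {SB} {r} (here refl))) q

     glued : k < m → Factorisation k r (ys ++ i ∷ zs) cs (ins k i r t′)
     glued k<m = record
       { len = length-ins k i r t′ ∙ t′-len
       ; inj = ins-inj k i r t′ t′-inj
       ; supp = ins-supported S k i r t′ t′-inj t′-supp (here refl) i∈S
       ; fix = fix-ins k i r t′ t′-fix
       ; prod = cycles-merge (prod-ins k i r t′ t′-inj (fix-weaken k r t′ t′-fix) k<) t′-cycles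
       ; conn = λ ψ h {y} q → let h′ , e = ins-invariant⁻ ψ k i r t′ t′-inj t′-fix k< h
                                  hB , hC = invariant-parts ψ h′
                              in case S-cases q of λ { (inj₁ q₁) → FB.conn ψ hB q₁ ; (inj₂ q₂) → FC.conn ψ hC q₂ ∙ e } }
       where
       k< : k < length t′
       k< = subst (k <_) (sym t′-len) k<m
       i∈S : i ∈ S
       i∈S = ∈-resp-↭ (↭-sym S↭) (∈-++⁺ʳ SB (here refl))

     glued-deficiencies : k < m → i ≢ r → deficiencies (ins k i r t′) ≡ suc (deficiencies tB + deficiencies tC)
     glued-deficiencies k<m i≢r = deficiencies-ins k i r t′ t′-inj t′-fix (subst (k <_) (sym t′-len) k<m) i≢r ∙ cong suc t′-deficiencies

     glued-key : k < m → key k r (ins k i r t′) ≡ i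
     glued-key k<m = key-ins k i r t′ t′-inj t′-fix (subst (k <_) (sym t′-len) k<m)

     -- The pieces have the same points in total and one cycle more. The deficiency sides match: the
     -- two summands 2 exceed the single one by 2, of which the inserted transposition takes up 1.
     bounds : bound r ys β + bound i zs γ ≡ suc (bound r (ys ++ i ∷ zs) cs)
     bounds = inter (length SB) (length SC) (length β) (length γ) ∙ cong₂ (λ a b → suc (a + suc b)) (sym (length-++ SB) ∙ sym (↭-length S↭)) (shuffles-length cs p)
       where inter : ∀ a b c d → (a + suc c) + (b + suc d) ≡ suc ((a + b) + suc (c + d))
             inter = solve-∀

   module Merged {k r xs i ws cs cs′ t′} (p : (i , ws , cs′) ∈ merges cs) (f : Factorisation (suc k) r (xs ++ i ∷ ws) cs′ t′) (k<m : k < m) where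
     private
       module FT = Factorisation f
       S↭ = points-merge r xs cs p
       k< : k < length t′
       k< = subst (k <_) (sym FT.len) k<m
       i∈S : i ∈ points r xs cs
       i∈S = ∈-resp-↭ (↭-sym S↭) (there (∈-++⁺ˡ (∈-++⁺ʳ xs (here refl))))

     merged : Factorisation k r xs cs (ins k i r t′)
     merged = record
       { len = length-ins k i r t′ ∙ FT.len
       ; inj = ins-inj k i r t′ FT.inj
       ; supp = ins-supported (points r xs cs) k i r t′ FT.inj (All.map (λ s {x} q → s (λ z → q (∈-resp-↭ (↭-sym S↭) z))) FT.supp) (here refl) i∈S
       ; fix = fix-ins k i r t′ FT.fix
       ; prod = cycles-unmerges p (cycles-split (prod-ins k i r t′ FT.inj (fix-weaken k r t′ FT.fix) k<) FT.prod)
       ; conn = λ ψ h q → FT.conn ψ (proj₁ (ins-invariant⁻ ψ k i r t′ FT.inj FT.fix k< h)) (∈-resp-↭ S↭ q) }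

     merged-deficiencies : i ≢ r → deficiencies (ins k i r t′) ≡ suc (deficiencies t′)
     merged-deficiencies = deficiencies-ins k i r t′ FT.inj FT.fix k<

     merged-key : key k r (ins k i r t′) ≡ i
     merged-key = key-ins k i r t′ FT.inj FT.fix k<

     merged-bound : bound r xs cs ≡ suc (bound r (xs ++ i ∷ ws) cs′)
     merged-bound = cong₂ (λ a b → a + suc b) (↭-length S↭) (merges-length cs p) ∙ ℕP.+-suc (length (points r (xs ++ i ∷ ws) cs′)) (suc (length cs′))

   k<m : ∀ {k j} → k + suc j ≡ m → k < m
   k<m {k} {j} refl = subst (k <_) (sym (ℕP.+-suc k j)) (s≤s (ℕP.m≤m+n k j))

   next : ∀ {k j} → k + suc j ≡ m → suc k + j ≡ m
   next {k} {j} e = sym (ℕP.+-suc k j) ∙ e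

   merge-i≢r : ∀ {r xs cs i ws cs′} → Unique (points r xs cs) → (i , ws , cs′) ∈ merges cs → i ≢ r
   merge-i≢r {r} {xs} {cs} u p refl = Unique[x∷xs]⇒x∉xs (Unique-↭ (points-merge r xs cs p) u) (∈-++⁺ˡ (∈-++⁺ʳ xs (here refl)))

   split-i≢r : ∀ {r ys i zs cs} → Unique (points r (ys ++ i ∷ zs) cs) → i ≢ r
   split-i≢r {ys = ys} u refl = Unique[x∷xs]⇒x∉xs u (∈-++⁺ˡ (∈-++⁺ʳ ys (here refl)))

   private
     glue-sound-from : ∀ N k j r ys i zs {β γ b} →
       (∀ {t} → t ∈ en (suc N) (suc k) j r ys β → Minimal (suc k) r ys β t) → (∀ {t} → t ∈ en N 0 m i zs γ → Minimal 0 i zs γ t) →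
       b ∈ glueBlock N k j r ys i zs (β , γ) → ∃₂ λ tB tC → b ≡ glue tB tC × Minimal (suc k) r ys β tB × Minimal 0 i zs γ tC
     glue-sound-from N k j r ys i zs {β} {γ} sB sC q with ∈-concatMap-inv (λ tB → map (glue tB) (en N 0 m i zs γ)) {xs = en (suc N) (suc k) j r ys β} q
     ... | tB , tB∈ , q′ with ∈-map⁻ (glue tB) q′
     ... | tC , tC∈ , refl = tB , tC , refl , sB tB∈ , sC tC∈

     unique-B : ∀ r ys i zs cs {β γ} → Unique (points r (ys ++ i ∷ zs) cs) → (β , γ) ∈ shuffles cs → Unique (points r ys β)
     unique-B r ys i zs cs {β} u p = unique-++ˡ (points r ys β) (Unique-↭ (points-split r ys i zs cs p) u)

     unique-C : ∀ r ys i zs cs {β γ} → Unique (points r (ys ++ i ∷ zs) cs) → (β , γ) ∈ shuffles cs → Unique (points i zs γ)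
     unique-C r ys i zs cs {β} u p = unique-++ʳ (points r ys β) (Unique-↭ (points-split r ys i zs cs p) u)

   sound-step : ∀ N k j →
     (∀ r xs cs {t} → suc k + j ≡ m → Unique (points r xs cs) → t ∈ en (suc N) (suc k) j r xs cs → Minimal (suc k) r xs cs t) →
     (∀ r xs cs {t} → Unique (points r xs cs) → t ∈ en N 0 m r xs cs → Minimal 0 r xs cs t) →
     ∀ r xs cs {t} → k + suc j ≡ m → Unique (points r xs cs) → t ∈ en (suc N) k (suc j) r xs cs → Minimal k r xs cs t
   sound-step N k j IH IHC r xs cs e u q with ∈-++⁻ (en (suc N) (suc k) j r xs cs) q
   ... | inj₁ q₁ = let f , eq = IH r xs cs (next e) u q₁ in record { Factorisation f ; fix = fix-weaken k r _ (Factorisation.fix f) } , eq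
   ... | inj₂ q₂ with ∈-++⁻ (concatMap (mergeBlock N k j r xs) (merges cs)) q₂
   ... | inj₁ q₃ with ∈-concatMap-inv (mergeBlock N k j r xs) q₃
   ... | (i , ws , cs′) , p , q₄ with ∈-map⁻ (ins k i r) q₄
   ... | t′ , q₅ , refl with IH r (xs ++ i ∷ ws) cs′ (next e) (Unique-↭ (points-merge r xs cs p) u) q₅
   ... | f , eq = Merged.merged {cs = cs} p f (k<m e) , (cong (_+ 2) (Merged.merged-deficiencies {cs = cs} p f (k<m e) (merge-i≢r {xs = xs} {cs = cs} u p)) ∙ (cong suc eq ∙ sym (Merged.merged-bound {cs = cs} p f (k<m e))))
   sound-step N k j IH IHC r xs cs e u q | inj₂ q₂ | inj₂ q₃ with ∈-concatMap-inv (splitBlock N k j r cs) q₃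
   ... | (ys , i , zs) , s , q₄ with ∈-map⁻ (ins k i r) q₄
   ... | t′ , q₅ , refl with refl ← splitsOf-sound xs s with ∈-concatMap-inv (glueBlock N k j r ys i zs) q₅
   ... | (β , γ) , p , q₆ with glue-sound-from N k j r ys i zs
           (IH r ys β (next e) (unique-B r ys i zs cs u p)) (IHC i zs γ (unique-C r ys i zs cs u p)) q₆
   ... | tB , tC , refl , (fB , eB) , (fC , eC) = G.glued (k<m e) , (cong (_+ 2) (G.glued-deficiencies (k<m e) (split-i≢r {ys = ys} {cs = cs} u)) ∙
       ℕP.suc-injective (inter (deficiencies tB) (deficiencies tC) ∙ (cong₂ _+_ eB eC ∙ G.bounds)))
     where
     module G = Glued {cs = cs} p u fB fC
     inter : ∀ a b → suc (suc (a + b) + 2) ≡ (a + 2) + (b + 2)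
     inter = solve-∀

   sound : ∀ N k j r xs cs {t} → k + j ≡ m → Unique (points r xs cs) → t ∈ en N k j r xs cs → Minimal k r xs cs t
   sound N k zero r [] [] e u (here refl) = base-minimal k r
   sound (suc N) k (suc j) r xs cs = sound-step N k j (sound (suc N) (suc k) j) (λ r xs cs → sound N 0 m r xs cs refl) r xs cs

   glue-sound : ∀ N k j r ys i zs cs {β γ b} → k + suc j ≡ m → Unique (points r (ys ++ i ∷ zs) cs) → (β , γ) ∈ shuffles cs →
     b ∈ glueBlock N k j r ys i zs (β , γ) → ∃₂ λ tB tC → b ≡ glue tB tC × Minimal (suc k) r ys β tB × Minimal 0 i zs γ tC
   glue-sound N k j r ys i zs cs {β} {γ} e u p = glue-sound-from N k j r ys i zs
     (sound (suc N) (suc k) j r ys β (next e) (unique-B r ys i zs cs u p)) (sound N 0 m i zs γ refl (unique-C r ys i zs cs u p))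

   stay-key : ∀ N k j r xs cs {t} → k + suc j ≡ m → Unique (points r xs cs) → t ∈ en (suc N) (suc k) j r xs cs → key k r t ≡ r
   stay-key N k j r xs cs {t} e u q = key-fixed k r t (Factorisation.fix (proj₁ (sound (suc N) (suc k) j r xs cs (next e) u q)))

   merge-key : ∀ N k j r xs cs {x t} → k + suc j ≡ m → Unique (points r xs cs) → x ∈ merges cs → t ∈ mergeBlock N k j r xs x → key k r t ≡ proj₁ x
   merge-key N k j r xs cs {i , ws , cs′} e u p q with ∈-map⁻ (ins k i r) q
   ... | t′ , q′ , refl = Merged.merged-key {cs = cs} p (proj₁ (sound (suc N) (suc k) j r (xs ++ i ∷ ws) cs′ (next e) (Unique-↭ (points-merge r xs cs p) u) q′)) (k<m e)

   split-key : ∀ N k j r xs cs {x t} → k + suc j ≡ m → Unique (points r xs cs) → x ∈ splitsOf xs → t ∈ splitBlock N k j r cs x → key k r t ≡ proj₁ (proj₂ x)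
   split-key N k j r xs cs {ys , i , zs} e u s q with ∈-map⁻ (ins k i r) q
   ... | t′ , q′ , refl with refl ← splitsOf-sound xs s with ∈-concatMap-inv (glueBlock N k j r ys i zs) q′
   ... | (β , γ) , p , q″ with glue-sound N k j r ys i zs cs e u p q″
   ... | tB , tC , refl , (fB , _) , (fC , _) = Glued.glued-key {cs = cs} p u fB fC (k<m e)

   ins-injective : ∀ k i r {t t′ : List (Perm n)} → ins k i r t ≡ ins k i r t′ → t ≡ t′
   ins-injective k i r {t} {t′} e = sym (ins-ins k i r t) ∙ (cong (ins k i r) e ∙ ins-ins k i r t′)

   unique-glue : ∀ N k j r ys i zs cs {β γ} → k + suc j ≡ m → Unique (points r (ys ++ i ∷ zs) cs) → (β , γ) ∈ shuffles cs →
     Unique (en (suc N) (suc k) j r ys β) → Unique (en N 0 m i zs γ) → Unique (glueBlock N k j r ys i zs (β , γ))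
   unique-glue N k j r ys i zs cs {β} {γ} e u p vB vC = unique-concatMap (λ tB → map (glue tB) EC) (restrict φ) (λ t → t)
       (subst Unique (sym (map-id EB)) vB)
       (λ {tB} tB∈ → unique-map (glue tB) (λ {x} {y} x∈ y∈ eq → sym (G.restrict-C (factB tB∈) (factC x∈)) ∙ (cong (restrict (not ∘ φ)) eq ∙ G.restrict-C (factB tB∈) (factC y∈))) vC)
       λ {tB} {y} tB∈ q → let tC , tC∈ , eq = ∈-map⁻ (glue tB) q in cong (restrict φ) eq ∙ G.restrict-B (factB tB∈) (factC tC∈)
     where
     uB = unique-B r ys i zs cs u p
     uC = unique-C r ys i zs cs u p
     φ = indicator (points r ys β)
     EB = en (suc N) (suc k) j r ys β
     EC = en N 0 m i zs γ
     factB : ∀ {t} → t ∈ EB → Factorisation (suc k) r ys β t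
     factB q = proj₁ (sound (suc N) (suc k) j r ys β (next e) uB q)
     factC : ∀ {t} → t ∈ EC → Factorisation 0 i zs γ t
     factC q = proj₁ (sound N 0 m i zs γ refl uC q)
     module G {tB tC} (fB : Factorisation (suc k) r ys β tB) (fC : Factorisation 0 i zs γ tC) = Glued {cs = cs} p u fB fC

   -- The key separates the three blocks: it is r, a point of another cycle, or a point of the root
   -- cycle. Within the last two it names the point i. For a split, the orbit of r reveals the
   -- shuffle and restriction reveals the two pieces.
   unique-step : ∀ N k j →
     (∀ r xs cs → suc k + j ≡ m → Unique (points r xs cs) → Unique (en (suc N) (suc k) j r xs cs)) →
     (∀ r xs cs → Unique (points r xs cs) → Unique (en N 0 m r xs cs)) →
     ∀ r xs cs → k + suc j ≡ m → Unique (points r xs cs) → Unique (en (suc N) k (suc j) r xs cs)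
   unique-step N k j IH IHC r xs cs e u = unique-++ (IH r xs cs (next e) u)
     (unique-++
       (unique-concatMap (mergeBlock N k j r xs) (key k r) proj₁ (subst Unique (sym (map-merges cs)) (unique-++ʳ (r ∷ xs) u))
         (λ { {i , ws , cs′} p → unique-map (ins k i r) (λ _ _ → ins-injective k i r) (IH r (xs ++ i ∷ ws) cs′ (next e) (Unique-↭ (points-merge r xs cs p) u)) })
         (merge-key N k j r xs cs e u))
       (unique-concatMap (splitBlock N k j r cs) (key k r) (λ (_ , i , _) → i) (subst Unique (sym (map-splitsOf xs)) (unique-++ˡ xs (unique-++ʳ (r ∷ []) u)))
         (λ {x} s → unique-split x s)
         (split-key N k j r xs cs e u))
       λ p q → let x , x∈ , p′ = ∈-concatMap-inv (mergeBlock N k j r xs) p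
                   y , y∈ , q′ = ∈-concatMap-inv (splitBlock N k j r cs) q
               in unique-disjoint (r ∷ xs) u (there (split-∈ y∈)) (subst (_∈ concat cs) (sym (merge-key N k j r xs cs e u x∈ p′) ∙ split-key N k j r xs cs e u y∈ q′) (merge-∈ x∈)))
     λ p q → Unique[x∷xs]⇒x∉xs u (subst (_∈ xs ++ concat cs) (stay-key N k j r xs cs e u p) (other-key q))
     where
     split-∈ : ∀ {x} → x ∈ splitsOf xs → proj₁ (proj₂ x) ∈ xs
     split-∈ {x} p = subst (proj₁ (proj₂ x) ∈_) (map-splitsOf xs) (∈-map⁺ (λ (_ , i , _) → i) p)
     merge-∈ : ∀ {x} → x ∈ merges cs → proj₁ x ∈ concat cs
     merge-∈ {x} p = subst (proj₁ x ∈_) (map-merges cs) (∈-map⁺ proj₁ p)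
     other-key : ∀ {t} → t ∈ concatMap (mergeBlock N k j r xs) (merges cs) ++ concatMap (splitBlock N k j r cs) (splitsOf xs) → key k r t ∈ xs ++ concat cs
     other-key q with ∈-++⁻ (concatMap (mergeBlock N k j r xs) (merges cs)) q
     ... | inj₁ q₁ = let x , x∈ , q′ = ∈-concatMap-inv (mergeBlock N k j r xs) q₁ in ∈-++⁺ʳ xs (subst (_∈ concat cs) (sym (merge-key N k j r xs cs e u x∈ q′)) (merge-∈ x∈))
     ... | inj₂ q₂ = let x , x∈ , q′ = ∈-concatMap-inv (splitBlock N k j r cs) q₂ in ∈-++⁺ˡ (subst (_∈ xs) (sym (split-key N k j r xs cs e u x∈ q′)) (split-∈ x∈))
     -- The shuffle is read off the glued tuple: a cycle belongs to the piece of r exactly if its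
     -- first point lies in the orbit of r.
     mark : List (Perm n) → List (Fin n) → Bool
     mark t [] = false
     mark t (x ∷ _) = orb t r x
     unique-split : ∀ x → x ∈ splitsOf xs → Unique (splitBlock N k j r cs x)
     unique-split (ys , i , zs) s with refl ← splitsOf-sound xs s = unique-map (ins k i r) (λ _ _ → ins-injective k i r)
       (unique-shuffles mark cs (glueBlock N k j r ys i zs) (λ {(β , γ)} p → unique-glue N k j r ys i zs cs e u p (IH r ys β (next e) (unique-B r ys i zs cs u p)) (IHC i zs γ (unique-C r ys i zs cs u p))) marks)
       where
       mark-All : ∀ {t b f} (δ : List (List (Fin n))) → All (Cyc f) δ → (∀ {x} → x ∈ concat δ → orb t r x ≡ b) → All (λ c → mark t c ≡ b) δ
       mark-All [] [] h = []
       mark-All ((x ∷ c) ∷ δ) (_ ∷ ps) h = h (here refl) ∷ mark-All δ ps (λ q → h (∈-++⁺ʳ (x ∷ c) q))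
       marks : ∀ {β γ b} → (β , γ) ∈ shuffles cs → b ∈ glueBlock N k j r ys i zs (β , γ) → All (λ c → mark b c ≡ true) β × All (λ c → mark b c ≡ false) γ
       marks {β} {γ} p q with glue-sound N k j r ys i zs cs e u p q
       ... | tB , tC , refl , (fB , _) , (fC , _) =
         mark-All β (All.tail (cyc (Factorisation.prod fB))) (λ q → Glued.orb-B {cs = cs} p u fB fC (there (∈-++⁺ʳ ys q))) ,
         mark-All γ (All.tail (cyc (Factorisation.prod fC))) (λ q → Glued.orb-C {cs = cs} p u fB fC (there (∈-++⁺ʳ zs q)))

   unique : ∀ N k j r xs cs → k + j ≡ m → Unique (points r xs cs) → Unique (en N k j r xs cs)
   unique N k zero r [] [] e u = [] ∷ []
   unique N k zero r [] (_ ∷ _) e u = []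
   unique N k zero r (_ ∷ _) _ e u = []
   unique zero k (suc j) r xs cs e u = []
   unique (suc N) k (suc j) r xs cs = unique-step N k j (unique (suc N) (suc k) j) (λ r xs cs → unique N 0 m r xs cs refl) r xs cs

-- Length and completeness of the enumeration

module TupleCompleteness where
 open import Defs
 open Recursion using (picks; shuffles; cuts; module Count)
 open CycleLists
 open CycleTypes
 open Transitivity
 open Tuples
 open import Data.Nat using (ℕ; zero; suc; s≤s; _+_; _*_; _≤_; _<_)
 import Data.Nat.Properties as ℕP
 open import Data.Nat.Tactic.RingSolver using (solve-∀)
 open import Data.Bool using (Bool; true; false; not; if_then_else_)
 open import Data.List using (List; []; _∷_; length; map; _++_; concat; concatMap; replicate)
 open import Data.List.Properties using (length-map; length-++; ++-assoc; map-++; map-∘)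
 open import Data.Nat.ListAction using (sum)
 open import Data.Nat.ListAction.Properties using (sum-++)
 open import Data.List.Relation.Unary.All using (All; []; _∷_)
 import Data.List.Relation.Unary.All as All
 import Data.List.Relation.Unary.All.Properties as AllP
 open import Data.List.Relation.Unary.Any using (here; there)
 open import Data.List.Relation.Unary.AllPairs using ([]; _∷_)
 open import Data.List.Relation.Unary.Unique.Propositional.Properties using (Unique[x∷xs]⇒x∉xs)
 open import Data.List.Membership.Propositional using (_∈_; _∉_)
 open import Data.List.Membership.Propositional.Properties
 open import Data.List.Relation.Binary.Permutation.Propositional using (_↭_; ↭-sym)
 open import Data.List.Relation.Binary.Permutation.Propositional.Properties using (∈-resp-↭; ++-comm; ↭-length)
 open import Data.Fin using (Fin; _≟_)
 open import Data.Vec.Properties using (lookup∘tabulate)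
 open import Data.Product using (_×_; _,_; proj₁; proj₂)
 open import Data.Sum using (inj₁; inj₂)
 open import Data.Empty using (⊥-elim)
 open import Data.Unit using (tt)
 open import Function using (_∘_)
 open import Relation.Binary.PropositionalEquality hiding ([_]) renaming (trans to _∙_)
 open import Relation.Nullary using (¬_; yes; no; contradiction)

 private variable
   A B : Set

 length-concatMap : (f : A → List B) (xs : List A) → length (concatMap f xs) ≡ sum (map (λ x → length (f x)) xs)
 length-concatMap f [] = refl
 length-concatMap f (x ∷ xs) = length-++ (f x) ∙ cong (length (f x) +_) (length-concatMap f xs)

 sum-map-concatMap : (φ : B → ℕ) (f : A → List B) (xs : List A) → sum (map φ (concatMap f xs)) ≡ sum (map (λ x → sum (map φ (f x))) xs)
 sum-map-concatMap φ f [] = refl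
 sum-map-concatMap φ f (x ∷ xs) = cong sum (map-++ φ (f x) (concatMap f xs)) ∙ (sum-++ (map φ (f x)) _ ∙ cong (sum (map φ (f x)) +_) (sum-map-concatMap φ f xs))

 sum-map-cong : {φ ψ : A → ℕ} (xs : List A) → (∀ {x} → x ∈ xs → φ x ≡ ψ x) → sum (map φ xs) ≡ sum (map ψ xs)
 sum-map-cong [] h = refl
 sum-map-cong (x ∷ xs) h = cong₂ _+_ (h (here refl)) (sum-map-cong xs (λ q → h (there q)))

 sum-map-const : (c : ℕ) (xs : List A) → sum (map (λ _ → c) xs) ≡ length xs * c
 sum-map-const c [] = refl
 sum-map-const c (x ∷ xs) = cong (c +_) (sum-map-const c xs)

 picks-map : (f : A → B) (xs : List A) → picks (map f xs) ≡ map (λ (c , cs) → f c , map f cs) (picks xs)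
 picks-map f [] = refl
 picks-map f (x ∷ xs) = cong ((f x , map f xs) ∷_) (cong (map _) (picks-map f xs) ∙ (sym (map-∘ (picks xs)) ∙ map-∘ (picks xs)))

 shuffles-map : (f : A → B) (xs : List A) → shuffles (map f xs) ≡ map (λ (β , γ) → map f β , map f γ) (shuffles xs)
 shuffles-map f [] = refl
 shuffles-map f (x ∷ xs) = cong₂ _++_ (cong (map _) (shuffles-map f xs) ∙ (sym (map-∘ (shuffles xs)) ∙ map-∘ (shuffles xs))) (cong (map _) (shuffles-map f xs) ∙ (sym (map-∘ (shuffles xs)) ∙ map-∘ (shuffles xs)))
   ∙ sym (map-++ _ (map _ (shuffles xs)) (map _ (shuffles xs)))

 length-splitsOf : (xs : List A) → length (splitsOf xs) ≡ length xs
 length-splitsOf [] = refl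
 length-splitsOf (x ∷ xs) = cong suc (length-map _ (splitsOf xs) ∙ length-splitsOf xs)

 sum-splitsOf : (ψ : ℕ → ℕ → ℕ) (xs : List A) → sum (map (λ (ys , _ , zs) → ψ (length ys) (length zs)) (splitsOf xs)) ≡ cuts (length xs) ψ
 sum-splitsOf ψ [] = refl
 sum-splitsOf ψ (x ∷ xs) = cong (ψ 0 (length xs) +_) (cong sum (sym (map-∘ (splitsOf xs))) ∙ sum-splitsOf (λ b → ψ (suc b)) xs)

 module Completeness {n : ℕ} (m : ℕ) where
   open Count m
   open Enumeration {n} m

   -- A cycle of length c can be opened at c points with equal counts, which gives the factor c of
   -- the recursion; the splits of the root cycle are indexed by its cut points.
   length-step : ∀ N k j → (∀ r xs cs → length (en (suc N) (suc k) j r xs cs) ≡ F (suc N) j (length xs) (map length cs)) →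
     (∀ r xs cs → length (en N 0 m r xs cs) ≡ F N m (length xs) (map length cs)) →
     ∀ r xs cs → length (en (suc N) k (suc j) r xs cs) ≡ F (suc N) (suc j) (length xs) (map length cs)
   length-step N k j IH IHC r xs cs = length-++ (en (suc N) (suc k) j r xs cs) ∙ cong₂ _+_ (IH r xs cs)
     (length-++ (concatMap (mergeBlock N k j r xs) (merges cs)) ∙ cong₂ _+_ mergeLength splitLength)
     where
     a = length xs
     mergeLength : length (concatMap (mergeBlock N k j r xs) (merges cs)) ≡ sum (map (λ (c , β) → c * F (suc N) j (a + c) β) (picks (map length cs)))
     mergeLength = length-concatMap (mergeBlock N k j r xs) (merges cs)
       ∙ (sum-map-concatMap (λ x → length (mergeBlock N k j r xs x)) _ (picks cs)
       ∙ (sum-map-cong (picks cs) (λ {p} _ → each p)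
       ∙ cong sum (map-∘ (picks cs) ∙ cong (map (λ (c , β) → c * F (suc N) j (a + c) β)) (sym (picks-map length cs)))))
       where
       each : ∀ p → sum (map (λ x → length (mergeBlock N k j r xs x)) (map (λ (i , ws) → i , ws , proj₂ p) (rotations (proj₁ p)))) ≡ length (proj₁ p) * F (suc N) j (a + length (proj₁ p)) (map length (proj₂ p))
       each (c , cs′) = cong sum (sym (map-∘ (rotations c)) ∙ sym (map-∘ (splitsOf c)))
         ∙ (sum-map-cong (splitsOf c) (λ {x} s → term x s) ∙ (sum-map-const _ (splitsOf c) ∙ cong (_* F (suc N) j (a + length c) (map length cs′)) (length-splitsOf c)))
         where
         term : ∀ x → x ∈ splitsOf c → length (mergeBlock N k j r xs (proj₁ (proj₂ x) , proj₂ (proj₂ x) ++ proj₁ x , cs′)) ≡ F (suc N) j (a + length c) (map length cs′)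
         term (ys , i , zs) s = length-map (ins k i r) (en (suc N) (suc k) j r (xs ++ i ∷ zs ++ ys) cs′) ∙ (IH r (xs ++ i ∷ zs ++ ys) cs′
           ∙ cong (λ l → F (suc N) j l (map length cs′)) (length-++ xs ∙ cong (a +_) (sym (cong length (splitsOf-sound c s) ∙ ↭-length (++-comm ys (i ∷ zs))))))
     splitLength : length (concatMap (splitBlock N k j r cs) (splitsOf xs)) ≡ cuts a (λ b b′ → sum (map (λ (β , γ) → F (suc N) j b β * F N m b′ γ) (shuffles (map length cs))))
     splitLength = length-concatMap (splitBlock N k j r cs) (splitsOf xs) ∙ (sum-map-cong (splitsOf xs) (λ {x} _ → term x)
       ∙ sum-splitsOf (λ b b′ → sum (map (λ (β , γ) → F (suc N) j b β * F N m b′ γ) (shuffles (map length cs)))) xs)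
       where
       term : ∀ x → length (splitBlock N k j r cs x) ≡ sum (map (λ (β , γ) → F (suc N) j (length (proj₁ x)) β * F N m (length (proj₂ (proj₂ x))) γ) (shuffles (map length cs)))
       term (ys , i , zs) = length-map (ins k i r) (concatMap (glueBlock N k j r ys i zs) (shuffles cs)) ∙ (length-concatMap (glueBlock N k j r ys i zs) (shuffles cs) ∙ (sum-map-cong (shuffles cs) (λ {p} _ → pair p)
         ∙ cong sum (map-∘ (shuffles cs) ∙ cong (map (λ (β , γ) → F (suc N) j (length ys) β * F N m (length zs) γ)) (sym (shuffles-map length cs)))))
         where
         pair : ∀ p → length (glueBlock N k j r ys i zs p) ≡ F (suc N) j (length ys) (map length (proj₁ p)) * F N m (length zs) (map length (proj₂ p))
         pair (β , γ) = length-concatMap (λ tB → map (glue tB) (en N 0 m i zs γ)) (en (suc N) (suc k) j r ys β)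
           ∙ (sum-map-cong (en (suc N) (suc k) j r ys β) (λ {tB} _ → length-map (glue tB) (en N 0 m i zs γ))
           ∙ (sum-map-const _ (en (suc N) (suc k) j r ys β) ∙ cong₂ _*_ (IH r ys β) (IHC i zs γ)))

   length-en : ∀ N k j r xs cs → length (en N k j r xs cs) ≡ F N j (length xs) (map length cs)
   length-en N k zero r [] [] = refl
   length-en N k zero r [] (_ ∷ _) = refl
   length-en N k zero r (_ ∷ _) _ = refl
   length-en zero k (suc j) r xs cs = refl
   length-en (suc N) k (suc j) r xs cs = length-step N k j (length-en (suc N) (suc k) j) (length-en N 0 m) r xs cs

   select-shuffles : ∀ (f : Fin n → Fin n) ψ cs → All (Cyc f) cs → (select ψ cs , select (not ∘ ψ) cs) ∈ shuffles cs
   select-shuffles f ψ [] [] = here refl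
   select-shuffles f ψ ((x ∷ xs) ∷ cs) (_ ∷ ps) with ψ x
   ... | true = ∈-++⁺ˡ (∈-map⁺ _ (select-shuffles f ψ cs ps))
   ... | false = ∈-++⁺ʳ (map _ (shuffles cs)) (∈-map⁺ _ (select-shuffles f ψ cs ps))

   select-true : ∀ ψ x xs (cs : List (List (Fin n))) → ψ x ≡ true → select ψ ((x ∷ xs) ∷ cs) ≡ (x ∷ xs) ∷ select ψ cs
   select-true ψ x xs cs e = cong (λ b → if b then (x ∷ xs) ∷ select ψ cs else select ψ cs) e

   select-false : ∀ ψ x xs (cs : List (List (Fin n))) → ψ x ≡ false → select ψ ((x ∷ xs) ∷ cs) ≡ select ψ cs
   select-false ψ x xs cs e = cong (λ b → if b then (x ∷ xs) ∷ select ψ cs else select ψ cs) e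

   -- Extends an invariant function of a restricted tuple to one of the whole tuple, by a constant
   -- outside the set.
   blend : (Fin n → Bool) → (Fin n → Bool) → Bool → Fin n → Bool
   blend ψ φ b x = if ψ x then φ x else b

   blend-true : ∀ ψ φ b {x} → ψ x ≡ true → blend ψ φ b x ≡ φ x
   blend-true ψ φ b {x} e = cong (λ c → if c then φ x else b) e

   blend-false : ∀ ψ φ b {x} → ψ x ≡ false → blend ψ φ b x ≡ b
   blend-false ψ φ b {x} e = cong (λ c → if c then φ x else b) e

   blend-invariant : ∀ ψ φ b (t : List (Perm n)) → Invariant ψ t → Invariant φ (restrict ψ t) → Invariant (blend ψ φ b) t
   blend-invariant ψ φ b [] [] [] = []
   blend-invariant ψ φ b (σ ∷ t) (h ∷ hs) (g ∷ gs) = go ∷ blend-invariant ψ φ b t hs gs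
     where go : InvariantUnder (blend ψ φ b) σ
           go x with bool-cases (ψ x)
           ... | inj₁ e = blend-true ψ φ b {app σ x} (h x ∙ e) ∙ (cong φ (sym (restrict-in ψ σ e)) ∙ (g x ∙ sym (blend-true ψ φ b {x} e)))
           ... | inj₂ e = blend-false ψ φ b {app σ x} (h x ∙ e) ∙ sym (blend-false ψ φ b {x} e)

   select-supported : ∀ ψ (t : List (Perm n)) cs → Invariant ψ t → Cycles (app (prodₚ t)) cs → SupportedOn (concat cs) t → SupportedOn (concat (select ψ cs)) (restrict ψ t)
   select-supported ψ t cs h c s = AllP.map⁺ (All.map (λ {σ} → go {σ}) s)
     where go : ∀ {σ : Perm n} → (∀ {x} → x ∉ concat cs → app σ x ≡ x) → ∀ {x} → x ∉ concat (select ψ cs) → app (restrictₚ ψ σ) x ≡ x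
           go {σ} s {x} x∉ with bool-cases (ψ x)
           ... | inj₂ e = restrict-out ψ σ e
           ... | inj₁ e = restrict-in ψ σ e ∙ s (λ q → x∉ (select-∈⁺ ψ (app (prodₚ t)) (prod-invariant ψ t h) cs (cyc c) e q))

   select-cycles : ∀ ψ (t : List (Perm n)) cs → Invariant ψ t → Cycles (app (prodₚ t)) cs → Cycles (app (prodₚ (restrict ψ t))) (select ψ cs)
   select-cycles ψ t cs h c = cycles-ext (λ x → sym (prod-restrict ψ t h x)) (cycles-restrict ψ (app (prodₚ t)) (prod-invariant ψ t h) c)

   -- Bound and membership are proved together: when the whole tuple attains its bound, the bounds
   -- for the two pieces force each piece to attain its own.
   Complete : ℕ → ℕ → ℕ → Fin n → List (Fin n) → List (List (Fin n)) → List (Perm n) → Set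
   Complete N k j r xs cs t = bound r xs cs ≤ deficiencies t + 2 × (deficiencies t + 2 ≡ bound r xs cs → t ∈ en N k j r xs cs)

   all-fixed : ∀ k r (t : List (Perm n)) → length t ≡ k → FixFirst k r t → All (λ σ → app σ r ≡ r) t
   all-fixed zero r [] _ _ = []
   all-fixed (suc k) r (σ ∷ t) e (f , fs) = f ∷ all-fixed k r t (ℕP.suc-injective e) fs

   fixed-invariant : ∀ r (t : List (Perm n)) → All Inj t → All (λ σ → app σ r ≡ r) t → Invariant (indicator (r ∷ [])) t
   fixed-invariant r [] [] [] = []
   fixed-invariant r (σ ∷ t) (p ∷ ps) (e ∷ es) = (λ x → bool-ext (to x) (from x)) ∷ fixed-invariant r t ps es
     where
     to : ∀ x → indicator (r ∷ []) (app σ x) ≡ true → indicator (r ∷ []) x ≡ true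
     to x h with indicator-true⁻ {r ∷ []} {app σ x} h
     ... | here q = indicator-true {r ∷ []} {x} (here (injective p (q ∙ sym e)))
     from : ∀ x → indicator (r ∷ []) x ≡ true → indicator (r ∷ []) (app σ x) ≡ true
     from x h with indicator-true⁻ {r ∷ []} {x} h
     ... | here refl = indicator-true {r ∷ []} {app σ r} (here e)

   -- If all m factors fix r, the set containing r alone is invariant; connectedness then excludes
   -- every other point, and the factors are identities.
   complete-base : ∀ N k r xs cs t → k ≡ m → Factorisation k r xs cs t → Complete N k 0 r xs cs t
   complete-base N k r xs cs t refl f = go xs cs f
     where
     only : ∀ xs cs → Factorisation m r xs cs t → ∀ {y} → y ∈ points r xs cs → y ≡ r
     only xs cs f {y} q with indicator-true⁻ {r ∷ []} {y} (F.conn (indicator (r ∷ [])) (fixed-invariant r t F.inj (all-fixed m r t F.len F.fix)) q ∙ indicator-true {r ∷ []} {r} (here refl))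
       where module F = Factorisation f
     ... | here e = e
     go : ∀ xs cs → Factorisation m r xs cs t → Complete N m 0 r xs cs t
     go (x ∷ xs) cs f = ⊥-elim (Unique[x∷xs]⇒x∉xs (uniq (Factorisation.prod f)) (here (sym (only (x ∷ xs) cs f (there (here refl))))))
     go [] (c ∷ cs) f with cyc (Factorisation.prod f)
     go [] ((x ∷ c) ∷ cs) f | _ ∷ _ ∷ _ = ⊥-elim (Unique[x∷xs]⇒x∉xs (uniq (Factorisation.prod f)) (here (sym (only [] ((x ∷ c) ∷ cs) f (there (here refl))))))
     go [] [] f = ℕP.m≤n+m 2 (deficiencies t) , λ _ → here (identity t F.len F.supp (all-fixed m r t F.len F.fix))
       where
       module F = Factorisation f
       identity : ∀ {l} t → length t ≡ l → SupportedOn (r ∷ []) t → All (λ σ → app σ r ≡ r) t → t ≡ replicate l idₚ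
       identity [] refl _ _ = refl
       identity (σ ∷ t) refl (s ∷ ss) (e ∷ es) = cong₂ _∷_ (perm-ext ext) (identity t refl ss es)
         where ext : ∀ x → app σ x ≡ app idₚ x
               ext x with x ∈? (r ∷ [])
               ... | yes (here refl) = e ∙ sym (lookup∘tabulate (λ x → x) x)
               ... | no x∉ = s x∉ ∙ sym (lookup∘tabulate (λ x → x) x)

   sums-tight : ∀ {a a′ b b′} → a ≤ a′ → b ≤ b′ → a′ + b′ ≡ a + b → a′ ≡ a × b′ ≡ b
   sums-tight {a} {a′} {b} {b′} p q e = ea , ℕP.+-cancelˡ-≡ a′ b′ b (e ∙ cong (_+ b) (sym ea))
     where ea : a′ ≡ a
           ea = ℕP.≤-antisym (ℕP.+-cancelʳ-≤ b a′ a (ℕP.≤-trans (ℕP.+-monoʳ-≤ a′ q) (ℕP.≤-reflexive e))) p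

   module Step (N k j : ℕ)
     (IH : ∀ r xs cs t → suc k + j ≡ m → Factorisation (suc k) r xs cs t → length (points r xs cs) ≤ suc N → Complete (suc N) (suc k) j r xs cs t)
     (IHC : ∀ r xs cs t → Factorisation 0 r xs cs t → length (points r xs cs) ≤ N → Complete N 0 m r xs cs t)
     (r : Fin n) (xs : List (Fin n)) (cs : List (List (Fin n))) (t : List (Perm n)) (e : k + suc j ≡ m)
     (f : Factorisation k r xs cs t) (le : length (points r xs cs) ≤ suc N) where

     private
       module FT = Factorisation f
       S = points r xs cs
       i = key k r t
       t′ = ins k i r t
       k< : k < length t
       k< = subst (k <_) (sym FT.len) (k<m e)
       k<′ : k < length t′
       k<′ = subst (k <_) (sym (length-ins k i r t)) k<
       inj′ : All Inj t′
       inj′ = ins-inj k i r t FT.inj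
       fix′ : FixFirst (suc k) r t′
       fix′ = fix-ins-key k r t FT.inj FT.fix
       i∈S : i ∈ S
       i∈S = key-∈ S k r t FT.inj FT.supp (here refl)
       supp′ : SupportedOn S t′
       supp′ = ins-supported S k i r t FT.inj FT.supp (here refl) i∈S
       len′ : length t′ ≡ m
       len′ = length-ins k i r t ∙ FT.len
       prod′ : ∀ x → app (prodₚ t′) x ≡ sw i r (app (prodₚ t) x)
       prod′ = prod-ins k i r t FT.inj FT.fix k<
       def′ : i ≢ r → deficiencies t ≡ suc (deficiencies t′)
       def′ ne = cong deficiencies (sym (ins-ins k i r t)) ∙ deficiencies-ins k i r t′ inj′ fix′ k<′ ne
       lift : ∀ φ → Invariant φ t′ → φ i ≡ φ r → Invariant φ t
       lift φ h eq = subst (Invariant φ) (ins-ins k i r t) (ins-invariant φ k i r t′ inj′ fix′ h eq)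

     stay : i ≡ r → Complete (suc N) k (suc j) r xs cs t
     stay eq with IH r xs cs t (next e) (record { FT ; fix = key-fixed⁻ k r t FT.inj FT.fix eq }) le
     ... | b , c = b , λ q → ∈-++⁺ˡ (c q)

     merge : i ≢ r → ∀ {ws cs′} → (i , ws , cs′) ∈ merges cs → Complete (suc N) k (suc j) r xs cs t
     merge ne {ws} {cs′} p with IH r (xs ++ i ∷ ws) cs′ t′ (next e) f′ (subst (_≤ suc N) (↭-length S↭) le)
       where
       S↭ = points-merge r xs cs p
       prod″ : Cycles (app (prodₚ t′)) ((r ∷ xs ++ i ∷ ws) ∷ cs′)
       prod″ = cycles-merge prod′ (cycles-domerges p FT.prod)
       f′ : Factorisation (suc k) r (xs ++ i ∷ ws) cs′ t′
       f′ = record { len = len′ ; inj = inj′ ; supp = All.map (λ s {x} q → s (λ z → q (∈-resp-↭ S↭ z))) supp′ ; fix = fix′ ; prod = prod″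
         -- The points i and r lie on one cycle of the new product, so a function invariant under
         -- `t′` agrees on them and is also invariant under t.
         ; conn = λ φ h q → FT.conn φ (lift φ h (cyc-inv φ (app (prodₚ t′)) (r ∷ xs ++ i ∷ ws) (prod-invariant φ t′ h) (All.head (cyc prod″)) (there (∈-++⁺ʳ xs (here refl))) (here refl))) (∈-resp-↭ (↭-sym S↭) q) }
     ... | b , c = subst₂ _≤_ (sym bnd) (cong (_+ 2) (sym (def′ ne))) (s≤s b) ,
       λ q → ∈-++⁺ʳ (en (suc N) (suc k) j r xs cs) (∈-++⁺ˡ (∈-concatMap (mergeBlock N k j r xs) p
         (subst (_∈ mergeBlock N k j r xs (i , ws , cs′)) (ins-ins k i r t) (∈-map⁺ (ins k i r) (c (ℕP.suc-injective (cong (_+ 2) (sym (def′ ne)) ∙ (q ∙ bnd))))))))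
       where
       bnd : bound r xs cs ≡ suc (bound r (xs ++ i ∷ ws) cs′)
       bnd = cong₂ (λ a b → a + suc b) (↭-length (points-merge r xs cs p)) (merges-length cs p) ∙ ℕP.+-suc (length (points r (xs ++ i ∷ ws) cs′)) (suc (length cs′))

     split : i ≢ r → ∀ {ys zs} → (ys , i , zs) ∈ splitsOf xs → Complete (suc N) k (suc j) r xs cs t
     split ne {ys} {zs} s with bool-cases (orb t′ r i)
     -- The tuple stays connected although its product gained a cycle, so the genus drops: the bound
     -- for `t′` is larger by 1 while its deficiency is smaller by 1. Hence t strictly exceeds its
     -- bound and is not minimal.
     ... | inj₁ joined = ℕP.≤-trans (ℕP.n≤1+n _) strict , λ q → contradiction strict (subst (λ z → ¬ (suc (bound r xs cs) ≤ z)) (sym q) ℕP.1+n≰n)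
       where
       xs≡ = splitsOf-sound xs s
       all = (r ∷ ys) ∷ (i ∷ zs) ∷ cs
       S≡ : S ≡ concat all
       S≡ = cong (λ l → points r l cs) xs≡ ∙ cong (r ∷_) (++-assoc ys (i ∷ zs) (concat cs))
       f′ : Factorisation (suc k) r ys ((i ∷ zs) ∷ cs) t′
       f′ = record { len = len′ ; inj = inj′ ; supp = subst (λ S → SupportedOn S t′) S≡ supp′ ; fix = fix′
         ; prod = cycles-split prod′ (subst (λ l → Cycles (app (prodₚ t)) ((r ∷ l) ∷ cs)) xs≡ FT.prod)
         ; conn = λ φ h {y} q → FT.conn φ (lift φ h (orb-min φ t′ r h joined)) (subst (y ∈_) (sym S≡) q) }
       strict : suc (bound r xs cs) ≤ deficiencies t + 2
       strict = ℕP.≤-trans (subst (_≤ deficiencies t′ + 2) (cong (_+ suc (suc (length cs))) (cong length (sym S≡)) ∙ ℕP.+-suc (length S) (suc (length cs)))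
           (proj₁ (IH r ys ((i ∷ zs) ∷ cs) t′ (next e) f′ (subst (λ S → length S ≤ suc N) S≡ le))))
         (subst (λ z → deficiencies t′ + 2 ≤ z + 2) (sym (def′ ne)) (ℕP.n≤1+n (deficiencies t′ + 2)))
     ... | inj₂ apart = bnd≤ , λ q → mem (sums-tight (proj₁ cB) (proj₁ cC) (total q))
       where
       ψ = orb t′ r
       ψ-inv : Invariant ψ t′
       ψ-inv = orb-invariant t′ r inj′
       ψr : ψ r ≡ true
       ψr = orb-r t′ r
       ψ-not : Invariant (not ∘ ψ) t′
       ψ-not = not-invariant ψ t′ ψ-inv
       xs≡ = splitsOf-sound xs s
       all = (r ∷ ys) ∷ (i ∷ zs) ∷ cs
       S≡ : S ≡ concat all
       S≡ = cong (λ l → points r l cs) xs≡ ∙ cong (r ∷_) (++-assoc ys (i ∷ zs) (concat cs))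
       prod″ : Cycles (app (prodₚ t′)) all
       prod″ = cycles-split prod′ (subst (λ l → Cycles (app (prodₚ t)) ((r ∷ l) ∷ cs)) xs≡ FT.prod)
       tB = restrict ψ t′
       tC = restrict (not ∘ ψ) t′
       β = select ψ cs
       γ = select (not ∘ ψ) cs
       p : (β , γ) ∈ shuffles cs
       p = select-shuffles (app (prodₚ t′)) ψ cs (All.tail (All.tail (cyc prod″)))
       allB : select ψ all ≡ (r ∷ ys) ∷ β
       allB = select-true ψ r ys ((i ∷ zs) ∷ cs) ψr ∙ cong ((r ∷ ys) ∷_) (select-false ψ i zs cs apart)
       allC : select (not ∘ ψ) all ≡ (i ∷ zs) ∷ γ
       allC = select-false (not ∘ ψ) r ys ((i ∷ zs) ∷ cs) (cong not ψr) ∙ select-true (not ∘ ψ) i zs cs (cong not apart)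
       supp″ : SupportedOn (concat all) t′
       supp″ = subst (λ S → SupportedOn S t′) S≡ supp′
       S↭ : S ↭ points r ys β ++ points i zs γ
       S↭ = subst (λ l → points r l cs ↭ points r ys β ++ points i zs γ) (sym xs≡) (points-split r ys i zs cs p)
       inB : ∀ {y} → y ∈ points r ys β → ψ y ≡ true
       inB {y} q = select-φ ψ (app (prodₚ t′)) (prod-invariant ψ t′ ψ-inv) all (cyc prod″) (subst (λ l → y ∈ concat l) (sym allB) q)
       inC : ∀ {y} → y ∈ points i zs γ → not (ψ y) ≡ true
       inC {y} q = select-φ (not ∘ ψ) (app (prodₚ t′)) (prod-invariant (not ∘ ψ) t′ ψ-not) all (cyc prod″) (subst (λ l → y ∈ concat l) (sym allC) q)
       connB : ∀ φ → Invariant φ tB → ∀ {y} → y ∈ points r ys β → φ y ≡ φ r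
       connB φ h {y} q = sym (blend-true ψ φ (φ r) {y} (inB q)) ∙ (orb-min χ t′ r (blend-invariant ψ φ (φ r) t′ ψ-inv h) (inB q) ∙ blend-true ψ φ (φ r) {r} ψr)
         where χ = blend ψ φ (φ r)
       -- In t the piece of i is attached to r through (i r). The extension takes the value φ i on
       -- the piece of r, so it agrees at i and r and is invariant under t, whose connectedness then
       -- applies.
       connC : ∀ φ → Invariant φ tC → ∀ {y} → y ∈ points i zs γ → φ y ≡ φ i
       connC φ h {y} q = sym (blend-true (not ∘ ψ) φ (φ i) {y} (inC q)) ∙ (FT.conn χ (lift χ (blend-invariant (not ∘ ψ) φ (φ i) t′ ψ-not h) (χi ∙ sym χr)) (∈-resp-↭ (↭-sym S↭) (∈-++⁺ʳ (points r ys β) q)) ∙ χr)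
         where
         χ = blend (not ∘ ψ) φ (φ i)
         χi : χ i ≡ φ i
         χi = blend-true (not ∘ ψ) φ (φ i) {i} (cong not apart)
         χr : χ r ≡ φ i
         χr = blend-false (not ∘ ψ) φ (φ i) {r} (cong not ψr)
       fB : Factorisation (suc k) r ys β tB
       fB = record { len = length-map (restrictₚ ψ) t′ ∙ len′ ; inj = restrict-All-inj ψ t′ inj′ ψ-inv
         ; supp = subst (λ l → SupportedOn (concat l) tB) allB (select-supported ψ t′ all ψ-inv prod″ supp″)
         ; fix = restrict-fix ψ (suc k) r t′ ψr fix′ ; prod = subst (Cycles (app (prodₚ tB))) allB (select-cycles ψ t′ all ψ-inv prod″) ; conn = connB }
       fC : Factorisation 0 i zs γ tC
       fC = record { len = length-map (restrictₚ (not ∘ ψ)) t′ ∙ len′ ; inj = restrict-All-inj (not ∘ ψ) t′ inj′ ψ-not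
         ; supp = subst (λ l → SupportedOn (concat l) tC) allC (select-supported (not ∘ ψ) t′ all ψ-not prod″ supp″)
         ; fix = tt ; prod = subst (Cycles (app (prodₚ tC))) allC (select-cycles (not ∘ ψ) t′ all ψ-not prod″) ; conn = connC }
       lengths : length S ≡ length (points r ys β) + length (points i zs γ)
       lengths = ↭-length S↭ ∙ length-++ (points r ys β)
       cB : Complete (suc N) (suc k) j r ys β tB
       cB = IH r ys β tB (next e) fB (ℕP.≤-trans (subst (length (points r ys β) ≤_) (sym lengths) (ℕP.m≤m+n _ _)) le)
       cC : Complete N 0 m i zs γ tC
       cC = IHC i zs γ tC fC (ℕP.≤-pred (ℕP.≤-trans (subst (suc (length (points i zs γ)) ≤_) (sym lengths) (s≤s (ℕP.m≤n+m (length (points i zs γ)) (length (ys ++ concat β))))) le))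
       bounds : bound r ys β + bound i zs γ ≡ suc (bound r xs cs)
       bounds = inter (length (points r ys β)) (length (points i zs γ)) (length β) (length γ) ∙ cong₂ (λ a b → suc (a + suc b)) (sym lengths) (shuffles-length cs p)
         where inter : ∀ a b c d → (a + suc c) + (b + suc d) ≡ suc ((a + b) + suc (c + d))
               inter = solve-∀
       defs : suc (deficiencies t + 2) ≡ (deficiencies tB + 2) + (deficiencies tC + 2)
       defs = cong (λ z → suc (z + 2)) (def′ ne ∙ cong suc (deficiencies-restrict ψ t′ inj′ ψ-inv)) ∙ inter (deficiencies tB) (deficiencies tC)
         where inter : ∀ a b → suc (suc (a + b) + 2) ≡ (a + 2) + (b + 2)
               inter = solve-∀
       bnd≤ : bound r xs cs ≤ deficiencies t + 2
       bnd≤ = ℕP.≤-pred (subst₂ _≤_ bounds (sym defs) (ℕP.+-mono-≤ (proj₁ cB) (proj₁ cC)))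
       total : deficiencies t + 2 ≡ bound r xs cs → (deficiencies tB + 2) + (deficiencies tC + 2) ≡ bound r ys β + bound i zs γ
       total q = sym defs ∙ (cong suc q ∙ sym bounds)
       mem : deficiencies tB + 2 ≡ bound r ys β × deficiencies tC + 2 ≡ bound i zs γ → t ∈ en (suc N) k (suc j) r xs cs
       mem (qB , qC) = ∈-++⁺ʳ (en (suc N) (suc k) j r xs cs) (∈-++⁺ʳ (concatMap (mergeBlock N k j r xs) (merges cs)) (∈-concatMap (splitBlock N k j r cs) s
         (subst (_∈ splitBlock N k j r cs (ys , i , zs)) (ins-ins k i r t) (∈-map⁺ (ins k i r) (∈-concatMap (glueBlock N k j r ys i zs) p
           (∈-concatMap (λ tB → map (glue tB) (en N 0 m i zs γ)) (proj₂ cB qB) (subst (_∈ map (glue tB) (en N 0 m i zs γ)) (glue-restrict ψ t′ ψ-inv) (∈-map⁺ (glue tB) (proj₂ cC qC)))))))))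

     complete-step : Complete (suc N) k (suc j) r xs cs t
     complete-step with i ≟ r
     ... | yes eq = stay eq
     ... | no ne with i∈S
     ... | here eq = contradiction eq ne
     ... | there q with ∈-++⁻ xs q
     ... | inj₁ q₁ = let _ , _ , s = splitsOf-∈ q₁ in split ne s
     ... | inj₂ q₂ = let _ , _ , p = merges-∈ {cs = cs} q₂ in merge ne p

   -- The first component is the Riemann–Hurwitz bound (nonnegative genus).
   complete : ∀ N k j r xs cs t → k + j ≡ m → Factorisation k r xs cs t → length (points r xs cs) ≤ N → Complete N k j r xs cs t
   complete N k zero r xs cs t e f le = complete-base N k r xs cs t (sym (ℕP.+-identityʳ k) ∙ e) f
   complete (suc N) k (suc j) r xs cs t e f le =
     Step.complete-step N k j (complete (suc N) (suc k) j) (λ r xs cs t → complete N 0 m r xs cs t refl) r xs cs t e f le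

-- The count of the theorem is the solution of the recursion

module Counts where
 open import Defs
 open Binomials
 open MultiplicativeFamilies hiding (here; there; _∙_)
 open StepSeries
 open EulerOperator
 open Residues
 open Recursion
 open CycleLists
 open CycleTypes
 open Transitivity
 open Tuples
 open TupleCompleteness
 open import Data.Nat using (ℕ; zero; suc; z≤n; s≤s; _+_; _*_; _∸_; _≤_; _≡ᵇ_)
 import Data.Nat.Properties as ℕP
 import Data.Nat.Tactic.RingSolver as ℕR
 open import Data.Integer using (ℤ; +_; 0ℤ; 1ℤ)
 import Data.Integer as ℤ
 import Data.Integer.Properties as ℤP
 open import Data.Bool using (Bool; true; false; _∧_)
 open import Data.List using (List; []; _∷_; length; map; _++_; concat; concatMap; allFin; filterᵇ; take; drop)
 open import Data.List.Properties using (length-map; length-++; take++drop≡id; length-take; length-drop)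
 open import Data.Nat.ListAction using (sum)
 open import Data.List.Relation.Unary.All using (All; []; _∷_)
 import Data.List.Relation.Unary.All as All
 import Data.List.Relation.Unary.All.Properties as AllP
 open import Data.List.Relation.Unary.Any using (here; there)
 open import Data.List.Relation.Unary.AllPairs using ([]; _∷_)
 open import Data.List.Relation.Unary.Unique.Propositional using (Unique)
 open import Data.List.Relation.Unary.Unique.Propositional.Properties using (Unique[x∷xs]⇒x∉xs; allFin⁺) renaming (filter⁺ to unique-filter)
 open import Data.List.Membership.Propositional using (_∈_)
 open import Data.List.Membership.Propositional.Properties
 open import Data.List.Relation.Binary.Permutation.Propositional using (_↭_; ↭-refl; ↭-trans; prep; swap; refl; trans)
 open import Data.List.Relation.Binary.Permutation.Propositional.Properties using (∈-resp-↭; ↭-length)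
 open import Data.Fin using (Fin)
 import Data.Vec as Vec
 open import Data.Vec using (Vec; lookup)
 open import Data.Vec.Properties using (lookup∘tabulate)
 open import Data.Product using (_×_; _,_; ∃₂; proj₁; proj₂)
 import Data.Sum
 open import Data.Unit using (tt)
 open import Function using (_∘_)
 open import Relation.Binary.PropositionalEquality hiding ([_]) renaming (trans to _∙_)
 open import Relation.Nullary using (contradiction)
 open import Data.Bool.Properties using (T?)

 private variable
   A B : Set

 unique-concatMap-∷ : ∀ {X Y : Set} (_◁_ : X → Y → B) → (∀ {x x′ y y′} → x ◁ y ≡ x′ ◁ y′ → x ≡ x′ × y ≡ y′) →
   {xs : List X} {ys : List Y} → Unique xs → Unique ys → Unique (concatMap (λ x → map (x ◁_) ys) xs)
 unique-concatMap-∷ _◁_ inj {[]} _ _ = []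
 unique-concatMap-∷ _◁_ inj {x ∷ xs} {ys} (a ∷ u) v = unique-++ (unique-map (x ◁_) (λ _ _ e → proj₂ (inj e)) v) (unique-concatMap-∷ _◁_ inj u v)
   λ p q → let _ , _ , e = ∈-map⁻ (x ◁_) p
               x′ , x′∈ , q′ = ∈-concatMap-inv (λ x → map (x ◁_) ys) {xs = xs} q
               _ , _ , e′ = ∈-map⁻ (x′ ◁_) q′
           in All.lookup a x′∈ (proj₁ (inj (sym e ∙ e′)))

 vecs-unique : ∀ n k → Unique (vecs {n} k)
 vecs-unique n zero = [] ∷ []
 vecs-unique n (suc k) = unique-concatMap-∷ Vec._∷_ (λ { refl → refl , refl }) (allFin⁺ n) (vecs-unique n k)

 vecs-∈ : ∀ n k (v : Vec (Fin n) k) → v ∈ vecs k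
 vecs-∈ n zero Vec.[] = here refl
 vecs-∈ n (suc k) (i Vec.∷ v) = ∈-concatMap (λ i → map (i Vec.∷_) (vecs k)) (∈-allFin i) (∈-map⁺ (i Vec.∷_) (vecs-∈ n k v))

 perms-unique : ∀ n → Unique (perms n)
 perms-unique n = unique-filter (T? ∘ isPermᵇ) (vecs-unique n n)

 perms-∈ : ∀ {n} {σ : Perm n} → Inj σ → σ ∈ perms n
 perms-∈ {n} {σ} i = filterᵇ-∈ isPermᵇ (vecs-∈ n n σ) (isPerm-true i)

 perms-∈⁻ : ∀ {n} {σ : Perm n} → σ ∈ perms n → Inj σ
 perms-∈⁻ {n} p = isPerm-true⁻ (proj₂ (filterᵇ-∈⁻ isPermᵇ {xs = vecs n} p))

 tuples-unique : ∀ k {xs : List A} → Unique xs → Unique (tuples k xs)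
 tuples-unique zero u = [] ∷ []
 tuples-unique (suc k) u = unique-concatMap-∷ _∷_ (λ { refl → refl , refl }) u (tuples-unique k u)

 tuples-∈ : ∀ {xs : List A} t → All (_∈ xs) t → t ∈ tuples (length t) xs
 tuples-∈ [] [] = here refl
 tuples-∈ {xs = xs} (x ∷ t) (p ∷ ps) = ∈-concatMap (λ x → map (x ∷_) (tuples (length t) xs)) p (∈-map⁺ (x ∷_) (tuples-∈ t ps))

 tuples-∈⁻ : ∀ k {xs : List A} {t} → t ∈ tuples k xs → length t ≡ k × All (_∈ xs) t
 tuples-∈⁻ zero (here refl) = refl , []
 tuples-∈⁻ (suc k) {xs} p with ∈-concatMap-inv (λ x → map (x ∷_) (tuples k xs)) {xs = xs} p
 ... | x , x∈ , q with ∈-map⁻ (x ∷_) q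
 ... | t , t∈ , refl = let e , a = tuples-∈⁻ k t∈ in cong suc e , x∈ ∷ a

 permEq-true : ∀ {n} {σ τ : Perm n} → σ ≡ τ → permEqᵇ σ τ ≡ true
 permEq-true {n} {σ} refl = all-true _ (allFin n) (λ {x} _ → finEq-true {i = app σ x} refl)

 permEq-true⁻ : ∀ {n} {σ τ : Perm n} → permEqᵇ σ τ ≡ true → σ ≡ τ
 permEq-true⁻ {n} {σ} {τ} e = perm-ext λ x → finEq-true⁻ {i = app σ x} {app τ x} (all-true⁻ _ (allFin n) e (∈-allFin x))

 module _ {n : ℕ} where

   deficiencies-numCycles : ∀ (t : List (Perm n)) → All Inj t → deficiencies t + sum (map numCycles t) ≡ length t * n
   deficiencies-numCycles [] [] = refl
   deficiencies-numCycles (σ ∷ t) (p ∷ ps) = inter (deficiency σ) (numCycles σ) (deficiencies t) (sum (map numCycles t)) ∙ cong₂ _+_ (ℕP.m∸n+n≡m (numCycles≤ p)) (deficiencies-numCycles t ps)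
     where inter : ∀ a b c d → (a + c) + (b + d) ≡ (a + b) + (c + d)
           inter = ℕR.solve-∀

   -- Each cycle grows from a fixed point by transpositions that put a new point in front, so
   -- `cycles-merge` verifies the construction.
   build : List (List (Fin n)) → Perm n
   build [] = idₚ
   build ([] ∷ cs) = build cs
   build ((x ∷ ws) ∷ cs) = link x ws
     where link : Fin n → List (Fin n) → Perm n
           link x [] = build cs
           link x (y ∷ ws) = swapₚ y x ∘ₚ link y ws

   build-cycles : ∀ cs → Unique (concat cs) → All (λ c → 1 ≤ length c) cs → Inj (build cs) × Cycles (app (build cs)) cs
   build-cycles [] u _ = mkInj (λ {x} {y} e → sym (lookup∘tabulate (λ x → x) x) ∙ (e ∙ lookup∘tabulate (λ x → x) y)) , cycles [] [] (λ {x} _ → lookup∘tabulate (λ x → x) x)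
   build-cycles ((x ∷ []) ∷ cs) (a ∷ u) (_ ∷ ps) =
     let i , c = build-cycles cs u ps
     in i , cycles (fixes c (Unique[x∷xs]⇒x∉xs (a ∷ u)) ∷ cyc c) (a ∷ u) (λ y∉ → fixes c (λ q → y∉ (there q)))
   build-cycles ((x ∷ y ∷ ws) ∷ cs) (a ∷ u) (_ ∷ ps) =
     let i , c = build-cycles ((y ∷ ws) ∷ cs) u (s≤s z≤n ∷ ps)
     in swap-inj y x i , cycles-merge {xs = []} (app-swap y x (build ((y ∷ ws) ∷ cs)))
          (cycles (fixes c (Unique[x∷xs]⇒x∉xs (a ∷ u)) ∷ cyc c) (a ∷ u) (λ z∉ → fixes c (λ q → z∉ (there q))))

   cyc-determined : ∀ f g cs → All (Cyc {n} f) cs → All (Cyc g) cs → ∀ {x} → x ∈ concat cs → f x ≡ g x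
   cyc-determined f g ((a ∷ xs) ∷ cs) (p ∷ ps) (q ∷ qs) z with ∈-++⁻ (a ∷ xs) z
   ... | Data.Sum.inj₁ z₁ = chain a xs p q z₁
     where
     chain : ∀ a xs {z} → Chain {n} f a xs z → Chain g a xs z → ∀ {x} → x ∈ a ∷ xs → f x ≡ g x
     chain a [] p q (here refl) = p ∙ sym q
     chain a (b ∷ xs) (p , _) (q , _) (here refl) = p ∙ sym q
     chain a (b ∷ xs) (_ , p) (_ , q) (there z) = chain b xs p q z
   ... | Data.Sum.inj₂ z₂ = cyc-determined f g cs ps qs z₂

   total-↭ : ∀ {cs ds : List (List (Fin n))} → cs ↭ ds → Total cs → Total ds
   total-↭ p t x = ∈-resp-↭ (concat-↭ p) (t x)

 module Counting (m₁ : ℕ) {n : ℕ} where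
   m = suc (suc m₁)
   open Count m
   open Enumeration {n} m
   open Completeness {n} m

   private
     -- Since deficiencies and cycle numbers add up to m n, the prescribed total number of cycles is
     -- the genus 0 equation for deficiencies. The truncated subtraction is exact because l ≤ n.
     exponent : ∀ d c l → d + c ≡ m * n → l ≤ n → (d + 2 ≡ n + l → c ≡ xexp m n l) × (c ≡ xexp m n l → d + 2 ≡ n + l)
     exponent d c l e l≤ = (λ q → ℕP.+-cancelʳ-≡ l c (xexp m n l) (to q ∙ sym x+l)) , from
       where
       big : l ≤ suc m₁ * n + 2
       big = ℕP.≤-trans l≤ (ℕP.≤-trans (ℕP.m≤m+n n (m₁ * n)) (ℕP.m≤m+n (suc m₁ * n) 2))
       x+l : xexp m n l + l ≡ suc m₁ * n + 2
       x+l = ℕP.m∸n+n≡m big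
       to : d + 2 ≡ n + l → c + l ≡ suc m₁ * n + 2
       to q = ℕP.+-cancelˡ-≡ n _ _ (rearr₁ n c l ∙ (cong (_+ c) (sym q) ∙ (rearr₂ d c ∙ (cong (_+ 2) e ∙ ℕP.+-assoc n (suc m₁ * n) 2))))
         where rearr₁ : ∀ n c l → n + (c + l) ≡ n + l + c
               rearr₁ = ℕR.solve-∀
               rearr₂ : ∀ d c → d + 2 + c ≡ d + c + 2
               rearr₂ = ℕR.solve-∀
       from : c ≡ xexp m n l → d + 2 ≡ n + l
       from q = ℕP.+-cancelʳ-≡ c _ _ (rearr₁ d c ∙ (cong (_+ 2) e ∙ (ℕP.+-assoc n (suc m₁ * n) 2 ∙ (cong (λ z → n + z) (sym x+l ∙ cong (_+ l) (sym q)) ∙ rearr₂ n c l))))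
         where rearr₁ : ∀ d c → d + 2 + c ≡ d + c + 2
               rearr₁ = ℕR.solve-∀
               rearr₂ : ∀ n c l → n + (c + l) ≡ n + l + c
               rearr₂ = ℕR.solve-∀

   -- The filtered tuples and the enumeration are lists without repetition and with the same
   -- members, by soundness and completeness; hence they have equal length.
   Gcount-F : ∀ N (π : Perm n) r xs cs α → Cycles (app π) ((r ∷ xs) ∷ cs) → Total ((r ∷ xs) ∷ cs) → length α ≡ suc (length cs) → n ≤ N →
              Gcount m n π α ≡ F N m (length xs) (map length cs)
   Gcount-F N π r xs cs α c tot lα n≤N = ↭-length (unique-set-↭ (unique-filter (T? ∘ P) (tuples-unique m (perms-unique n))) (unique N 0 m r xs cs refl (uniq c)) to from) ∙ length-en N 0 m r xs cs
     where
     P : List (Perm n) → Bool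
     P t = permEqᵇ (prodₚ t) π ∧ transitiveᵇ t ∧ (sum (map numCycles t) ≡ᵇ xexp m n (length α))
     size : length (points r xs cs) ≡ n
     size = total-length (uniq c) tot
     l≤n : suc (length cs) ≤ n
     l≤n = subst (suc (length cs) ≤_) (excess-length (app π) ((r ∷ xs) ∷ cs) (cyc c) ∙ size) (ℕP.m≤n+m (suc (length cs)) (excess ((r ∷ xs) ∷ cs)))
     exps : ∀ t → length t ≡ m → All Inj t → (deficiencies t + 2 ≡ n + suc (length cs) → sum (map numCycles t) ≡ xexp m n (suc (length cs))) × (sum (map numCycles t) ≡ xexp m n (suc (length cs)) → deficiencies t + 2 ≡ n + suc (length cs))
     exps t len i = exponent (deficiencies t) (sum (map numCycles t)) (suc (length cs)) (deficiencies-numCycles t i ∙ cong (_* n) len) l≤n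
     to : ∀ {t} → t ∈ filterᵇ P (tuples m (perms n)) → t ∈ en N 0 m r xs cs
     to {t} q with filterᵇ-∈⁻ P {xs = tuples m (perms n)} q
     ... | t∈ , e with tuples-∈⁻ m t∈
     ... | len , t-perms = proj₂ (complete N 0 m r xs cs t refl fact (subst (_≤ N) (sym size) n≤N))
           (proj₂ (exps t len inj′) (≡ᵇ-true⁻ _ _ (proj₂ (∧-true {transitiveᵇ t} (proj₂ (∧-true {permEqᵇ (prodₚ t) π} e)))) ∙ cong (xexp m n) lα) ∙ cong (_+ suc (length cs)) (sym size))
       where
       inj′ : All Inj t
       inj′ = All.map perms-∈⁻ t-perms
       prod≡ : prodₚ t ≡ π
       prod≡ = permEq-true⁻ (proj₁ (∧-true {permEqᵇ (prodₚ t) π} e))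
       fact : Factorisation 0 r xs cs t
       fact = record { len = len ; inj = inj′ ; supp = All.map (λ _ {x} x∉ → contradiction (tot x) x∉) inj′ ; fix = tt
         ; prod = subst (λ σ → Cycles (app σ) ((r ∷ xs) ∷ cs)) (sym prod≡) c
         ; conn = λ φ h {y} _ → transitive-true⁻ t (proj₁ (∧-true {transitiveᵇ t} (proj₂ (∧-true {permEqᵇ (prodₚ t) π} e)))) φ h y r }
     from : ∀ {t} → t ∈ en N 0 m r xs cs → t ∈ filterᵇ P (tuples m (perms n))
     from {t} q with sound N 0 m r xs cs refl (uniq c) q
     ... | f , e = filterᵇ-∈ P (subst (λ l → t ∈ tuples l (perms n)) FT.len (tuples-∈ t (All.map perms-∈ FT.inj))) Pt
       where
       module FT = Factorisation f
       conn : ∀ φ → Invariant φ t → ∀ x y → φ x ≡ φ y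
       conn φ h x y = FT.conn φ h (tot x) ∙ sym (FT.conn φ h (tot y))
       agree : ∀ x → app (prodₚ t) x ≡ app π x
       agree x = cyc-determined (app (prodₚ t)) (app π) ((r ∷ xs) ∷ cs) (cyc FT.prod) (cyc c) (tot x)
       Pt : P t ≡ true
       Pt = cong₂ _∧_ (permEq-true {σ = prodₚ t} {π} (perm-ext agree)) (cong₂ _∧_ (transitive-true t FT.inj conn)
         (≡ᵇ-true (proj₁ (exps t FT.len FT.inj) (e ∙ cong (_+ suc (length cs)) size) ∙ cong (xexp m n) (sym lα))))

 chunks : List ℕ → List A → List (List A)
 chunks [] L = []
 chunks (c ∷ α) L = take c L ∷ chunks α (drop c L)

 concat-chunks : ∀ α (L : List A) → sum α ≡ length L → concat (chunks α L) ≡ L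
 concat-chunks [] [] _ = refl
 concat-chunks (c ∷ α) L e = cong (take c L ++_) (concat-chunks α (drop c L) (sym (ℕP.m+n∸m≡n c (sum α)) ∙ (cong (_∸ c) e ∙ sym (length-drop c L)))) ∙ take++drop≡id c L

 length-chunks : ∀ α (L : List A) → sum α ≡ length L → map length (chunks α L) ≡ α
 length-chunks [] L _ = refl
 length-chunks (c ∷ α) L e = cong₂ _∷_ (length-take c L ∙ ℕP.m≤n⇒m⊓n≡m (subst (c ≤_) e (ℕP.m≤m+n c (sum α))))
   (length-chunks α (drop c L) (sym (ℕP.m+n∸m≡n c (sum α)) ∙ (cong (_∸ c) e ∙ sym (length-drop c L))))

 pick-map⁻ : ∀ (f : A → B) xs {c β} → Pick c β (map f xs) → ∃₂ λ x ys → Pick x ys xs × f x ≡ c × map f ys ≡ β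
 pick-map⁻ f (x ∷ xs) MultiplicativeFamilies.here = x , xs , MultiplicativeFamilies.here , refl , refl
 pick-map⁻ f (x ∷ xs) (MultiplicativeFamilies.there p) = let y , ys , q , e , e′ = pick-map⁻ f xs p in y , x ∷ ys , MultiplicativeFamilies.there q , e , cong (f x ∷_) e′

 pick-↭ : ∀ {c : A} {β α} → Pick c β α → α ↭ c ∷ β
 pick-↭ MultiplicativeFamilies.here = ↭-refl
 pick-↭ {c = c} (MultiplicativeFamilies.there {d = d} p) = ↭-trans (prep _ (pick-↭ p)) (swap _ _ ↭-refl)

 module Roots (m₁ : ℕ) where
   open Link m₁ using (RootIndependent; F; degree; F-formula)

   -- For one fixed permutation of type α the tuples are counted without reference to a root, and
   -- every choice of a root cycle computes this same number.
   root-independent : RootIndependent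
   root-independent N α pos le c β c′ β′ p p′ = sym (value c β p) ∙ value c′ β′ p′
     where
     n = sum α
     cs = chunks α (allFin n)
     size : sum α ≡ length (allFin n)
     size = sym (length-allFin {n})
     all≡ : concat cs ≡ allFin n
     all≡ = concat-chunks α (allFin n) size
     lengths : map length cs ≡ α
     lengths = length-chunks α (allFin n) size
     built = build-cycles cs (subst Unique (sym all≡) (allFin⁺ n)) (AllP.map⁻ (subst (All (1 ≤_)) (sym lengths) pos))
     π = build cs
     value : ∀ c β → Pick (suc c) β α → Gcount (suc (suc m₁)) n π α ≡ F N (suc (suc m₁)) c β
     value c β p with pick-map⁻ length cs (subst (Pick (suc c) β) (sym lengths) p)
     ... | r ∷ xs , ds , q , refl , refl = Counting.Gcount-F m₁ N π r xs ds α (cycles-↭ (pick-↭ q) (proj₂ built))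
            (total-↭ (pick-↭ q) (λ x → subst (x ∈_) (sym all≡) (∈-allFin x))) (cong length (sym lengths) ∙ (length-map length cs ∙ ↭-length (pick-↭ q))) le

 insert-↭ : ∀ x ys → insert x ys ↭ x ∷ ys
 insert-↭ x [] = ↭-refl
 insert-↭ x (y ∷ ys) with x Data.Nat.≤ᵇ y
 ... | true = ↭-refl
 ... | false = ↭-trans (prep y (insert-↭ x ys)) (swap y x ↭-refl)

 isort-↭ : ∀ xs → isort xs ↭ xs
 isort-↭ [] = ↭-refl
 isort-↭ (x ∷ xs) = ↭-trans (insert-↭ x (isort xs)) (prep x (isort-↭ xs))

 sum-↭ : ∀ {α β} → α ↭ β → sum α ≡ sum β
 sum-↭ refl = refl
 sum-↭ (prep x p) = cong (λ z → x + z) (sum-↭ p)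
 sum-↭ (swap x y p) = sym (ℕP.+-assoc x y _) ∙ (cong₂ _+_ (ℕP.+-comm x y) (sum-↭ p) ∙ ℕP.+-assoc y x _)
 sum-↭ (trans p q) = sum-↭ p ∙ sum-↭ q

 module Formula (m₁ : ℕ) where
   open Solution m₁
   open Coefficients m₁
   open Residue m₁
   open Link m₁ using (F; degree; F-formula)

   Ψ-↭ : ∀ {α β} → α ↭ β → Ψ α ≡ Ψ β
   Ψ-↭ refl = refl
   Ψ-↭ (prep x p) = cong (ψ x ℤ.*_) (Ψ-↭ p)
   Ψ-↭ (swap x y p) = sym (ℤP.*-assoc (ψ x) (ψ y) _) ∙ (cong₂ ℤ._*_ (ℤP.*-comm (ψ x) (ψ y)) (Ψ-↭ p) ∙ ℤP.*-assoc (ψ y) (ψ x) _)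
   Ψ-↭ (trans p q) = Ψ-↭ p ∙ Ψ-↭ q

   ρ-↭ : ∀ t {α β} → α ↭ β → ρ t α ≡ ρ t β
   ρ-↭ t {[]} {[]} p = refl
   ρ-↭ t {[]} {_ ∷ _} p with () ← ↭-length p
   ρ-↭ t {_ ∷ _} {[]} p with () ← ↭-length p
   ρ-↭ t {c ∷ α} {e ∷ β} p = cong₂ ℤ._*_ (Ψ-↭ p) (cong₂ (λ s l → t ℤ.* ff (D ℤ.* + s ℤ.+ t ℤ.- 1ℤ) l) (sum-↭ p) (ℕP.suc-injective (↭-length p)))

   -- D Q is a difference of values of ρ, and these depend only on the product of the ψ, the size
   -- and the length.
   Q-↭ : ∀ {α β} → α ↭ β → Q α ≡ Q β
   Q-↭ {α} {β} p = cancel D (+suc≢0 m₁) (D·Q α ∙ (cong₂ ℤ._-_ (ρ-↭ 1ℤ p) (ρ-↭ 0ℤ p) ∙ sym (D·Q β)))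

   degree-↭ : ∀ {α β} → α ↭ β → degree α ≡ degree β
   degree-↭ p = cong₂ (λ s l → D ℤ.* + s ℤ.- + l ℤ.+ 1ℤ ℤ.+ 1ℤ) (sum-↭ p) (↭-length p)

   G-formula : ∀ {n} (π : Perm (suc n)) α → Inj π → cycleType π ≡ α →
               degree α ℤ.* (+ sum α ℤ.* + Gcount (suc (suc m₁)) (suc n) π α) ≡ mm ℤ.* Q α
   G-formula {n} π α i refl with cyclesOf (app π) (injective i)
   ... | [] , c , t with () ← t Data.Fin.zero
   ... | [] ∷ _ , c , _ with () ← All.head (cyc c)
   ... | ((r ∷ xs) ∷ cs) , c , t = cong₂ ℤ._*_ (degree-↭ α↭) (cong₂ ℤ._*_ (cong +_ (sum-↭ α↭)) (cong +_ (Counting.Gcount-F m₁ (suc n) π r xs cs α c t (↭-length α↭ ∙ cong suc (length-map length cs)) ℕP.≤-refl)))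
       ∙ (F-formula (Roots.root-independent m₁) (suc n) (length xs) (map length cs) positive (ℕP.≤-reflexive size) ∙ cong (mm ℤ.*_) (sym (Q-↭ α↭)))
     where
     α↭ : α ↭ map length ((r ∷ xs) ∷ cs)
     α↭ = ↭-trans (isort-↭ (map (orbitLen π) (leaders π))) (leaders-↭ π c t)
     nonempty : ∀ {cs} → All (Cyc (app π)) cs → Positive (map length cs)
     nonempty {[]} [] = []
     nonempty {(x ∷ c) ∷ cs} (_ ∷ ps) = s≤s z≤n ∷ nonempty ps
     positive : Positive (map length cs)
     positive = nonempty (All.tail (cyc c))
     sum-length : ∀ (cs : List (List (Fin (suc n)))) → sum (map length cs) ≡ length (concat cs)
     sum-length [] = refl
     sum-length (c ∷ cs) = cong (λ z → length c + z) (sum-length cs) ∙ sym (length-++ c)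
     size : sum (map length ((r ∷ xs) ∷ cs)) ≡ suc n
     size = sum-length ((r ∷ xs) ∷ cs) ∙ total-length (uniq c) t

-- The quadratic identity for Q

module QuadraticIdentity where
 open Binomials
 open MultiplicativeFamilies
 open StepSeries
 open EulerOperator
 open Residues
 open WalkLemma
 open Recursion
 open import Data.Integer using (ℤ; +_; _+_; _*_; -_; _-_; 0ℤ; 1ℤ)
 open import Data.Integer.Properties hiding (_≟_; _<?_)
 open import Data.Integer.Tactic.RingSolver using (solve-∀)
 open import Data.Nat using (ℕ; suc)
 import Data.Nat as ℕ
 import Data.Nat.Properties as ℕP
 open import Data.List using (List; []; _∷_; length)
 open import Data.List.Relation.Unary.All using (All; []; _∷_)
 import Data.List.Relation.Unary.All as All
 open import Data.Nat.ListAction using (sum)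
 open import Data.Product using (_×_; _,_)
 open import Relation.Binary.PropositionalEquality
 open import Relation.Nullary using (¬_)
 open ≡-Reasoning
 open PS using (_×ₛ_)
 open Sh using (_⋆_)

 sumList-* : ∀ {A : Set} x (φ : A → ℤ) xs → sumList (λ y → x * φ y) xs ≡ x * sumList φ xs
 sumList-* x φ [] = sym (*-zeroʳ x)
 sumList-* x φ (y ∷ ys) = trans (cong (_+_ (x * φ y)) (sumList-* x φ ys)) (sym (*-distribˡ-+ x _ _))

 sumList-+ : ∀ {A : Set} (φ χ : A → ℤ) xs → sumList (λ y → φ y + χ y) xs ≡ sumList φ xs + sumList χ xs
 sumList-+ φ χ [] = refl
 sumList-+ φ χ (y ∷ ys) = trans (cong (_+_ (φ y + χ y)) (sumList-+ φ χ ys)) (lem (φ y) (χ y) _ _)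
   where lem : ∀ a b c d → (a + b) + (c + d) ≡ (a + c) + (b + d)
         lem = solve-∀

 shuffles-sum : ∀ α → All (λ (β , γ) → sum β ℕ.+ sum γ ≡ sum α) (shuffles α)
 shuffles-sum [] = refl ∷ []
 shuffles-sum (c ∷ α) = AllP.++⁺
   (AllP.map⁺ (All.map (λ { {β , γ} e → trans (ℕP.+-assoc c (sum β) (sum γ)) (cong (c ℕ.+_) e) }) (shuffles-sum α)))
   (AllP.map⁺ (All.map (λ { {β , γ} e → trans (sym (ℕP.+-assoc (sum β) c (sum γ))) (trans (cong (ℕ._+ sum γ) (ℕP.+-comm (sum β) c)) (trans (ℕP.+-assoc c (sum β) (sum γ)) (cong (c ℕ.+_) e))) }) (shuffles-sum α)))
   where import Data.List.Relation.Unary.All.Properties as AllP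

 module Quadratic (d : ℕ) where
   open Solution d
   open Coefficients d
   open Residue d
   open Decomposition d
   open Link d using (degree)

   M-top : ∀ t α → M t 0ℤ α (sum α) ≡ ρ t α
   M-top t α = begin
     shift (sum α) f (sum α) ≡⟨ cong (shift (sum α) f) (sym (ℕP.+-identityʳ (sum α))) ⟩
     shift (sum α) f (sum α ℕ.+ 0) ≡⟨ shift-at (sum α) f 0 ⟩
     1ℤ * ρ (t + D * 0ℤ) α ≡⟨ *-identityˡ _ ⟩
     ρ (t + D * 0ℤ) α ≡⟨ cong (λ z → ρ z α) (trans (cong (_+_ t) (*-zeroʳ D)) (+-identityʳ t)) ⟩
     ρ t α ∎
     where f : Ser
           f i = a 0ℤ i * ρ (t + D * + i) α

   -- R^t R^(t′) = R^(t+t′), read off the product rule for M at exponent 0 of y.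
   ρ-shuffles : ∀ t t′ α → sumList (λ (β , γ) → ρ t β * ρ t′ γ) (shuffles α) ≡ ρ (t + t′) α
   ρ-shuffles t t′ α = begin
     sumList (λ (β , γ) → ρ t β * ρ t′ γ) (shuffles α) ≡⟨ sym (sumList-cong (All.map (λ {p} → term {p}) (shuffles-sum α))) ⟩
     sumList (λ (β , γ) → (M t 0ℤ β ×ₛ M t′ 0ℤ γ) (sum α)) (shuffles α) ≡⟨ sym (⋆-shuffles (M t 0ℤ) (M t′ 0ℤ) α (sum α)) ⟩
     (M t 0ℤ ⋆ M t′ 0ℤ) α (sum α) ≡⟨ M-⋆ a-family t 0ℤ t′ 0ℤ α (sum α) ⟩
     M (t + t′) 0ℤ α (sum α) ≡⟨ M-top (t + t′) α ⟩
     ρ (t + t′) α ∎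
     where
     term : ∀ {(β , γ) : List ℕ × List ℕ} → sum β ℕ.+ sum γ ≡ sum α → (M t 0ℤ β ×ₛ M t′ 0ℤ γ) (sum α) ≡ ρ t β * ρ t′ γ
     term {β , γ} e = begin
       (M t 0ℤ β ×ₛ M t′ 0ℤ γ) (sum α) ≡⟨ shift-×-shift (sum β) (sum γ) f g (sum α) ⟩
       shift (sum β ℕ.+ sum γ) (f ×ₛ g) (sum α) ≡⟨ cong (shift (sum β ℕ.+ sum γ) (f ×ₛ g)) (trans (sym e) (sym (ℕP.+-identityʳ _))) ⟩
       shift (sum β ℕ.+ sum γ) (f ×ₛ g) (sum β ℕ.+ sum γ ℕ.+ 0) ≡⟨ shift-at (sum β ℕ.+ sum γ) (f ×ₛ g) 0 ⟩
       f 0 * g 0 ≡⟨ cong₂ _*_ (base t β) (base t′ γ) ⟩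
       ρ t β * ρ t′ γ ∎
       where
       f g : Ser
       f i = a 0ℤ i * ρ (t + D * + i) β
       g i = a 0ℤ i * ρ (t′ + D * + i) γ
       base : ∀ t β → 1ℤ * ρ (t + D * 0ℤ) β ≡ ρ t β
       base t β = trans (*-identityˡ _) (cong (λ z → ρ z β) (trans (cong (_+_ t) (*-zeroʳ D)) (+-identityʳ t)))

   -- As D Q = ρ 1 - ρ 0 and ρ t is multiplicative in t, the square of D Q is a second difference in t.
   Q-shuffles : ∀ α → D * D * sumList (λ (β , γ) → Q β * Q γ) (shuffles α) ≡ ρ (1ℤ + 1ℤ) α - ρ 1ℤ α - ρ 1ℤ α + ρ 0ℤ α
   Q-shuffles α = begin
     D * D * sumList (λ (β , γ) → Q β * Q γ) (shuffles α) ≡⟨ sym (sumList-* (D * D) _ (shuffles α)) ⟩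
     sumList (λ (β , γ) → D * D * (Q β * Q γ)) (shuffles α) ≡⟨ sumList-cong {xs = shuffles α} (All.tabulate λ { {β , γ} _ → expand β γ }) ⟩
     sumList (λ p → (A₁ p + -1ℤ * A₂ p) + (-1ℤ * A₃ p + A₄ p)) (shuffles α)
       ≡⟨ trans (sumList-+ _ _ (shuffles α)) (cong₂ _+_ (sumList-+ A₁ _ (shuffles α)) (sumList-+ _ A₄ (shuffles α))) ⟩
     (sumList A₁ (shuffles α) + sumList (λ p → -1ℤ * A₂ p) (shuffles α)) + (sumList (λ p → -1ℤ * A₃ p) (shuffles α) + sumList A₄ (shuffles α))
       ≡⟨ cong₂ _+_ (cong₂ _+_ (ρ-shuffles 1ℤ 1ℤ α) (trans (sumList-* -1ℤ A₂ (shuffles α)) (cong (-1ℤ *_) (ρ-shuffles 1ℤ 0ℤ α))))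
                    (cong₂ _+_ (trans (sumList-* -1ℤ A₃ (shuffles α)) (cong (-1ℤ *_) (ρ-shuffles 0ℤ 1ℤ α))) (ρ-shuffles 0ℤ 0ℤ α)) ⟩
     (ρ (1ℤ + 1ℤ) α + -1ℤ * ρ 1ℤ α) + (-1ℤ * ρ 1ℤ α + ρ 0ℤ α) ≡⟨ lem₂ (ρ (1ℤ + 1ℤ) α) (ρ 1ℤ α) (ρ 0ℤ α) ⟩
     ρ (1ℤ + 1ℤ) α - ρ 1ℤ α - ρ 1ℤ α + ρ 0ℤ α ∎
     where
     -1ℤ = - 1ℤ
     A₁ A₂ A₃ A₄ : List ℕ × List ℕ → ℤ
     A₁ (β , γ) = ρ 1ℤ β * ρ 1ℤ γ
     A₂ (β , γ) = ρ 1ℤ β * ρ 0ℤ γ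
     A₃ (β , γ) = ρ 0ℤ β * ρ 1ℤ γ
     A₄ (β , γ) = ρ 0ℤ β * ρ 0ℤ γ
     lem₁ : ∀ D q r → D * D * (q * r) ≡ (D * q) * (D * r)
     lem₁ = solve-∀
     lem₂ : ∀ x y z → (x + - 1ℤ * y) + (- 1ℤ * y + z) ≡ x - y - y + z
     lem₂ = solve-∀
     lem₃ : ∀ w x y z → (w - x) * (y - z) ≡ (w * y + - 1ℤ * (w * z)) + (- 1ℤ * (x * y) + x * z)
     lem₃ = solve-∀
     expand : ∀ β γ → D * D * (Q β * Q γ) ≡ (A₁ (β , γ) + -1ℤ * A₂ (β , γ)) + (-1ℤ * A₃ (β , γ) + A₄ (β , γ))
     expand β γ = trans (lem₁ D (Q β) (Q γ)) (trans (cong₂ _*_ (D·Q β) (D·Q γ)) (lem₃ (ρ 1ℤ β) (ρ 0ℤ β) (ρ 1ℤ γ) (ρ 0ℤ γ)))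

   degree-nonzero : ∀ α → Positive α → ¬ (degree α ≡ 0ℤ)
   degree-nonzero α p e with euler-pos α (sum α) p ℕP.≤-refl
   ... | x , y with () ← trans (sym e) (trans (cong (_+ 1ℤ) y) (+1≡suc (suc x)))

   -- Put x = (m-1)|α| and l the length of the whole word. For l ≥ 2, ρ 1 and ρ 2 are multiples of
   -- the falling factorial of x of length l - 2, by x - l + 2 and 2(x + 1); since x - l + 2 is also
   -- the degree, a polynomial identity remains. For one letter ρ is linear in t and both sides
   -- vanish.
   second-difference : ∀ c α → (1ℤ + 1ℤ) * + length α * (ρ 1ℤ (c ∷ α) - ρ 0ℤ (c ∷ α))
     ≡ degree (c ∷ α) * (ρ (1ℤ + 1ℤ) (c ∷ α) - ρ 1ℤ (c ∷ α) - ρ 1ℤ (c ∷ α) + ρ 0ℤ (c ∷ α))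
   second-difference c α rewrite ρ-zero c α = go α
     where
     lem₁ : ∀ P g → (1ℤ + 1ℤ) * 0ℤ * (P * (1ℤ * 1ℤ) - 0ℤ) ≡ g * (P * ((1ℤ + 1ℤ) * 1ℤ) - P * (1ℤ * 1ℤ) - P * (1ℤ * 1ℤ) + 0ℤ)
     lem₁ = solve-∀
     lem₂ : ∀ P x k f → (1ℤ + 1ℤ) * (k + 1ℤ) * (P * (1ℤ * (f * (x - k))) - 0ℤ)
       ≡ (x - (k + 1ℤ + 1ℤ) + 1ℤ + 1ℤ) * (P * ((1ℤ + 1ℤ) * ((x + (1ℤ + 1ℤ) - 1ℤ) * f)) - P * (1ℤ * (f * (x - k))) - P * (1ℤ * (f * (x - k))) + 0ℤ)
     lem₂ = solve-∀
     lem₃ : ∀ x → x + 1ℤ - 1ℤ ≡ x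
     lem₃ = solve-∀
     lem₄ : ∀ x → x + (1ℤ + 1ℤ) - 1ℤ - 1ℤ ≡ x
     lem₄ = solve-∀
     go : ∀ α → (1ℤ + 1ℤ) * + length α * (ρ 1ℤ (c ∷ α) - 0ℤ)
       ≡ degree (c ∷ α) * (ρ (1ℤ + 1ℤ) (c ∷ α) - ρ 1ℤ (c ∷ α) - ρ 1ℤ (c ∷ α) + 0ℤ)
     go [] = lem₁ (Ψ (c ∷ [])) (degree (c ∷ []))
     go α@(c′ ∷ α′) = begin
       (1ℤ + 1ℤ) * + suc k * (ρ 1ℤ (c ∷ α) - 0ℤ) ≡⟨ cong₂ (λ u v → (1ℤ + 1ℤ) * u * (v - 0ℤ)) (sym (+1≡suc k)) ρ₁ ⟩
       (1ℤ + 1ℤ) * (+ k + 1ℤ) * (P * (1ℤ * (f * (x - + k))) - 0ℤ) ≡⟨ lem₂ P x (+ k) f ⟩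
       (x - (+ k + 1ℤ + 1ℤ) + 1ℤ + 1ℤ) * (P * ((1ℤ + 1ℤ) * ((x + (1ℤ + 1ℤ) - 1ℤ) * f)) - P * (1ℤ * (f * (x - + k))) - P * (1ℤ * (f * (x - + k))) + 0ℤ)
         ≡⟨ cong₂ _*_ (cong (λ z → x - z + 1ℤ + 1ℤ) (trans (cong (_+ 1ℤ) (+1≡suc k)) (+1≡suc (suc k))))
                      (cong₂ (λ u v → u - v - v + 0ℤ) (sym ρ₂) (sym ρ₁)) ⟩
       degree (c ∷ α) * (ρ (1ℤ + 1ℤ) (c ∷ α) - ρ 1ℤ (c ∷ α) - ρ 1ℤ (c ∷ α) + 0ℤ) ∎
       where
       k = length α′
       P = Ψ (c ∷ α)
       x = D * + sum (c ∷ α)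
       f = ff x k
       ρ₁ : ρ 1ℤ (c ∷ α) ≡ P * (1ℤ * (f * (x - + k)))
       ρ₁ = cong (λ z → P * (1ℤ * z)) (trans (cong (λ z → ff z (suc k)) (lem₃ x)) (ff-last x k))
       ρ₂ : ρ (1ℤ + 1ℤ) (c ∷ α) ≡ P * ((1ℤ + 1ℤ) * ((x + (1ℤ + 1ℤ) - 1ℤ) * f))
       ρ₂ = cong (λ z → P * ((1ℤ + 1ℤ) * ((x + (1ℤ + 1ℤ) - 1ℤ) * ff z k))) (lem₄ x)

   -- The hypothesis on g is the formula for the count. After multiplication by the degree and by D
   -- both sides are expressed through ρ, where `Q-shuffles` and `second-difference` meet.
   quadratic : ∀ g c α → Positive (c ∷ α) → degree (c ∷ α) * (+ sum (c ∷ α) * g) ≡ mm * Q (c ∷ α) →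
     (1ℤ + 1ℤ) * mm * + sum (c ∷ α) * + length α * g ≡ D * sumList (λ (β , γ) → (mm * Q β) * (mm * Q γ)) (shuffles (c ∷ α))
   quadratic g c α pos e = cancel D (+suc≢0 d) (cancel (degree α⁺) (degree-nonzero α⁺ pos) (begin
     degree α⁺ * (D * ((1ℤ + 1ℤ) * mm * + sum α⁺ * + length α * g)) ≡⟨ lem₁ (degree α⁺) D mm (+ sum α⁺) (+ length α) g ⟩
     (1ℤ + 1ℤ) * mm * + length α * D * (degree α⁺ * (+ sum α⁺ * g)) ≡⟨ cong ((1ℤ + 1ℤ) * mm * + length α * D *_) e ⟩
     (1ℤ + 1ℤ) * mm * + length α * D * (mm * Q α⁺) ≡⟨ lem₂ mm (+ length α) D (Q α⁺) ⟩
     mm * mm * ((1ℤ + 1ℤ) * + length α * (D * Q α⁺)) ≡⟨ cong (λ z → mm * mm * ((1ℤ + 1ℤ) * + length α * z)) (D·Q α⁺) ⟩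
     mm * mm * ((1ℤ + 1ℤ) * + length α * (ρ 1ℤ α⁺ - ρ 0ℤ α⁺)) ≡⟨ cong (mm * mm *_) (second-difference c α) ⟩
     mm * mm * (degree α⁺ * (ρ (1ℤ + 1ℤ) α⁺ - ρ 1ℤ α⁺ - ρ 1ℤ α⁺ + ρ 0ℤ α⁺)) ≡⟨ cong (λ z → mm * mm * (degree α⁺ * z)) (sym (Q-shuffles α⁺)) ⟩
     mm * mm * (degree α⁺ * (D * D * sumList (λ (β , γ) → Q β * Q γ) (shuffles α⁺))) ≡⟨ lem₃ mm (degree α⁺) D _ ⟩
     degree α⁺ * (D * (D * (mm * mm * sumList (λ (β , γ) → Q β * Q γ) (shuffles α⁺))))
       ≡⟨ cong (λ z → degree α⁺ * (D * (D * z))) (trans (sym (sumList-* (mm * mm) _ (shuffles α⁺))) (sumList-cong {xs = shuffles α⁺} (All.tabulate λ { {β , γ} _ → lem₄ mm (Q β) (Q γ) }))) ⟩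
     degree α⁺ * (D * (D * sumList (λ (β , γ) → (mm * Q β) * (mm * Q γ)) (shuffles α⁺))) ∎))
     where
     α⁺ = c ∷ α
     lem₁ : ∀ e D m n l g → e * (D * ((1ℤ + 1ℤ) * m * n * l * g)) ≡ (1ℤ + 1ℤ) * m * l * D * (e * (n * g))
     lem₁ = solve-∀
     lem₂ : ∀ m l D q → (1ℤ + 1ℤ) * m * l * D * (m * q) ≡ m * m * ((1ℤ + 1ℤ) * l * (D * q))
     lem₂ = solve-∀
     lem₃ : ∀ m e D s → m * m * (e * (D * D * s)) ≡ e * (D * (D * (m * m * s)))
     lem₃ = solve-∀
     lem₄ : ∀ m q r → m * m * (q * r) ≡ (m * q) * (m * r)
     lem₄ = solve-∀

-- From words to partitions

module PartitionLists where
 open import Defs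
 open EulerOperator using (Positive)
 open Recursion using (shuffles; sumList; sumList-cong)
 open QuadraticIdentity using (sumList-+)
 open CycleLists using (unique-concatMap; ∈-concatMap; ∈-concatMap-inv; unique-map)
 open CycleTypes using (∧-true; any-true; any-true⁻; filterᵇ-∈; filterᵇ-∈⁻; ≡ᵇ-true; ≡ᵇ-true⁻; ≤ᵇ-true; ≤ᵇ-true⁻; true≢false)
 open Counts using (insert-↭; isort-↭; sum-↭)
 open import Data.Nat using (ℕ; zero; suc; z≤n; s≤s; _+_; _*_; _∸_; _≤_; _≡ᵇ_; _≤ᵇ_; _≟_)
 import Data.Nat.Properties as ℕP
 import Data.Nat.Tactic.RingSolver as ℕR
 open import Data.Integer using (ℤ; +_; 0ℤ)
 import Data.Integer as ℤ
 import Data.Integer.Properties as ℤP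
 open import Data.Bool using (Bool; true; false; if_then_else_)
 open import Data.Bool.Properties using (T?)
 open import Data.List using (List; []; _∷_; map; _++_; concatMap; filterᵇ; upTo)
 import Data.List.Properties as List
 open import Data.Nat.ListAction using (sum)
 open import Data.Nat.ListAction.Properties using (sum-++)
 open import Data.List.Relation.Unary.All using (All; []; _∷_)
 import Data.List.Relation.Unary.All as All
 import Data.List.Relation.Unary.All.Properties as AllP
 open import Data.List.Relation.Unary.Any using (here; there)
 open import Data.List.Relation.Unary.AllPairs using (AllPairs; []; _∷_)
 open import Data.List.Relation.Unary.Unique.Propositional using (Unique)
 open import Data.List.Relation.Unary.Unique.Propositional.Properties using (upTo⁺) renaming (filter⁺ to unique-filter)
 open import Data.List.Membership.Propositional using (_∈_; _∉_)
 open import Data.List.Membership.Propositional.Properties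
 open import Data.List.Relation.Binary.Permutation.Propositional using (_↭_; ↭-refl; ↭-sym; ↭-trans; ↭-reflexive; prep; swap; refl; trans)
 open import Data.List.Relation.Binary.Permutation.Propositional.Properties using (∈-resp-↭; All-resp-↭; ↭-length; drop-∷; shift; ↭-empty-inv)
 open import Data.Product using (_×_; _,_; ∃; proj₁; proj₂)
 import Data.Product.Properties as Product
 open import Data.Sum using (_⊎_; inj₁; inj₂)
 open import Function using (id)
 open import Relation.Binary.Definitions using (DecidableEquality)
 open import Relation.Binary.PropositionalEquality hiding ([_]) renaming (trans to _∙_)
 open import Relation.Nullary using (¬_; yes; no; contradiction; does)

 private variable
   A : Set

 Ascending : List ℕ → Set
 Ascending = AllPairs _≤_

 insert-ascending : ∀ x {ys} → Ascending ys → Ascending (insert x ys)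
 insert-ascending x [] = [] ∷ []
 insert-ascending x {y ∷ ys} (p ∷ s) with x ≤ᵇ y in e
 ... | true = (≤ᵇ-true⁻ x y e ∷ All.map (ℕP.≤-trans (≤ᵇ-true⁻ x y e)) p) ∷ p ∷ s
 ... | false = All-resp-↭ (↭-sym (insert-↭ x ys)) (ℕP.<⇒≤ (ℕP.≰⇒> λ le → true≢false (≤ᵇ-true le) e) ∷ p) ∷ insert-ascending x s

 isort-ascending : ∀ α → Ascending (isort α)
 isort-ascending [] = []
 isort-ascending (x ∷ α) = insert-ascending x (isort-ascending α)

 ascending-↭ : ∀ {α β} → Ascending α → Ascending β → α ↭ β → α ≡ β
 ascending-↭ {[]} {[]} _ _ p = refl
 ascending-↭ {[]} {_ ∷ _} _ _ p with () ← ↭-length p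
 ascending-↭ {_ ∷ _} {[]} _ _ p with () ← ↭-length p
 ascending-↭ {x ∷ α} {y ∷ β} (a ∷ s) (b ∷ t) p with ℕP.≤-antisym (least a (∈-resp-↭ (↭-sym p) (here refl))) (least b (∈-resp-↭ p (here refl)))
   where least : ∀ {x z xs} → All (x ≤_) xs → z ∈ x ∷ xs → x ≤ z
         least a (here refl) = ℕP.≤-refl
         least a (there q) = All.lookup a q
 ... | refl = cong (x ∷_) (ascending-↭ s t (drop-∷ p))

 isort-≡ : ∀ {α β} → Ascending β → α ↭ β → isort α ≡ β
 isort-≡ {α} s p = ascending-↭ (isort-ascending α) s (↭-trans (isort-↭ α) p)

 listEq-true : ∀ α → listEqᵇ α α ≡ true
 listEq-true [] = refl
 listEq-true (x ∷ α) rewrite ≡ᵇ-true {x} refl = listEq-true α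

 listEq-true⁻ : ∀ α β → listEqᵇ α β ≡ true → α ≡ β
 listEq-true⁻ [] [] _ = refl
 listEq-true⁻ (x ∷ α) (y ∷ β) e = let p , q = ∧-true {x ≡ᵇ y} e in cong₂ _∷_ (≡ᵇ-true⁻ x y p) (listEq-true⁻ α β q)

 mem-true : ∀ {α L} → α ∈ L → memᵇ α L ≡ true
 mem-true {α} {L} p = any-true (listEqᵇ α) L p (listEq-true α)

 mem-true⁻ : ∀ {α L} → memᵇ α L ≡ true → α ∈ L
 mem-true⁻ {α} {L} e = let β , β∈ , q = any-true⁻ (listEqᵇ α) L e in subst (_∈ L) (sym (listEq-true⁻ α β q)) β∈

 positive-empty : ∀ {α} → Positive α → sum α ≡ 0 → α ≡ []
 positive-empty [] _ = refl
 positive-empty {x ∷ α} (p ∷ _) e with () ← ℕP.≤-trans p (subst (x ≤_) e (ℕP.m≤m+n x (sum α)))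

 record Partition (n : ℕ) (α : List ℕ) : Set where
   constructor partition
   field
     size : sum α ≡ n
     positive : Positive α
     ascending : Ascending α

 private
   candidates : ℕ → ℕ → List ℕ
   candidates n lo = filterᵇ (λ k → lo ≤ᵇ k) (map suc (upTo (suc n)))

   block : ℕ → ℕ → ℕ → List (List ℕ)
   block f n k = map (k ∷_) (partsFrom f (suc n ∸ k) k)

   candidates-∈⁻ : ∀ n lo {k} → k ∈ candidates n lo → lo ≤ k × 1 ≤ k × k ≤ suc n
   candidates-∈⁻ n lo {k} q with filterᵇ-∈⁻ (λ k → lo ≤ᵇ k) {xs = map suc (upTo (suc n))} q
   ... | k∈ , e with ∈-map⁻ suc k∈
   ... | j , j∈ , refl = ≤ᵇ-true⁻ lo (suc j) e , s≤s z≤n , ∈-upTo⁻ j∈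

 parts-sound : ∀ f n lo {α} → α ∈ partsFrom f n lo → Partition n α × All (lo ≤_) α
 parts-sound f zero lo (here refl) = partition refl [] [] , []
 parts-sound (suc f) (suc n) lo p with ∈-concatMap-inv (block f n) {xs = candidates n lo} p
 ... | k , k∈ , q with ∈-map⁻ (k ∷_) q
 ... | α , α∈ , refl with candidates-∈⁻ n lo k∈ | parts-sound f (suc n ∸ k) k α∈
 ... | lo≤k , 1≤k , k≤ | partition s pos asc , low = partition (cong (λ z → k + z) s ∙ ℕP.m+[n∸m]≡n k≤) (1≤k ∷ pos) (low ∷ asc) , (lo≤k ∷ All.map (ℕP.≤-trans lo≤k) low)

 parts-complete : ∀ f n lo {α} → n ≤ f → Partition n α → All (lo ≤_) α → α ∈ partsFrom f n lo
 parts-complete f zero lo le (partition s pos _) _ = here (positive-empty pos s)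
 parts-complete (suc f) (suc n) lo {[]} _ (partition () _ _) _
 parts-complete (suc f) (suc n) lo {suc k ∷ α} (s≤s le) (partition s (_ ∷ pos) (low ∷ asc)) (lo≤k ∷ _) =
   ∈-concatMap (block f n) (filterᵇ-∈ (λ k → lo ≤ᵇ k) (∈-map⁺ suc (∈-upTo⁺ (s≤s (subst (k ≤_) (ℕP.suc-injective s) (ℕP.m≤m+n k (sum α)))))) (≤ᵇ-true lo≤k))
     (∈-map⁺ (suc k ∷_) (parts-complete f (n ∸ k) (suc k) (ℕP.≤-trans (ℕP.m∸n≤m n k) le) (partition (sym (ℕP.m+n∸m≡n k (sum α)) ∙ cong (_∸ k) (ℕP.suc-injective s)) pos asc) low))

 parts-unique : ∀ f n lo → Unique (partsFrom f n lo)
 parts-unique f zero lo = [] ∷ []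
 parts-unique zero (suc n) lo = []
 parts-unique (suc f) (suc n) lo = unique-concatMap (block f n) first id
   (subst Unique (sym (List.map-id (candidates n lo))) (unique-filter (λ k → T? (lo ≤ᵇ k)) (unique-map suc (λ _ _ → ℕP.suc-injective) (upTo⁺ (suc n)))))
   (λ {k} _ → unique-map (k ∷_) (λ { _ _ refl → refl }) (parts-unique f (suc n ∸ k) k)) label
   where
   first : List ℕ → ℕ
   first [] = 0
   first (x ∷ _) = x
   label : ∀ {k α} → k ∈ candidates n lo → α ∈ block f n k → first α ≡ k
   label {k} _ q with ∈-map⁻ (k ∷_) q
   ... | _ , _ , refl = refl

 partitions-sound : ∀ n {α} → α ∈ partitions n → Partition n α
 partitions-sound n p = proj₁ (parts-sound n n 1 p)

 partitions-complete : ∀ {n α} → Partition n α → α ∈ partitions n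
 partitions-complete {n} p = parts-complete n n 1 ℕP.≤-refl p (Partition.positive p)

 private
   compatible : List ℕ → List ℕ × List ℕ → Bool
   compatible α p = listEqᵇ (isort (proj₁ p ++ proj₂ p)) α

   withFirst : List ℕ → ℕ → List ℕ → List (List ℕ × List ℕ)
   withFirst α j β = map (β ,_) (partitions (sum α ∸ j))

   withSize : List ℕ → ℕ → List (List ℕ × List ℕ)
   withSize α j = concatMap (withFirst α j) (partitions j)

   withFirst-≡ : ∀ α j β {p} → p ∈ withFirst α j β → proj₁ p ≡ β
   withFirst-≡ α j β q with ∈-map⁻ (β ,_) q
   ... | _ , _ , refl = refl

   withSize-≡ : ∀ α j {p} → p ∈ withSize α j → sum (proj₁ p) ≡ j
   withSize-≡ α j q with ∈-concatMap-inv (withFirst α j) {xs = partitions j} q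
   ... | β , β∈ , q′ = cong sum (withFirst-≡ α j β q′) ∙ Partition.size (partitions-sound j β∈)

   unique-id : {L : List A} → Unique L → Unique (map id L)
   unique-id {L = L} = subst Unique (sym (List.map-id L))

 splits-sound : ∀ {α β γ} → (β , γ) ∈ splits α → (Partition (sum β) β × Partition (sum γ) γ) × β ++ γ ↭ α
 splits-sound {α} {β} {γ} p with filterᵇ-∈⁻ (compatible α) {xs = concatMap (withSize α) (upTo (suc (sum α)))} p
 ... | q , e with ∈-concatMap-inv (withSize α) {xs = upTo (suc (sum α))} q
 ... | j , _ , q₁ with ∈-concatMap-inv (withFirst α j) {xs = partitions j} q₁
 ... | β′ , β∈ , q₂ with ∈-map⁻ (β′ ,_) q₂
 ... | γ′ , γ∈ , refl with partitions-sound j β∈ | partitions-sound (sum α ∸ j) γ∈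
 ... | partition sβ pβ aβ | partition sγ pγ aγ = (partition refl pβ aβ , partition refl pγ aγ) , ↭-trans (↭-sym (isort-↭ (β ++ γ))) (↭-reflexive (listEq-true⁻ _ α e))

 splits-complete : ∀ {α β γ} → Ascending α → Partition (sum β) β → Partition (sum γ) γ → β ++ γ ↭ α → (β , γ) ∈ splits α
 splits-complete {α} {β} {γ} asc pβ pγ p = filterᵇ-∈ (compatible α)
   (∈-concatMap (withSize α) {xs = upTo (suc (sum α))} (∈-upTo⁺ (s≤s (subst (sum β ≤_) sums (ℕP.m≤m+n (sum β) (sum γ)))))
     (∈-concatMap (withFirst α (sum β)) {xs = partitions (sum β)} (partitions-complete pβ)
       (∈-map⁺ (β ,_) (subst (λ k → γ ∈ partitions k) (sym (ℕP.m+n∸m≡n (sum β) (sum γ)) ∙ cong (_∸ sum β) sums) (partitions-complete pγ)))))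
   (subst (λ δ → listEqᵇ δ α ≡ true) (sym (isort-≡ asc p)) (listEq-true α))
   where sums : sum β + sum γ ≡ sum α
         sums = sym (sum-++ β γ) ∙ sum-↭ p

 splits-unique : ∀ α → Unique (splits α)
 splits-unique α = unique-filter (λ p → T? (compatible α p)) (unique-concatMap (withSize α) (λ p → sum (proj₁ p)) id (unique-id (upTo⁺ (suc (sum α))))
   (λ {j} _ → unique-concatMap (withFirst α j) proj₁ id (unique-id (parts-unique j j 1))
     (λ {β} _ → unique-map (β ,_) (λ { _ _ refl → refl }) (parts-unique (sum α ∸ j) (sum α ∸ j) 1)) (λ {β} _ → withFirst-≡ α j β))
   (λ {j} _ → withSize-≡ α j))

 shuffles-sound : ∀ {α β γ} → (β , γ) ∈ shuffles α → β ++ γ ↭ α × (Ascending α → Ascending β × Ascending γ)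
 shuffles-sound {[]} (here refl) = ↭-refl , λ _ → [] , []
 shuffles-sound {c ∷ α} p with ∈-++⁻ (map (λ (β , γ) → c ∷ β , γ) (shuffles α)) p
 ... | inj₁ q with ∈-map⁻ _ q
 ...   | (β , γ) , q′ , refl = let r , s = shuffles-sound q′ in prep c r ,
         λ { (a ∷ asc) → (AllP.++⁻ˡ β (All-resp-↭ (↭-sym r) a) ∷ proj₁ (s asc)) , proj₂ (s asc) }
 shuffles-sound {c ∷ α} p | inj₂ q with ∈-map⁻ _ q
 ...   | (β , γ) , q′ , refl = let r , s = shuffles-sound q′ in ↭-trans (shift c β γ) (prep c r) ,
         λ { (a ∷ asc) → proj₁ (s asc) , (AllP.++⁻ʳ β (All-resp-↭ (↭-sym r) a) ∷ proj₂ (s asc)) }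

 shuffles⊆splits : ∀ {n α p} → Partition n α → p ∈ shuffles α → p ∈ splits α
 shuffles⊆splits {p = β , γ} (partition _ pos asc) q with shuffles-sound q
 ... | r , s = splits-complete asc (partition refl (AllP.++⁻ˡ β pos′) (proj₁ (s asc))) (partition refl (AllP.++⁻ʳ β pos′) (proj₂ (s asc))) r
   where pos′ = All-resp-↭ (↭-sym r) pos

 module Occurrences {A : Set} (_≟_ : DecidableEquality A) where
   δ : A → A → ℕ
   δ u x = if does (u ≟ x) then 1 else 0

   δ-refl : ∀ u → δ u u ≡ 1
   δ-refl u with u ≟ u
   ... | yes _ = refl
   ... | no ne = contradiction refl ne

   δ-≢ : ∀ {u x} → u ≢ x → δ u x ≡ 0
   δ-≢ {u} {x} ne with u ≟ x
   ... | yes e = contradiction e ne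
   ... | no _ = refl

   occ : A → List A → ℕ
   occ u [] = 0
   occ u (x ∷ xs) = δ u x + occ u xs

   occ-↭ : ∀ u {xs ys} → xs ↭ ys → occ u xs ≡ occ u ys
   occ-↭ u refl = refl
   occ-↭ u (prep x p) = cong (λ z → δ u x + z) (occ-↭ u p)
   occ-↭ u (swap x y p) = sym (ℕP.+-assoc (δ u x) (δ u y) _) ∙ (cong₂ _+_ (ℕP.+-comm (δ u x) (δ u y)) (occ-↭ u p) ∙ ℕP.+-assoc (δ u y) (δ u x) _)
   occ-↭ u (trans p q) = occ-↭ u p ∙ occ-↭ u q

   occ-++ : ∀ u xs ys → occ u (xs ++ ys) ≡ occ u xs + occ u ys
   occ-++ u [] ys = refl
   occ-++ u (x ∷ xs) ys = cong (λ z → δ u x + z) (occ-++ u xs ys) ∙ sym (ℕP.+-assoc (δ u x) _ _)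

   occ-∉ : ∀ {u xs} → u ∉ xs → occ u xs ≡ 0
   occ-∉ {xs = []} _ = refl
   occ-∉ {xs = x ∷ xs} n = cong₂ _+_ (δ-≢ (λ e → n (here e))) (occ-∉ (λ q → n (there q)))

   occ-map : ∀ {u} (f : A → A) → (∀ {x y} → f x ≡ f y → x ≡ y) → ∀ xs → occ (f u) (map f xs) ≡ occ u xs
   occ-map f inj [] = refl
   occ-map {u} f inj (x ∷ xs) = cong₂ _+_ head (occ-map f inj xs)
     where head : δ (f u) (f x) ≡ δ u x
           head with u ≟ x
           ... | yes refl = δ-refl (f u)
           ... | no ne = δ-≢ (λ e → ne (inj e))

   sum-δ : ∀ (φ : A → ℤ) {x U} → Unique U → x ∈ U → sumList (λ u → + δ u x ℤ.* φ u) U ≡ φ x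
   sum-δ φ {x} {U = u ∷ U} (a ∷ _) (here refl) = cong₂ ℤ._+_ (cong (λ z → + z ℤ.* φ x) (δ-refl x) ∙ ℤP.*-identityˡ (φ x)) (rest a) ∙ ℤP.+-identityʳ (φ x)
     where rest : ∀ {U} → All (λ y → ¬ x ≡ y) U → sumList (λ u → + δ u x ℤ.* φ u) U ≡ 0ℤ
           rest [] = refl
           rest {u ∷ _} (ne ∷ a) = cong₂ ℤ._+_ (cong (λ z → + z ℤ.* φ u) (δ-≢ (λ e → ne (sym e))) ∙ ℤP.*-zeroˡ (φ u)) (rest a)
   sum-δ φ {x} {U = u ∷ U} (a ∷ un) (there p) = cong₂ ℤ._+_ (cong (λ z → + z ℤ.* φ u) (δ-≢ (λ e → All.lookup a p e)) ∙ ℤP.*-zeroˡ (φ u)) (sum-δ φ un p) ∙ ℤP.+-identityˡ (φ x)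

   group : ∀ (φ : A → ℤ) {U} → Unique U → ∀ L → (∀ {x} → x ∈ L → x ∈ U) → sumList φ L ≡ sumList (λ u → + occ u L ℤ.* φ u) U
   group φ {U} un [] h = sym (zeros U)
     where zeros : ∀ U → sumList (λ u → 0ℤ ℤ.* φ u) U ≡ 0ℤ
           zeros [] = refl
           zeros (u ∷ U) = cong₂ ℤ._+_ (ℤP.*-zeroˡ (φ u)) (zeros U)
   group φ {U} un (x ∷ L) h = cong₂ ℤ._+_ (sym (sum-δ φ un (h (here refl)))) (group φ un L (λ q → h (there q))) ∙ (sym (sumList-+ _ _ U) ∙ sumList-cong (All.tabulate {xs = U} λ {u} _ →
     sym (ℤP.*-distribʳ-+ (φ u) (+ δ u x) (+ occ u L)) ∙ cong (ℤ._* φ u) (sym (ℤP.pos-+ (δ u x) (occ u L)))))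

 open Occurrences _≟_ public using () renaming (δ to δℕ; δ-refl to δℕ-refl; δ-≢ to δℕ-≢; occ to mult; occ-↭ to mult-↭; occ-++ to mult-++; occ-∉ to mult-∉)

 _≟ₚ_ : DecidableEquality (List ℕ × List ℕ)
 _≟ₚ_ = Product.≡-dec (List.≡-dec _≟_) (List.≡-dec _≟_)

 open Occurrences _≟ₚ_ public using (occ; occ-map; occ-∉; occ-++; group)

 -- z α = ∏ i ^ dᵢ · dᵢ ! if α has dᵢ parts equal to i.
 z : List ℕ → ℕ
 z [] = 1
 z (c ∷ α) = c * mult c (c ∷ α) * z α

 z-↭ : ∀ {α β} → α ↭ β → z α ≡ z β
 z-↭ refl = refl
 z-↭ (prep c p) = cong₂ (λ u v → c * u * v) (mult-↭ c (prep c p)) (z-↭ p)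
 z-↭ {_ ∷ _ ∷ α} {_ ∷ _ ∷ β} (swap x y p) with x ≟ y
 ... | yes refl = cong₂ _*_ (cong (λ w → x * (δℕ x x + (δℕ x x + w))) (mult-↭ x p)) (cong₂ _*_ (cong (λ w → x * (δℕ x x + w)) (mult-↭ x p)) (z-↭ p))
 ... | no ne = cong₂ _*_ (cong₂ (λ v w → x * (δℕ x x + (v + w))) (δℕ-≢ ne) (mult-↭ x p)) (cong₂ _*_ (cong (λ w → y * (δℕ y y + w)) (mult-↭ y p)) (z-↭ p))
   ∙ (rearr (x * (δℕ x x + mult x β)) (y * (δℕ y y + mult y β)) (z β) ∙ cong (λ v → y * (δℕ y y + (v + mult y β)) * (x * (δℕ x x + mult x β) * z β)) (sym (δℕ-≢ (λ e → ne (sym e)))))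
   where rearr : ∀ a b c → a * (b * c) ≡ b * (a * c)
         rearr = ℕR.solve-∀
 z-↭ (trans p q) = z-↭ p ∙ z-↭ q

 z-nonzero : ∀ {α} → Positive α → z α ≢ 0
 z-nonzero {c ∷ α} (s≤s _ ∷ pos) e with ℕP.m*n≡0⇒m≡0∨n≡0 (c * mult c (c ∷ α)) e
 ... | inj₂ e′ = z-nonzero pos e′
 z-nonzero {suc c ∷ α} (s≤s _ ∷ pos) e | inj₁ e′ with () ← cong (λ w → suc c * (w + mult (suc c) α)) (sym (δℕ-refl (suc c))) ∙ e′

 head-or-absent : ∀ {c β} → Ascending β → All (c ≤_) β → (∃ λ β′ → β ≡ c ∷ β′) ⊎ (c ∉ β)
 head-or-absent {β = []} _ _ = inj₂ λ ()
 head-or-absent {c} {b ∷ β} (a ∷ _) (c≤b ∷ _) with c ≟ b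
 ... | yes refl = inj₁ (β , refl)
 ... | no ne = inj₂ λ { (here e) → ne e ; (there q) → ne (ℕP.≤-antisym c≤b (All.lookup a q)) }

 -- The number of shuffles with parts β and γ is a product of binomial coefficients in the
 -- multiplicities, which is z α / (z β z γ). In the induction the smallest part c goes to β or to
 -- γ, and its multiplicities there add up to that in α.
 occ-z : ∀ {α β γ} → Ascending α → Ascending β → Ascending γ → β ++ γ ↭ α → occ (β , γ) (shuffles α) * (z β * z γ) ≡ z α
 occ-z {[]} {β} {γ} _ _ _ p with β | γ | ↭-empty-inv p
 ... | [] | [] | refl = refl
 occ-z {c ∷ α} {β} {γ} (a ∷ sα) sβ sγ p = begin
   occ (β , γ) (map consˡ (shuffles α) ++ map consʳ (shuffles α)) * (z β * z γ) ≡⟨ cong (_* (z β * z γ)) (occ-++ (β , γ) (map consˡ (shuffles α)) (map consʳ (shuffles α))) ⟩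
   (occ (β , γ) (map consˡ (shuffles α)) + occ (β , γ) (map consʳ (shuffles α))) * (z β * z γ) ≡⟨ ℕP.*-distribʳ-+ (z β * z γ) (occ (β , γ) (map consˡ (shuffles α))) _ ⟩
   occ (β , γ) (map consˡ (shuffles α)) * (z β * z γ) + occ (β , γ) (map consʳ (shuffles α)) * (z β * z γ)
     ≡⟨ cong₂ _+_ (left (head-or-absent sβ lowβ)) (right (head-or-absent sγ lowγ)) ⟩
   c * mult c β * z α + c * mult c γ * z α ≡⟨ distrib c (mult c β) (mult c γ) (z α) ⟩
   c * (mult c β + mult c γ) * z α ≡⟨ cong (λ w → c * w * z α) (sym (mult-++ c β γ) ∙ mult-↭ c p) ⟩
   c * mult c (c ∷ α) * z α ∎
   where
   open ≡-Reasoning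
   consˡ consʳ : List ℕ × List ℕ → List ℕ × List ℕ
   consˡ (β , γ) = c ∷ β , γ
   consʳ (β , γ) = β , c ∷ γ
   distrib : ∀ c u v w → c * u * w + c * v * w ≡ c * (u + v) * w
   distrib = ℕR.solve-∀
   low : All (c ≤_) (β ++ γ)
   low = All-resp-↭ (↭-sym p) (ℕP.≤-refl ∷ a)
   lowβ = AllP.++⁻ˡ β low
   lowγ = AllP.++⁻ʳ β low
   left : (∃ λ β′ → β ≡ c ∷ β′) ⊎ (c ∉ β) → occ (β , γ) (map consˡ (shuffles α)) * (z β * z γ) ≡ c * mult c β * z α
   left (inj₂ c∉) = cong (_* (z β * z γ)) (occ-∉ absent) ∙ sym (cong (_* z α) (cong (c *_) (mult-∉ c∉) ∙ ℕP.*-zeroʳ c))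
     where absent : (β , γ) ∉ map consˡ (shuffles α)
           absent q with ∈-map⁻ consˡ q
           ... | _ , _ , refl = c∉ (here refl)
   left (inj₁ (β′ , refl)) = begin
     occ (c ∷ β′ , γ) (map consˡ (shuffles α)) * (c * mult c β * z β′ * z γ) ≡⟨ cong (_* (c * mult c β * z β′ * z γ)) (occ-map consˡ (λ { refl → refl }) (shuffles α)) ⟩
     occ (β′ , γ) (shuffles α) * (c * mult c β * z β′ * z γ) ≡⟨ rearr (occ (β′ , γ) (shuffles α)) (c * mult c β) (z β′) (z γ) ⟩
     c * mult c β * (occ (β′ , γ) (shuffles α) * (z β′ * z γ)) ≡⟨ cong (c * mult c β *_) (occ-z sα (tail sβ) sγ (drop-∷ p)) ⟩
     c * mult c β * z α ∎
     where rearr : ∀ o k x y → o * (k * x * y) ≡ k * (o * (x * y))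
           rearr = ℕR.solve-∀
           tail : ∀ {x xs} → Ascending (x ∷ xs) → Ascending xs
           tail (_ ∷ s) = s
   right : (∃ λ γ′ → γ ≡ c ∷ γ′) ⊎ (c ∉ γ) → occ (β , γ) (map consʳ (shuffles α)) * (z β * z γ) ≡ c * mult c γ * z α
   right (inj₂ c∉) = cong (_* (z β * z γ)) (occ-∉ absent) ∙ sym (cong (_* z α) (cong (c *_) (mult-∉ c∉) ∙ ℕP.*-zeroʳ c))
     where absent : (β , γ) ∉ map consʳ (shuffles α)
           absent q with ∈-map⁻ consʳ q
           ... | _ , _ , refl = c∉ (here refl)
   right (inj₁ (γ′ , refl)) = begin
     occ (β , c ∷ γ′) (map consʳ (shuffles α)) * (z β * (c * mult c γ * z γ′)) ≡⟨ cong (_* (z β * (c * mult c γ * z γ′))) (occ-map consʳ (λ { refl → refl }) (shuffles α)) ⟩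
     occ (β , γ′) (shuffles α) * (z β * (c * mult c γ * z γ′)) ≡⟨ rearr (occ (β , γ′) (shuffles α)) (c * mult c γ) (z β) (z γ′) ⟩
     c * mult c γ * (occ (β , γ′) (shuffles α) * (z β * z γ′)) ≡⟨ cong (c * mult c γ *_) (occ-z sα sβ (tail sγ) (drop-∷ (↭-trans (↭-sym (shift c β γ′)) p))) ⟩
     c * mult c γ * z α ∎
     where rearr : ∀ o k x y → o * (x * (k * y)) ≡ k * (o * (x * y))
           rearr = ℕR.solve-∀
           tail : ∀ {x xs} → Ascending (x ∷ xs) → Ascending xs
           tail (_ ∷ s) = s

 -- Collecting equal pairs turns a sum over subsets of positions into a sum over factorisations p_β
 -- p_γ = p_α, as in the product of series.
 splits-shuffles : ∀ {n α} → Partition n α → ∀ (φ : List ℕ × List ℕ → ℤ) →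
   sumList (λ u → + occ u (shuffles α) ℤ.* φ u) (splits α) ≡ sumList φ (shuffles α)
 splits-shuffles {α = α} pα φ = sym (group φ (splits-unique α) (shuffles α) (shuffles⊆splits pα))

-- The size of a conjugacy class

module ConjugacyClasses where
 open import Defs
 open EulerOperator using (Positive)
 open Recursion using (picks)
 open CycleLists
 open CycleTypes
 open TupleCompleteness using (length-concatMap; sum-map-concatMap; sum-map-cong; sum-map-const)
 open Counts using (perms-∈; perms-∈⁻; perms-unique; build; build-cycles; cyc-determined; isort-↭; sum-↭)
 open PartitionLists
 open import Data.Nat using (ℕ; zero; suc; s≤s; _+_; _*_; _∸_; _≤_; _≡ᵇ_; _!)
 import Data.Nat as ℕ
 import Data.Nat.Properties as ℕP
 import Data.Nat.Tactic.RingSolver as ℕR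
 open import Data.Bool using (Bool; true; false; not; if_then_else_)
 open import Data.Bool.Properties using (T?)
 open import Data.List using (List; []; _∷_; [_]; length; map; _++_; concat; concatMap; allFin; filterᵇ; take)
 open import Data.List.Properties using (length-map; map-∘)
 import Data.List.Properties as List
 open import Data.Nat.ListAction using (sum)
 open import Data.List.Relation.Unary.All using (All; []; _∷_)
 import Data.List.Relation.Unary.All as All
 import Data.List.Relation.Unary.All.Properties as AllP
 open import Data.List.Relation.Unary.Any using (here; there)
 open import Data.List.Relation.Unary.AllPairs using ([]; _∷_)
 open import Data.List.Relation.Unary.Unique.Propositional using (Unique)
 open import Data.List.Relation.Unary.Unique.Propositional.Properties using (allFin⁺) renaming (filter⁺ to unique-filter)
 open import Data.List.Membership.Propositional using (_∈_; _∉_)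
 open import Data.List.Membership.Propositional.Properties
 open import Data.List.Relation.Binary.Permutation.Propositional using (_↭_; ↭-refl; ↭-sym; ↭-trans; ↭-reflexive; prep; swap; refl)
 open import Data.List.Relation.Binary.Permutation.Propositional.Properties using (∈-resp-↭; All-resp-↭; ↭-length; drop-∷; ↭-empty-inv; ++⁺ˡ)
 open import Data.Fin using (Fin)
 open import Data.Product using (_×_; _,_; ∃; proj₁; proj₂)
 open import Data.Empty using (⊥-elim)
 open import Function using (_∘_)
 open import Relation.Binary.PropositionalEquality hiding ([_]) renaming (trans to _∙_)
 open import Relation.Nullary using (yes; no; contradiction)

 private variable
   A : Set

 distinctFrom : ℕ → ℕ × List ℕ → Bool
 distinctFrom c (e , _) = not (e ≡ᵇ c)

 -- Equal parts give the same remainder, so each value is picked once; otherwise the same list of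
 -- cycles would be generated repeatedly.
 distinctPicks : List ℕ → List (ℕ × List ℕ)
 distinctPicks [] = []
 distinctPicks (c ∷ α) = (c , α) ∷ map (λ (e , β) → e , c ∷ β) (filterᵇ (distinctFrom c) (distinctPicks α))

 distinctPicks-↭ : ∀ α {c β} → (c , β) ∈ distinctPicks α → α ↭ c ∷ β
 distinctPicks-↭ (c ∷ α) (here refl) = ↭-refl
 distinctPicks-↭ (c ∷ α) (there p) with ∈-map⁻ _ p
 ... | (e , β) , q , refl = ↭-trans (prep c (distinctPicks-↭ α (proj₁ (filterᵇ-∈⁻ (distinctFrom c) {xs = distinctPicks α} q)))) (swap c e ↭-refl)

 private
   distinct-true : ∀ {c e β} → e ≢ c → distinctFrom c (e , β) ≡ true
   distinct-true {c} {e} ne = cong not (≢true (λ q → ne (≡ᵇ-true⁻ e c q)))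

   distinct-true⁻ : ∀ {c p} → distinctFrom c p ≡ true → proj₁ p ≢ c
   distinct-true⁻ {c} h refl with () ← sym h ∙ cong not (≡ᵇ-true {c} refl)

 distinctPicks-∈ : ∀ {α c} → c ∈ α → ∃ λ β → (c , β) ∈ distinctPicks α
 distinctPicks-∈ {c ∷ α} (here refl) = α , here refl
 distinctPicks-∈ {d ∷ α} {c} (there p) with c Data.Nat.≟ d
 ... | yes refl = α , here refl
 ... | no ne = let β , q = distinctPicks-∈ p in d ∷ β , there (∈-map⁺ _ (filterᵇ-∈ (distinctFrom d) q (distinct-true {β = β} ne)))

 distinctPicks-unique : ∀ α → Unique (map proj₁ (distinctPicks α))
 distinctPicks-unique [] = []
 distinctPicks-unique (c ∷ α) = All.tabulate fresh ∷ subst Unique (map-∘ F) (keep (distinctPicks α) (distinctPicks-unique α))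
   where
   F = filterᵇ (distinctFrom c) (distinctPicks α)
   fresh : ∀ {e} → e ∈ map proj₁ (map (λ (e , β) → e , c ∷ β) F) → c ≢ e
   fresh q refl with ∈-map⁻ proj₁ q
   ... | _ , q₁ , e₁ with ∈-map⁻ _ q₁
   ... | p , q₂ , refl = distinct-true⁻ {c} {p} (proj₂ (filterᵇ-∈⁻ (distinctFrom c) {xs = distinctPicks α} q₂)) (sym e₁)
   keep : ∀ L → Unique (map proj₁ L) → Unique (map proj₁ (filterᵇ (distinctFrom c) L))
   keep [] _ = []
   keep (p ∷ L) (a ∷ u) with distinctFrom c p
   ... | false = keep L u
   ... | true = AllP.map⁺ (All.tabulate λ q → All.lookup (AllP.map⁻ a) (proj₁ (filterᵇ-∈⁻ (distinctFrom c) {xs = L} q))) ∷ keep L u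

 sum-distinctPicks : ∀ (f : ℕ → ℕ) α → sum (map (λ (e , _) → f e * mult e α) (distinctPicks α)) ≡ sum (map f α)
 sum-distinctPicks f [] = refl
 sum-distinctPicks f (c ∷ α) = begin
   f c * mult c (c ∷ α) + sum (map (λ (e , _) → f e * mult e (c ∷ α)) (map (λ (e , β) → e , c ∷ β) F))
     ≡⟨ cong₂ _+_ (cong (λ w → f c * (w + mult c α)) (δℕ-refl c)) (cong sum (sym (map-∘ F)) ∙ drop-c (distinctPicks α)) ⟩
   f c * (1 + mult c α) + sum (map (λ (e , _) → g e * mult e α) (distinctPicks α)) ≡⟨ cong (λ w → f c * (1 + mult c α) + w) (sum-distinctPicks g α) ⟩
   f c * (1 + mult c α) + sum (map g α) ≡⟨ cong (_+ sum (map g α)) (ℕP.*-suc (f c) (mult c α)) ∙ ℕP.+-assoc (f c) (f c * mult c α) _ ⟩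
   f c + (f c * mult c α + sum (map g α)) ≡⟨ cong (λ w → f c + w) (merge α) ⟩
   f c + sum (map f α) ∎
   where
   open ≡-Reasoning
   F = filterᵇ (distinctFrom c) (distinctPicks α)
   g : ℕ → ℕ
   g e = if e ≡ᵇ c then 0 else f e
   drop-c : ∀ L → sum (map (λ (e , _) → f e * mult e (c ∷ α)) (filterᵇ (distinctFrom c) L)) ≡ sum (map (λ (e , _) → g e * mult e α) L)
   drop-c [] = refl
   drop-c ((e , _) ∷ L) with e ≡ᵇ c in eq
   ... | true = drop-c L
   ... | false = cong₂ _+_ (cong (λ w → f e * (w + mult e α)) (δℕ-≢ {e} {c} (λ { refl → true≢false (≡ᵇ-true {e} refl) eq }))) (drop-c L)
   merge : ∀ α → f c * mult c α + sum (map g α) ≡ sum (map f α)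
   merge [] = cong (_+ 0) (ℕP.*-zeroʳ (f c))
   merge (e ∷ α) with e ≡ᵇ c in eq
   ... | true with refl ← ≡ᵇ-true⁻ e c eq = cong (λ w → f c * (w + mult c α) + sum (map g α)) (δℕ-refl c)
         ∙ (cong (_+ sum (map g α)) (ℕP.*-suc (f c) (mult c α)) ∙ (ℕP.+-assoc (f c) (f c * mult c α) _ ∙ cong (λ w → f c + w) (merge α)))
   ... | false = cong (λ w → f c * (w + mult c α) + (f e + sum (map g α))) (δℕ-≢ {c} {e} (λ { refl → true≢false (≡ᵇ-true {e} refl) eq }))
         ∙ (rearr (f c * mult c α) (f e) (sum (map g α)) ∙ cong (λ w → f e + w) (merge α))
     where rearr : ∀ a b c → a + (b + c) ≡ b + (a + c)
           rearr = ℕR.solve-∀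

 arrangements : ℕ → List A → List (List A × List A)
 arrangements zero L = [ [] , L ]
 arrangements (suc c) L = concatMap (λ (x , L′) → map (λ (xs , R) → x ∷ xs , R) (arrangements c L′)) (picks L)

 private
   block : ℕ → A × List A → List (List A × List A)
   block c (x , L′) = map (λ (xs , R) → x ∷ xs , R) (arrangements c L′)

 arrangements-sound : ∀ c (L : List A) {xs R} → (xs , R) ∈ arrangements c L → L ↭ xs ++ R × length xs ≡ c
 arrangements-sound zero L (here refl) = ↭-refl , refl
 arrangements-sound (suc c) L p with ∈-concatMap-inv (block c) {xs = picks L} p
 ... | (x , L′) , q , r with ∈-map⁻ _ r
 ... | (xs , R) , r′ , refl = let s , e = arrangements-sound c L′ r′ in ↭-trans (picks-↭ L q) (prep x s) , cong suc e

 arrangements-complete : ∀ xs {L S : List A} → L ↭ xs ++ S → ∃ λ R → (xs , R) ∈ arrangements (length xs) L × R ↭ S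
 arrangements-complete [] {L} p = L , here refl , p
 arrangements-complete (x ∷ xs) {L} {S} p =
   let L′ , q = picks-∈ (∈-resp-↭ (↭-sym p) (here refl))
       R , r , s = arrangements-complete xs {L′} {S} (drop-∷ (↭-trans (↭-sym (picks-↭ L q)) p))
   in R , ∈-concatMap (block (length xs)) q (∈-map⁺ _ r) , s

 private
   picks-determined : ∀ {L : List A} {x M N} → Unique L → (x , M) ∈ picks L → (x , N) ∈ picks L → M ≡ N
   picks-determined {L = _ ∷ _} u (here refl) (here refl) = refl
   picks-determined {L = y ∷ L} (a ∷ u) (here refl) (there q) with ∈-map⁻ _ q
   ... | _ , q′ , refl = contradiction refl (All.lookup a (subst (_ ∈_) (map-picks L) (∈-map⁺ proj₁ q′)))
   picks-determined {L = y ∷ L} (a ∷ u) (there p) (here refl) with ∈-map⁻ _ p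
   ... | _ , p′ , refl = contradiction refl (All.lookup a (subst (_ ∈_) (map-picks L) (∈-map⁺ proj₁ p′)))
   picks-determined {L = y ∷ L} (a ∷ u) (there p) (there q) with ∈-map⁻ _ p | ∈-map⁻ _ q
   ... | _ , p′ , refl | _ , q′ , refl = cong (y ∷_) (picks-determined u p′ q′)

   tail-unique : ∀ {x : A} {xs} → Unique (x ∷ xs) → Unique xs
   tail-unique (_ ∷ u) = u

   picks-unique-rest : ∀ {L : List A} {x M} → Unique L → (x , M) ∈ picks L → Unique M
   picks-unique-rest {L = L} u q = tail-unique (Unique-↭ (picks-↭ L q) u)

 arrangements-determined : ∀ c {L : List A} {xs R S} → Unique L → (xs , R) ∈ arrangements c L → (xs , S) ∈ arrangements c L → R ≡ S
 arrangements-determined zero u (here refl) (here refl) = refl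
 arrangements-determined (suc c) {L} u p q with ∈-concatMap-inv (block c) {xs = picks L} p | ∈-concatMap-inv (block c) {xs = picks L} q
 ... | (x , M) , p₁ , p₂ | (y , N) , q₁ , q₂ with ∈-map⁻ _ p₂ | ∈-map⁻ _ q₂
 ... | _ , p₃ , refl | _ , q₃ , refl with picks-determined u p₁ q₁
 ... | refl = arrangements-determined c (picks-unique-rest u p₁) p₃ q₃

 arrangements-unique : ∀ c {L : List A} → Unique L → Unique (arrangements c L)
 arrangements-unique zero u = [] ∷ []
 arrangements-unique (suc c) {L} u = unique-concatMap (block c) (λ p → take 1 (proj₁ p)) (λ p → proj₁ p ∷ [])
   (subst Unique (sym (map-∘ (picks L))) (unique-map [_] (λ { _ _ refl → refl }) (subst Unique (sym (map-picks L)) u)))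
   (λ { {x , M} q → unique-map _ (λ { _ _ refl → refl }) (arrangements-unique c (picks-unique-rest u q)) })
   λ {x} _ → label x
   where
   label : ∀ x {p} → p ∈ block c x → take 1 (proj₁ p) ≡ proj₁ x ∷ []
   label x q with ∈-map⁻ _ q
   ... | _ , _ , refl = refl

 -- Weighting an arrangement by the number of orders of the remaining points counts the orders of
 -- all points.
 sum-arrangements : ∀ c (L : List A) → c ≤ length L → sum (map (λ (_ , R) → length R !) (arrangements c L)) ≡ length L !
 sum-arrangements zero L _ = ℕP.+-identityʳ (length L !)
 sum-arrangements (suc c) L@(_ ∷ L₀) (s≤s le) = begin
   sum (map (λ (_ , R) → length R !) (concatMap (block c) (picks L))) ≡⟨ sum-map-concatMap _ (block c) (picks L) ⟩
   sum (map (λ p → sum (map (λ (_ , R) → length R !) (block c p))) (picks L)) ≡⟨ sum-map-cong (picks L) (λ {p} → inner p) ⟩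
   sum (map (λ _ → length L₀ !) (picks L)) ≡⟨ sum-map-const (length L₀ !) (picks L) ⟩
   length (picks L) * length L₀ ! ≡⟨ cong (_* length L₀ !) (sym (length-map proj₁ (picks L)) ∙ cong length (map-picks L)) ⟩
   length L ! ∎
   where
   open ≡-Reasoning
   inner : ∀ p → p ∈ picks L → sum (map (λ (_ , R) → length R !) (block c p)) ≡ length L₀ !
   inner (x , M) q = cong sum (sym (map-∘ (arrangements c M))) ∙ (sum-arrangements c M (subst (c ≤_) (sym len) le) ∙ cong _! len)
     where len : length M ≡ length L₀
           len = sym (ℕP.suc-injective (↭-length (picks-↭ L q)))

 -- The cycle through the first remaining point r has one of the distinct parts c of α as its length and c - 1 further
 -- points in order; weighting by z turns the choice of c into Σ c · mult c α = |α|. N is fuel, at least the number of points.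
 cyclesOfType : ℕ → List A → List ℕ → List (List (List A))
 cyclesOfType N [] [] = [ [] ]
 cyclesOfType N [] (_ ∷ _) = []
 cyclesOfType zero (r ∷ L) α = []
 cyclesOfType (suc N) (r ∷ L) α =
   concatMap (λ (c , β) → concatMap (λ (xs , R) → map ((r ∷ xs) ∷_) (cyclesOfType N R β)) (arrangements (c ∸ 1) L)) (distinctPicks α)

 private
   withRoot : ℕ → A → List ℕ → List A × List A → List (List (List A))
   withRoot N r β (xs , R) = map ((r ∷ xs) ∷_) (cyclesOfType N R β)

   withPart : ℕ → A → List A → ℕ × List ℕ → List (List (List A))
   withPart N r L (c , β) = concatMap (withRoot N r β) (arrangements (c ∸ 1) L)

   suc-pred : ∀ {c} → 1 ≤ c → suc (c ∸ 1) ≡ c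
   suc-pred (s≤s _) = refl

 cyclesOfType-length : ∀ N (L : List A) α → length L ≤ N → Positive α → sum α ≡ length L → length (cyclesOfType N L α) * z α ≡ length L !
 cyclesOfType-length N [] [] _ _ _ = refl
 cyclesOfType-length N [] (c ∷ α) _ (s≤s _ ∷ _) ()
 cyclesOfType-length (suc N) (r ∷ L) α (s≤s le) pos e = begin
   length (cyclesOfType (suc N) (r ∷ L) α) * z α ≡⟨ cong (_* z α) (length-concatMap (withPart N r L) (distinctPicks α)) ∙ sum-map-* (z α) (λ p → length (withPart N r L p)) (distinctPicks α) ⟩
   sum (map (λ p → length (withPart N r L p) * z α) (distinctPicks α)) ≡⟨ sum-map-cong (distinctPicks α) (λ {p} → outer p) ⟩
   sum (map (λ (c , _) → c * mult c α * length L !) (distinctPicks α)) ≡⟨ sym (sum-map-* (length L !) (λ (c , _) → c * mult c α) (distinctPicks α)) ⟩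
   sum (map (λ (c , _) → c * mult c α) (distinctPicks α)) * length L ! ≡⟨ cong (_* length L !) (sum-distinctPicks (λ c → c) α ∙ (cong sum (List.map-id α) ∙ e)) ⟩
   length (r ∷ L) ! ∎
   where
   open ≡-Reasoning

   sum-map-* : ∀ {B : Set} k (φ : B → ℕ) xs → sum (map φ xs) * k ≡ sum (map (λ x → φ x * k) xs)
   sum-map-* k φ [] = refl
   sum-map-* k φ (x ∷ xs) = ℕP.*-distribʳ-+ k (φ x) _ ∙ cong (λ w → φ x * k + w) (sum-map-* k φ xs)
   rearr : ∀ l k w → l * (k * w) ≡ l * w * k
   rearr = ℕR.solve-∀
   outer : ∀ p → p ∈ distinctPicks α → length (withPart N r L p) * z α ≡ proj₁ p * mult (proj₁ p) α * length L !
   outer (c , β) q = begin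
     length (withPart N r L (c , β)) * z α ≡⟨ cong (length (withPart N r L (c , β)) *_) (z-↭ α↭ ∙ cong (λ w → c * w * z β) (sym (mult-↭ c α↭))) ⟩
     length (withPart N r L (c , β)) * (c * mult c α * z β) ≡⟨ rearr (length (withPart N r L (c , β))) (c * mult c α) (z β) ⟩
     length (withPart N r L (c , β)) * z β * (c * mult c α) ≡⟨ cong (_* (c * mult c α)) (cong (_* z β) (length-concatMap (withRoot N r β) (arrangements (c ∸ 1) L)) ∙ sum-map-* (z β) (λ p → length (withRoot N r β p)) (arrangements (c ∸ 1) L)) ⟩
     sum (map (λ p → length (withRoot N r β p) * z β) (arrangements (c ∸ 1) L)) * (c * mult c α)
       ≡⟨ cong (_* (c * mult c α)) (sum-map-cong (arrangements (c ∸ 1) L) (λ {p} → inner p)) ⟩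
     sum (map (λ (_ , R) → length R !) (arrangements (c ∸ 1) L)) * (c * mult c α)
       ≡⟨ cong (_* (c * mult c α)) (sum-arrangements (c ∸ 1) L (ℕ.s≤s⁻¹ (subst₂ _≤_ (sym c≡) e′ (ℕP.m≤m+n c (sum β))))) ⟩
     length L ! * (c * mult c α) ≡⟨ ℕP.*-comm (length L !) _ ⟩
     c * mult c α * length L ! ∎
     where
     α↭ : α ↭ c ∷ β
     α↭ = distinctPicks-↭ α q
     pos′ = All-resp-↭ α↭ pos
     c≡ : suc (c ∸ 1) ≡ c
     c≡ = suc-pred (All.head pos′)
     e′ : c + sum β ≡ suc (length L)
     e′ = sym (sum-↭ α↭) ∙ e
     inner : ∀ p → p ∈ arrangements (c ∸ 1) L → length (withRoot N r β p) * z β ≡ length (proj₂ p) !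
     inner (xs , R) q′ = cong (_* z β) (length-map _ (cyclesOfType N R β)) ∙ cyclesOfType-length N R β (ℕP.≤-trans (subst (length R ≤_) (sym len) (ℕP.m≤n+m (length R) (c ∸ 1))) le) (All.tail pos′)
       (ℕP.+-cancelˡ-≡ (c ∸ 1) _ _ (ℕP.suc-injective (cong (_+ sum β) c≡ ∙ e′) ∙ len))
       where
       sound = arrangements-sound (c ∸ 1) L q′
       len : length L ≡ c ∸ 1 + length R
       len = ↭-length (proj₁ sound) ∙ (List.length-++ xs ∙ cong (_+ length R) (proj₂ sound))

 cyclesOfType-sound : ∀ N (L : List A) α {cs} → Positive α → cs ∈ cyclesOfType N L α → L ↭ concat cs × α ↭ map length cs
 cyclesOfType-sound N [] [] pos (here refl) = ↭-refl , ↭-refl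
 cyclesOfType-sound (suc N) (r ∷ L) α pos p with ∈-concatMap-inv (withPart N r L) {xs = distinctPicks α} p
 ... | (c , β) , p₁ , p₂ with ∈-concatMap-inv (withRoot N r β) {xs = arrangements (c ∸ 1) L} p₂
 ... | (xs , R) , p₃ , p₄ with ∈-map⁻ _ p₄
 ... | cs , p₅ , refl with arrangements-sound (c ∸ 1) L p₃ | All-resp-↭ (distinctPicks-↭ α p₁) pos
 ... | L↭ , len | c-pos ∷ pos′ = let s , t = cyclesOfType-sound N R β pos′ p₅ in
   prep r (↭-trans L↭ (++⁺ˡ xs s)) , ↭-trans (distinctPicks-↭ α p₁) (↭-trans (↭-reflexive (cong (_∷ β) (sym (suc-pred c-pos) ∙ cong suc (sym len)))) (prep _ t))

 cyclesOfType-unique : ∀ N {L : List A} α → Unique L → Positive α → Unique (cyclesOfType N L α)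
 cyclesOfType-unique N {[]} [] _ _ = [] ∷ []
 cyclesOfType-unique N {[]} (_ ∷ _) _ _ = []
 cyclesOfType-unique zero {r ∷ L} α _ _ = []
 cyclesOfType-unique {A = A} (suc N) {r ∷ L} α (_ ∷ u) pos = unique-concatMap (withPart N r L) (λ cs → length (first cs)) proj₁ (distinctPicks-unique α)
   (λ { {c , β} q → unique-concatMap (withRoot N r β) first (λ p → r ∷ proj₁ p)
     (unique-map (λ p → r ∷ proj₁ p) (λ { {xs , R} {_ , S} p q refl → cong (xs ,_) (arrangements-determined (c ∸ 1) u p q) }) (arrangements-unique (c ∸ 1) u))
     (λ { {xs , R} p → unique-map ((r ∷ xs) ∷_) (λ { _ _ refl → refl }) (cyclesOfType-unique N β (unique-++ʳ xs (Unique-↭ (proj₁ (arrangements-sound (c ∸ 1) L p)) u)) (All.tail (All-resp-↭ (distinctPicks-↭ α q) pos))) })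
     (λ {p} _ → first-≡ β p) })
   λ { {c , β} q q′ → length-≡ c β (All.head (All-resp-↭ (distinctPicks-↭ α q) pos)) q′ }
   where
   first : List (List A) → List A
   first [] = []
   first (c ∷ _) = c
   first-≡ : ∀ β p {cs} → cs ∈ withRoot N r β p → first cs ≡ r ∷ proj₁ p
   first-≡ β (xs , R) q with ∈-map⁻ _ q
   ... | _ , _ , refl = refl
   length-≡ : ∀ c β → 1 ≤ c → ∀ {cs} → cs ∈ withPart N r L (c , β) → length (first cs) ≡ c
   length-≡ c β c-pos q with ∈-concatMap-inv (withRoot N r β) {xs = arrangements (c ∸ 1) L} q
   ... | p , p∈ , q′ = cong length (first-≡ β p q′) ∙ (cong suc (proj₂ (arrangements-sound (c ∸ 1) L p∈)) ∙ suc-pred c-pos)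

 module _ {n : ℕ} (f : Fin n → Fin n) where
   cyclesOfType-complete : ∀ N L α cs → length L ≤ N → All (Cyc f) cs → L ↭ concat cs → α ↭ map length cs → ∃ λ ds → ds ∈ cyclesOfType N L α × All (Cyc f) ds
   cyclesOfType-complete N [] α [] _ _ _ q with ↭-empty-inv q
   ... | refl = [] , here refl , []
   cyclesOfType-complete N [] α ((x ∷ c) ∷ cs) _ _ p _ with () ← ↭-length p
   cyclesOfType-complete N [] α ([] ∷ cs) _ (() ∷ _) _ _
   cyclesOfType-complete (suc N) (r ∷ L) α cs (s≤s le) cy p q with merges-∈ {cs = cs} (∈-resp-↭ p (here refl))
   ... | ws , cs′ , m with merges-↭ cs m | merges-sound cs m
   ... | cat , lens | ys , zs , refl , cs↭ with All-resp-↭ cs↭ cy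
   ... | c₁ ∷ cy′ with arrangements-complete ws {L} (drop-∷ (↭-trans p cat)) | distinctPicks-∈ (∈-resp-↭ (↭-sym (↭-trans q lens)) (here refl))
   ... | R , a , R↭ | β , b with cyclesOfType-complete N R β cs′ (ℕP.≤-trans (ℕP.≤-trans (ℕP.m≤n+m (length R) (length ws)) (ℕP.≤-reflexive (sym (↭-length (proj₁ (arrangements-sound (length ws) L a)) ∙ List.length-++ ws)))) le) cy′ R↭
                                   (drop-∷ (↭-trans (↭-sym (distinctPicks-↭ α b)) (↭-trans q lens)))

   ... | ds , d , cy″ = (r ∷ ws) ∷ ds , ∈-concatMap (withPart N r L) b (∈-concatMap (withRoot N r β) {xs = arrangements (length ws) L} a (∈-map⁺ _ d)) , rotate f ys c₁ ∷ cy″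

   private
     chain-determined : ∀ {r} a xs ys → Chain f a xs r → Chain f a ys r → r ∉ xs → r ∉ ys → xs ≡ ys
     chain-determined a [] [] _ _ _ _ = refl
     chain-determined a [] (y ∷ ys) p (q , _) _ n = ⊥-elim (n (here (sym p ∙ q)))
     chain-determined a (x ∷ xs) [] (p , _) q n _ = ⊥-elim (n (here (sym q ∙ p)))
     chain-determined a (x ∷ xs) (y ∷ ys) (p , ps) (q , qs) n n′ with sym p ∙ q
     ... | refl = cong (x ∷_) (chain-determined x xs ys ps qs (λ i → n (there i)) (λ i → n′ (there i)))

   -- From the root on, f dictates the order of the points until it returns, so the first cycle and
   -- with it the set of remaining points are determined; the same then holds for the rest.
   cyclesOfType-determined : ∀ N {L α β cs ds} → Unique L → cs ∈ cyclesOfType N L α → ds ∈ cyclesOfType N L β → All (Cyc f) cs → All (Cyc f) ds → cs ≡ ds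
   cyclesOfType-determined N {[]} {[]} {[]} u (here refl) (here refl) _ _ = refl
   cyclesOfType-determined (suc N) {r ∷ L} {α} {β} (r∉ ∷ u) p q cy cy′
     with ∈-concatMap-inv (withPart N r L) {xs = distinctPicks α} p | ∈-concatMap-inv (withPart N r L) {xs = distinctPicks β} q
   ... | (c , α′) , _ , p₁ | (d , β′) , _ , q₁
     with ∈-concatMap-inv (withRoot N r α′) {xs = arrangements (c ∸ 1) L} p₁ | ∈-concatMap-inv (withRoot N r β′) {xs = arrangements (d ∸ 1) L} q₁
   ... | (xs , R) , p₂ , p₃ | (ys , S) , q₂ , q₃ with ∈-map⁻ _ p₃ | ∈-map⁻ _ q₃
   ... | _ , p₄ , refl | _ , q₄ , refl with arrangements-sound (c ∸ 1) L p₂ | arrangements-sound (d ∸ 1) L q₂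
   ... | xs↭ , lc | ys↭ , ld with chain-determined r xs ys (All.head cy) (All.head cy′) (absent xs xs↭) (absent ys ys↭)
     where absent : ∀ xs {R} → L ↭ xs ++ R → r ∉ xs
           absent xs e i = All.lookup r∉ (∈-resp-↭ (↭-sym e) (∈-++⁺ˡ i)) refl
   ... | refl with sym lc ∙ ld
   ... | same with arrangements-determined (c ∸ 1) u p₂ (subst (λ k → (xs , S) ∈ arrangements k L) (sym same) q₂)
   ... | refl = cong ((r ∷ xs) ∷_) (cyclesOfType-determined N (unique-++ʳ xs (Unique-↭ xs↭ u)) p₄ q₄ (All.tail cy) (All.tail cy′))

 -- `build` is a bijection from the normalised cycle lists to the class, and their number times z α
 -- is n factorial.
 classSize-z : ∀ {n α} → Partition n α → classSize n α * z α ≡ n !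
 classSize-z {n} {α} (partition size pos asc) = cong (_* z α) (↭-length class ∙ length-map build G) ∙ (cyclesOfType-length n (allFin n) α (ℕP.≤-reflexive length-allFin) pos (size ∙ sym (length-allFin {n})) ∙ cong _! (length-allFin {n}))
   where
   P : Perm n → Bool
   P σ = listEqᵇ (cycleType σ) α
   G = cyclesOfType n (allFin n) α
   module Sound {cs} (p : cs ∈ G) where
     sound = cyclesOfType-sound n (allFin n) α pos p
     built = build-cycles cs (Unique-↭ (proj₁ sound) (allFin⁺ n)) (AllP.map⁻ (All-resp-↭ (proj₂ sound) pos))
     total : Total cs
     total x = ∈-resp-↭ (proj₁ sound) (∈-allFin x)
     type : cycleType (build cs) ≡ α
     type = isort-≡ asc (↭-trans (leaders-↭ (build cs) (proj₂ built) total) (↭-sym (proj₂ sound)))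
   determined : ∀ {cs ds} → cs ∈ G → ds ∈ G → build cs ≡ build ds → cs ≡ ds
   determined {cs} {ds} p q e = cyclesOfType-determined (app (build cs)) n {α = α} {β = α} (allFin⁺ n) p q (cyc (proj₂ (Sound.built p)))
     (subst (λ σ → All (Cyc (app σ)) ds) (sym e) (cyc (proj₂ (Sound.built q))))
   to : ∀ {σ} → σ ∈ filterᵇ P (perms n) → σ ∈ map build G
   to {σ} p with filterᵇ-∈⁻ P {xs = perms n} p
   ... | σ∈ , e with perms-∈⁻ σ∈
   ... | i with cyclesOf (app σ) (injective i)
   ... | cs , c , t with cyclesOfType-complete (app σ) n (allFin n) α cs (ℕP.≤-reflexive length-allFin) (cyc c)
                          (unique-set-↭ (allFin⁺ n) (uniq c) (λ {x} _ → t x) (λ {x} _ → ∈-allFin x))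
                          (↭-trans (↭-reflexive (sym (listEq-true⁻ (cycleType σ) α e))) (↭-trans (isort-↭ (map (orbitLen σ) (leaders σ))) (leaders-↭ σ c t)))
   ... | ds , d , cy = subst (_∈ map build G) (perm-ext λ x → cyc-determined (app (build ds)) (app σ) ds (cyc (proj₂ (Sound.built d))) cy (Sound.total d x)) (∈-map⁺ build d)
   from : ∀ {σ} → σ ∈ map build G → σ ∈ filterᵇ P (perms n)
   from p with ∈-map⁻ build p
   ... | cs , q , refl = filterᵇ-∈ P (perms-∈ (proj₁ (Sound.built q))) (subst (λ β → listEqᵇ β α ≡ true) (sym (Sound.type q)) (listEq-true α))
   class : filterᵇ P (perms n) ↭ map build G
   class = unique-set-↭ (unique-filter (T? ∘ P) (perms-unique n)) (unique-map build determined (cyclesOfType-unique n α (allFin⁺ n) pos)) to from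

-- Comparison of coefficients in the differential equation

module SeriesEquation where
 open import Defs
 open Binomials using (+1≡suc)
 open StepSeries using (module Solution)
 open EulerOperator using (Positive)
 open Residues using (module Residue)
 open Recursion using (module Link; sumList; shuffles)
 open QuadraticIdentity using (module Quadratic)
 open CycleTypes using (isPerm-true⁻; ≡ᵇ-true; ≡ᵇ-true⁻)
 open Transitivity using (bool-ext)
 open Counts using (module Formula; sum-↭)
 open PartitionLists
 open ConjugacyClasses
 open import Data.Rational using (ℚ; 0ℚ; 1ℚ; _/_)
 import Data.Rational as ℚ
 import Data.Rational.Properties as ℚP
 open import Data.Rational.Unnormalised using (mkℚᵘ; *≡*)
 import Data.Rational.Unnormalised.Properties as ℚᵘP
 open import Data.Integer using (ℤ; +_; 0ℤ; 1ℤ)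
 import Data.Integer as ℤ
 import Data.Integer.Properties as ℤP
 import Data.Integer.Tactic.RingSolver as ℤR
 open import Data.Nat using (ℕ; zero; suc; z≤n; s≤s; _+_; _*_; _∸_; _≤_; _≡ᵇ_; _≤ᵇ_; _!)
 import Data.Nat as ℕ
 import Data.Nat.Properties as ℕP
 import Data.Nat.Tactic.RingSolver as ℕR
 open import Data.Bool using (Bool; true; false; _∧_; if_then_else_)
 open import Data.List using (List; []; _∷_; length; map; _++_; concatMap; upTo)
 open import Data.List.Properties using (length-++; map-applyUpTo)
 open import Data.Nat.ListAction using (sum)
 open import Data.Nat.ListAction.Properties using (sum-++)
 open import Data.List.Relation.Unary.All using ([]; _∷_)
 open import Data.List.Relation.Unary.Any using (here; there)
 open import Data.List.Membership.Propositional using (_∈_)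
 open import Data.List.Relation.Binary.Permutation.Propositional.Properties using (↭-length)
 open import Data.Product using (_×_; _,_; proj₁; proj₂)
 open import Data.Maybe using (nothing)
 open import Function using (id)
 open import Level using (0ℓ)
 open import Tactic.RingSolver using (solve-∀)
 open import Tactic.RingSolver.Core.AlmostCommutativeRing using (AlmostCommutativeRing; fromCommutativeRing)
 open import Relation.Binary.PropositionalEquality hiding ([_]) renaming (trans to _∙_)
 open import Relation.Nullary using (contradiction)
 open ≡-Reasoning

 private variable
   A B : Set

 ℚ-ring : AlmostCommutativeRing 0ℓ 0ℓ
 ℚ-ring = fromCommutativeRing ℚP.+-*-commutativeRing (λ _ → nothing)

 -- Kept abstract so that type checking never runs the gcd hidden in _/_.
 abstract
   ι : ℤ → ℚ
   ι x = x / 1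

   ι-/ : ∀ x → ι x ≡ x / 1
   ι-/ x = refl

   ι-+ : ∀ x y → ι (x ℤ.+ y) ≡ ι x ℚ.+ ι y
   ι-+ x y = ℚP.toℚᵘ-injective (ℚᵘP.≃-trans (ℚP.toℚᵘ-fromℚᵘ (mkℚᵘ (x ℤ.+ y) 0)) (ℚᵘP.≃-trans (*≡* (lem x y))
     (ℚᵘP.≃-sym (ℚᵘP.≃-trans (ℚP.toℚᵘ-homo-+ (ι x) (ι y)) (ℚᵘP.+-cong (ℚP.toℚᵘ-fromℚᵘ (mkℚᵘ x 0)) (ℚP.toℚᵘ-fromℚᵘ (mkℚᵘ y 0)))))))
     where lem : ∀ x y → (x ℤ.+ y) ℤ.* + 1 ≡ (x ℤ.* + 1 ℤ.+ y ℤ.* + 1) ℤ.* + 1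
           lem = ℤR.solve-∀

   /-ι : ∀ x y z d .{{_ : ℕ.NonZero d}} → x ℤ.* z ≡ y ℤ.* + d → (x / d) ℚ.* ι z ≡ ι y
   /-ι x y z d@(suc d′) e = ℚP.toℚᵘ-injective (ℚᵘP.≃-trans (ℚP.toℚᵘ-homo-* (x / d) (ι z)) (ℚᵘP.≃-trans
     (ℚᵘP.*-cong (ℚP.toℚᵘ-fromℚᵘ (mkℚᵘ x d′)) (ℚP.toℚᵘ-fromℚᵘ (mkℚᵘ z 0))) (ℚᵘP.≃-trans (*≡* lem) (ℚᵘP.≃-sym (ℚP.toℚᵘ-fromℚᵘ (mkℚᵘ y 0))))))
     where lem : (x ℤ.* z) ℤ.* + 1 ≡ y ℤ.* (+ d ℤ.* + 1)
           lem = cong (ℤ._* + 1) e ∙ ℤP.*-assoc y (+ d) (+ 1)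

 ι-* : ∀ x y → ι (x ℤ.* y) ≡ ι x ℚ.* ι y
 ι-* x y = sym (/-ι x (x ℤ.* y) y 1 (sym (ℤP.*-identityʳ (x ℤ.* y)))) ∙ cong (ℚ._* ι y) (sym (ι-/ x))

 ι-cancel : ∀ {k x y} → k ≢ 0 → ι (+ k) ℚ.* x ≡ ι (+ k) ℚ.* y → x ≡ y
 ι-cancel {zero} nz _ = contradiction refl nz
 ι-cancel {k@(suc _)} {x} {y} _ e = sym (unit x) ∙ (cong (w ℚ.*_) e ∙ unit y)
   where
   w = 1ℤ / k
   unit : ∀ x → w ℚ.* (ι (+ k) ℚ.* x) ≡ x
   unit x = sym (ℚP.*-assoc w (ι (+ k)) x) ∙ (cong (ℚ._* x) (/-ι 1ℤ 1ℤ (+ k) k refl ∙ ι-/ 1ℤ) ∙ ℚP.*-identityˡ x)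

 ι-product : ∀ o s t {r v w x y} → o * (s * t) ≡ r → v ℚ.* ι (+ s) ≡ ι x → w ℚ.* ι (+ t) ≡ ι y → ι (+ r) ℚ.* (v ℚ.* w) ≡ ι (+ o ℤ.* (x ℤ.* y))
 ι-product o s t {r} {v} {w} {x} {y} e p q = begin
   ι (+ r) ℚ.* (v ℚ.* w) ≡⟨ cong (ℚ._* (v ℚ.* w)) (cong ι (cong +_ (sym e) ∙ ℤP.pos-* o (s * t)) ∙ (ι-* (+ o) _ ∙ cong (ι (+ o) ℚ.*_) (cong ι (ℤP.pos-* s t) ∙ ι-* (+ s) (+ t)))) ⟩
   ι (+ o) ℚ.* (ι (+ s) ℚ.* ι (+ t)) ℚ.* (v ℚ.* w) ≡⟨ rearr (ι (+ o)) (ι (+ s)) (ι (+ t)) v w ⟩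
   ι (+ o) ℚ.* ((v ℚ.* ι (+ s)) ℚ.* (w ℚ.* ι (+ t))) ≡⟨ cong (ι (+ o) ℚ.*_) (cong₂ ℚ._*_ p q ∙ sym (ι-* x y)) ∙ sym (ι-* (+ o) _) ⟩
   ι (+ o ℤ.* (x ℤ.* y)) ∎
   where rearr : ∀ o x y v w → o ℚ.* (x ℚ.* y) ℚ.* (v ℚ.* w) ≡ o ℚ.* ((v ℚ.* x) ℚ.* (w ℚ.* y))
         rearr = solve-∀ ℚ-ring

 Σℚ : (A → ℚ) → List A → ℚ
 Σℚ f xs = sumℚ (map f xs)

 sumℚ-++ : ∀ xs ys → sumℚ (xs ++ ys) ≡ sumℚ xs ℚ.+ sumℚ ys
 sumℚ-++ [] ys = sym (ℚP.+-identityˡ _)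
 sumℚ-++ (x ∷ xs) ys = cong (x ℚ.+_) (sumℚ-++ xs ys) ∙ sym (ℚP.+-assoc x _ _)

 sumℚ-concatMap : ∀ (f : A → List ℚ) xs → sumℚ (concatMap f xs) ≡ Σℚ (λ x → sumℚ (f x)) xs
 sumℚ-concatMap f [] = refl
 sumℚ-concatMap f (x ∷ xs) = sumℚ-++ (f x) _ ∙ cong (sumℚ (f x) ℚ.+_) (sumℚ-concatMap f xs)

 Σℚ-cong : ∀ {f g : A → ℚ} xs → (∀ {x} → x ∈ xs → f x ≡ g x) → Σℚ f xs ≡ Σℚ g xs
 Σℚ-cong [] h = refl
 Σℚ-cong (x ∷ xs) h = cong₂ ℚ._+_ (h (here refl)) (Σℚ-cong xs (λ q → h (there q)))

 Σℚ-zero : ∀ (xs : List A) → Σℚ (λ _ → 0ℚ) xs ≡ 0ℚ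
 Σℚ-zero [] = refl
 Σℚ-zero (x ∷ xs) = ℚP.+-identityˡ _ ∙ Σℚ-zero xs

 Σℚ-*ʳ : ∀ (f : A → ℚ) k xs → Σℚ (λ x → f x ℚ.* k) xs ≡ Σℚ f xs ℚ.* k
 Σℚ-*ʳ f k [] = sym (ℚP.*-zeroˡ k)
 Σℚ-*ʳ f k (x ∷ xs) = cong (f x ℚ.* k ℚ.+_) (Σℚ-*ʳ f k xs) ∙ sym (ℚP.*-distribʳ-+ k (f x) _)

 Σℚ-*ˡ : ∀ k (f : A → ℚ) xs → Σℚ (λ x → k ℚ.* f x) xs ≡ k ℚ.* Σℚ f xs
 Σℚ-*ˡ k f [] = sym (ℚP.*-zeroʳ k)
 Σℚ-*ˡ k f (x ∷ xs) = cong (k ℚ.* f x ℚ.+_) (Σℚ-*ˡ k f xs) ∙ sym (ℚP.*-distribˡ-+ k (f x) _)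

 Σℚ-+ : ∀ (f g : A → ℚ) xs → Σℚ (λ x → f x ℚ.+ g x) xs ≡ Σℚ f xs ℚ.+ Σℚ g xs
 Σℚ-+ f g [] = refl
 Σℚ-+ f g (x ∷ xs) = cong (f x ℚ.+ g x ℚ.+_) (Σℚ-+ f g xs) ∙ inter (f x) (g x) _ _
   where inter : ∀ a b c d → (a ℚ.+ b) ℚ.+ (c ℚ.+ d) ≡ (a ℚ.+ c) ℚ.+ (b ℚ.+ d)
         inter = solve-∀ ℚ-ring

 Σℚ-swap : ∀ (f : A → B → ℚ) xs ys → Σℚ (λ x → Σℚ (f x) ys) xs ≡ Σℚ (λ y → Σℚ (λ x → f x y) xs) ys
 Σℚ-swap f [] ys = sym (Σℚ-zero ys)
 Σℚ-swap f (x ∷ xs) ys = cong (Σℚ (f x) ys ℚ.+_) (Σℚ-swap f xs ys) ∙ sym (Σℚ-+ (f x) _ ys)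

 Σℚ-ι : ∀ (φ : A → ℤ) xs → Σℚ (λ x → ι (φ x)) xs ≡ ι (sumList φ xs)
 Σℚ-ι φ [] = sym (ι-/ 0ℤ)
 Σℚ-ι φ (x ∷ xs) = cong (ι (φ x) ℚ.+_) (Σℚ-ι φ xs) ∙ sym (ι-+ (φ x) _)

 χ : Bool → ℚ
 χ true = 1ℚ
 χ false = 0ℚ

 Σℚ-upTo : ∀ (f : ℕ → ℚ) N → Σℚ f (upTo (suc N)) ≡ f 0 ℚ.+ Σℚ (λ i → f (suc i)) (upTo N)
 Σℚ-upTo f N = cong (λ l → f 0 ℚ.+ sumℚ l) (map-applyUpTo suc f N ∙ sym (map-applyUpTo id (λ i → f (suc i)) N))

 -- Exponents of monomials add under multiplication, expressed through indicators.
 convolution : ∀ a s t → Σℚ (λ i → χ (i ≡ᵇ s) ℚ.* χ (a ∸ i ≡ᵇ t)) (upTo (suc a)) ≡ χ (a ≡ᵇ s + t)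
 convolution a zero t = Σℚ-upTo (λ i → χ (i ≡ᵇ 0) ℚ.* χ (a ∸ i ≡ᵇ t)) a
   ∙ (cong₂ ℚ._+_ (ℚP.*-identityˡ (χ (a ≡ᵇ t))) (Σℚ-cong (upTo a) (λ {i} _ → ℚP.*-zeroˡ (χ (a ∸ suc i ≡ᵇ t))) ∙ Σℚ-zero (upTo a)) ∙ ℚP.+-identityʳ _)
 convolution zero (suc s) t = cong (ℚ._+ 0ℚ) (ℚP.*-zeroˡ (χ (0 ≡ᵇ t)))
 convolution (suc a) (suc s) t = Σℚ-upTo (λ i → χ (i ≡ᵇ suc s) ℚ.* χ (suc a ∸ i ≡ᵇ t)) (suc a)
   ∙ (cong₂ ℚ._+_ (ℚP.*-zeroˡ (χ (suc a ≡ᵇ t))) (convolution a s t) ∙ ℚP.+-identityˡ _)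

 if-∧ : ∀ s t u v (x : ℚ) → (if s ∧ t ∧ u ∧ v then x else 0ℚ) ≡ χ t ℚ.* (χ u ℚ.* (χ v ℚ.* (if s then x else 0ℚ)))
 if-∧ s false u v x = no-first s ∙ sym (ℚP.*-zeroˡ (χ u ℚ.* (χ v ℚ.* (if s then x else 0ℚ))))
   where no-first : ∀ s → (if s ∧ false then x else 0ℚ) ≡ 0ℚ
         no-first true = refl
         no-first false = refl
 if-∧ true true false v x = sym (ℚP.*-identityˡ _ ∙ ℚP.*-zeroˡ (χ v ℚ.* x))
 if-∧ true true true false x = sym (ℚP.*-identityˡ _ ∙ (ℚP.*-identityˡ _ ∙ ℚP.*-zeroˡ x))
 if-∧ true true true true x = sym (ℚP.*-identityˡ _ ∙ (ℚP.*-identityˡ _ ∙ ℚP.*-identityˡ x))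
 if-∧ false true u v x = sym (ℚP.*-identityˡ _ ∙ (cong (χ u ℚ.*_) (ℚP.*-zeroʳ (χ v)) ∙ ℚP.*-zeroʳ (χ u)))

 χ-at : ∀ (f g : ℕ → ℚ) {x y} → (x ≡ y → f x ≡ g y) → χ (x ≡ᵇ y) ℚ.* f x ≡ χ (x ≡ᵇ y) ℚ.* g y
 χ-at f g {x} {y} h with x ≡ᵇ y in e
 ... | true = cong (1ℚ ℚ.*_) (h (≡ᵇ-true⁻ x y e))
 ... | false = ℚP.*-zeroˡ (f x) ∙ sym (ℚP.*-zeroˡ (g y))

 -- Each p_β comes with a single monomial in z, u and x. If these exponents are additive over the
 -- factorisations of p_α, the sums over exponents in the product collapse and only the sum over
 -- `splits` is left.
 module Convolve (V : List ℕ → ℚ) (N L E : List ℕ → ℕ) (F : Series) (α : List ℕ)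
   (F-at : ∀ {β} → Partition (sum β) β → ∀ a b c → F a b c β ≡ χ (a ≡ᵇ N β) ℚ.* (χ (b ≡ᵇ L β) ℚ.* (χ (c ≡ᵇ E β) ℚ.* V β))) where

   square : ∀ n l e → (∀ {β γ} → (β , γ) ∈ splits α → (N β + N γ ≡ n) × (L β + L γ ≡ l) × (E β + E γ ≡ e)) → ∀ a b c →
     (F · F) a b c α ≡ χ (a ≡ᵇ n) ℚ.* (χ (b ≡ᵇ l) ℚ.* (χ (c ≡ᵇ e) ℚ.* Σℚ (λ (β , γ) → V β ℚ.* V γ) (splits α)))
   square n l e additive a b c = begin
     (F · F) a b c α
       ≡⟨ sumℚ-concatMap layer₁ As ∙ Σℚ-cong As (λ {a₁} _ → sumℚ-concatMap (layer₂ a₁) Bs ∙ Σℚ-cong Bs (λ {b₁} _ → sumℚ-concatMap (layer₃ a₁ b₁) Cs)) ⟩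
     Σℚ (λ a₁ → Σℚ (λ b₁ → Σℚ (λ c₁ → Σℚ (T a₁ b₁ c₁) (splits α)) Cs) Bs) As
       ≡⟨ Σℚ-cong As (λ {a₁} _ → Σℚ-cong Bs (λ {b₁} _ → Σℚ-swap (T a₁ b₁) Cs (splits α)) ∙ Σℚ-swap (λ b₁ p → Σℚ (λ c₁ → T a₁ b₁ c₁ p) Cs) Bs (splits α))
          ∙ Σℚ-swap (λ a₁ p → Σℚ (λ b₁ → Σℚ (λ c₁ → T a₁ b₁ c₁ p) Cs) Bs) As (splits α) ⟩
     Σℚ (λ p → Σℚ (λ a₁ → Σℚ (λ b₁ → Σℚ (λ c₁ → T a₁ b₁ c₁ p) Cs) Bs) As) (splits α) ≡⟨ Σℚ-cong (splits α) (λ {p} → collapse p) ⟩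
     Σℚ (λ p → χ (a ≡ᵇ n) ℚ.* (χ (b ≡ᵇ l) ℚ.* (χ (c ≡ᵇ e) ℚ.* W p))) (splits α)
       ≡⟨ Σℚ-*ˡ (χ (a ≡ᵇ n)) (λ p → χ (b ≡ᵇ l) ℚ.* (χ (c ≡ᵇ e) ℚ.* W p)) (splits α) ∙ cong (χ (a ≡ᵇ n) ℚ.*_)
          (Σℚ-*ˡ (χ (b ≡ᵇ l)) (λ p → χ (c ≡ᵇ e) ℚ.* W p) (splits α) ∙ cong (χ (b ≡ᵇ l) ℚ.*_) (Σℚ-*ˡ (χ (c ≡ᵇ e)) W (splits α))) ⟩
     χ (a ≡ᵇ n) ℚ.* (χ (b ≡ᵇ l) ℚ.* (χ (c ≡ᵇ e) ℚ.* Σℚ W (splits α))) ∎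
     where
     As = upTo (suc a)
     Bs = upTo (suc b)
     Cs = upTo (suc c)
     W : List ℕ × List ℕ → ℚ
     W (β , γ) = V β ℚ.* V γ
     T : ℕ → ℕ → ℕ → List ℕ × List ℕ → ℚ
     T a₁ b₁ c₁ p = F a₁ b₁ c₁ (proj₁ p) ℚ.* F (a ∸ a₁) (b ∸ b₁) (c ∸ c₁) (proj₂ p)
     layer₃ : ℕ → ℕ → ℕ → List ℚ
     layer₃ a₁ b₁ c₁ = map (T a₁ b₁ c₁) (splits α)
     layer₂ : ℕ → ℕ → List ℚ
     layer₂ a₁ b₁ = concatMap (layer₃ a₁ b₁) Cs
     layer₁ : ℕ → List ℚ
     layer₁ a₁ = concatMap (layer₂ a₁) Bs
     rearrange : ∀ p q r v p′ q′ r′ w → (p ℚ.* (q ℚ.* (r ℚ.* v))) ℚ.* (p′ ℚ.* (q′ ℚ.* (r′ ℚ.* w))) ≡ (p ℚ.* p′) ℚ.* ((q ℚ.* q′) ℚ.* ((r ℚ.* r′) ℚ.* (v ℚ.* w)))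
     rearrange = solve-∀ ℚ-ring
     collapse : ∀ p → p ∈ splits α → Σℚ (λ a₁ → Σℚ (λ b₁ → Σℚ (λ c₁ → T a₁ b₁ c₁ p) Cs) Bs) As ≡ χ (a ≡ᵇ n) ℚ.* (χ (b ≡ᵇ l) ℚ.* (χ (c ≡ᵇ e) ℚ.* W p))
     collapse p@(β , γ) q with splits-sound {α} q | additive q
     ... | (pβ , pγ) , _ | eN , eL , eE = begin
       Σℚ (λ a₁ → Σℚ (λ b₁ → Σℚ (λ c₁ → T a₁ b₁ c₁ p) Cs) Bs) As
         ≡⟨ Σℚ-cong As (λ {a₁} _ → Σℚ-cong Bs (λ {b₁} _ → Σℚ-cong Cs (λ {c₁} _ → cong₂ ℚ._*_ (F-at pβ a₁ b₁ c₁) (F-at pγ (a ∸ a₁) (b ∸ b₁) (c ∸ c₁))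
              ∙ rearrange (χ (a₁ ≡ᵇ N β)) (χ (b₁ ≡ᵇ L β)) (χ (c₁ ≡ᵇ E β)) (V β) (χ (a ∸ a₁ ≡ᵇ N γ)) (χ (b ∸ b₁ ≡ᵇ L γ)) (χ (c ∸ c₁ ≡ᵇ E γ)) (V γ)))) ⟩
       Σℚ (λ a₁ → Σℚ (λ b₁ → Σℚ (λ c₁ → X a₁ ℚ.* (Y b₁ ℚ.* (Z c₁ ℚ.* W p))) Cs) Bs) As
         ≡⟨ Σℚ-cong As (λ {a₁} _ → Σℚ-cong Bs (λ {b₁} _ → Σℚ-*ˡ (X a₁) (λ c₁ → Y b₁ ℚ.* (Z c₁ ℚ.* W p)) Cs ∙ cong (X a₁ ℚ.*_) (Σℚ-*ˡ (Y b₁) (λ c₁ → Z c₁ ℚ.* W p) Cs ∙ cong (Y b₁ ℚ.*_) (Σℚ-*ʳ Z (W p) Cs)))) ⟩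
       Σℚ (λ a₁ → Σℚ (λ b₁ → X a₁ ℚ.* (Y b₁ ℚ.* (Σℚ Z Cs ℚ.* W p))) Bs) As
         ≡⟨ Σℚ-cong As (λ {a₁} _ → Σℚ-*ˡ (X a₁) (λ b₁ → Y b₁ ℚ.* (Σℚ Z Cs ℚ.* W p)) Bs ∙ cong (X a₁ ℚ.*_) (Σℚ-*ʳ Y (Σℚ Z Cs ℚ.* W p) Bs)) ⟩
       Σℚ (λ a₁ → X a₁ ℚ.* (Σℚ Y Bs ℚ.* (Σℚ Z Cs ℚ.* W p))) As ≡⟨ Σℚ-*ʳ X (Σℚ Y Bs ℚ.* (Σℚ Z Cs ℚ.* W p)) As ⟩
       Σℚ X As ℚ.* (Σℚ Y Bs ℚ.* (Σℚ Z Cs ℚ.* W p))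
         ≡⟨ cong₂ ℚ._*_ (convolution a (N β) (N γ) ∙ cong (λ k → χ (a ≡ᵇ k)) eN) (cong₂ ℚ._*_ (convolution b (L β) (L γ) ∙ cong (λ k → χ (b ≡ᵇ k)) eL) (cong (ℚ._* W p) (convolution c (E β) (E γ) ∙ cong (λ k → χ (c ≡ᵇ k)) eE))) ⟩
       χ (a ≡ᵇ n) ℚ.* (χ (b ≡ᵇ l) ℚ.* (χ (c ≡ᵇ e) ℚ.* W p)) ∎
       where
       X Y Z : ℕ → ℚ
       X a₁ = χ (a₁ ≡ᵇ N β) ℚ.* χ (a ∸ a₁ ≡ᵇ N γ)
       Y b₁ = χ (b₁ ≡ᵇ L β) ℚ.* χ (b ∸ b₁ ≡ᵇ L γ)
       Z c₁ = χ (c₁ ≡ᵇ E β) ℚ.* χ (c ∸ c₁ ≡ᵇ E γ)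

 length≤sum : ∀ {α} → Positive α → length α ≤ sum α
 length≤sum [] = z≤n
 length≤sum (p ∷ ps) = ℕP.+-mono-≤ p (length≤sum ps)

 module Equation (d : ℕ) (rep : (n : ℕ) → List ℕ → Perm n)
   (rep-type : ∀ n α → α ∈ partitions n → (isPermᵇ (rep n α) ≡ true) × (cycleType (rep n α) ≡ α)) where

   open Solution d using (D; mm)
   open Residue d using (Q)
   open Link d using (degree)
   open Quadratic d using (quadratic)

   m : ℕ
   m = suc (suc d)

   count : List ℕ → ℕ
   count β = Gcount m (sum β) (rep (sum β) β) β

   weightAt : ℕ → List ℕ → ℚ
   weightAt a β = if 1 ≤ᵇ a then ((+ (Gcount m a (rep a β) β * classSize a β)) / (a !)) {{ℕP._!≢0 a}} else 0ℚ

   weight : List ℕ → ℚ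
   weight β = weightAt (sum β) β

   -- The exponent of x that accompanies p_β: the total number of cycles of a tuple of genus 0.
   genus0 : List ℕ → ℕ
   genus0 β = xexp m (sum β) (length β)

   module _ {β} (p : Partition (sum β) β) where
     open Partition p

     short : length β ≤ suc d * sum β
     short = ℕP.≤-trans (length≤sum positive) (ℕP.m≤m+n (sum β) (d * sum β))

     genus0-suc : suc (suc d * sum β + 1 ∸ length β) ≡ genus0 β
     genus0-suc = sym (ℕP.+-∸-assoc 1 (ℕP.≤-trans short (ℕP.m≤m+n _ 1))) ∙ cong (_∸ length β) (sym (ℕP.+-suc (suc d * sum β) 1))

     degree-genus0 : degree β ≡ + genus0 β
     degree-genus0 = begin
       D ℤ.* + sum β ℤ.- + length β ℤ.+ 1ℤ ℤ.+ 1ℤ ≡⟨ cong (λ w → w ℤ.- + length β ℤ.+ 1ℤ ℤ.+ 1ℤ) (sym (ℤP.pos-* (suc d) (sum β))) ⟩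
       + (suc d * sum β) ℤ.- + length β ℤ.+ 1ℤ ℤ.+ 1ℤ ≡⟨ rearr (+ (suc d * sum β)) (+ length β) ⟩
       (+ (suc d * sum β) ℤ.+ + 2) ℤ.- + length β ≡⟨ cong (λ w → w ℤ.- + length β) (sym (ℤP.pos-+ (suc d * sum β) 2)) ⟩
       + (suc d * sum β + 2) ℤ.- + length β ≡⟨ ℤP.m-n≡m⊖n (suc d * sum β + 2) (length β) ∙ ℤP.⊖-≥ (ℕP.≤-trans short (ℕP.m≤m+n _ 2)) ⟩
       + genus0 β ∎
       where rearr : ∀ x l → x ℤ.- l ℤ.+ 1ℤ ℤ.+ 1ℤ ≡ x ℤ.+ + 2 ℤ.- l
             rearr = ℤR.solve-∀

     Gseries-at : ∀ a b c → Gseries m rep a b c β ≡ χ (a ≡ᵇ sum β) ℚ.* (χ (b ≡ᵇ length β) ℚ.* (χ (c ≡ᵇ genus0 β) ℚ.* weight β))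
     Gseries-at a b c = begin
       Gseries m rep a b c β ≡⟨ if-∧ (1 ≤ᵇ a) (memᵇ β (partitions a)) (b ≡ᵇ length β) (c ≡ᵇ xexp m a b) _ ⟩
       χ (memᵇ β (partitions a)) ℚ.* X a b ≡⟨ cong (λ t → χ t ℚ.* X a b) member ⟩
       χ (a ≡ᵇ sum β) ℚ.* X a b ≡⟨ χ-at (λ a → X a b) (λ a → X a b) {a} {sum β} (cong (λ a → X a b)) ⟩
       χ (a ≡ᵇ sum β) ℚ.* X (sum β) b ≡⟨ cong (χ (a ≡ᵇ sum β) ℚ.*_) (χ-at (Y (sum β)) (Y (sum β)) {b} {length β} (cong (Y (sum β)))) ⟩
       χ (a ≡ᵇ sum β) ℚ.* (χ (b ≡ᵇ length β) ℚ.* (χ (c ≡ᵇ genus0 β) ℚ.* weight β)) ∎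
       where
       Y X : ℕ → ℕ → ℚ
       Y a b = χ (c ≡ᵇ xexp m a b) ℚ.* weightAt a β
       X a b = χ (b ≡ᵇ length β) ℚ.* Y a b
       member : memᵇ β (partitions a) ≡ (a ≡ᵇ sum β)
       member = bool-ext (λ e → ≡ᵇ-true {a} (sym (Partition.size (partitions-sound a (mem-true⁻ {β} {partitions a} e)))))
         (λ e → mem-true (subst (λ k → β ∈ partitions k) (sym (≡ᵇ-true⁻ a (sum β) e)) (partitions-complete p)))

   -- The coefficient at p_β after z d/dz and d/dx. Multiplied by z β it is the integer m Q β, by
   -- the formula for the count and the class size.
   V : List ℕ → ℚ
   V β = ι (+ sum β) ℚ.* (ι (+ genus0 β) ℚ.* weight β)

   V-[] : V [] ≡ 0ℚ
   V-[] = cong (ℚ._* (ι (+ genus0 []) ℚ.* weight [])) (ι-/ 0ℤ) ∙ ℚP.*-zeroˡ (ι (+ genus0 []) ℚ.* weight [])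

   -- The exponent of x after differentiation.
   E : List ℕ → ℕ
   E β = suc d * sum β + 1 ∸ length β

   zDzDx-at : ∀ {β} → Partition (sum β) β → ∀ a b c → zDz (Dx (Gseries m rep)) a b c β ≡ χ (a ≡ᵇ sum β) ℚ.* (χ (b ≡ᵇ length β) ℚ.* (χ (c ≡ᵇ E β) ℚ.* V β))
   zDzDx-at {β} p a b c = begin
     ℕ→ℚ a ℚ.* (ℕ→ℚ (suc c) ℚ.* Gseries m rep a b (suc c) β) ≡⟨ cong₂ (λ u v → u ℚ.* (v ℚ.* Gseries m rep a b (suc c) β)) (sym (ι-/ (+ a))) (sym (ι-/ (+ suc c))) ⟩
     ι (+ a) ℚ.* (ι (+ suc c) ℚ.* Gseries m rep a b (suc c) β) ≡⟨ cong (λ w → ι (+ a) ℚ.* (ι (+ suc c) ℚ.* w)) (Gseries-at p a b (suc c)) ⟩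
     ι (+ a) ℚ.* (ι (+ suc c) ℚ.* (χa ℚ.* (χb ℚ.* (χ (suc c ≡ᵇ genus0 β) ℚ.* weight β)))) ≡⟨ rearr₁ (ι (+ a)) (ι (+ suc c)) χa χb (χ (suc c ≡ᵇ genus0 β)) (weight β) ⟩
     (χa ℚ.* ι (+ a)) ℚ.* (χb ℚ.* ((χ (suc c ≡ᵇ genus0 β) ℚ.* ι (+ suc c)) ℚ.* weight β))
       ≡⟨ cong₂ (λ u v → u ℚ.* (χb ℚ.* (v ℚ.* weight β))) (χ-at (λ k → ι (+ k)) (λ k → ι (+ k)) {a} {sum β} (cong (λ k → ι (+ k))))
            (χ-at (λ k → ι (+ k)) (λ k → ι (+ k)) {suc c} {genus0 β} (cong (λ k → ι (+ k))) ∙ cong (λ k → χ (suc c ≡ᵇ k) ℚ.* ι (+ genus0 β)) (sym (genus0-suc p))) ⟩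
     (χa ℚ.* ι (+ sum β)) ℚ.* (χb ℚ.* ((χ (c ≡ᵇ E β) ℚ.* ι (+ genus0 β)) ℚ.* weight β)) ≡⟨ sym (rearr₂ (ι (+ sum β)) (ι (+ genus0 β)) χa χb (χ (c ≡ᵇ E β)) (weight β)) ⟩
     χa ℚ.* (χb ℚ.* (χ (c ≡ᵇ E β) ℚ.* V β)) ∎
     where
     χa = χ (a ≡ᵇ sum β)
     χb = χ (b ≡ᵇ length β)
     rearr₁ : ∀ x y p q r w → x ℚ.* (y ℚ.* (p ℚ.* (q ℚ.* (r ℚ.* w)))) ≡ (p ℚ.* x) ℚ.* (q ℚ.* ((r ℚ.* y) ℚ.* w))
     rearr₁ = solve-∀ ℚ-ring
     rearr₂ : ∀ x y p q r w → p ℚ.* (q ℚ.* (r ℚ.* (x ℚ.* (y ℚ.* w)))) ≡ (p ℚ.* x) ℚ.* (q ℚ.* ((r ℚ.* y) ℚ.* w))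
     rearr₂ = solve-∀ ℚ-ring

   -- The exponents (m-1)n - l + 1 left by d/dx add up to (m-1)n - l + 2, the exponent in G itself;
   -- this is why the square can match the left side at all.
   additive : ∀ {α β γ} → (β , γ) ∈ splits α → (sum β + sum γ ≡ sum α) × (length β + length γ ≡ length α) × (E β + E γ ≡ genus0 α)
   additive {α} {β} {γ} q with splits-sound {α} q
   ... | (pβ , pγ) , p = sums , lengths , exponents
     where
     sums : sum β + sum γ ≡ sum α
     sums = sym (sum-++ β γ) ∙ sum-↭ p
     lengths : length β + length γ ≡ length α
     lengths = sym (length-++ β) ∙ ↭-length p
     x = suc d * sum β
     y = suc d * sum γ
     inter : ∀ x y l k → (x + l) + (y + k) ≡ (x + y) + (l + k)
     inter = ℕR.solve-∀
     two : ∀ e s t → e * s + 1 + (e * t + 1) ≡ e * (s + t) + 2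
     two = ℕR.solve-∀
     cancelled : (E β + E γ) + (length β + length γ) ≡ suc d * (sum β + sum γ) + 2
     cancelled = sym (inter (E β) (E γ) (length β) (length γ)) ∙ (cong₂ _+_ (ℕP.m∸n+n≡m (ℕP.≤-trans (short pβ) (ℕP.m≤m+n x 1))) (ℕP.m∸n+n≡m (ℕP.≤-trans (short pγ) (ℕP.m≤m+n y 1))) ∙ two (suc d) (sum β) (sum γ))
     exponents : E β + E γ ≡ genus0 α
     exponents = sym (ℕP.m+n∸n≡m (E β + E γ) (length β + length γ)) ∙ cong₂ _∸_ (cancelled ∙ cong (λ s → suc d * s + 2) sums) lengths

   count-formula : ∀ {α} → Partition (sum α) α → α ≢ [] → degree α ℤ.* (+ sum α ℤ.* + count α) ≡ mm ℤ.* Q α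
   count-formula {[]} _ ne = contradiction refl ne
   count-formula {zero ∷ _} (partition _ (() ∷ _) _) _
   count-formula {suc c ∷ α} p _ = let i , t = rep-type _ _ (partitions-complete p)
     in Formula.G-formula d (rep (suc (c + sum α)) (suc c ∷ α)) (suc c ∷ α) (isPerm-true⁻ i) t

   weight-z : ∀ {α} → Partition (sum α) α → α ≢ [] → weight α ℚ.* ι (+ z α) ≡ ι (+ count α)
   weight-z {[]} _ ne = contradiction refl ne
   weight-z {zero ∷ _} (partition _ (() ∷ _) _) _
   weight-z {α@(suc c ∷ α′)} p _ = /-ι (+ (count α * classSize (sum α) α)) (+ count α) (+ z α) (sum α !) {{ℕP._!≢0 (sum α)}}
     (sym (ℤP.pos-* (count α * classSize (sum α) α) (z α)) ∙ (cong +_ (ℕP.*-assoc (count α) (classSize (sum α) α) (z α) ∙ cong (count α *_) (classSize-z p)) ∙ ℤP.pos-* (count α) (sum α !)))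

   V-z : ∀ {β} → Partition (sum β) β → V β ℚ.* ι (+ z β) ≡ ι (mm ℤ.* Q β)
   V-z {[]} _ = cong (ℚ._* ι (+ 1)) V-[] ∙ (ℚP.*-zeroˡ (ι (+ 1)) ∙ sym (cong ι (ℤP.*-zeroʳ mm) ∙ ι-/ 0ℤ))
   V-z {β@(_ ∷ _)} p = begin
     ι (+ sum β) ℚ.* (ι (+ genus0 β) ℚ.* weight β) ℚ.* ι (+ z β) ≡⟨ rearr (ι (+ sum β)) (ι (+ genus0 β)) (weight β) (ι (+ z β)) ⟩
     ι (+ genus0 β) ℚ.* (ι (+ sum β) ℚ.* (weight β ℚ.* ι (+ z β))) ≡⟨ cong (λ w → ι (+ genus0 β) ℚ.* (ι (+ sum β) ℚ.* w)) (weight-z p λ ()) ⟩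
     ι (+ genus0 β) ℚ.* (ι (+ sum β) ℚ.* ι (+ count β)) ≡⟨ cong (ι (+ genus0 β) ℚ.*_) (sym (ι-* (+ sum β) (+ count β))) ∙ sym (ι-* (+ genus0 β) _) ⟩
     ι (+ genus0 β ℤ.* (+ sum β ℤ.* + count β)) ≡⟨ cong (λ w → ι (w ℤ.* (+ sum β ℤ.* + count β))) (sym (degree-genus0 p)) ∙ cong ι (count-formula p λ ()) ⟩
     ι (mm ℤ.* Q β) ∎
     where rearr : ∀ x y w t → x ℚ.* (y ℚ.* w) ℚ.* t ≡ y ℚ.* (x ℚ.* (w ℚ.* t))
           rearr = solve-∀ ℚ-ring

   products : List ℕ → ℚ
   products α = Σℚ (λ (β , γ) → V β ℚ.* V γ) (splits α)

   -- Each pair takes its share z α = occ · z β · z γ, which clears both denominators and leaves the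
   -- number of shuffles as multiplicity.
   z-products : ∀ {α} → Partition (sum α) α → ι (+ z α) ℚ.* products α ≡ ι (sumList (λ (β , γ) → (mm ℤ.* Q β) ℤ.* (mm ℤ.* Q γ)) (shuffles α))
   z-products {α} p = begin
     ι (+ z α) ℚ.* products α ≡⟨ sym (Σℚ-*ˡ (ι (+ z α)) (λ (β , γ) → V β ℚ.* V γ) (splits α)) ⟩
     Σℚ (λ (β , γ) → ι (+ z α) ℚ.* (V β ℚ.* V γ)) (splits α) ≡⟨ Σℚ-cong (splits α) (λ {q} → term q) ⟩
     Σℚ (λ q → ι (+ occ q (shuffles α) ℤ.* φ q)) (splits α) ≡⟨ Σℚ-ι (λ q → + occ q (shuffles α) ℤ.* φ q) (splits α) ⟩
     ι (sumList (λ q → + occ q (shuffles α) ℤ.* φ q) (splits α)) ≡⟨ cong ι (splits-shuffles p φ) ⟩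
     ι (sumList φ (shuffles α)) ∎
     where
     φ : List ℕ × List ℕ → ℤ
     φ (β , γ) = (mm ℤ.* Q β) ℤ.* (mm ℤ.* Q γ)
     term : ∀ q → q ∈ splits α → ι (+ z α) ℚ.* (V (proj₁ q) ℚ.* V (proj₂ q)) ≡ ι (+ occ q (shuffles α) ℤ.* φ q)
     term (β , γ) q = let (pβ , pγ) , r = splits-sound {α} q in
       ι-product (occ (β , γ) (shuffles α)) (z β) (z γ) {v = V β} {w = V γ} (occ-z {α} {β} {γ} (Partition.ascending p) (Partition.ascending pβ) (Partition.ascending pγ) r) (V-z {β} pβ) (V-z {γ} pγ)

   -- After multiplication by z α this is the integer identity `quadratic`. At the empty partition
   -- both sides are 0, since its size is 0 and V vanishes there.
   coefficients : ∀ {α} → Partition (sum α) α →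
     ι (+ (2 * m)) ℚ.* (ι (+ sum α) ℚ.* (ι (+ length α ℤ.- + 1) ℚ.* weight α)) ≡ ι (+ (m ∸ 1)) ℚ.* products α
   coefficients {[]} _ = begin
     k ℚ.* (ι (+ 0) ℚ.* w) ≡⟨ cong (λ u → k ℚ.* (u ℚ.* w)) (ι-/ 0ℤ) ⟩
     k ℚ.* (0ℚ ℚ.* w) ≡⟨ cong (k ℚ.*_) (ℚP.*-zeroˡ w) ∙ ℚP.*-zeroʳ k ⟩
     0ℚ ≡⟨ sym (ℚP.*-zeroʳ k′) ∙ cong (k′ ℚ.*_) (sym empty) ⟩
     k′ ℚ.* products [] ∎
     where
     k = ι (+ (2 * m))
     k′ = ι (+ (m ∸ 1))
     w = ι (+ 0 ℤ.- + 1) ℚ.* weight []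
     empty : products [] ≡ 0ℚ
     empty = cong (λ v → v ℚ.* V [] ℚ.+ 0ℚ) V-[] ∙ (ℚP.+-identityʳ _ ∙ ℚP.*-zeroˡ (V []))
   coefficients {α@(c ∷ α′)} p = ι-cancel (z-nonzero (Partition.positive p)) (begin
     ι (+ z α) ℚ.* (ι (+ (2 * m)) ℚ.* (ι (+ sum α) ℚ.* (ι (+ l) ℚ.* weight α))) ≡⟨ rearr₁ (ι (+ z α)) (ι (+ (2 * m))) (ι (+ sum α)) (ι (+ l)) (weight α) ⟩
     ι (+ (2 * m)) ℚ.* (ι (+ sum α) ℚ.* (ι (+ l) ℚ.* (weight α ℚ.* ι (+ z α)))) ≡⟨ cong (λ w → ι (+ (2 * m)) ℚ.* (ι (+ sum α) ℚ.* (ι (+ l) ℚ.* w))) (weight-z p λ ()) ⟩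
     ι (+ (2 * m)) ℚ.* (ι (+ sum α) ℚ.* (ι (+ l) ℚ.* ι (+ count α)))
       ≡⟨ cong (ι (+ (2 * m)) ℚ.*_) (cong (ι (+ sum α) ℚ.*_) (sym (ι-* (+ l) (+ count α))) ∙ sym (ι-* (+ sum α) _)) ∙ sym (ι-* (+ (2 * m)) _) ⟩
     ι (+ (2 * m) ℤ.* (+ sum α ℤ.* (+ l ℤ.* + count α))) ≡⟨ cong ι (cong (ℤ._* (+ sum α ℤ.* (+ l ℤ.* + count α))) 2m ∙ assoc ((1ℤ ℤ.+ 1ℤ) ℤ.* mm) (+ sum α) (+ l) (+ count α)) ⟩
     ι ((1ℤ ℤ.+ 1ℤ) ℤ.* mm ℤ.* + sum α ℤ.* + l ℤ.* + count α) ≡⟨ cong ι (quadratic (+ count α) c α′ (Partition.positive p) (count-formula p λ ())) ⟩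
     ι (D ℤ.* S) ≡⟨ ι-* D S ⟩
     ι D ℚ.* ι S ≡⟨ cong (ι D ℚ.*_) (sym (z-products p)) ⟩
     ι D ℚ.* (ι (+ z α) ℚ.* products α) ≡⟨ rearr₂ (ι D) (ι (+ z α)) (products α) ⟩
     ι (+ z α) ℚ.* (ι D ℚ.* products α) ∎)
     where
     l = length α′
     S = sumList (λ (β , γ) → (mm ℤ.* Q β) ℤ.* (mm ℤ.* Q γ)) (shuffles α)
     2m : + (2 * m) ≡ (1ℤ ℤ.+ 1ℤ) ℤ.* mm
     2m = ℤP.pos-* 2 m ∙ cong ((1ℤ ℤ.+ 1ℤ) ℤ.*_) (sym (+1≡suc (suc d)))
     assoc : ∀ x s l g → x ℤ.* (s ℤ.* (l ℤ.* g)) ≡ x ℤ.* s ℤ.* l ℤ.* g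
     assoc = ℤR.solve-∀
     rearr₁ : ∀ t x y u w → t ℚ.* (x ℚ.* (y ℚ.* (u ℚ.* w))) ≡ x ℚ.* (y ℚ.* (u ℚ.* (w ℚ.* t)))
     rearr₁ = solve-∀ ℚ-ring
     rearr₂ : ∀ x t s → x ℚ.* (t ℚ.* s) ≡ t ℚ.* (x ℚ.* s)
     rearr₂ = solve-∀ ℚ-ring

   lhs-at : ∀ {α} → Partition (sum α) α → ∀ k a b c → scale k (zDz (uDuMinus1 (Gseries m rep))) a b c α
     ≡ χ (a ≡ᵇ sum α) ℚ.* (χ (b ≡ᵇ length α) ℚ.* (χ (c ≡ᵇ genus0 α) ℚ.* (k ℚ.* (ι (+ sum α) ℚ.* (ι (+ length α ℤ.- + 1) ℚ.* weight α)))))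
   lhs-at {α} p k a b c = cong₂ (λ u v → k ℚ.* (u ℚ.* (v ℚ.* Gseries m rep a b c α))) (sym (ι-/ (+ a))) (sym (ι-/ (+ b ℤ.- + 1)))
     ∙ (cong (λ w → k ℚ.* (ι (+ a) ℚ.* (ι (+ b ℤ.- + 1) ℚ.* w))) (Gseries-at p a b c)
     ∙ (factor-χ k (ι (+ a)) (ι (+ b ℤ.- + 1)) (χ (a ≡ᵇ sum α)) (χ (b ≡ᵇ length α)) (χ (c ≡ᵇ genus0 α)) (weight α)
     ∙ (cong₂ (λ u v → u ℚ.* (v ℚ.* (χ (c ≡ᵇ genus0 α) ℚ.* (k ℚ.* weight α))))
          (χ-at (λ k → ι (+ k)) (λ k → ι (+ k)) {a} {sum α} (cong (λ k → ι (+ k))))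
          (χ-at (λ k → ι (+ k ℤ.- + 1)) (λ k → ι (+ k ℤ.- + 1)) {b} {length α} (cong (λ k → ι (+ k ℤ.- + 1))))
     ∙ unfactor-χ k (ι (+ sum α)) (ι (+ length α ℤ.- + 1)) (χ (a ≡ᵇ sum α)) (χ (b ≡ᵇ length α)) (χ (c ≡ᵇ genus0 α)) (weight α))))
     where
     factor-χ : ∀ k x y p q r w → k ℚ.* (x ℚ.* (y ℚ.* (p ℚ.* (q ℚ.* (r ℚ.* w))))) ≡ (p ℚ.* x) ℚ.* ((q ℚ.* y) ℚ.* (r ℚ.* (k ℚ.* w)))
     factor-χ = solve-∀ ℚ-ring
     unfactor-χ : ∀ k x y p q r w → (p ℚ.* x) ℚ.* ((q ℚ.* y) ℚ.* (r ℚ.* (k ℚ.* w))) ≡ p ℚ.* (q ℚ.* (r ℚ.* (k ℚ.* (x ℚ.* (y ℚ.* w)))))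
     unfactor-χ = solve-∀ ℚ-ring

   rhs-at : ∀ {α} k a b c → scale k (zDz (Dx (Gseries m rep)) · zDz (Dx (Gseries m rep))) a b c α
     ≡ χ (a ≡ᵇ sum α) ℚ.* (χ (b ≡ᵇ length α) ℚ.* (χ (c ≡ᵇ genus0 α) ℚ.* (k ℚ.* products α)))
   rhs-at {α} k a b c = cong (k ℚ.*_) (Convolve.square V sum length E (zDz (Dx (Gseries m rep))) α zDzDx-at (sum α) (length α) (genus0 α) (λ {β} {γ} → additive {α} {β} {γ}) a b c)
     ∙ inward (χ (a ≡ᵇ sum α)) (χ (b ≡ᵇ length α)) (χ (c ≡ᵇ genus0 α)) k (products α)
     where
     inward : ∀ p q r k s → k ℚ.* (p ℚ.* (q ℚ.* (r ℚ.* s))) ≡ p ℚ.* (q ℚ.* (r ℚ.* (k ℚ.* s)))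
     inward = solve-∀ ℚ-ring

   equation : ∀ {α} → Partition (sum α) α → ∀ a b c →
     scale ((+ (2 * m)) / 1) (zDz (uDuMinus1 (Gseries m rep))) a b c α ≡ scale ((+ (m ∸ 1)) / 1) (zDz (Dx (Gseries m rep)) · zDz (Dx (Gseries m rep))) a b c α
   equation {α} p a b c = lhs-at p ((+ (2 * m)) / 1) a b c
     ∙ (cong (λ w → χ (a ≡ᵇ sum α) ℚ.* (χ (b ≡ᵇ length α) ℚ.* (χ (c ≡ᵇ genus0 α) ℚ.* w))) coeffs ∙ sym (rhs-at {α} ((+ (m ∸ 1)) / 1) a b c))
     where
     coeffs : (+ (2 * m)) / 1 ℚ.* (ι (+ sum α) ℚ.* (ι (+ length α ℤ.- + 1) ℚ.* weight α)) ≡ (+ (m ∸ 1)) / 1 ℚ.* products α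
     coeffs = cong (ℚ._* (ι (+ sum α) ℚ.* (ι (+ length α ℤ.- + 1) ℚ.* weight α))) (sym (ι-/ (+ (2 * m)))) ∙ (coefficients p ∙ cong (ℚ._* products α) (ι-/ (+ (m ∸ 1))))

open import Defs
open import Data.Nat using (ℕ; suc; s≤s; _≤_; _∸_; _*_)
open import Data.Bool using (true)
open import Data.List using (List)
open import Data.List.Membership.Propositional using (_∈_)
open import Data.Product using (_×_)
open import Data.Integer using (+_)
open import Data.Rational using (_/_)
open import Relation.Binary.PropositionalEquality using (_≡_; refl)
open PartitionLists using (partition; partitions-sound)

theorem3 : (m : ℕ) → 2 ≤ m →
    (rep : (n : ℕ) → List ℕ → Perm n) →
    (∀ n α → α ∈ partitions n → (isPermᵇ (rep n α) ≡ true) × (cycleType (rep n α) ≡ α)) →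
    ∀ n λ′ → λ′ ∈ partitions n → ∀ a b c →
      scale ((+ (2 * m)) / 1) (zDz (uDuMinus1 (Gseries m rep))) a b c λ′
        ≡ scale ((+ (m ∸ 1)) / 1)
            (zDz (Dx (Gseries m rep)) · zDz (Dx (Gseries m rep))) a b c λ′
theorem3 (suc (suc d)) (s≤s (s≤s _)) rep rep-type n α α∈ =
  let partition _ positive ascending = partitions-sound n α∈
  in SeriesEquation.Equation.equation d rep rep-type (partition refl positive ascending)
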